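{- Let $P$ be a polyomino with $N$ tiles, width $w$ and height $h$, with a single robot in the model described in the context, and let $c$ be a constant positive integer. The robot can scale $P$ by $c$ (replacing each tile by a $c\times c$ square of tiles) within $\mathcal{O}((w^2+h^2)c^2N)$ steps using $\mathcal{O}(c^2wh)$ additional tiles and $\mathcal{O}(c^2N)$ additional space.
   Context: Model: A single robot acts as a deterministic finite automaton (constant memory) on the infinite grid graph with vertex set $\mathbb{Z}^2$ and edges between nodes at unit distance; nodes are called pixels. Each pixel is either empty or occupied by a tile. In each step the robot, based on its state and the state of its current pixel, applies a transition function $\delta(p,b)=(q,c',d)$: it changes to state $q$, sets the current pixel to state $c'$ (so it may create or remove a tile), and moves one step in direction $d\in\{\text{up},\text{down},\text{left},\text{right}\}$. A diagonal pair is a pair of pixels $(x_1,y_1),(x_2,y_2)$ with $|x_1-x_2|=|y_1-y_2|=1$. A polyomino is a connected set $P\subset\mathbb{Z}^2$ of tiles such that for every diagonal pair $p_1,p_2\in P$ there is a tile of $P$ adjacent to both. Width $w$ and height $h$ are the dimensions of the smallest axis-parallel rectangle containing $P$. Complexity measures: steps = total number of robot moves; additional space = number of visited pixels outside the bounding rectangle of the input polyomino; additional (auxiliary) tiles = maximum number of tiles on the grid minus the number of tiles of the input polyomino. -}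

module Defs where

open import Data.Bool using (Bool; true; false; if_then_else_)
open import Data.Nat as ℕ using (ℕ; suc; _≤_; _<_)
open import Data.Integer as ℤ using (ℤ; +_; _⊓_; _⊔_; ∣_∣; _-_)
open import Data.Fin using (Fin)
open import Data.Product using (_×_; _,_; proj₁; proj₂; Σ; ∃; ∃-syntax)
open import Data.Product.Properties using (≡-dec)
open import Data.List using (List; []; _∷_; map; filter; length; foldr; deduplicate; upTo)
open import Data.List.Membership.Propositional using (_∈_)
open import Data.List.Relation.Unary.Unique.Propositional using (Unique)
open import Data.List.Relation.Unary.Any using (any?)
open import Relation.Binary.PropositionalEquality using (_≡_; _≢_)
open import Relation.Nullary using (¬_; ¬?; Dec; yes; no)
open import Relation.Nullary.Decidable using (⌊_⌋; _⊎-dec_)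
open import Data.Sum using (_⊎_)
open import Relation.Binary using (DecidableEquality)

Pixel : Set
Pixel = ℤ × ℤ

_≟P_ : DecidableEquality Pixel
_≟P_ = ≡-dec ℤ._≟_ ℤ._≟_

Adjacent : Pixel → Pixel → Set
Adjacent (x₁ , y₁) (x₂ , y₂) = ∣ x₁ - x₂ ∣ ℕ.+ ∣ y₁ - y₂ ∣ ≡ 1

Diagonal : Pixel → Pixel → Set
Diagonal (x₁ , y₁) (x₂ , y₂) = (∣ x₁ - x₂ ∣ ≡ 1) × (∣ y₁ - y₂ ∣ ≡ 1)

-- Polyominoes (finite tile sets given as duplicate-free lists)

data PathIn (P : List Pixel) : Pixel → Pixel → Set where
  here : ∀ {p} → PathIn P p p
  step : ∀ {p q r} → Adjacent p q → q ∈ P → PathIn P q r → PathIn P p r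

record IsPolyomino (P : List Pixel) : Set where
  field
    nonempty  : ∃[ p ] p ∈ P
    unique    : Unique P
    connected : ∀ {p q} → p ∈ P → q ∈ P → PathIn P p q
    diagonal  : ∀ {p q} → p ∈ P → q ∈ P → Diagonal p q →
                ∃[ t ] (t ∈ P × Adjacent t p × Adjacent t q)

tilesOf : List Pixel → ℕ
tilesOf = length

-- bounding rectangle (values for [] are irrelevant: polyominoes are nonempty)
minL maxL : List ℤ → ℤ
minL []       = + 0
minL (z ∷ zs) = foldr _⊓_ z zs
maxL []       = + 0
maxL (z ∷ zs) = foldr _⊔_ z zs

minX maxX minY maxY : List Pixel → ℤ
minX P = minL (map proj₁ P)
maxX P = maxL (map proj₁ P)
minY P = minL (map proj₂ P)
maxY P = maxL (map proj₂ P)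

width height : List Pixel → ℕ
width  P = suc ∣ maxX P - minX P ∣
height P = suc ∣ maxY P - minY P ∣

inBox : List Pixel → Pixel → Set
inBox P (x , y) = (minX P ℤ.≤ x × x ℤ.≤ maxX P) × (minY P ℤ.≤ y × y ℤ.≤ maxY P)

inBox? : (P : List Pixel) → (q : Pixel) → Dec (inBox P q)
inBox? P (x , y) with minX P ℤ.≤? x | x ℤ.≤? maxX P | minY P ℤ.≤? y | y ℤ.≤? maxY P
... | yes a | yes b | yes c | yes d = yes ((a , b) , (c , d))
... | no ¬a | _ | _ | _ = no λ { ((a , _) , _) → ¬a a }
... | yes _ | no ¬b | _ | _ = no λ { ((_ , b) , _) → ¬b b }
... | yes _ | yes _ | no ¬c | _ = no λ { (_ , (c , _)) → ¬c c }
... | yes _ | yes _ | yes _ | no ¬d = no λ { (_ , (_ , d)) → ¬d d }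

InScaled : ℕ → List Pixel → ℤ → ℤ → Pixel → Set
InScaled c P a b q =
  ∃[ p ] (p ∈ P × Σ ℕ λ i → Σ ℕ λ j → i < c × j < c ×
    q ≡ (a ℤ.+ (+ c) ℤ.* proj₁ p ℤ.+ + i , b ℤ.+ (+ c) ℤ.* proj₂ p ℤ.+ + j))

data Dir : Set where
  up down left right : Dir

move : Dir → Pixel → Pixel
move up    (x , y) = (x , y ℤ.+ + 1)
move down  (x , y) = (x , y ℤ.- + 1)
move left  (x , y) = (x ℤ.- + 1 , y)
move right (x , y) = (x ℤ.+ + 1 , y)

record Robot : Set where
  field
    nStates : ℕ
    start   : Fin nStates
    halt    : Fin nStates
    δ       : Fin nStates → Bool → Fin nStates × Bool × Dir

occupied : Pixel → List Pixel → Bool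
occupied p ts = ⌊ any? (p ≟P_) ts ⌋

setPixel : Pixel → Bool → List Pixel → List Pixel
setPixel p true  ts = if occupied p ts then ts else p ∷ ts
setPixel p false ts = filter (λ t → ¬? (p ≟P t)) ts

record Config (R : Robot) : Set where
  constructor config
  field
    state : Fin (Robot.nStates R)
    pos   : Pixel
    tiles : List Pixel
open Config public

stepR : (R : Robot) → Config R → Config R
stepR R (config s p ts) with Robot.δ R s (occupied p ts)
... | (s' , b' , d) = config s' (move d p) (setPixel p b' ts)

run : (R : Robot) → ℕ → Config R → Config R
run R ℕ.zero  C = C
run R (suc t) C = run R t (stepR R C)

initial : (R : Robot) → List Pixel → Pixel → Config R
initial R P s = config (Robot.start R) s P

additionalSpace : (R : Robot) → List Pixel → Pixel → ℕ → ℕ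
additionalSpace R P s T =
  length (deduplicate _≟P_
    (filter (λ q → ¬? (inBox? P q))
      (map (λ i → pos (run R i (initial R P s))) (upTo (suc T)))))

HaltsAt : (R : Robot) → List Pixel → Pixel → ℕ → Set
HaltsAt R P s T =
  (state (run R T (initial R P s)) ≡ Robot.halt R) ×
  (∀ i → i < T → state (run R i (initial R P s)) ≢ Robot.halt R)

{-# OPTIONS --safe #-}

-- In a polyomino no 2×2 window consists of two diagonal tiles only, so this
-- pattern can serve as a pebble that the robot recognises.  Four pebbles span a
-- rectangle around the start, whose sides are pushed outward as long as they meet
-- tiles; by connectivity, the tile-free frame obtained in the end encloses P.
-- Starting from a leftmost tile, the robot explores P by depth-first search, with
-- one pebble on the current tile and another one below it on the frame.  The copy
-- is built to the right of the frame and doubles as the memory of the search: its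
-- c×c cells record (c ≥ 2) which tiles have been visited, and the current path is
-- kept as a chain of pointers between cells, which the robot reverses while it
-- walks along the path and restores on its way back.  A cell is filled when the
-- search leaves its tile for good.  Finally, P is erased column by column.
--
-- Every step of the search takes time O(w + h + c² + cN), and there are O(N) of
-- them; cN ≤ c w h bounds the walk along the path.

module Submission where

open import Defs
open import Data.Bool using (Bool; true; false; if_then_else_; not; _∧_; _∨_)
open import Data.Bool.Properties using (∨-conicalˡ; ∨-conicalʳ)
open import Data.Empty using (⊥; ⊥-elim)
open import Data.Integer as ℤ using (ℤ; +_)
import Data.Integer.Properties as ℤ
open import Data.List using (List; []; _∷_; length; _ʳ++_; _++_; map; foldr; upTo; cartesianProductWith; concatMap; filter; deduplicate)
open import Data.List.Membership.Propositional using (_∈_; _∉_)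
open import Data.List.Membership.Propositional.Properties using (∈-filter⁺; ∈-filter⁻; ∈-∃++; ∈-++⁺ˡ; ∈-++⁺ʳ; ∈-++⁻; ∈-map⁺; ∈-map⁻; ∈-upTo⁺; ∈-upTo⁻; ∈-cartesianProductWith⁺; ∈-cartesianProductWith⁻; ∈-deduplicate⁻)
open import Data.List.Properties using (length-ʳ++; ʳ++-ʳ++; ++-identityʳ; length-++; length-map; length-upTo)
import Data.List.Relation.Unary.All as All
open import Data.List.Relation.Unary.All.Properties using (All¬⇒¬Any)
open import Data.List.Relation.Unary.AllPairs using ([]; _∷_)
open import Data.List.Relation.Unary.Any using (here; there; any?)
import Data.List.Relation.Unary.Unique.DecPropositional.Properties as UniqueDec
open import Data.List.Relation.Unary.Unique.Propositional using (Unique)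
import Data.List.Relation.Unary.Unique.Propositional.Properties as Unique
open import Data.Maybe using (Maybe; just; nothing; fromMaybe)
open import Data.Nat as ℕ using (ℕ; zero; suc)
import Data.Nat.Properties as ℕ
open import Data.Product using (_×_; _,_; proj₁; proj₂; ∃-syntax; map₁; Σ)
open import Data.Sum using (_⊎_; inj₁; inj₂; [_,_]′)
open import Data.Unit using (tt; ⊤)
open import Function using (_∘_; id; _$_)
open import Function.Bundles using (_⇔_; mk⇔)
open import Relation.Binary.PropositionalEquality
open import Relation.Nullary using (yes; no; ¬?; ¬_; Dec)
open import Relation.Nullary.Decidable using (⌊_⌋)

-- The robot sees a single pixel and has constantly many states, so everything that grows with `P`
-- (the search path, the place to return to) must lie on the grid. Algorithms are written for an
-- automaton that sees a 2×2 window; one of its steps costs at most nine robot moves. Correctness is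
-- expressed by a weakest precondition that also carries a step budget and the set of admissible
-- positions, so that one derivation yields result, time and space. A pebble hides four pixels. They
-- are carried in the finite state and put back when the pebble is lifted. A window extends up and
-- to the right of its position, so the bounds for opposite sides of the frame differ by one. After
-- its growth the frame is widened twice more, to keep its pebbles clear of the pebble of the search
-- even when that probes a pixel next to the bounding box. The root of the search is a leftmost
-- tile, so that no cell of the copy lies to the left of the cell of the root and the copy cannot
-- run into the frame. The robot depends on `c`, since it counts up to `c` in its states; the
-- constant `K` does not. For `c = 1` a cell has no room for a 2×2 code, but `P` is its own scaling.

-- Linear arithmetic over the integers and the natural numbers.

module LinearArithmetic where

  open import Data.Bool using (Bool; true; false; T; _∧_)
  open import Data.Bool.ListAction using (any)
  open import Data.Integer using (-[1+_]; _+_; _-_; _*_; _≤_; +≤+)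
  open import Data.Integer.Tactic.RingSolver using (solve-∀)
  open import Data.Fin using (Fin; zero; suc)
  open import Data.List as List using (List; []; _∷_; _++_; concatMap; map)
  open import Data.List.Relation.Unary.All using (All; []; _∷_)
  open import Data.List.Relation.Unary.All.Properties using (++⁺)
  open import Data.Vec as Vec using (Vec; []; _∷_; lookup; replicate; zipWith)
  open import Data.Vec.N-ary using (N-ary; _$ⁿ_; curryⁿ; ∀ⁿ)
  open import Data.Vec.Properties using (lookup-map)

  data Ex (n : ℕ) : Set where
    var  : Fin n → Ex n
    κ    : ℕ → Ex n
    _⊕_ _⊖_ : Ex n → Ex n → Ex n

  infixl 6 _⊕_ _⊖_
  infix 4 _≼_ _≐_
  infix 3 _⊢_

  ⟦_⟧ : ∀ {n} → Ex n → Vec ℤ n → ℤ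
  ⟦ var i ⟧ ρ   = lookup ρ i
  ⟦ κ k ⟧ ρ   = + k
  ⟦ a ⊕ b ⟧ ρ = ⟦ a ⟧ ρ + ⟦ b ⟧ ρ
  ⟦ a ⊖ b ⟧ ρ = ⟦ a ⟧ ρ - ⟦ b ⟧ ρ

  data Fo (n : ℕ) : Set where
    _≼_ _≐_ : Ex n → Ex n → Fo n

  Holds : ∀ {n} → Fo n → Vec ℤ n → Set
  Holds (a ≼ b) ρ = ⟦ a ⟧ ρ ≤ ⟦ b ⟧ ρ
  Holds (a ≐ b) ρ = ⟦ a ⟧ ρ ≡ ⟦ b ⟧ ρ

  data Problem (n : ℕ) : Set where
    _⊢_ : List (Fo n) → Fo n → Problem n

  -- Curried, so that an instance of `lin` takes its hypotheses as ordinary arguments.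
  Implies : ∀ {n} → List (Fo n) → Fo n → Vec ℤ n → Set
  Implies []       g ρ = Holds g ρ
  Implies (h ∷ hs) g ρ = Holds h ρ → Implies hs g ρ

  Valid : ∀ {n} → Problem n → Vec ℤ n → Set
  Valid (hs ⊢ g) = Implies hs g

  -- A form (k , as) stands for k + Σ aᵢ xᵢ.
  Form : ℕ → Set
  Form n = ℤ × Vec ℤ n

  dot : ∀ {n} → Vec ℤ n → Vec ℤ n → ℤ
  dot []       []       = + 0
  dot (a ∷ as) (x ∷ xs) = a * x + dot as xs

  eval : ∀ {n} → Form n → Vec ℤ n → ℤ
  eval (k , as) ρ = k + dot as ρ

  zeroF : ∀ {n} → Vec ℤ n
  zeroF = replicate _ (+ 0)

  unit : ∀ {n} → Fin n → Vec ℤ n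
  unit zero    = + 1 ∷ zeroF
  unit (suc i) = + 0 ∷ unit i

  lincomb : ∀ {n} → ℤ → ℤ → Form n → Form n → Form n
  lincomb p q (k , as) (l , bs) = p * k + q * l , zipWith (λ a b → p * a + q * b) as bs

  norm : ∀ {n} → Ex n → Form n
  norm (var i)   = + 0 , unit i
  norm (κ k)   = + k , zeroF
  norm (a ⊕ b) = lincomb (+ 1) (+ 1) (norm a) (norm b)
  norm (a ⊖ b) = lincomb (+ 1) (ℤ.- (+ 1)) (norm a) (norm b)

  private
    dot-zero : ∀ {n} (ρ : Vec ℤ n) → dot zeroF ρ ≡ + 0
    dot-zero []      = refl
    dot-zero (x ∷ ρ) rewrite dot-zero ρ = trans (ℤ.+-identityʳ _) (ℤ.*-zeroˡ x)

    dot-unit : ∀ {n} (i : Fin n) ρ → dot (unit i) ρ ≡ lookup ρ i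
    dot-unit zero    (x ∷ ρ) rewrite dot-zero ρ = trans (ℤ.+-identityʳ _) (ℤ.*-identityˡ x)
    dot-unit (suc i) (x ∷ ρ) rewrite dot-unit i ρ = trans (cong (_+ lookup ρ i) (ℤ.*-zeroˡ x)) (ℤ.+-identityˡ _)

    dot-comb : ∀ {n} p q (as bs ρ : Vec ℤ n) →
      dot (zipWith (λ a b → p * a + q * b) as bs) ρ ≡ p * dot as ρ + q * dot bs ρ
    dot-comb p q []       []       []      = lem p q
      where lem : ∀ p q → + 0 ≡ p * + 0 + q * + 0
            lem = solve-∀
    dot-comb p q (a ∷ as) (b ∷ bs) (x ∷ ρ) rewrite dot-comb p q as bs ρ = lem p q a b x (dot as ρ) (dot bs ρ)
      where lem : ∀ p q a b x s t → (p * a + q * b) * x + (p * s + q * t) ≡ p * (a * x + s) + q * (b * x + t)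
            lem = solve-∀

    eval-comb : ∀ {n} p q (f g : Form n) ρ → eval (lincomb p q f g) ρ ≡ p * eval f ρ + q * eval g ρ
    eval-comb p q (k , as) (l , bs) ρ rewrite dot-comb p q as bs ρ = lem p q k l (dot as ρ) (dot bs ρ)
      where lem : ∀ p q k l s t → (p * k + q * l) + (p * s + q * t) ≡ p * (k + s) + q * (l + t)
            lem = solve-∀

    eval-norm : ∀ {n} (e : Ex n) ρ → eval (norm e) ρ ≡ ⟦ e ⟧ ρ
    eval-norm (var i)   ρ = trans (ℤ.+-identityˡ _) (dot-unit i ρ)
    eval-norm (κ k)   ρ = trans (cong (λ s → + k + s) (dot-zero ρ)) (ℤ.+-identityʳ (+ k))
    eval-norm (a ⊕ b) ρ = trans (eval-comb (+ 1) (+ 1) (norm a) (norm b) ρ)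
      (trans (lem (eval (norm a) ρ) (eval (norm b) ρ)) (cong₂ _+_ (eval-norm a ρ) (eval-norm b ρ)))
      where lem : ∀ x y → + 1 * x + + 1 * y ≡ x + y
            lem = solve-∀
    eval-norm (a ⊖ b) ρ = trans (eval-comb (+ 1) (ℤ.- (+ 1)) (norm a) (norm b) ρ)
      (trans (lem (eval (norm a) ρ) (eval (norm b) ρ)) (cong₂ _-_ (eval-norm a ρ) (eval-norm b ρ)))
      where lem : ∀ x y → + 1 * x + (ℤ.- (+ 1)) * y ≡ x - y
            lem = solve-∀

  NonNeg : ∀ {n} → Vec ℤ n → Form n → Set
  NonNeg ρ f = + 0 ≤ eval f ρ

  -- Fourier–Motzkin elimination of the first variable.
  record Split (n : ℕ) : Set where
    constructor split
    field
      lowers uppers : List (ℕ × Form n)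
      others        : List (Form n)

  splitBy : ∀ {n} → List (Form (suc n)) → Split n
  splitBy [] = split [] [] []
  splitBy ((k , + zero ∷ as) ∷ fs)    = let split p n z = splitBy fs in split p n ((k , as) ∷ z)
  splitBy ((k , + suc a ∷ as) ∷ fs)   = let split p n z = splitBy fs in split ((suc a , k , as) ∷ p) n z
  splitBy ((k , -[1+ a ] ∷ as) ∷ fs)  = let split p n z = splitBy fs in split p ((suc a , k , as) ∷ n) z

  -- In `b * (a * x + f) + a * (- b * x + g)` the variable `x` cancels, and both multipliers are
  -- nonnegative.
  resolve : ∀ {n} → ℕ × Form n → ℕ × Form n → Form n
  resolve (a , f) (b , g) = lincomb (+ b) (+ a) f g

  eliminate : ∀ {n} → List (Form (suc n)) → List (Form n)
  eliminate fs = let split p n z = splitBy fs in concatMap (λ f → map (resolve f) n) p ++ z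

  isNeg : Form 0 → Bool
  isNeg (-[1+ _ ] , _) = true
  isNeg (+ _ , _)      = false

  refute : ∀ n → List (Form n) → Bool
  refute zero    fs = any isNeg fs
  refute (suc n) fs = refute n (eliminate fs)

  private

    Pos Neg : ∀ {n} → ℤ → Vec ℤ n → ℕ × Form n → Set
    Pos x ρ (a , f) = + 0 ≤ + a * x + eval f ρ
    Neg x ρ (a , f) = + 0 ≤ (ℤ.- (+ a)) * x + eval f ρ

    split-sound : ∀ {n} x (ρ : Vec ℤ n) fs → All (NonNeg (x ∷ ρ)) fs →
      let split p n z = splitBy fs in All (Pos x ρ) p × All (Neg x ρ) n × All (NonNeg ρ) z
    split-sound x ρ [] [] = [] , [] , []
    split-sound x ρ ((k , + zero ∷ as) ∷ fs) (h ∷ hs) =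
      let p , n , z = split-sound x ρ fs hs in p , n , subst (+ 0 ≤_) (lem k x (dot as ρ)) h ∷ z
      where lem : ∀ k x s → k + (+ 0 * x + s) ≡ k + s
            lem = solve-∀
    split-sound x ρ ((k , + suc a ∷ as) ∷ fs) (h ∷ hs) =
      let p , n , z = split-sound x ρ fs hs in subst (+ 0 ≤_) (lem k (+ suc a) x (dot as ρ)) h ∷ p , n , z
      where lem : ∀ k a x s → k + (a * x + s) ≡ a * x + (k + s)
            lem = solve-∀
    split-sound x ρ ((k , -[1+ a ] ∷ as) ∷ fs) (h ∷ hs) =
      let p , n , z = split-sound x ρ fs hs in p , subst (+ 0 ≤_) (lem k (-[1+ a ]) x (dot as ρ)) h ∷ n , z
      where lem : ∀ k a x s → k + (a * x + s) ≡ a * x + (k + s)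
            lem = solve-∀

    resolve-sound : ∀ {n} x (ρ : Vec ℤ n) f g → Pos x ρ f → Neg x ρ g → NonNeg ρ (resolve f g)
    resolve-sound x ρ (a , f) (b , g) hf hg rewrite eval-comb (+ b) (+ a) f g ρ =
      subst (+ 0 ≤_) (lem (+ a) (+ b) x (eval f ρ) (eval g ρ)) (ℤ.+-mono-≤ (scale b hf) (scale a hg))
      where scale : ∀ p {x} → + 0 ≤ x → + 0 ≤ + p * x
            scale p {x} h = subst (_≤ + p * x) (ℤ.*-zeroʳ (+ p)) (ℤ.*-monoˡ-≤-nonNeg (+ p) h)
            lem : ∀ a b x s t → b * (a * x + s) + a * ((ℤ.- b) * x + t) ≡ b * s + a * t
            lem = solve-∀

    eliminate-sound : ∀ {n} x (ρ : Vec ℤ n) fs → All (NonNeg (x ∷ ρ)) fs → All (NonNeg ρ) (eliminate fs)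
    eliminate-sound x ρ fs hs = let p , n , z = split-sound x ρ fs hs in ++⁺ (pairs p n) z
      where
        row : ∀ f {gs} → Pos x ρ f → All (Neg x ρ) gs → All (NonNeg ρ) (map (resolve f) gs)
        row f {[]}     hf []       = []
        row f {g ∷ gs} hf (h ∷ hs) = resolve-sound x ρ f g hf h ∷ row f hf hs
        pairs : ∀ {fs gs} → All (Pos x ρ) fs → All (Neg x ρ) gs → All (NonNeg ρ) (concatMap (λ f → map (resolve f) gs) fs)
        pairs {[]}     []       hg = []
        pairs {f ∷ fs} (h ∷ hf) hg = ++⁺ (row f h hg) (pairs hf hg)

    refute-sound : ∀ n fs (ρ : Vec ℤ n) → T (refute n fs) → All (NonNeg ρ) fs → ⊥
    refute-sound zero ((-[1+ k ] , []) ∷ fs) [] t (h ∷ hs) with () ← subst (+ 0 ≤_) (ℤ.+-identityʳ (-[1+ k ])) h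
    refute-sound zero ((+ k , []) ∷ fs) [] t (h ∷ hs) = refute-sound zero fs [] t hs
    refute-sound (suc n) fs (x ∷ ρ) t hs = refute-sound n (eliminate fs) ρ t (eliminate-sound x ρ fs hs)

  hyps : ∀ {n} → List (Fo n) → List (Form n)
  hyps []             = []
  hyps ((a ≼ b) ∷ hs) = norm (b ⊖ a) ∷ hyps hs
  hyps ((a ≐ b) ∷ hs) = norm (b ⊖ a) ∷ norm (a ⊖ b) ∷ hyps hs

  -- Over the integers the negation of `a ≤ b` is `0 ≤ a - b - 1`. Integrality enters only here: the
  -- elimination works over the rationals, so the test may reject a valid problem but never accepts
  -- an invalid one.
  decide : ∀ {n} → Problem n → Bool
  decide {n} (hs ⊢ (a ≼ b)) = refute n (norm (a ⊖ b ⊖ κ 1) ∷ hyps hs)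
  decide {n} (hs ⊢ (a ≐ b)) = refute n (norm (a ⊖ b ⊖ κ 1) ∷ hyps hs) ∧ refute n (norm (b ⊖ a ⊖ κ 1) ∷ hyps hs)

  private
    T-∧ : ∀ {a b} → T (a ∧ b) → T a × T b
    T-∧ {true} t = tt , t

    diff : ∀ {n} (a b : Ex n) ρ → ⟦ a ⟧ ρ ≤ ⟦ b ⟧ ρ → NonNeg ρ (norm (b ⊖ a))
    diff a b ρ h = subst (+ 0 ≤_) (sym (eval-norm (b ⊖ a) ρ)) (ℤ.i≤j⇒0≤j-i h)

    refute-≤ : ∀ {n} (a b : Ex n) fs ρ → T (refute n (norm (a ⊖ b ⊖ κ 1) ∷ fs)) → All (NonNeg ρ) fs → ⟦ a ⟧ ρ ≤ ⟦ b ⟧ ρ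
    refute-≤ {n} a b fs ρ t hs with ⟦ a ⟧ ρ ℤ.≤? ⟦ b ⟧ ρ
    ... | yes p = p
    ... | no ¬p = ⊥-elim (refute-sound n _ ρ t (subst (+ 0 ≤_) (sym (eval-norm (a ⊖ b ⊖ κ 1) ρ)) strict ∷ hs))
      where strict : + 0 ≤ ⟦ a ⟧ ρ - ⟦ b ⟧ ρ - + 1
            strict = subst (+ 0 ≤_) (lem (⟦ a ⟧ ρ) (⟦ b ⟧ ρ)) (ℤ.i≤j⇒0≤j-i (ℤ.i<j⇒suc[i]≤j (ℤ.≰⇒> ¬p)))
              where lem : ∀ x y → x - (+ 1 + y) ≡ x - y - + 1
                    lem = solve-∀

    goal-sound : ∀ {n} hs (g : Fo n) ρ → T (decide (hs ⊢ g)) → All (NonNeg ρ) (hyps hs) → Holds g ρ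
    goal-sound hs (a ≼ b) ρ t h = refute-≤ a b _ ρ t h
    goal-sound hs (a ≐ b) ρ t h = let t₁ , t₂ = T-∧ t in ℤ.≤-antisym (refute-≤ a b _ ρ t₁ h) (refute-≤ b a _ ρ t₂ h)

    implies : ∀ {n} hs (g : Fo n) ρ → (All (NonNeg ρ) (hyps hs) → Holds g ρ) → Implies hs g ρ
    implies []             g ρ k = k []
    implies ((a ≼ b) ∷ hs) g ρ k = λ h → implies hs g ρ λ hs′ → k (diff a b ρ h ∷ hs′)
    implies ((a ≐ b) ∷ hs) g ρ k = λ h → implies hs g ρ λ hs′ → k (diff a b ρ (ℤ.≤-reflexive h) ∷ diff b a ρ (ℤ.≤-reflexive (sym h)) ∷ hs′)

    sound : ∀ {n} (p : Problem n) ρ → T (decide p) → Valid p ρ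
    sound (hs ⊢ g) ρ t = implies hs g ρ (goal-sound hs g ρ t)

    ∀-curry : ∀ n {B : Vec ℤ n → Set} → (∀ ρ → B ρ) → ∀ⁿ n (curryⁿ B)
    ∀-curry zero    f = f []
    ∀-curry (suc n) f = λ x → ∀-curry n (λ ρ → f (x ∷ ρ))

  vars : ∀ {n} → Vec (Ex n) n
  vars = Vec.map var (Vec.allFin _)

  -- Proof by evaluation: when the test succeeds, the hidden argument has type `⊤` and is filled in
  -- automatically. Nonlinear terms such as `+ c * x` are passed as values of variables.
  lin : ∀ n (f : N-ary n (Ex n) (Problem n)) {_ : T (decide (f $ⁿ vars))} →
        ∀ⁿ n (curryⁿ (Valid (f $ⁿ vars)))
  lin n f {t} = ∀-curry n (λ ρ → sound (f $ⁿ vars) ρ t)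

  ⟦_⟧ℕ : ∀ {n} → Ex n → Vec ℕ n → ℕ
  ⟦ var i ⟧ℕ ρ   = lookup ρ i
  ⟦ κ k ⟧ℕ ρ   = k
  ⟦ a ⊕ b ⟧ℕ ρ = ⟦ a ⟧ℕ ρ ℕ.+ ⟦ b ⟧ℕ ρ
  ⟦ a ⊖ b ⟧ℕ ρ = ⟦ a ⟧ℕ ρ ℕ.∸ ⟦ b ⟧ℕ ρ

  Holdsℕ : ∀ {n} → Fo n → Vec ℕ n → Set
  Holdsℕ (a ≼ b) ρ = ⟦ a ⟧ℕ ρ ℕ.≤ ⟦ b ⟧ℕ ρ
  Holdsℕ (a ≐ b) ρ = ⟦ a ⟧ℕ ρ ≡ ⟦ b ⟧ℕ ρ

  Impliesℕ : ∀ {n} → List (Fo n) → Fo n → Vec ℕ n → Set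
  Impliesℕ []       g ρ = Holdsℕ g ρ
  Impliesℕ (h ∷ hs) g ρ = Holdsℕ h ρ → Impliesℕ hs g ρ

  Validℕ : ∀ {n} → Problem n → Vec ℕ n → Set
  Validℕ (hs ⊢ g) = Impliesℕ hs g

  -- Truncated subtraction is not linear, so it is excluded from problems over ℕ.
  additive : ∀ {n} → Ex n → Bool
  additive (var i)   = true
  additive (κ k)   = true
  additive (a ⊕ b) = additive a ∧ additive b
  additive (a ⊖ b) = false

  additiveF : ∀ {n} → Fo n → Bool
  additiveF (a ≼ b) = additive a ∧ additive b
  additiveF (a ≐ b) = additive a ∧ additive b

  nonNegatives : ∀ {n} → List (Fo n)
  nonNegatives = List.map (λ i → κ 0 ≼ var i) (List.allFin _)

  decideℕ : ∀ {n} → Problem n → Bool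
  decideℕ (hs ⊢ g) = (List.foldr (λ h b → additiveF h ∧ b) true hs ∧ additiveF g) ∧ decide (nonNegatives ++ hs ⊢ g)

  private
    casts : ∀ {n} → Vec ℕ n → Vec ℤ n
    casts = Vec.map (λ k → + k)

    eval-additive : ∀ {n} (e : Ex n) ρ → T (additive e) → ⟦ e ⟧ (casts ρ) ≡ + ⟦ e ⟧ℕ ρ
    eval-additive (var i)   ρ t = lookup-map i (λ k → + k) ρ
    eval-additive (κ k)   ρ t = refl
    eval-additive (a ⊕ b) ρ t = let t₁ , t₂ = T-∧ t in cong₂ _+_ (eval-additive a ρ t₁) (eval-additive b ρ t₂)

    raise : ∀ {n} (f : Fo n) ρ → T (additiveF f) → Holdsℕ f ρ → Holds f (casts ρ)
    raise (a ≼ b) ρ t h = let t₁ , t₂ = T-∧ {additive a} t in subst₂ _≤_ (sym (eval-additive a ρ t₁)) (sym (eval-additive b ρ t₂)) (+≤+ h)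
    raise (a ≐ b) ρ t h = let t₁ , t₂ = T-∧ {additive a} t in trans (eval-additive a ρ t₁) (trans (cong (λ k → + k) h) (sym (eval-additive b ρ t₂)))

    lower : ∀ {n} (f : Fo n) ρ → T (additiveF f) → Holds f (casts ρ) → Holdsℕ f ρ
    lower (a ≼ b) ρ t h = let t₁ , t₂ = T-∧ {additive a} t in ℤ.drop‿+≤+ (subst₂ _≤_ (eval-additive a ρ t₁) (eval-additive b ρ t₂) h)
    lower (a ≐ b) ρ t h = let t₁ , t₂ = T-∧ {additive a} t in ℤ.+-injective (trans (sym (eval-additive a ρ t₁)) (trans h (eval-additive b ρ t₂)))

    discharge : ∀ {n} (is : List (Fin n)) hs (g : Fo n) ρ →
      Implies (List.map (λ i → κ 0 ≼ var i) is ++ hs) g (casts ρ) → Implies hs g (casts ρ)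
    discharge []       hs g ρ k = k
    discharge (i ∷ is) hs g ρ k = discharge is hs g ρ (k (subst (+ 0 ≤_) (sym (lookup-map i (λ k → + k) ρ)) (+≤+ ℕ.z≤n)))

    transfer : ∀ {n} hs (g : Fo n) ρ → T (List.foldr (λ h b → additiveF h ∧ b) true hs) → T (additiveF g) →
      Implies hs g (casts ρ) → Impliesℕ hs g ρ
    transfer []       g ρ t u k = lower g ρ u k
    transfer (h ∷ hs) g ρ t u k = λ p → let t₁ , t₂ = T-∧ {additiveF h} t in transfer hs g ρ t₂ u (k (raise h ρ t₁ p))

    soundℕ : ∀ {n} (p : Problem n) ρ → T (decideℕ p) → Validℕ p ρ
    soundℕ (hs ⊢ g) ρ t =
      let t₁ , t₂ = T-∧ t
          u₁ , u₂ = T-∧ {List.foldr (λ h b → additiveF h ∧ b) true hs} t₁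
      in transfer hs g ρ u₁ u₂ (discharge (List.allFin _) hs g ρ (sound (nonNegatives ++ hs ⊢ g) (casts ρ) t₂))

    ∀-curryℕ : ∀ n {B : Vec ℕ n → Set} → (∀ ρ → B ρ) → ∀ⁿ n (curryⁿ B)
    ∀-curryℕ zero    f = f []
    ∀-curryℕ (suc n) f = λ x → ∀-curryℕ n (λ ρ → f (x ∷ ρ))

  linℕ : ∀ n (f : N-ary n (Ex n) (Problem n)) {_ : T (decideℕ (f $ⁿ vars))} →
         ∀ⁿ n (curryⁿ (Validℕ (f $ⁿ vars)))
  linℕ n f {t} = ∀-curryℕ n (λ ρ → soundℕ (f $ⁿ vars) ρ t)

  0≤+ : ∀ n → + 0 ≤ + n
  0≤+ n = +≤+ ℕ.z≤n

open LinearArithmetic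

-- Window programs, their logic, and their compilation to robots.

module WindowPrograms where

  open import Data.Fin as Fin using (Fin; zero; suc)
  import Data.Fin.Properties as Fin

  -- A retract of `Fin size` rather than a bijection, so that a type qualifies as soon as it embeds
  -- with a left inverse into sums and products of finite types.
  record Finite (A : Set) : Set where
    no-eta-equality
    field
      size    : ℕ
      enc     : A → Fin size
      dec     : Fin size → A
      dec-enc : ∀ a → dec (enc a) ≡ a
  open Finite

  retract : ∀ {A B : Set} → Finite B → (f : A → B) (g : B → A) → (∀ a → g (f a) ≡ a) → Finite A
  retract F f g gf = record
    { size = size F ; enc = enc F ∘ f ; dec = g ∘ dec F
    ; dec-enc = λ a → trans (cong g (dec-enc F (f a))) (gf a) }

  instance
    finite-⊤ : Finite ⊤
    finite-⊤ = record { size = 1 ; enc = λ _ → zero ; dec = λ _ → tt ; dec-enc = λ _ → refl }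

    finite-⊎ : ∀ {A B : Set} → ⦃ Finite A ⦄ → ⦃ Finite B ⦄ → Finite (A ⊎ B)
    finite-⊎ {A} {B} ⦃ F ⦄ ⦃ G ⦄ = record
      { size = size F ℕ.+ size G
      ; enc = λ x → Fin.join _ _ (Data.Sum.map (enc F) (enc G) x)
      ; dec = λ i → Data.Sum.map (dec F) (dec G) (Fin.splitAt (size F) i)
      ; dec-enc = λ x → trans (cong (Data.Sum.map (dec F) (dec G)) (Fin.splitAt-join (size F) (size G) (Data.Sum.map (enc F) (enc G) x))) (inv x) }
      where
        inv : ∀ x → Data.Sum.map (dec F) (dec G) (Data.Sum.map (enc F) (enc G) x) ≡ x
        inv (inj₁ a) = cong inj₁ (dec-enc F a)
        inv (inj₂ b) = cong inj₂ (dec-enc G b)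

    finite-× : ∀ {A B : Set} → ⦃ Finite A ⦄ → ⦃ Finite B ⦄ → Finite (A × B)
    finite-× ⦃ F ⦄ ⦃ G ⦄ = record
      { size = size F ℕ.* size G
      ; enc = λ (a , b) → Fin.combine (enc F a) (enc G b)
      ; dec = λ i → Data.Product.map (dec F) (dec G) (Fin.remQuot (size G) i)
      ; dec-enc = λ (a , b) → trans (cong (Data.Product.map (dec F) (dec G)) (Fin.remQuot-combine (enc F a) (enc G b)))
                                    (cong₂ _,_ (dec-enc F a) (dec-enc G b)) }

    finite-Bool : Finite Bool
    finite-Bool = retract {B = ⊤ ⊎ ⊤} finite-⊎ (λ { true → inj₁ tt ; false → inj₂ tt })
      (λ { (inj₁ _) → true ; (inj₂ _) → false }) (λ { true → refl ; false → refl })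

    finite-Maybe : ∀ {A : Set} → ⦃ Finite A ⦄ → Finite (Maybe A)
    finite-Maybe {A} = retract {B = A ⊎ ⊤} finite-⊎ (λ { (just a) → inj₁ a ; nothing → inj₂ tt })
      (λ { (inj₁ a) → just a ; (inj₂ _) → nothing }) (λ { (just a) → refl ; nothing → refl })

    finite-Dir : Finite Dir
    finite-Dir = retract {B = Bool × Bool} finite-×
      (λ { up → true , true ; down → true , false ; left → false , true ; right → false , false })
      (λ { (true , true) → up ; (true , false) → down ; (false , true) → left ; (false , false) → right })
      (λ { up → refl ; down → refl ; left → refl ; right → refl })

  -- Programs are specified on characteristic functions, compared pointwise, because a tile list
  -- also depends on the history of writes.
  Picture : Set
  Picture = Pixel → Bool

  opaque
    put : Pixel → Bool → Picture → Picture
    put p b f r = if ⌊ p ≟P r ⌋ then b else f r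

    put-same : ∀ p b f → put p b f p ≡ b
    put-same p b f with p ≟P p
    ... | yes _ = refl
    ... | no ¬e = ⊥-elim (¬e refl)

    put-other : ∀ {p r} b f → p ≢ r → put p b f r ≡ f r
    put-other {p} {r} b f ne with p ≟P r
    ... | yes e = ⊥-elim (ne e)
    ... | no _  = refl

    put-idem : ∀ p f → put p (f p) f ≗ f
    put-idem p f r with p ≟P r
    ... | yes refl = refl
    ... | no _     = refl

    put-cong : ∀ p b {f g : Picture} → f ≗ g → put p b f ≗ put p b g
    put-cong p b e r with p ≟P r
    ... | yes _ = refl
    ... | no _  = e r

  -- The bits are those of q, q + (1,0), q + (1,1), q + (0,1), in this order.
  data Win : Set where
    mkW : (b₀ b₁ b₂ b₃ : Bool) → Win

  instance
    finite-Win : Finite Win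
    finite-Win = retract {B = Bool × Bool × Bool × Bool} finite-×
      (λ { (mkW a b c d) → a , b , c , d }) (λ { (a , b , c , d) → mkW a b c d }) (λ { (mkW a b c d) → refl })

  corner₁ corner₂ corner₃ : Pixel → Pixel
  corner₁ q = move right q
  corner₂ q = move up (move right q)
  corner₃ q = move up q

  win : Picture → Pixel → Win
  win f q = mkW (f q) (f (corner₁ q)) (f (corner₂ q)) (f (corner₃ q))

  opaque
    paint : Pixel → Win → Picture → Picture
    paint q (mkW a b c d) f = put (corner₃ q) d (put (corner₂ q) c (put (corner₁ q) b (put q a f)))

    paint-def : ∀ q a b c d f → paint q (mkW a b c d) f ≡ put (corner₃ q) d (put (corner₂ q) c (put (corner₁ q) b (put q a f)))
    paint-def q a b c d f = refl

  paintM : Maybe Win → Pixel → Picture → Picture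
  paintM nothing  q f = f
  paintM (just w) q f = paint q w f

  moveM : Maybe Dir → Pixel → Pixel
  moveM nothing  q = q
  moveM (just d) q = move d q

  opaque
    unfolding paint

    -- Justifies that a step without a write is executed by writing back the window just read.
    paint-idem : ∀ q f → paint q (win f q) f ≗ f
    paint-idem q f r = trans (put-cong₃ r) (put-idem (corner₃ q) f r)
      where
        e₀ : put q (f q) f ≗ f
        e₀ = put-idem q f
        e₁ : put (corner₁ q) (f (corner₁ q)) (put q (f q) f) ≗ f
        e₁ r = trans (put-cong (corner₁ q) _ e₀ r) (put-idem (corner₁ q) f r)
        e₂ : put (corner₂ q) (f (corner₂ q)) (put (corner₁ q) (f (corner₁ q)) (put q (f q) f)) ≗ f
        e₂ r = trans (put-cong (corner₂ q) _ e₁ r) (put-idem (corner₂ q) f r)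
        put-cong₃ : paint q (win f q) f ≗ put (corner₃ q) (f (corner₃ q)) f
        put-cong₃ = put-cong (corner₃ q) (f (corner₃ q)) e₂

  -- Window programs: finite automata which, in one step, read the 2×2 window at
  -- their position, optionally overwrite it and optionally move.

  record Prog (A B : Set) : Set₁ where
    no-eta-equality
    field
      St    : Set
      fin   : Finite St
      enter : A → St
      next  : St → Win → (St ⊎ B) × Maybe Win × Maybe Dir
  open Prog

  op : ∀ {A B : Set} → ⦃ Finite A ⦄ → (A → Win → B × Maybe Win × Maybe Dir) → Prog A B
  op {A} k .St = A
  op ⦃ F ⦄ k .fin = F
  op k .enter = id
  op k .next a w = map₁ inj₂ (k a w)

  first : ∀ {A B C : Set} (p : Prog A B) (r : Prog B C) → St p ⊎ B → (St p ⊎ St r) ⊎ C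
  first p r = [ inj₁ ∘ inj₁ , inj₁ ∘ inj₂ ∘ enter r ]′

  inLeft : ∀ {S S′ C : Set} → S ⊎ C → (S ⊎ S′) ⊎ C
  inLeft = [ inj₁ ∘ inj₁ , inj₂ ]′

  inRight : ∀ {S S′ C : Set} → S′ ⊎ C → (S ⊎ S′) ⊎ C
  inRight = [ inj₁ ∘ inj₂ , inj₂ ]′

  again : ∀ {A B : Set} (p : Prog A (A ⊎ B)) → St p ⊎ (A ⊎ B) → St p ⊎ B
  again p = [ inj₁ , [ inj₁ ∘ enter p , inj₂ ]′ ]′

  tag : ∀ {X S B : Set} → X → S ⊎ B → (X × S) ⊎ (X × B)
  tag x = Data.Sum.map (x ,_) (x ,_)

  infixr 4 _⟫_
  _⟫_ : ∀ {A B C : Set} → Prog A B → Prog B C → Prog A C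
  (p ⟫ r) .St = St p ⊎ St r
  (p ⟫ r) .fin = finite-⊎ ⦃ fin p ⦄ ⦃ fin r ⦄
  (p ⟫ r) .enter = inj₁ ∘ enter p
  (p ⟫ r) .next (inj₁ s) w = map₁ (first p r) (next p s w)
  (p ⟫ r) .next (inj₂ s) w = map₁ inRight (next r s w)

  choice : ∀ {A B C : Set} → Prog A C → Prog B C → Prog (A ⊎ B) C
  choice p r .St = St p ⊎ St r
  choice p r .fin = finite-⊎ ⦃ fin p ⦄ ⦃ fin r ⦄
  choice p r .enter = Data.Sum.map (enter p) (enter r)
  choice p r .next (inj₁ s) w = map₁ inLeft (next p s w)
  choice p r .next (inj₂ s) w = map₁ inRight (next r s w)

  loop : ∀ {A B : Set} → Prog A (A ⊎ B) → Prog A B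
  loop p .St = St p
  loop p .fin = fin p
  loop p .enter = enter p
  loop p .next s w = map₁ (again p) (next p s w)

  carry : ∀ {A B : Set} (X : Set) → ⦃ Finite X ⦄ → Prog A B → Prog (X × A) (X × B)
  carry X p .St = X × St p
  carry X ⦃ F ⦄ p .fin = finite-× ⦃ F ⦄ ⦃ fin p ⦄
  carry X p .enter (x , a) = x , enter p a
  carry X p .next (x , s) w = map₁ (tag x) (next p s w)

  pre : ∀ {A A′ B : Set} → (A′ → A) → Prog A B → Prog A′ B
  pre h p .St = St p
  pre h p .fin = fin p
  pre h p .enter = enter p ∘ h
  pre h p .next = next p

  post : ∀ {A B B′ : Set} → (B → B′) → Prog A B → Prog A B′
  post h p .St = St p
  post h p .fin = fin p
  post h p .enter = enter p
  post h p .next s w = map₁ (Data.Sum.map id h) (next p s w)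

  -- WP p Q t s q f: from state s, at position q on picture f, program p visits
  -- only anchors and exits within t steps, in a situation satisfying Q.

  module Semantics (Anchor : Pixel → Set) where

    data WP {A B : Set} (p : Prog A B) (Q : B → Pixel → Picture → Set) : ℕ → St p → Pixel → Picture → Set where
      halts : ∀ {t s q f b mw md} → Anchor q → next p s (win f q) ≡ (inj₂ b , mw , md) →
              Q b (moveM md q) (paintM mw q f) → WP p Q (suc t) s q f
      goes  : ∀ {t s q f s′ mw md} → Anchor q → next p s (win f q) ≡ (inj₁ s′ , mw , md) →
              WP p Q t s′ (moveM md q) (paintM mw q f) → WP p Q (suc t) s q f

    -- The postcondition comes last and is itself a `Run` in a composition, so that derivations
    -- follow the text of the program.
    Run : ∀ {A B : Set} → Prog A B → A → ℕ → Pixel → Picture → (B → Pixel → Picture → Set) → Set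
    Run p a t q f Q = WP p Q t (enter p a) q f

    module _ {A B : Set} {p : Prog A B} where

      wp-mono : ∀ {Q t t′ s q f} → t ℕ.≤ t′ → WP p Q t s q f → WP p Q t′ s q f
      wp-mono (ℕ.s≤s le) (halts a e x) = halts a e x
      wp-mono (ℕ.s≤s le) (goes a e x)  = goes a e (wp-mono le x)

      wp-at : ∀ {Q t s q q′ f} → q ≡ q′ → WP p Q t s q′ f → WP p Q t s q f
      wp-at refl x = x

      wp-post : ∀ {Q Q′ t s q f} → (∀ {b q f} → Q b q f → Q′ b q f) → WP p Q t s q f → WP p Q′ t s q f
      wp-post h (halts a e x) = halts a e (h x)
      wp-post h (goes a e x)  = goes a e (wp-post h x)

      -- The outcome of a run does not depend on the postcondition it is proved for.
      wp-exact : ∀ {Q t s q f} → WP p Q t s q f → ∃[ b ] ∃[ q′ ] ∃[ f′ ]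
        (Q b q′ f′ × WP p (λ b₁ q₁ f₁ → (b₁ ≡ b × q₁ ≡ q′) × f₁ ≡ f′) t s q f)
      wp-exact (halts a e x) = _ , _ , _ , x , halts a e ((refl , refl) , refl)
      wp-exact (goes a e x)  = let b , q′ , f′ , y , w = wp-exact x in b , q′ , f′ , y , goes a e w

    run-op : ∀ {A B : Set} {F : Finite A} {k : A → Win → B × Maybe Win × Maybe Dir} {a q f b mw md Q} →
      Anchor q → k a (win f q) ≡ (b , mw , md) → Q b (moveM md q) (paintM mw q f) → Run (op ⦃ F ⦄ k) a 1 q f Q
    run-op a e x = halts a (cong (map₁ inj₂) e) x

    module _ {A B C : Set} {p : Prog A B} {r : Prog B C} where
      wp-⟫₂ : ∀ {Q t s q f} → WP r Q t s q f → WP (p ⟫ r) Q t (inj₂ s) q f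
      wp-⟫₂ (halts a e x) = halts a (cong (map₁ inRight) e) x
      wp-⟫₂ (goes a e x)  = goes a (cong (map₁ inRight) e) (wp-⟫₂ x)

      -- The budgets add without overhead, because the last step of `p` already enters the first
      -- state of `r`.
      wp-⟫ : ∀ {Q t₁ t₂ s q f} → WP p (λ b q f → Run r b t₂ q f Q) t₁ s q f → WP (p ⟫ r) Q (t₁ ℕ.+ t₂) (inj₁ s) q f
      wp-⟫ {t₁ = suc t₁} {t₂} (halts a e x) = goes a (cong (map₁ (first p r)) e) (wp-mono (ℕ.m≤n+m t₂ t₁) (wp-⟫₂ x))
      wp-⟫ (goes a e x)  = goes a (cong (map₁ (first p r)) e) (wp-⟫ x)

    module _ {A B C : Set} {p : Prog A C} {r : Prog B C} where
      wp-choice₁ : ∀ {Q t s q f} → WP p Q t s q f → WP (choice p r) Q t (inj₁ s) q f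
      wp-choice₁ (halts a e x) = halts a (cong (map₁ inLeft) e) x
      wp-choice₁ (goes a e x)  = goes a (cong (map₁ inLeft) e) (wp-choice₁ x)

      wp-choice₂ : ∀ {Q t s q f} → WP r Q t s q f → WP (choice p r) Q t (inj₂ s) q f
      wp-choice₂ (halts a e x) = halts a (cong (map₁ inRight) e) x
      wp-choice₂ (goes a e x)  = goes a (cong (map₁ inRight) e) (wp-choice₂ x)

    module _ {A B : Set} {p : Prog A (A ⊎ B)} where
      Again : ℕ → (B → Pixel → Picture → Set) → A ⊎ B → Pixel → Picture → Set
      Again t Q (inj₁ a) q f = Run (loop p) a t q f Q
      Again t Q (inj₂ b) q f = Q b q f

      -- Unfolds a single iteration. Loops are treated below by induction on a bound for the
      -- iterations that remain.
      wp-loop : ∀ {Q t₁ t₂ s q f} → WP p (Again t₂ Q) t₁ s q f → WP (loop p) Q (t₁ ℕ.+ t₂) s q f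
      wp-loop {t₁ = suc t₁} {t₂} (halts {b = inj₁ a′} a e x) = goes a (cong (map₁ (again p)) e) (wp-mono (ℕ.m≤n+m t₂ t₁) x)
      wp-loop (halts {b = inj₂ b} a e x)  = halts a (cong (map₁ (again p)) e) x
      wp-loop (goes a e x)                = goes a (cong (map₁ (again p)) e) (wp-loop x)

    wp-carry : ∀ {A B X : Set} {F : Finite X} {p : Prog A B} {Q t x s q f} →
      WP p (λ b → Q (x , b)) t s q f → WP (carry X ⦃ F ⦄ p) Q t (x , s) q f
    wp-carry {x = z} (halts a e x) = halts a (cong (map₁ (tag z)) e) x
    wp-carry {x = z} (goes a e x)  = goes a (cong (map₁ (tag z)) e) (wp-carry x)

    wp-pre : ∀ {A A′ B : Set} {h : A′ → A} {p : Prog A B} {Q t s q f} → WP p Q t s q f → WP (pre h p) Q t s q f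
    wp-pre (halts a e x) = halts a e x
    wp-pre (goes a e x)  = goes a e (wp-pre x)

    wp-map : ∀ {A B B′ : Set} {h : B → B′} {p : Prog A B} {Q t s q f} →
      WP p (λ b → Q (h b)) t s q f → WP (post h p) Q t s q f
    wp-map {h = h} (halts a e x) = halts a (cong (map₁ (Data.Sum.map id h)) e) x
    wp-map {h = h} (goes a e x)  = goes a (cong (map₁ (Data.Sum.map id h)) e) (wp-map x)

  -- For joining two phases: the positions used by the second one can be named only when the outcome
  -- of the first is known.
  wp-anchors : ∀ {Anchor Anchor′ : Pixel → Set} → (∀ {q} → Anchor q → Anchor′ q) → ∀ {A B : Set} {p : Prog A B} {Q t s q f} →
    Semantics.WP Anchor p Q t s q f → Semantics.WP Anchor′ p Q t s q f
  wp-anchors h (Semantics.halts a e x) = Semantics.halts (h a) e x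
  wp-anchors h (Semantics.goes a e x)  = Semantics.goes (h a) e (wp-anchors h x)

  pic : List Pixel → Picture
  pic ts q = occupied q ts

  ∈⇒pic : ∀ {q ts} → q ∈ ts → pic ts q ≡ true
  ∈⇒pic {q} {ts} h with any? (q ≟P_) ts
  ... | yes _ = refl
  ... | no ¬p = ⊥-elim (¬p h)

  pic⇒∈ : ∀ {q ts} → pic ts q ≡ true → q ∈ ts
  pic⇒∈ {q} {ts} h with any? (q ≟P_) ts
  ... | yes p = p

  bool-ext : ∀ {a b : Bool} → (a ≡ true → b ≡ true) → (b ≡ true → a ≡ true) → a ≡ b
  bool-ext {true}  {b}     f g = sym (f refl)
  bool-ext {false} {true}  f g = g refl
  bool-ext {false} {false} f g = refl

  opaque
    unfolding put

    pic-set : ∀ p b ts → pic (setPixel p b ts) ≗ put p b (pic ts)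
    pic-set p false ts r with p ≟P r
    ... | yes refl = bool-ext (λ h → ⊥-elim (proj₂ (∈-filter⁻ (λ t → ¬? (p ≟P t)) {xs = ts} (pic⇒∈ h)) refl)) (λ ())
    ... | no ne    = bool-ext (λ h → ∈⇒pic (proj₁ (∈-filter⁻ (λ t → ¬? (p ≟P t)) {xs = ts} (pic⇒∈ h))))
                              (λ h → ∈⇒pic (∈-filter⁺ (λ t → ¬? (p ≟P t)) (pic⇒∈ h) ne))
    pic-set p true ts r with pic ts p in eq
    ... | true with p ≟P r
    ...   | yes refl = eq
    ...   | no _     = refl
    pic-set p true ts r | false with p ≟P r
    ...   | yes refl = ∈⇒pic (here refl)
    ...   | no ne    = bool-ext (λ h → ∈⇒pic (tail (pic⇒∈ h))) (λ h → ∈⇒pic (there (pic⇒∈ h)))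
      where tail : r ∈ p ∷ ts → r ∈ ts
            tail (here e)  = ⊥-elim (ne (sym e))
            tail (there h) = h

  -- One round of four moves around the window reads it, a second round writes it, and a ninth move
  -- leads to the next position. Either round ends where it began.
  data Phase : Set where
    r₀ r₁ r₂ r₃ w₀ w₁ w₂ w₃ mv : Phase

  finite-Phase : Finite Phase
  finite-Phase = retract {B = Maybe (Dir ⊎ Dir)} finite-Maybe
    (λ { r₀ → just (inj₁ up) ; r₁ → just (inj₁ down) ; r₂ → just (inj₁ left) ; r₃ → just (inj₁ right)
       ; w₀ → just (inj₂ up) ; w₁ → just (inj₂ down) ; w₂ → just (inj₂ left) ; w₃ → just (inj₂ right) ; mv → nothing })
    (λ { (just (inj₁ up)) → r₀ ; (just (inj₁ down)) → r₁ ; (just (inj₁ left)) → r₂ ; (just (inj₁ right)) → r₃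
       ; (just (inj₂ up)) → w₀ ; (just (inj₂ down)) → w₁ ; (just (inj₂ left)) → w₂ ; (just (inj₂ right)) → w₃ ; nothing → mv })
    (λ { r₀ → refl ; r₁ → refl ; r₂ → refl ; r₃ → refl ; w₀ → refl ; w₁ → refl ; w₂ → refl ; w₃ → refl ; mv → refl })

  -- The robot of a window program.

  module Compile {B : Set} (p : Prog ⊤ B) where

    Busy Control : Set
    Busy    = St p × Win × Phase
    Control = Maybe Busy

    opaque
      -- Opaque, so that the number of states of a concrete program is never evaluated.
      finite-Control : Finite Control
      finite-Control = finite-Maybe ⦃ finite-× ⦃ fin p ⦄ ⦃ finite-× ⦃ finite-Win ⦄ ⦃ finite-Phase ⦄ ⦄ ⦄

    resume : St p ⊎ B → Control
    resume (inj₁ s) = just (s , mkW false false false false , r₀)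
    resume (inj₂ _) = nothing

    bit₀ bit₁ bit₂ bit₃ : Win → Bool
    bit₀ (mkW a b c d) = a
    bit₁ (mkW a b c d) = b
    bit₂ (mkW a b c d) = c
    bit₃ (mkW a b c d) = d

    -- Without a move of the program the round of writing already ends at the right pixel, and the
    -- phase `mv` is skipped.
    finish : St p → Win → (St p ⊎ B) × Maybe Win × Maybe Dir → Control
    finish s w (r , _ , nothing) = resume r
    finish s w (r , _ , just d)  = just (s , w , mv)

    direction : Maybe Dir → Dir
    direction nothing  = up
    direction (just d) = d

    δ′ : Control → Bool → Control × Bool × Dir
    δ′ nothing x = nothing , x , up
    δ′ (just (s , mkW a b c d , r₀)) x = just (s , mkW x b c d , r₁) , x , right
    δ′ (just (s , mkW a b c d , r₁)) x = just (s , mkW a x c d , r₂) , x , up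
    δ′ (just (s , mkW a b c d , r₂)) x = just (s , mkW a b x d , r₃) , x , left
    δ′ (just (s , mkW a b c d , r₃)) x = just (s , mkW a b c x , w₀) , x , down
    -- Instead of being stored, the result of `next` is computed anew in each phase from the stored
    -- state and window. If nothing is to be written, `fromMaybe` yields the window that was read.
    δ′ (just (s , w , w₀)) x = just (s , w , w₁) , bit₀ (fromMaybe w (proj₁ (proj₂ (next p s w)))) , right
    δ′ (just (s , w , w₁)) x = just (s , w , w₂) , bit₁ (fromMaybe w (proj₁ (proj₂ (next p s w)))) , up
    δ′ (just (s , w , w₂)) x = just (s , w , w₃) , bit₂ (fromMaybe w (proj₁ (proj₂ (next p s w)))) , left
    δ′ (just (s , w , w₃)) x = finish s w (next p s w) , bit₃ (fromMaybe w (proj₁ (proj₂ (next p s w)))) , down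
    δ′ (just (s , w , mv)) x = resume (proj₁ (next p s w)) , x , direction (proj₂ (proj₂ (next p s w)))

    encode : Control → Fin (size finite-Control)
    encode = enc finite-Control

    robot : Robot
    robot = record
      { nStates = size finite-Control
      ; start   = encode (resume (inj₁ (enter p tt)))
      ; halt    = encode nothing
      ; δ       = λ i x → map₁ encode (δ′ (dec finite-Control i) x) }

    step-encode : ∀ {σ σ′ b d q ts} → δ′ σ (occupied q ts) ≡ (σ′ , b , d) →
      stepR robot (config (encode σ) q ts) ≡ config (encode σ′) (move d q) (setPixel q b ts)
    step-encode {σ} {q = q} {ts} e rewrite dec-enc finite-Control σ | e = refl

    -- Supplies the second half of `HaltsAt`: no earlier configuration is in the halting state.
    busy≢halt : ∀ {σ} → encode (just σ) ≢ encode nothing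
    busy≢halt {σ} e with trans (sym (dec-enc finite-Control (just σ))) (trans (cong (dec finite-Control) e) (dec-enc finite-Control nothing))
    ... | ()

  module Trace (R : Robot) (Region : Pixel → Set) where

    data Steps : ℕ → Config R → Config R → Set where
      []  : ∀ {C} → Steps 0 C C
      _∷_ : ∀ {n C C′} → (state C ≢ Robot.halt R × Region (pos C)) → Steps n (stepR R C) C′ → Steps (suc n) C C′

    cons : ∀ {n C C₁ C′} → (state C ≢ Robot.halt R × Region (pos C)) → stepR R C ≡ C₁ → Steps n C₁ C′ → Steps (suc n) C C′
    cons h refl ss = h ∷ ss

    run-steps : ∀ {n C C′} → Steps n C C′ → run R n C ≡ C′
    run-steps []       = refl
    run-steps (_ ∷ ss) = run-steps ss

    steps-before : ∀ {n C C′} → Steps n C C′ → ∀ i → i ℕ.< n → state (run R i C) ≢ Robot.halt R × Region (pos (run R i C))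
    steps-before (h ∷ ss) zero    (ℕ.s≤s lt) = h
    steps-before (h ∷ ss) (suc i) (ℕ.s≤s lt) = steps-before ss i lt

  -- Simulation of window programs by robots.

  module Simulation {B : Set} (p : Prog ⊤ B) (Anchor : Pixel → Set) where
    open Compile p
    open Semantics Anchor

    -- The pixels that the rounds of the robot can touch. Additional space and tiles are both
    -- counted on this set.
    Region : Pixel → Set
    Region r = ∃[ q ] (Anchor q × (r ≡ q ⊎ r ≡ corner₁ q ⊎ r ≡ corner₂ q ⊎ r ≡ corner₃ q))

    open Trace robot Region

    Outcome : (Pixel → Picture → Set) → Control → Pixel → ℕ → List Pixel → Set
    Outcome Q σ q n ts = ∃[ T ] ∃[ q′ ] ∃[ ts′ ] ∃[ f′ ]
      (T ℕ.≤ n × Steps T (config (encode σ) q ts) (config (encode nothing) q′ ts′) × pic ts′ ≗ f′ × Q q′ f′)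

    -- Quantified over all tile lists with picture `f`, since the logic of programs sees the picture
    -- only.
    Reach : (Pixel → Picture → Set) → Control → Pixel → Picture → ℕ → Set
    Reach Q σ q f n = ∀ ts → pic ts ≗ f → Outcome Q σ q n ts

    module _ {Q : Pixel → Picture → Set} where

      micro : ∀ {σ σ′ b d q f n} → Region q → δ′ (just σ) (f q) ≡ (σ′ , b , d) →
        Reach Q σ′ (move d q) (put q b f) n → Reach Q (just σ) q f (suc n)
      micro {σ} {σ′} {b} {d} {q} {f} reg e k ts eq with k (setPixel q b ts) (λ r → trans (pic-set q b ts r) (put-cong q b eq r))
      ... | T , q′ , ts′ , f′ , le , ss , eq′ , h =
        suc T , q′ , ts′ , f′ , ℕ.s≤s le , cons (busy≢halt , reg) (step-encode {just σ} {σ′} {b} {d} {q} {ts} e′) ss , eq′ , h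
        where e′ : δ′ (just σ) (occupied q ts) ≡ (σ′ , b , d)
              e′ = trans (cong (δ′ (just σ)) (eq q)) e

      reach-cong : ∀ {σ q f g n} → f ≗ g → Reach Q σ q f n → Reach Q σ q g n
      reach-cong e k ts eq = k ts (λ r → trans (eq r) (sym (e r)))

      micro-read : ∀ {σ σ′ d q f n} → Region q → δ′ (just σ) (f q) ≡ (σ′ , f q , d) →
        Reach Q σ′ (move d q) f n → Reach Q (just σ) q f (suc n)
      micro-read {q = q} {f} reg e k = micro reg e (reach-cong (λ r → sym (put-idem q f r)) k)

      reach-mono : ∀ {σ q f m n} → m ℕ.≤ n → Reach Q σ q f m → Reach Q σ q f n
      reach-mono le k ts eq = let T , q′ , ts′ , f′ , l , rest = k ts eq in T , q′ , ts′ , f′ , ℕ.≤-trans l le , rest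

      reach-at : ∀ {σ q q′ f n} → q ≡ q′ → Reach Q σ q′ f n → Reach Q σ q f n
      reach-at refl k = k

      private
        back : ∀ q → move left (corner₂ q) ≡ corner₃ q
        back (x , y) = cong₂ _,_ (lin 1 (λ x → [] ⊢ x ⊕ κ 1 ⊖ κ 1 ≐ x) x) refl

        home : ∀ q → move down (corner₃ q) ≡ q
        home (x , y) = cong₂ _,_ refl (lin 1 (λ y → [] ⊢ y ⊕ κ 1 ⊖ κ 1 ≐ y) y)

        round-rest : ∀ {s q f n r mw md} → Anchor q → next p s (win f q) ≡ (r , mw , md) →
          Reach Q (resume r) (moveM md q) (paintM mw q f) n →
          Reach Q (just (s , win f q , w₀)) q f (5 ℕ.+ n)
        round-rest {s} {q} {f} {n} {r} {mw} {md} anc e k =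
          micro (q , anc , inj₁ refl) refl
         (micro (q , anc , inj₂ (inj₁ refl)) refl
         (micro (q , anc , inj₂ (inj₂ (inj₁ refl))) refl
         (reach-at (back q)
         (micro (q , anc , inj₂ (inj₂ (inj₂ refl))) refl
         (reach-at (home q)
         (last (next p s (win f q)) e))))))
          where
            W : Win
            W = fromMaybe (win f q) (proj₁ (proj₂ (next p s (win f q))))
            F : Picture
            F = put (corner₃ q) (bit₃ W) (put (corner₂ q) (bit₂ W) (put (corner₁ q) (bit₁ W) (put q (bit₀ W) f)))
            painted : paintM mw q f ≗ F
            painted = go (proj₁ (proj₂ (next p s (win f q)))) (cong (proj₁ ∘ proj₂) e)
              where
                go : ∀ m → m ≡ mw → paintM mw q f ≗
                  (let V = fromMaybe (win f q) m in
                   put (corner₃ q) (bit₃ V) (put (corner₂ q) (bit₂ V) (put (corner₁ q) (bit₁ V) (put q (bit₀ V) f))))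
                go nothing             refl r = trans (sym (paint-idem q f r)) (cong (λ h → h r) (paint-def q _ _ _ _ f))
                go (just (mkW a b c d)) refl r = cong (λ h → h r) (paint-def q a b c d f)
            last : ∀ x → x ≡ (r , mw , md) → Reach Q (finish s (win f q) x) q F (suc n)
            -- Eight robot moves were enough; one unit of the budget of nine is left over.
            last (r , mw , nothing) refl = reach-mono (ℕ.n≤1+n n) (reach-cong painted k)
            last (r , mw , just d) refl = micro-read (q , anc , inj₁ refl)
              (cong (λ x → resume (proj₁ x) , F q , direction (proj₂ (proj₂ x))) e) (reach-cong painted k)

      round-step : ∀ {s w q f n r mw md} → Anchor q → next p s (win f q) ≡ (r , mw , md) →
        Reach Q (resume r) (moveM md q) (paintM mw q f) n →
        Reach Q (just (s , w , r₀)) q f (9 ℕ.+ n)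
      round-step {s} {mkW a b c d} {q} {f} {n} anc e k =
        micro-read (q , anc , inj₁ refl) refl
       (micro-read (q , anc , inj₂ (inj₁ refl)) refl
       (micro-read (q , anc , inj₂ (inj₂ (inj₁ refl))) refl
       (reach-at (back q)
       (micro-read (q , anc , inj₂ (inj₂ (inj₂ refl))) refl
       (reach-at (home q) (round-rest anc e k))))))

      simulate : ∀ {Q′ : B → Pixel → Picture → Set} {t s q f} → (∀ {b q f} → Q′ b q f → Q q f) →
        WP p Q′ t s q f → Reach Q (resume (inj₁ s)) q f (9 ℕ.* t)
      simulate {t = suc t} h (halts a e x) = reach-mono (ℕ.≤-trans (ℕ.m≤m+n 9 _) (ℕ.≤-reflexive (sym (ℕ.*-suc 9 t)))) (round-step a e stop)
        where stop : Reach Q nothing _ _ 0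
              stop ts eq = 0 , _ , ts , _ , ℕ.z≤n , [] , eq , h x
      simulate {t = suc t} h (goes a e x) = reach-mono (ℕ.≤-reflexive (sym (ℕ.*-suc 9 t))) (round-step a e (simulate h x))

open WindowPrograms

-- Pebbles, and walks from one pebble to the next.

module Pebbles where

  open import Data.Integer using (_+_; _-_; _≤_)

  1≰0 : ¬ (+ 1 ≤ + 0)
  1≰0 (ℤ.+≤+ ())

  opp : Dir → Dir
  opp up    = down
  opp down  = up
  opp left  = right
  opp right = left

  adv : Dir → ℕ → Pixel → Pixel
  adv up    k (x , y) = x , y + + k
  adv down  k (x , y) = x , y - + k
  adv left  k (x , y) = x - + k , y
  adv right k (x , y) = x + + k , y

  adv-zero : ∀ d q → adv d 0 q ≡ q
  adv-zero up    (x , y) = cong (x ,_) (lin 1 (λ y → [] ⊢ y ⊕ κ 0 ≐ y) y)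
  adv-zero down  (x , y) = cong (x ,_) (lin 1 (λ y → [] ⊢ y ⊖ κ 0 ≐ y) y)
  adv-zero left  (x , y) = cong (_, y) (lin 1 (λ x → [] ⊢ x ⊖ κ 0 ≐ x) x)
  adv-zero right (x , y) = cong (_, y) (lin 1 (λ x → [] ⊢ x ⊕ κ 0 ≐ x) x)

  adv-move : ∀ d k q → adv d k (move d q) ≡ adv d (suc k) q
  adv-move up    k (x , y) = cong (x ,_) (lin 2 (λ y k → (κ 0 ≼ k) ∷ [] ⊢ y ⊕ κ 1 ⊕ k ≐ y ⊕ (κ 1 ⊕ k)) y (+ k) (0≤+ k))
  adv-move down  k (x , y) = cong (x ,_) (lin 2 (λ y k → (κ 0 ≼ k) ∷ [] ⊢ y ⊖ κ 1 ⊖ k ≐ y ⊖ (κ 1 ⊕ k)) y (+ k) (0≤+ k))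
  adv-move left  k (x , y) = cong (_, y) (lin 2 (λ x k → (κ 0 ≼ k) ∷ [] ⊢ x ⊖ κ 1 ⊖ k ≐ x ⊖ (κ 1 ⊕ k)) x (+ k) (0≤+ k))
  adv-move right k (x , y) = cong (_, y) (lin 2 (λ x k → (κ 0 ≼ k) ∷ [] ⊢ x ⊕ κ 1 ⊕ k ≐ x ⊕ (κ 1 ⊕ k)) x (+ k) (0≤+ k))

  move-adv : ∀ d k q → move d (adv d k q) ≡ adv d (suc k) q
  move-adv up    k (x , y) = cong (x ,_) (lin 2 (λ y k → (κ 0 ≼ k) ∷ [] ⊢ y ⊕ k ⊕ κ 1 ≐ y ⊕ (κ 1 ⊕ k)) y (+ k) (0≤+ k))
  move-adv down  k (x , y) = cong (x ,_) (lin 2 (λ y k → (κ 0 ≼ k) ∷ [] ⊢ y ⊖ k ⊖ κ 1 ≐ y ⊖ (κ 1 ⊕ k)) y (+ k) (0≤+ k))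
  move-adv left  k (x , y) = cong (_, y) (lin 2 (λ x k → (κ 0 ≼ k) ∷ [] ⊢ x ⊖ k ⊖ κ 1 ≐ x ⊖ (κ 1 ⊕ k)) x (+ k) (0≤+ k))
  move-adv right k (x , y) = cong (_, y) (lin 2 (λ x k → (κ 0 ≼ k) ∷ [] ⊢ x ⊕ k ⊕ κ 1 ≐ x ⊕ (κ 1 ⊕ k)) x (+ k) (0≤+ k))

  adv-opp : ∀ d j k q → adv (opp d) j (adv d (j ℕ.+ k) q) ≡ adv d k q
  adv-opp up    j k (x , y) = cong (x ,_) (lin 3 (λ y j k → (κ 0 ≼ j) ∷ (κ 0 ≼ k) ∷ [] ⊢ y ⊕ (j ⊕ k) ⊖ j ≐ y ⊕ k) y (+ j) (+ k) (0≤+ j) (0≤+ k))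
  adv-opp down  j k (x , y) = cong (x ,_) (lin 3 (λ y j k → (κ 0 ≼ j) ∷ (κ 0 ≼ k) ∷ [] ⊢ y ⊖ (j ⊕ k) ⊕ j ≐ y ⊖ k) y (+ j) (+ k) (0≤+ j) (0≤+ k))
  adv-opp left  j k (x , y) = cong (_, y) (lin 3 (λ x j k → (κ 0 ≼ j) ∷ (κ 0 ≼ k) ∷ [] ⊢ x ⊖ (j ⊕ k) ⊕ j ≐ x ⊖ k) x (+ j) (+ k) (0≤+ j) (0≤+ k))
  adv-opp right j k (x , y) = cong (_, y) (lin 3 (λ x j k → (κ 0 ≼ j) ∷ (κ 0 ≼ k) ∷ [] ⊢ x ⊕ (j ⊕ k) ⊖ j ≐ x ⊕ k) x (+ j) (+ k) (0≤+ j) (0≤+ k))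

  move-opp : ∀ d q → move (opp d) (move d q) ≡ q
  move-opp up    (x , y) = cong (x ,_) (lin 1 (λ y → [] ⊢ y ⊕ κ 1 ⊖ κ 1 ≐ y) y)
  move-opp down  (x , y) = cong (x ,_) (lin 1 (λ y → [] ⊢ y ⊖ κ 1 ⊕ κ 1 ≐ y) y)
  move-opp left  (x , y) = cong (_, y) (lin 1 (λ x → [] ⊢ x ⊖ κ 1 ⊕ κ 1 ≐ x) x)
  move-opp right (x , y) = cong (_, y) (lin 1 (λ x → [] ⊢ x ⊕ κ 1 ⊖ κ 1 ≐ x) x)

  opp-opp : ∀ d → opp (opp d) ≡ d
  opp-opp up    = refl
  opp-opp down  = refl
  opp-opp left  = refl
  opp-opp right = refl

  InWin : Pixel → Pixel → Set
  InWin (x , y) (u , w) = (x ≤ u × u ≤ x + + 1) × (y ≤ w × w ≤ y + + 1)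

  inWin? : ∀ r q → Dec (InWin r q)
  inWin? (x , y) (u , w) with x ℤ.≤? u | u ℤ.≤? x + + 1 | y ℤ.≤? w | w ℤ.≤? y + + 1
  ... | yes a | yes b | yes c | yes d = yes ((a , b) , (c , d))
  ... | no ¬a | _ | _ | _ = no λ ((a , _) , _) → ¬a a
  ... | yes _ | no ¬b | _ | _ = no λ ((_ , b) , _) → ¬b b
  ... | yes _ | yes _ | no ¬c | _ = no λ (_ , (c , _)) → ¬c c
  ... | yes _ | yes _ | yes _ | no ¬d = no λ (_ , (_ , d)) → ¬d d

  inWin₀ : ∀ r → InWin r r
  inWin₀ (x , y) = (ℤ.≤-refl , (ℤ.i≤i+j x (+ 1))) , (ℤ.≤-refl , (ℤ.i≤i+j y (+ 1)))

  inWin₁ : ∀ r → InWin r (corner₁ r)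
  inWin₁ (x , y) = ((ℤ.i≤i+j x (+ 1)) , ℤ.≤-refl) , (ℤ.≤-refl , (ℤ.i≤i+j y (+ 1)))

  inWin₂ : ∀ r → InWin r (corner₂ r)
  inWin₂ (x , y) = ((ℤ.i≤i+j x (+ 1)) , ℤ.≤-refl) , ((ℤ.i≤i+j y (+ 1)) , ℤ.≤-refl)

  inWin₃ : ∀ r → InWin r (corner₃ r)
  inWin₃ (x , y) = (ℤ.≤-refl , (ℤ.i≤i+j x (+ 1))) , ((ℤ.i≤i+j y (+ 1)) , ℤ.≤-refl)

  private
    between : ∀ x u → x ≤ u → u ≤ x + + 1 → u ≡ x ⊎ u ≡ x + + 1
    between x u a b with u ℤ.≤? x
    ... | yes c = inj₁ (ℤ.≤-antisym c a)
    ... | no ¬c = inj₂ (ℤ.≤-antisym b (subst (_≤ u) (ℤ.+-comm (+ 1) x) (ℤ.i<j⇒suc[i]≤j (ℤ.≰⇒> ¬c))))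

  inWin-cases : ∀ {r q} → InWin r q → q ≡ r ⊎ q ≡ corner₁ r ⊎ q ≡ corner₂ r ⊎ q ≡ corner₃ r
  inWin-cases {x , y} {u , w} ((a , b) , (c , d)) with between x u a b | between y w c d
  ... | inj₁ refl | inj₁ refl = inj₁ refl
  ... | inj₂ refl | inj₁ refl = inj₂ (inj₁ refl)
  ... | inj₂ refl | inj₂ refl = inj₂ (inj₂ (inj₁ refl))
  ... | inj₁ refl | inj₂ refl = inj₂ (inj₂ (inj₂ refl))

  private
    x≢x+1 : ∀ {x : ℤ} → x ≢ x + + 1
    x≢x+1 {x} e = 1≰0 (lin 1 (λ x → (x ≐ x ⊕ κ 1) ∷ [] ⊢ κ 1 ≼ κ 0) x e)

    01≢ : ∀ q → q ≢ corner₁ q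
    01≢ q e = x≢x+1 (cong proj₁ e)
    02≢ : ∀ q → q ≢ corner₂ q
    02≢ q e = x≢x+1 (cong proj₁ e)
    03≢ : ∀ q → q ≢ corner₃ q
    03≢ q e = x≢x+1 (cong proj₂ e)
    12≢ : ∀ q → corner₁ q ≢ corner₂ q
    12≢ q e = x≢x+1 (cong proj₂ e)
    13≢ : ∀ q → corner₁ q ≢ corner₃ q
    13≢ q e = x≢x+1 (sym (cong proj₁ e))
    23≢ : ∀ q → corner₂ q ≢ corner₃ q
    23≢ q e = x≢x+1 (sym (cong proj₁ e))

  opaque
    unfolding paint

    paint-win : ∀ q w f → win (paint q w f) q ≡ w
    paint-win q (mkW a b c d) f = trans
      (cong₂ (λ s t → mkW s t (F (corner₂ q)) (F (corner₃ q))) e₀ e₁) (cong₂ (mkW a b) e₂ e₃)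
      where
        F : Picture
        F = paint q (mkW a b c d) f
        e₀ : F q ≡ a
        e₀ = trans (put-other d _ (≢-sym (03≢ q))) (trans (put-other c _ (≢-sym (02≢ q))) (trans (put-other b _ (≢-sym (01≢ q))) (put-same q a f)))
        e₁ : F (corner₁ q) ≡ b
        e₁ = trans (put-other d _ (≢-sym (13≢ q))) (trans (put-other c _ (≢-sym (12≢ q))) (put-same _ b _))
        e₂ : F (corner₂ q) ≡ c
        e₂ = trans (put-other d _ (≢-sym (23≢ q))) (put-same _ c _)
        e₃ : F (corner₃ q) ≡ d
        e₃ = put-same _ d _

    paint-off : ∀ {q r} w f → ¬ InWin q r → paint q w f r ≡ f r
    paint-off {q} (mkW a b c d) f ¬in = trans (put-other d _ (λ { refl → ¬in (inWin₃ q) }))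
      (trans (put-other c _ (λ { refl → ¬in (inWin₂ q) })) (trans (put-other b _ (λ { refl → ¬in (inWin₁ q) }))
      (put-other a _ (λ { refl → ¬in (inWin₀ q) }))))

  bit₀ bit₁ bit₂ bit₃ : Win → Bool
  bit₀ (mkW a b c d) = a
  bit₁ (mkW a b c d) = b
  bit₂ (mkW a b c d) = c
  bit₃ (mkW a b c d) = d

  win-at : ∀ {f g r q} → win f r ≡ win g r → InWin r q → f q ≡ g q
  win-at e i with inWin-cases i
  ... | inj₁ refl                      = cong bit₀ e
  ... | inj₂ (inj₁ refl)               = cong bit₁ e
  ... | inj₂ (inj₂ (inj₁ refl))        = cong bit₂ e
  ... | inj₂ (inj₂ (inj₂ refl))        = cong bit₃ e

  win-ext : ∀ {f g} q → (∀ r → InWin q r → f r ≡ g r) → win f q ≡ win g q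
  win-ext q e rewrite e _ (inWin₀ q) | e _ (inWin₁ q) | e _ (inWin₂ q) | e _ (inWin₃ q) = refl

  -- Disjointness of the two windows, in a form linear in the coordinates.
  Far : Pixel → Pixel → Set
  Far (x , y) (u , w) = (x + + 2 ≤ u ⊎ u + + 2 ≤ x) ⊎ (y + + 2 ≤ w ⊎ w + + 2 ≤ y)

  far-sym : ∀ {r q} → Far r q → Far q r
  far-sym (inj₁ (inj₁ a)) = inj₁ (inj₂ a)
  far-sym (inj₁ (inj₂ a)) = inj₁ (inj₁ a)
  far-sym (inj₂ (inj₁ a)) = inj₂ (inj₂ a)
  far-sym (inj₂ (inj₂ a)) = inj₂ (inj₁ a)

  far-disjoint : ∀ {r q p} → Far r q → InWin r p → InWin q p → ⊥
  far-disjoint {x , y} {u , w} {s , t} (inj₁ (inj₁ a)) ((b , c) , _) ((d , e) , _) =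
    1≰0 (lin 3 (λ x u s → (x ⊕ κ 2 ≼ u) ∷ (s ≼ x ⊕ κ 1) ∷ (u ≼ s) ∷ [] ⊢ κ 1 ≼ κ 0) x u s a c d)
  far-disjoint {x , y} {u , w} {s , t} (inj₁ (inj₂ a)) ((b , c) , _) ((d , e) , _) =
    1≰0 (lin 3 (λ x u s → (u ⊕ κ 2 ≼ x) ∷ (x ≼ s) ∷ (s ≼ u ⊕ κ 1) ∷ [] ⊢ κ 1 ≼ κ 0) x u s a b e)
  far-disjoint {x , y} {u , w} {s , t} (inj₂ (inj₁ a)) (_ , (b , c)) (_ , (d , e)) =
    1≰0 (lin 3 (λ x u s → (x ⊕ κ 2 ≼ u) ∷ (s ≼ x ⊕ κ 1) ∷ (u ≼ s) ∷ [] ⊢ κ 1 ≼ κ 0) y w t a c d)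
  far-disjoint {x , y} {u , w} {s , t} (inj₂ (inj₂ a)) (_ , (b , c)) (_ , (d , e)) =
    1≰0 (lin 3 (λ x u s → (u ⊕ κ 2 ≼ x) ∷ (x ≼ s) ∷ (s ≼ u ⊕ κ 1) ∷ [] ⊢ κ 1 ≼ κ 0) y w t a b e)

  win-paint-far : ∀ {r q} w f → Far r q → win (paint r w f) q ≡ win f q
  win-paint-far {r} {q} w f far = win-ext q (λ p i → paint-off w f (λ j → far-disjoint far j i))

  -- No window of a polyomino shows the pattern peb, see window-legal.

  peb blank : Win
  peb   = mkW false true false true
  blank = mkW false false false false

  isPeb : Win → Bool
  isPeb (mkW a b c d) = not a ∧ (b ∧ (not c ∧ d))

  isPeb⇒≡ : ∀ w → isPeb w ≡ true → w ≡ peb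
  isPeb⇒≡ (mkW false true false true) refl = refl

  -- `B` is the picture with all pebbles lifted. It is not determined by `f`: what the pebbles hide
  -- is known only to the memory of the program.
  record Overlay (f B : Picture) (rs : List Pixel) : Set where
    field
      on  : ∀ {r} → r ∈ rs → win f r ≡ peb
      off : ∀ q → (∀ {r} → r ∈ rs → ¬ InWin r q) → f q ≡ B q
  open Overlay public

  lift-peb : ∀ {f B r rs m} → Overlay f B (r ∷ rs) → (∀ {r′} → r′ ∈ rs → Far r r′) → m ≡ win B r → Overlay (paint r m f) B rs
  lift-peb {f} {B} {r} {rs} o far refl .on {r′} i = trans (win-paint-far (win B r) f (far i)) (o .on (there i))
  lift-peb {f} {B} {r} {rs} o far refl .off q ¬in with inWin? r q
  ... | yes i = win-at {paint r (win B r) f} {B} (paint-win r (win B r) f) i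
  ... | no ¬i = trans (paint-off (win B r) f ¬i) (o .off q λ { (here refl) → ¬i ; (there i) → ¬in i })

  place-peb : ∀ {f B r rs} → Overlay f B rs → (∀ {r′} → r′ ∈ rs → Far r r′) → Overlay (paint r peb f) B (r ∷ rs)
  place-peb {f} {r = r} o far .on (here refl) = paint-win r peb f
  place-peb {f} {r = r} o far .on (there i)   = trans (win-paint-far peb f (far i)) (o .on i)
  place-peb {f} {r = r} o far .off q ¬in      = trans (paint-off peb f (¬in (here refl))) (o .off q (¬in ∘ there))

  read-win : ∀ {f B r rs} → Overlay f B rs → (∀ {r′} → r′ ∈ rs → Far r r′) → win f r ≡ win B r
  read-win {r = r} o far = win-ext r (λ p i → o .off p (λ j k → far-disjoint (far j) i k))

  reorder : ∀ {f B rs rs′} → (∀ {r} → r ∈ rs′ → r ∈ rs) → (∀ {r} → r ∈ rs → r ∈ rs′) → Overlay f B rs → Overlay f B rs′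
  reorder s t o .on i      = o .on (s i)
  reorder s t o .off q ¬in = o .off q (¬in ∘ t)

  swap-peb : ∀ {f B r r′ rs} → Overlay f B (r ∷ r′ ∷ rs) → Overlay f B (r′ ∷ r ∷ rs)
  swap-peb = reorder sw sw
    where sw : ∀ {r r′ p rs} → p ∈ r ∷ r′ ∷ rs → p ∈ r′ ∷ r ∷ rs
          sw (here e)          = there (here e)
          sw (there (here e))  = here e
          sw (there (there i)) = there (there i)

  Clear : Pixel → Pixel → Set
  Clear r q = Far r q ⊎ (∃[ d ] q ≡ move d r)

  private
    true≢false : true ≢ false
    true≢false ()

    beside : ∀ {f r} d → win f r ≡ peb → isPeb (win f (move d r)) ≡ false
    beside {f} {r} d e with isPeb (win f (move d r)) in h
    ... | false = refl
    ... | true with isPeb⇒≡ (win f (move d r)) h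
    beside {f} {r} right e | true | g = ⊥-elim (true≢false (trans (sym (cong bit₁ e)) (cong bit₀ g)))
    beside {f} {r} left  e | true | g =
      ⊥-elim (true≢false (trans (sym (cong bit₁ g)) (trans (cong f (move-opp left r)) (cong bit₀ e))))
    beside {f} {r} up    e | true | g = ⊥-elim (true≢false (trans (sym (cong bit₃ e)) (cong bit₀ g)))
    beside {f} {r} down  e | true | g =
      ⊥-elim (true≢false (trans (sym (cong bit₃ g)) (trans (cong f (move-opp down r)) (cong bit₀ e))))

    all-far : ∀ {q} rs → (∀ {r} → r ∈ rs → Clear r q) →
      (∀ {r} → r ∈ rs → Far q r) ⊎ (∃[ r ] (r ∈ rs × ∃[ d ] q ≡ move d r))
    all-far []       c = inj₁ λ ()
    all-far (r ∷ rs) c with c (here refl) | all-far rs (c ∘ there)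
    ... | inj₂ o | _                  = inj₂ (r , here refl , o)
    ... | inj₁ _ | inj₂ (r′ , i , o)  = inj₂ (r′ , there i , o)
    ... | inj₁ a | inj₁ b             = inj₁ λ { (here refl) → far-sym a ; (there i) → b i }

  -- Either the window avoids all pebbles and shows `B`, or it is one step away from a pebble and
  -- `beside` applies.
  no-peb : ∀ {f B rs q} → Overlay f B rs → isPeb (win B q) ≡ false → (∀ {r} → r ∈ rs → Clear r q) → isPeb (win f q) ≡ false
  no-peb {f} {B} {rs} o legal clear with all-far rs clear
  ... | inj₁ far             = trans (cong isPeb (read-win o far)) legal
  ... | inj₂ (r , i , d , refl) = beside {f} {r} d (o .on i)

  -- `go n` makes `n + 1` moves, because a program takes at least one step; the same shift occurs in
  -- `steps`.
  go : ℕ → Prog Dir ⊤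
  go zero    = op (λ d _ → tt , nothing , just d)
  go (suc n) = op (λ d _ → d , nothing , just d) ⟫ go n

  -- The whole window serves to recognise a pebble, but only `bit₀`, the pixel on the line itself,
  -- is recorded as a tile met.
  scanStep : Dir × Bool → Win → ((Dir × Bool) ⊎ Bool) × Maybe Win × Maybe Dir
  scanStep (d , s) w = if isPeb w then (inj₂ s , nothing , nothing) else (inj₁ (d , s ∨ bit₀ w) , nothing , just d)

  scan : Prog (Dir × Bool) Bool
  scan = loop (op scanStep)

  seen : Picture → Dir → ℕ → Pixel → Bool → Bool
  seen f d zero    q s = s
  seen f d (suc n) q s = seen f d n (move d q) (s ∨ f q)

  seen-false : ∀ f d n q s → seen f d n q s ≡ false → s ≡ false × (∀ k → k ℕ.< n → f (adv d k q) ≡ false)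
  seen-false f d zero    q s e = e , λ k ()
  seen-false f d (suc n) q s e = let h₀ , h = seen-false f d n (move d q) (s ∨ f q) e in
    ∨-conicalˡ s (f q) h₀ , λ where
      zero    lt         → trans (cong f (adv-zero d q)) (∨-conicalʳ s (f q) h₀)
      (suc k) (ℕ.s≤s lt) → trans (cong f (sym (adv-move d k q))) (h k lt)

  seen-true : ∀ f d n q s → seen f d n q s ≡ true → s ≡ true ⊎ (∃[ k ] (k ℕ.< n × f (adv d k q) ≡ true))
  seen-true f d zero    q s e = inj₁ e
  seen-true f d (suc n) q s e with seen-true f d n (move d q) (s ∨ f q) e
  ... | inj₂ (k , lt , h) = inj₂ (suc k , ℕ.s≤s lt , trans (cong f (sym (adv-move d k q))) h)
  ... | inj₁ h with s
  ...   | true  = inj₁ refl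
  ...   | false = inj₂ (0 , ℕ.s≤s ℕ.z≤n , trans (cong f (adv-zero d q)) h)

  Ctx : Set
  Ctx = Dir × Dir × Win × Win

  -- From a pebble E, reached from a pebble S in direction d, moves both pebbles
  -- one step in direction o. The windows are the picture hidden by S and E.
  shift : Prog Ctx (Win × Win)
  shift = op liftE ⟫ op placeE ⟫ carry Ctx (go 1) ⟫ pre homeward (carry Ctx scan) ⟫ op liftS ⟫ op placeS
    where
      liftE : Ctx → Win → (Dir × Dir × Win) × Maybe Win × Maybe Dir
      liftE (d , o , mS , mE) _ = (d , o , mS) , just mE , just o
      placeE : Dir × Dir × Win → Win → (Ctx × Dir) × Maybe Win × Maybe Dir
      placeE (d , o , mS) w = ((d , o , mS , w) , opp d) , just peb , just (opp o)
      homeward : Ctx × ⊤ → Ctx × Dir × Bool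
      homeward (c , _) = c , opp (proj₁ c) , false
      liftS : Ctx × Bool → Win → Ctx × Maybe Win × Maybe Dir
      liftS ((d , o , mS , mE) , _) _ = (d , o , mS , mE) , just mS , just o
      placeS : Ctx → Win → (Win × Win) × Maybe Win × Maybe Dir
      placeS (d , o , mS , mE) w = (w , mE) , just peb , nothing

  -- Lines run only up or to the right. Hence the pixel after the first pebble lies in the window of
  -- that pebble, whereas the pixel before the last pebble is visible.
  data Perp : Dir → Dir → Set where
    up-left    : Perp up left
    up-right   : Perp up right
    right-up   : Perp right up
    right-down : Perp right down

  far-line : ∀ d j k q → 2 ℕ.+ j ℕ.≤ k → Far (adv d j q) (adv d k q)
  far-line up    j k (x , y) h = inj₂ (inj₁ (lin 3 (λ y j k → (κ 0 ≼ j) ∷ (κ 0 ≼ k) ∷ (κ 2 ⊕ j ≼ k) ∷ [] ⊢ y ⊕ j ⊕ κ 2 ≼ y ⊕ k) y (+ j) (+ k) (0≤+ j)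
      (0≤+ k) (ℤ.+≤+ h)))
  far-line down  j k (x , y) h = inj₂ (inj₂ (lin 3 (λ y j k → (κ 0 ≼ j) ∷ (κ 0 ≼ k) ∷ (κ 2 ⊕ j ≼ k) ∷ [] ⊢ y ⊖ k ⊕ κ 2 ≼ y ⊖ j) y (+ j) (+ k) (0≤+ j)
      (0≤+ k) (ℤ.+≤+ h)))
  far-line left  j k (x , y) h = inj₁ (inj₂ (lin 3 (λ y j k → (κ 0 ≼ j) ∷ (κ 0 ≼ k) ∷ (κ 2 ⊕ j ≼ k) ∷ [] ⊢ y ⊖ k ⊕ κ 2 ≼ y ⊖ j) x (+ j) (+ k) (0≤+ j)
      (0≤+ k) (ℤ.+≤+ h)))
  far-line right j k (x , y) h = inj₁ (inj₁ (lin 3 (λ y j k → (κ 0 ≼ j) ∷ (κ 0 ≼ k) ∷ (κ 2 ⊕ j ≼ k) ∷ [] ⊢ y ⊕ j ⊕ κ 2 ≼ y ⊕ k) x (+ j) (+ k) (0≤+ j)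
      (0≤+ k) (ℤ.+≤+ h)))

  far-side : ∀ {d o} → Perp d o → ∀ j k q → 2 ℕ.+ j ℕ.≤ k → Far (adv d j q) (move o (adv d k q))
  far-side up-left    j k (x , y) h = inj₂ (inj₁ (lin 3 (λ y j k → (κ 0 ≼ j) ∷ (κ 0 ≼ k) ∷ (κ 2 ⊕ j ≼ k) ∷ [] ⊢ y ⊕ j ⊕ κ 2 ≼ y ⊕ k) y (+ j) (+ k)
      (0≤+ j) (0≤+ k) (ℤ.+≤+ h)))
  far-side up-right   j k (x , y) h = inj₂ (inj₁ (lin 3 (λ y j k → (κ 0 ≼ j) ∷ (κ 0 ≼ k) ∷ (κ 2 ⊕ j ≼ k) ∷ [] ⊢ y ⊕ j ⊕ κ 2 ≼ y ⊕ k) y (+ j) (+ k)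
      (0≤+ j) (0≤+ k) (ℤ.+≤+ h)))
  far-side right-up   j k (x , y) h = inj₁ (inj₁ (lin 3 (λ y j k → (κ 0 ≼ j) ∷ (κ 0 ≼ k) ∷ (κ 2 ⊕ j ≼ k) ∷ [] ⊢ y ⊕ j ⊕ κ 2 ≼ y ⊕ k) x (+ j) (+ k)
      (0≤+ j) (0≤+ k) (ℤ.+≤+ h)))
  far-side right-down j k (x , y) h = inj₁ (inj₁ (lin 3 (λ y j k → (κ 0 ≼ j) ∷ (κ 0 ≼ k) ∷ (κ 2 ⊕ j ≼ k) ∷ [] ⊢ y ⊕ j ⊕ κ 2 ≼ y ⊕ k) x (+ j) (+ k)
      (0≤+ j) (0≤+ k) (ℤ.+≤+ h)))

  adv-side : ∀ {d o} → Perp d o → ∀ k q → move o (adv d k q) ≡ adv d k (move o q)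
  adv-side up-left    k q = refl
  adv-side up-right   k q = refl
  adv-side right-up   k q = refl
  adv-side right-down k q = refl

  adv-adv : ∀ d j k q → adv d k (adv d j q) ≡ adv d (j ℕ.+ k) q
  adv-adv up    j k (x , y) = cong (x ,_) (lin 3 (λ y j k → (κ 0 ≼ j) ∷ (κ 0 ≼ k) ∷ [] ⊢ y ⊕ j ⊕ k ≐ y ⊕ (j ⊕ k)) y (+ j) (+ k) (0≤+ j) (0≤+ k))
  adv-adv down  j k (x , y) = cong (x ,_) (lin 3 (λ y j k → (κ 0 ≼ j) ∷ (κ 0 ≼ k) ∷ [] ⊢ y ⊖ j ⊖ k ≐ y ⊖ (j ⊕ k)) y (+ j) (+ k) (0≤+ j) (0≤+ k))
  adv-adv left  j k (x , y) = cong (_, y) (lin 3 (λ x j k → (κ 0 ≼ j) ∷ (κ 0 ≼ k) ∷ [] ⊢ x ⊖ j ⊖ k ≐ x ⊖ (j ⊕ k)) x (+ j) (+ k) (0≤+ j) (0≤+ k))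
  adv-adv right j k (x , y) = cong (_, y) (lin 3 (λ x j k → (κ 0 ≼ j) ∷ (κ 0 ≼ k) ∷ [] ⊢ x ⊕ j ⊕ k ≐ x ⊕ (j ⊕ k)) x (+ j) (+ k) (0≤+ j) (0≤+ k))

  clear-end : ∀ d k n S → k ℕ.< n → Clear (adv d n S) (adv d k S)
  clear-end d k (suc n) S (ℕ.s≤s le) with ℕ.m≤n⇒m<n∨m≡n le
  ... | inj₁ lt   = inj₁ (far-sym (far-line d k (suc n) S (ℕ.s≤s lt)))
  ... | inj₂ refl = inj₂ (opp d , sym (trans (cong (move (opp d)) (sym (move-adv d k S))) (move-opp d (adv d k S))))

  not-in : ∀ {d o} → Perp d o → ∀ k n S → k ℕ.< n → ¬ InWin (adv d n S) (adv d k S)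
  not-in up-left    k n (x , y) lt (_ , (h , _)) = 1≰0 (lin 3 (λ y k n → (κ 0 ≼ k) ∷ (κ 0 ≼ n) ∷ (κ 1 ⊕ k ≼ n) ∷ (y ⊕ n ≼ y ⊕ k) ∷ [] ⊢ κ 1 ≼ κ 0) y
      (+ k) (+ n) (0≤+ k) (0≤+ n) (ℤ.+≤+ lt) h)
  not-in up-right   k n (x , y) lt (_ , (h , _)) = 1≰0 (lin 3 (λ y k n → (κ 0 ≼ k) ∷ (κ 0 ≼ n) ∷ (κ 1 ⊕ k ≼ n) ∷ (y ⊕ n ≼ y ⊕ k) ∷ [] ⊢ κ 1 ≼ κ 0) y
      (+ k) (+ n) (0≤+ k) (0≤+ n) (ℤ.+≤+ lt) h)
  not-in right-up   k n (x , y) lt ((h , _) , _) = 1≰0 (lin 3 (λ x k n → (κ 0 ≼ k) ∷ (κ 0 ≼ n) ∷ (κ 1 ⊕ k ≼ n) ∷ (x ⊕ n ≼ x ⊕ k) ∷ [] ⊢ κ 1 ≼ κ 0) x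
      (+ k) (+ n) (0≤+ k) (0≤+ n) (ℤ.+≤+ lt) h)
  not-in right-down k n (x , y) lt ((h , _) , _) = 1≰0 (lin 3 (λ x k n → (κ 0 ≼ k) ∷ (κ 0 ≼ n) ∷ (κ 1 ⊕ k ≼ n) ∷ (x ⊕ n ≼ x ⊕ k) ∷ [] ⊢ κ 1 ≼ κ 0) x
      (+ k) (+ n) (0≤+ k) (0≤+ n) (ℤ.+≤+ lt) h)

  anyW : Win → Bool
  anyW (mkW a b c d) = a ∨ (b ∨ (c ∨ d))

  any-false : ∀ w → anyW w ≡ false → (bit₀ w ≡ false) × (bit₁ w ≡ false) × (bit₃ w ≡ false)
  any-false (mkW false false false false) refl = refl , refl , refl

  any-true : ∀ B r → anyW (win B r) ≡ true → ∃[ t ] (InWin r t × B t ≡ true)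
  any-true B r e with B r in e₀ | B (corner₁ r) in e₁ | B (corner₂ r) in e₂ | B (corner₃ r) in e₃
  ... | true  | _     | _     | _    = r , inWin₀ r , e₀
  ... | false | true  | _     | _    = _ , inWin₁ r , e₁
  ... | false | false | true  | _    = _ , inWin₂ r , e₂
  ... | false | false | false | true = _ , inWin₃ r , e₃

  ∨-cases : ∀ a b c → a ∨ (b ∨ c) ≡ true → a ≡ true ⊎ b ≡ true ⊎ c ≡ true
  ∨-cases true  b     c e = inj₁ refl
  ∨-cases false true  c e = inj₂ (inj₁ refl)
  ∨-cases false false c e = inj₂ (inj₂ e)

  branch : ∀ {A : Set} → A × Bool → A ⊎ A
  branch (a , s) = if s then inj₁ a else inj₂ a

  quiet : Prog Ctx (Bool × Win × Win)
  quiet = pre toE (carry Ctx (go 0)) ⟫ pre homeward (carry Ctx scan) ⟫ op answer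
    where
      toE : Ctx → Ctx × Dir
      toE c = c , opp (proj₁ c)
      homeward : Ctx × ⊤ → Ctx × Dir × Bool
      homeward (c , _) = c , opp (proj₁ c) , false
      answer : Ctx × Bool → Win → (Bool × Win × Win) × Maybe Win × Maybe Dir
      answer ((d , o , mS , mE) , _) _ = (false , mS , mE) , nothing , nothing

  -- From a pebble S, shifts the line if it is forced to, or if a tile lies on the
  -- line or under one of its two pebbles; ends at S.
  side : Prog (Bool × Ctx) (Bool × Win × Win)
  side = pre out (carry (Bool × Ctx) (go 1)) ⟫ pre check (carry Ctx scan) ⟫ pre branch (choice (post (true ,_) shift) quiet)
    where
      out : Bool × Ctx → (Bool × Ctx) × Dir
      out (s , c) = (s , c) , proj₁ c
      check : (Bool × Ctx) × ⊤ → Ctx × Dir × Bool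
      check ((s , d , o , mS , mE) , _) = (d , o , mS , mE) , d , (s ∨ (anyW mS ∨ anyW mE))

  -- Correctness of walks and of shifting a line.

  module Walks (Anchor : Pixel → Set) where
    open Semantics Anchor public

    go-run : ∀ n {d q f Q} → (∀ k → k ℕ.≤ n → Anchor (adv d k q)) → Q tt (adv d (suc n) q) f → Run (go n) d (suc n) q f Q
    go-run zero {d} {q} {f} {Q} a h = run-op (subst Anchor (adv-zero d q) (a 0 ℕ.z≤n)) refl
      (subst (λ z → Q tt z f) (trans (sym (adv-move d 0 q)) (adv-zero d (move d q))) h)
    go-run (suc n) {d} {q} {f} {Q} a h = wp-⟫ {t₁ = 1} (run-op (subst Anchor (adv-zero d q) (a 0 ℕ.z≤n)) refl
      (go-run n (λ k le → subst Anchor (sym (adv-move d k q)) (a (suc k) (ℕ.s≤s le)))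
        (subst (λ z → Q tt z f) (sym (adv-move d (suc n) q)) h)))

    scan-run : ∀ n {d q f s Q} → (∀ k → k ℕ.< n → Anchor (adv d k q) × isPeb (win f (adv d k q)) ≡ false) →
      Anchor (adv d n q) → win f (adv d n q) ≡ peb → Q (seen f d n q s) (adv d n q) f → Run scan (d , s) (suc n) q f Q
    scan-run zero {d} {q} {f} {s} {Q} h a e k = wp-loop {t₁ = 1} {t₂ = 0} (run-op (subst Anchor (adv-zero d q) a)
      (cong (λ w → if isPeb w then (inj₂ s , nothing , nothing) else (inj₁ (d , s ∨ bit₀ w) , nothing , just d))
          (trans (cong (win f) (sym (adv-zero d q))) e))
      (subst (λ z → Q s z f) (adv-zero d q) k))
    scan-run (suc n) {d} {q} {f} {s} {Q} h a e k = wp-loop {t₁ = 1} {t₂ = suc n} (run-op (subst Anchor (adv-zero d q) (proj₁ h₀))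
      (cong (λ b → if b then (inj₂ s , nothing , nothing) else (inj₁ (d , s ∨ f q) , nothing , just d))
          (trans (cong (isPeb ∘ win f) (sym (adv-zero d q))) (proj₂ h₀)))
      (scan-run n (λ j lt → subst (λ z → Anchor z × isPeb (win f z) ≡ false) (sym (adv-move d j q)) (h (suc j) (ℕ.s≤s lt)))
        (subst Anchor (sym (adv-move d n q)) a) (trans (cong (win f) (adv-move d n q)) e)
        (subst (λ z → Q (seen f d n (move d q) (s ∨ f q)) z f) (sym (adv-move d n q)) k)))
      where h₀ : Anchor (adv d 0 q) × isPeb (win f (adv d 0 q)) ≡ false
            h₀ = h 0 (ℕ.s≤s ℕ.z≤n)

    -- The segment from a pebble at `S` to a pebble at `adv d n S`; `rs` are the remaining pebbles.
    -- By `long` the windows of the two ends are disjoint.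
    record Line (B : Picture) (d o : Dir) (n : ℕ) (S : Pixel) (rs : List Pixel) : Set where
      field
        perp   : Perp d o
        long   : 2 ℕ.≤ n
        anchor : ∀ k → k ℕ.≤ n → Anchor (adv d k S)
        legal  : ∀ k → k ℕ.≤ n → isPeb (win B (adv d k S)) ≡ false
        apart  : ∀ {r} → r ∈ rs → ∀ k → k ℕ.≤ n → Far r (adv d k S)

    record Target (d o : Dir) (n : ℕ) (S : Pixel) (rs : List Pixel) : Set where
      field
        anchorS : Anchor (move o S)
        anchorE : Anchor (move o (adv d n S))
        apartS  : ∀ {r} → r ∈ rs → Far r (move o S)
        apartE  : ∀ {r} → r ∈ rs → Far r (move o (adv d n S))

    clear-line : ∀ {B d S rs f} k → 0 ℕ.< k → Overlay f B (S ∷ rs) → isPeb (win B (adv d k S)) ≡ false →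
      (∀ {r} → r ∈ rs → Clear r (adv d k S)) → isPeb (win f (adv d k S)) ≡ false
    clear-line {d = d} {S} k 0<k ov lg cl = no-peb ov lg λ where
        (here refl) → near k 0<k
        (there i)   → cl i
      where
        near : ∀ k → 0 ℕ.< k → Clear S (adv d k S)
        near (suc zero)    _ = inj₂ (d , trans (sym (adv-move d 0 S)) (adv-zero d (move d S)))
        near (suc (suc k)) _ = inj₁ (subst (λ z → Far z (adv d (2 ℕ.+ k) S)) (adv-zero d S) (far-line d 0 (2 ℕ.+ k) S (ℕ.s≤s (ℕ.s≤s ℕ.z≤n))))

    -- The search for the pebble at `S` starts two pixels before the old end. The pixel directly
    -- before the old end is a diagonal neighbour of the new pebble, where the pebble pattern could
    -- show up falsely.
    shift-run : ∀ {B d o n S rs f mS mE Q} → Line B d o n S rs → Target d o n S rs →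
      Overlay f B (adv d n S ∷ S ∷ rs) → mS ≡ win B S → mE ≡ win B (adv d n S) →
      (∀ {f′} → Overlay f′ B (move o (adv d n S) ∷ move o S ∷ rs) →
        Q (win B (move o S) , win B (move o (adv d n S))) (move o S) f′) →
      Run shift (d , o , mS , mE) (6 ℕ.+ n) (adv d n S) f Q
    shift-run {n = suc zero} L = ⊥-elim (ℕ.<-irrefl refl (Line.long L))
    shift-run {n = zero} L = ⊥-elim (ℕ.n≮0 (Line.long L))
    shift-run {B} {d} {o} {suc (suc m)} {S} {rs} {f} {mS} {mE} {Q} L tg ov eS eE k =
      wp-mono (linℕ 1 (λ m → [] ⊢ κ 1 ⊕ (κ 1 ⊕ (κ 2 ⊕ ((κ 1 ⊕ m) ⊕ (κ 1 ⊕ κ 1)))) ≼ κ 6 ⊕ (κ 2 ⊕ m)) m)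
      (wp-⟫ {t₁ = 1} (run-op (L .Line.anchor n ℕ.≤-refl) refl
      (wp-⟫ {t₁ = 1} (run-op (tg .Target.anchorE) refl
      (wp-⟫ {t₁ = 2} (wp-carry (wp-at (move-opp o E) (go-run 1 back-anchors (wp-at (adv-opp d 2 m S)
      (wp-⟫ {t₁ = suc m} (wp-pre (wp-carry (scan-run m back-clear (subst Anchor (sym at-S) anchorS₀)
          (trans (cong (win f₂) at-S) (ov₂ .on (there (here refl))))
      (wp-at at-S
      (wp-⟫ {t₁ = 1} (run-op anchorS₀ refl
      (run-op {b = win B (move o S) , win B (move o E)} (tg .Target.anchorS) (cong₂ (λ s t → (s , t) , just peb , nothing) read-S read-E)
      (k ov₄))))))))))))))))))
      where
        n : ℕ
        n = suc (suc m)
        E : Pixel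
        E = adv d n S
        S≡ : adv d 0 S ≡ S
        S≡ = adv-zero d S
        anchorS₀ : Anchor S
        anchorS₀ = subst Anchor S≡ (L .Line.anchor 0 ℕ.z≤n)
        farSE : Far S E
        farSE = subst (λ z → Far z E) S≡ (far-line d 0 n S (ℕ.s≤s (ℕ.s≤s ℕ.z≤n)))
        farSE′ : Far S (move o E)
        farSE′ = subst (λ z → Far z (move o E)) S≡ (far-side (L .Line.perp) 0 n S (ℕ.s≤s (ℕ.s≤s ℕ.z≤n)))
        f₁ : Picture
        f₁ = paint E mE f
        ov₁ : Overlay f₁ B (S ∷ rs)
        ov₁ = lift-peb ov (λ { (here refl) → far-sym farSE ; (there i) → far-sym (L .Line.apart i n ℕ.≤-refl) }) eE
        E′-far : ∀ {r} → r ∈ S ∷ rs → Far (move o E) r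
        E′-far (here refl) = far-sym farSE′
        E′-far (there i)   = far-sym (tg .Target.apartE i)
        f₂ : Picture
        f₂ = paint (move o E) peb f₁
        ov₂ : Overlay f₂ B (move o E ∷ S ∷ rs)
        ov₂ = place-peb ov₁ E′-far
        read-E : win f₁ (move o E) ≡ win B (move o E)
        read-E = read-win ov₁ E′-far
        f₃ : Picture
        f₃ = paint S mS f₂
        ov₃ : Overlay f₃ B (move o E ∷ rs)
        ov₃ = lift-peb (swap-peb ov₂) (λ { (here refl) → farSE′ ; (there i) → far-sym (subst (Far _) S≡ (L .Line.apart i 0 ℕ.z≤n)) }) eS
        S′-far : ∀ {r} → r ∈ move o E ∷ rs → Far (move o S) r
        S′-far (here refl) = subst₂ Far (trans (sym (adv-side (L .Line.perp) 0 S)) (cong (move o) S≡)) (sym (adv-side (L .Line.perp) n S))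
            (far-line d 0 n (move o S) (ℕ.s≤s (ℕ.s≤s ℕ.z≤n)))
        S′-far (there i)   = far-sym (tg .Target.apartS i)
        f₄ : Picture
        f₄ = paint (move o S) peb f₃
        ov₄ : Overlay f₄ B (move o E ∷ move o S ∷ rs)
        ov₄ = swap-peb (place-peb ov₃ S′-far)
        read-S : win f₃ (move o S) ≡ win B (move o S)
        read-S = read-win ov₃ S′-far
        back-anchors : ∀ k → k ℕ.≤ 1 → Anchor (adv (opp d) k E)
        back-anchors zero    _ = subst Anchor (sym (adv-zero (opp d) E)) (L .Line.anchor n ℕ.≤-refl)
        back-anchors (suc zero) _ = subst Anchor (sym (adv-opp d 1 (suc m) S)) (L .Line.anchor (suc m) (ℕ.n≤1+n _))
        back-anchors (suc (suc k)) (ℕ.s≤s ())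
        at-S : adv (opp d) m (adv d m S) ≡ S
        at-S = trans (cong (λ z → adv (opp d) m (adv d z S)) (sym (ℕ.+-identityʳ m))) (trans (adv-opp d m 0 S) S≡)
        back-clear : ∀ j → j ℕ.< m → Anchor (adv (opp d) j (adv d m S)) × isPeb (win f₂ (adv (opp d) j (adv d m S))) ≡ false
        back-clear j lt with ℕ.m≤n⇒∃[o]m+o≡n lt
        ... | i , refl = subst (λ z → Anchor z × isPeb (win f₂ z) ≡ false)
          (trans (sym (adv-opp d j (suc i) S)) (cong (λ z → adv (opp d) j (adv d z S)) (ℕ.+-suc j i)))
          (L .Line.anchor (suc i) le , clear-line (suc i) (ℕ.s≤s ℕ.z≤n) (swap-peb ov₂) (L .Line.legal (suc i) le) λ where
            (here refl) → inj₁ (far-sym (far-side (L .Line.perp) (suc i) n S (linℕ 2 (λ i j → [] ⊢ κ 2 ⊕ (κ 1 ⊕ i) ≼ κ 2 ⊕ (κ 1 ⊕ (j ⊕ i))) i j)))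
            (there r)   → inj₁ (L .Line.apart r (suc i) le))
          where le : suc i ℕ.≤ n
                le = linℕ 2 (λ i j → [] ⊢ κ 1 ⊕ i ≼ κ 2 ⊕ (κ 1 ⊕ (j ⊕ i))) i j

    back-run : ∀ m {d S f s Q} → (∀ k → k ℕ.≤ m → Anchor (adv d k S)) →
      (∀ k → 0 ℕ.< k → k ℕ.≤ m → isPeb (win f (adv d k S)) ≡ false) → win f S ≡ peb →
      (∀ s′ → Q s′ S f) → Run scan (opp d , s) (suc m) (adv d m S) f Q
    back-run m {d} {S} {f} {s} {Q} anc clr e k = scan-run m before
      (subst Anchor (sym at-S) (subst Anchor (adv-zero d S) (anc 0 ℕ.z≤n))) (trans (cong (win f) at-S) e)
      (subst (λ z → Q (seen f (opp d) m (adv d m S) s) z f) (sym at-S) (k _))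
      where
        at-S : adv (opp d) m (adv d m S) ≡ S
        at-S = trans (cong (λ z → adv (opp d) m (adv d z S)) (sym (ℕ.+-identityʳ m))) (trans (adv-opp d m 0 S) (adv-zero d S))
        before : ∀ j → j ℕ.< m → Anchor (adv (opp d) j (adv d m S)) × isPeb (win f (adv (opp d) j (adv d m S))) ≡ false
        before j lt with ℕ.m≤n⇒∃[o]m+o≡n lt
        ... | i , refl = subst (λ z → Anchor z × isPeb (win f z) ≡ false)
          (trans (sym (adv-opp d j (suc i) S)) (cong (λ z → adv (opp d) j (adv d z S)) (ℕ.+-suc j i)))
          (anc (suc i) (ℕ.s≤s (ℕ.m≤n+m i j)) , clr (suc i) (ℕ.s≤s ℕ.z≤n) (ℕ.s≤s (ℕ.m≤n+m i j)))

    fwd-run : ∀ j m {d S f s Q} → (∀ k → k ℕ.≤ m → Anchor (adv d (j ℕ.+ k) S)) →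
      (∀ k → k ℕ.< m → isPeb (win f (adv d (j ℕ.+ k) S)) ≡ false) → win f (adv d (j ℕ.+ m) S) ≡ peb →
      Q (seen f d m (adv d j S) s) (adv d (j ℕ.+ m) S) f → Run scan (d , s) (suc m) (adv d j S) f Q
    fwd-run j m {d} {S} {f} {s} {Q} anc clr e k = scan-run m
      (λ i lt → subst (λ z → Anchor z × isPeb (win f z) ≡ false) (sym (adv-adv d j i S)) (anc i (ℕ.<⇒≤ lt) , clr i lt))
      (subst Anchor (sym (adv-adv d j m S)) (anc m ℕ.≤-refl)) (trans (cong (win f) (adv-adv d j m S)) e)
      (subst (λ z → Q (seen f d m (adv d j S) s) z f) (sym (adv-adv d j m S)) k)

    line-clear : ∀ {B d o n S rs f} → Line B d o n S rs → Overlay f B (adv d n S ∷ S ∷ rs) →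
      ∀ k → 0 ℕ.< k → k ℕ.< n → isPeb (win f (adv d k S)) ≡ false
    line-clear {B} {d} {o} {n} {S} L ov k 0<k k<n = clear-line k 0<k (swap-peb ov) (L .Line.legal k (ℕ.<⇒≤ k<n)) λ where
      (here refl) → clear-end d k n S k<n
      (there i)   → inj₁ (L .Line.apart i k (ℕ.<⇒≤ k<n))

    module _ {B : Picture} {d o : Dir} {n : ℕ} {S E : Pixel} {rs : List Pixel} {f : Picture} {force : Bool} {mS mE : Win}
        {Q : Bool × Win × Win → Pixel → Picture → Set}
      (E≡ : E ≡ adv d n S) (L : Line B d o n S rs) (tg : Target d o n S rs)
      (ov : Overlay f B (E ∷ S ∷ rs)) (eS : mS ≡ win B S) (eE : mE ≡ win B E)
      (quiet-k : force ≡ false → (∀ k → k ℕ.≤ n → B (adv d k S) ≡ false) → anyW (win B S) ≡ false → anyW (win B E) ≡ false → Q (false , mS , mE) S f)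
      (move-k : force ≡ true ⊎ (∃[ k ] (k ℕ.≤ n × ∃[ t ] (InWin (adv d k S) t × B t ≡ true))) →
        ∀ {f′} → Overlay f′ B (move o E ∷ move o S ∷ rs) → Q (true , win B (move o S) , win B (move o E)) (move o S) f′)
      where

      -- The scan starts at `adv d 2 S`, because the pebble at `S` covers the first two pixels of
      -- the line. These and the last pixel are judged from the remembered windows `mS` and `mE`,
      -- which may also report a tile next to the line; this is why `move-k` speaks of windows and
      -- `quiet-k` of pixels on the line.
      side-run : Run side (force , d , o , mS , mE) (2 ℕ.+ (n ℕ.+ (6 ℕ.+ n))) S f Q
      side-run = go-n n refl (Line.long L)
        where
          ov′ : Overlay f B (adv d n S ∷ S ∷ rs)
          ov′ = subst (λ z → Overlay f B (z ∷ S ∷ rs)) E≡ ov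
          eE′ : mE ≡ win B (adv d n S)
          eE′ = trans eE (cong (win B) E≡)
          S≡ : adv d 0 S ≡ S
          S≡ = adv-zero d S
          onS : win f S ≡ peb
          onS = ov′ .on (there (here refl))
          s₀ : Bool
          s₀ = force ∨ (anyW mS ∨ anyW mE)
          same : ∀ k → 2 ℕ.≤ k → k ℕ.< n → f (adv d k S) ≡ B (adv d k S)
          same k le lt = ov′ .off (adv d k S) λ where
            (here refl) i         → not-in (L .Line.perp) k n S lt i
            (there (here refl)) i → far-disjoint (subst (λ z → Far z (adv d k S)) S≡ (far-line d 0 k S le)) i (inWin₀ (adv d k S))
            (there (there r)) i   → far-disjoint (L .Line.apart r k (ℕ.<⇒≤ lt)) i (inWin₀ (adv d k S))
          module _ (m : ℕ) (n≡ : n ≡ 2 ℕ.+ m) where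
            result : Bool
            result = seen f d m (adv d 2 S) s₀
            bound : ∀ {k} → k ℕ.≤ m → 2 ℕ.+ k ℕ.≤ n
            bound le = subst (_ ℕ.≤_) (sym n≡) (ℕ.s≤s (ℕ.s≤s le))
            E≡′ : adv d n S ≡ adv d (2 ℕ.+ m) S
            E≡′ = cong (λ z → adv d z S) n≡
            free : result ≡ false → ∀ k → k ℕ.≤ n → B (adv d k S) ≡ false
            free r zero le = trans (cong B S≡) (trans (cong bit₀ (sym eS))
                (proj₁ (any-false mS (∨-conicalˡ _ (anyW mE) (∨-conicalʳ force _ (proj₁ (seen-false f d m (adv d 2 S) s₀ r)))))))
            free r (suc zero) le = along (L .Line.perp)
              where
                none : (bit₀ mS ≡ false) × (bit₁ mS ≡ false) × (bit₃ mS ≡ false)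
                none = any-false mS (∨-conicalˡ _ (anyW mE) (∨-conicalʳ force _ (proj₁ (seen-false f d m (adv d 2 S) s₀ r))))
                along : Perp d o → B (adv d 1 S) ≡ false
                along up-left    = trans (cong bit₃ (sym eS)) (proj₂ (proj₂ none))
                along up-right   = trans (cong bit₃ (sym eS)) (proj₂ (proj₂ none))
                along right-up   = trans (cong bit₁ (sym eS)) (proj₁ (proj₂ none))
                along right-down = trans (cong bit₁ (sym eS)) (proj₁ (proj₂ none))
            free r (suc (suc k)) le with suc (suc k) ℕ.<? n
            ... | yes lt = trans (sym (same (2 ℕ.+ k) (ℕ.s≤s (ℕ.s≤s ℕ.z≤n)) lt))
                  (trans (cong f (sym (adv-adv d 2 k S))) (proj₂ (seen-false f d m (adv d 2 S) s₀ r) k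
                      (ℕ.+-cancelˡ-< 2 _ _ (subst (2 ℕ.+ k ℕ.<_) n≡ lt))))
            ... | no ¬lt = trans (cong (λ z → B (adv d z S)) (ℕ.≤-antisym le (ℕ.≮⇒≥ ¬lt)))
                  (trans (cong bit₀ (sym eE′)) (proj₁ (any-false mE
                      (∨-conicalʳ (anyW mS) _ (∨-conicalʳ force _ (proj₁ (seen-false f d m (adv d 2 S) s₀ r)))))))
            reason : result ≡ true → force ≡ true ⊎ (∃[ k ] (k ℕ.≤ n × ∃[ t ] (InWin (adv d k S) t × B t ≡ true)))
            reason r with seen-true f d m (adv d 2 S) s₀ r
            ... | inj₂ (k , lt , e) = inj₂ (2 ℕ.+ k , bound (ℕ.<⇒≤ lt) , _ , inWin₀ _ ,
                    trans (sym (same (2 ℕ.+ k) (ℕ.s≤s (ℕ.s≤s ℕ.z≤n)) (subst (2 ℕ.+ k ℕ.<_) (sym n≡) (ℕ.s≤s (ℕ.s≤s lt)))))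
                        (trans (cong f (sym (adv-adv d 2 k S))) e))
            ... | inj₁ e with ∨-cases force (anyW mS) (anyW mE) e
            ...   | inj₁ h        = inj₁ h
            ...   | inj₂ (inj₁ a) = let t , i , h = any-true B S (trans (cong anyW (sym eS)) a) in
                    inj₂ (0 , ℕ.z≤n , t , subst (λ z → InWin z t) (sym S≡) i , h)
            ...   | inj₂ (inj₂ a) = let t , i , h = any-true B (adv d n S) (trans (cong anyW (sym eE′)) a) in
                    inj₂ (n , ℕ.≤-refl , t , i , h)
            after : ∀ s → s ≡ result → Run (pre branch (choice (post (true ,_) shift) quiet)) ((d , o , mS , mE) , s) (6 ℕ.+ n) (adv d (2 ℕ.+ m) S) f
                Q
            after true  e = wp-pre (wp-choice₁ (wp-map (wp-at (sym E≡′) (shift-run L tg ov′ eS eE′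
              λ {f′} o′ → subst (λ z → Q (true , win B (move o S) , win B (move o z)) (move o S) f′) E≡
                (move-k (reason (sym e)) (subst (λ z → Overlay f′ B (move o z ∷ move o S ∷ rs)) (sym E≡) o′))))))
            after false e = wp-pre (wp-choice₂ (wp-mono (subst (λ z → 1 ℕ.+ (suc (suc m) ℕ.+ 1) ℕ.≤ 6 ℕ.+ z) (sym n≡)
                (linℕ 1 (λ m → [] ⊢ κ 1 ⊕ ((κ 1 ⊕ (κ 1 ⊕ m)) ⊕ κ 1) ≼ κ 6 ⊕ (κ 2 ⊕ m)) m))
              (wp-⟫ {t₁ = 1} (wp-pre (wp-carry (go-run 0 {d = opp d}
                  (λ { zero _ → subst Anchor (sym (adv-zero (opp d) _)) (subst Anchor E≡′ (L .Line.anchor n ℕ.≤-refl)) })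
              (wp-at (adv-opp d 1 (suc m) S)
              (wp-⟫ {t₁ = suc (suc m)} (wp-pre (wp-carry (back-run (suc m)
                  (λ k le → L .Line.anchor k (ℕ.≤-trans le (subst (suc m ℕ.≤_) (sym n≡) (ℕ.n≤1+n _))))
                  (λ k 0<k le → line-clear L ov′ k 0<k (subst (k ℕ.<_) (sym n≡) (ℕ.s≤s le))) onS
              (λ _ → run-op (subst Anchor S≡ (L .Line.anchor 0 ℕ.z≤n)) refl
                (quiet-k (∨-conicalˡ force _ (proj₁ (seen-false f d m (adv d 2 S) s₀ (sym e)))) (free (sym e))
                  (trans (cong anyW (sym eS)) (∨-conicalˡ _ (anyW mE) (∨-conicalʳ force _ (proj₁ (seen-false f d m (adv d 2 S) s₀ (sym e))))))
                  (trans (cong anyW (sym eE)) (∨-conicalʳ (anyW mS) _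
                      (∨-conicalʳ force _ (proj₁ (seen-false f d m (adv d 2 S) s₀ (sym e)))))))))))))))))))
            start : Run side (force , d , o , mS , mE) (2 ℕ.+ (suc m ℕ.+ (6 ℕ.+ n))) S f Q
            start = wp-⟫ {t₁ = 2} (wp-pre (wp-carry (go-run 1 (λ k le → L .Line.anchor k (ℕ.≤-trans le (ℕ.≤-trans (ℕ.n≤1+n 1) (L .Line.long))))
              (wp-⟫ {t₁ = suc m} (wp-pre (wp-carry (fwd-run 2 m (λ k le → L .Line.anchor (2 ℕ.+ k) (bound le))
                (λ k lt → line-clear L ov′ (2 ℕ.+ k) (ℕ.s≤s ℕ.z≤n) (subst (2 ℕ.+ k ℕ.<_) (sym n≡) (ℕ.s≤s (ℕ.s≤s lt))))
                (trans (cong (win f) (sym E≡′)) (ov′ .on (here refl)))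
                (after result refl))))))))
          go-n : ∀ k → k ≡ n → 2 ℕ.≤ k → Run side (force , d , o , mS , mE) (2 ℕ.+ (n ℕ.+ (6 ℕ.+ n))) S f Q
          go-n (suc (suc m)) e (ℕ.s≤s (ℕ.s≤s _)) = wp-mono (ℕ.+-monoʳ-≤ 2 (ℕ.+-monoˡ-≤ (6 ℕ.+ n) (subst (suc m ℕ.≤_) e (ℕ.n≤1+n _))))
              (start m (sym e))

open Pebbles

-- The frame around the polyomino.

module Enclosure where

  open import Data.Integer using (_+_; _-_; _≤_)

  steps : ∀ {X : Set} → ⦃ Finite X ⦄ → Dir → ℕ → Prog X X
  steps {X} d n = post proj₁ (pre (_, d) (carry X (go n)))

  walk : ∀ {X : Set} → ⦃ Finite X ⦄ → Dir → Prog X X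
  walk {X} d = steps d 0 ⟫ post proj₁ (pre (λ x → x , d , false) (carry X scan))

  place : ∀ {X : Set} → ⦃ Finite X ⦄ → Prog X (X × Win)
  place = op (λ x w → (x , w) , just peb , nothing)

  -- The pictures hidden by the pebbles at the bottom left, bottom right, top left
  -- and top right corner.
  Mem : Set
  Mem = Win × Win × Win × Win

  -- The first bit forces every side to move, the second records whether some side has moved.
  Cycle : Set
  Cycle = Bool × Bool × Mem

  stage : Dir → Dir → (Mem → Win × Win) → (Mem → Win × Win → Mem) → Prog Cycle Cycle
  stage d o get put = post out (pre into (carry Cycle side))
    where
      into : Cycle → Cycle × Bool × Ctx
      into (s , v , M) = (s , v , M) , s , d , o , get M
      out : Cycle × Bool × Win × Win → Cycle
      out ((s , v , M) , b , ww) = s , (v ∨ b) , put M ww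

  bottomS leftS rightS topS cycle : Prog Cycle Cycle
  bottomS = stage right down (λ (a , b , c , e) → a , b) (λ (_ , _ , c , e) (a , b) → a , b , c , e)
  leftS   = stage up left  (λ (a , b , c , e) → a , c) (λ (_ , b , _ , e) (a , c) → a , b , c , e)
  rightS  = stage up right (λ (a , b , c , e) → b , e) (λ (a , _ , c , _) (b , e) → a , b , c , e)
  topS    = stage right up (λ (a , b , c , e) → c , e) (λ (a , b , _ , _) (c , e) → a , b , c , e)
  cycle = bottomS ⟫ leftS ⟫ walk right ⟫ rightS ⟫ walk left ⟫ walk up ⟫ topS ⟫ walk down

  growStep : Prog Mem (Mem ⊎ Mem)
  growStep = pre (λ M → false , false , M) (post (λ (s , v , M) → if v then inj₁ M else inj₂ M) cycle)

  grow : Prog Mem Mem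
  grow = loop growStep

  forced : Prog Mem Mem
  forced = pre (λ M → true , false , M) (post (λ (s , v , M) → M) cycle)

  -- The first pebbles are two pixels apart, the least distance with disjoint windows, and the start
  -- lies strictly between them.
  corners : Prog ⊤ Mem
  corners = steps left 0 ⟫ steps down 0 ⟫ place ⟫ steps right 1 ⟫ place ⟫ steps up 1 ⟫ place ⟫ steps left 1 ⟫ place
          ⟫ post (λ ((((_ , a) , b) , e) , c) → a , b , c , e) (steps down 1)

  -- Growth leaves a distance of at least one from the box, and the two forced cycles raise it to
  -- three: one pixel because the search also probes the pixels next to the box, two for disjoint
  -- windows.
  enclose : Prog ⊤ Mem
  enclose = corners ⟫ grow ⟫ forced ⟫ forced

  -- Limited to the left of `L`, because the codes in the copy may combine to the pebble pattern.
  Legal : Picture → ℤ → Set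
  Legal B L = ∀ x y → x ≤ L → isPeb (win B (x , y)) ≡ false

  Off : ℤ → ℤ → Set
  Off a b = a + + 2 ≤ b ⊎ b + + 2 ≤ a

  -- Keeps the reason together with the outcome. `Free` makes the final frame enclose `P`; `Near`
  -- keeps the frame from growing beyond the box by more than a constant.
  data Moved (force : Bool) (Free Near : Set) (v w : ℤ) : Bool → ℤ → Set where
    stays : force ≡ false → Free → Moved force Free Near v w false v
    moves : force ≡ true ⊎ Near → Moved force Free Near v w true w

  distance : ∀ {a b} → a ≤ b → ∃[ n ] b ≡ a + + n
  distance {a} {b} le = ℤ.∣ b - a ∣ , trans (lin 2 (λ a b → [] ⊢ b ≐ a ⊕ (b ⊖ a)) a b) (cong (λ z → a + z) (sym (ℤ.0≤i⇒+∣i∣≡i (ℤ.i≤j⇒0≤j-i le))))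

  -- Outside the copy the robot stays within distance 8 of the box, and `D` bounds every horizontal
  -- or vertical distance within this margin.
  record Surroundings : Set₁ where
    constructor surroundings
    field
      Anchor : Pixel → Set
      X⁻ X⁺ Y⁻ Y⁺ : ℤ
      D : ℕ
      wide : X⁺ - X⁻ + + 16 ≤ + D
      tall : Y⁺ - Y⁻ + + 16 ≤ + D
      big : ∀ {x y} → X⁻ - + 8 ≤ x → x ≤ X⁺ + + 8 → Y⁻ - + 8 ≤ y → y ≤ Y⁺ + + 8 → Anchor (x , y)

  module Frames (sur : Surroundings) where
    open Surroundings sur
    open Walks Anchor public

    steps-run : ∀ {X : Set} {F : Finite X} n {d} {x : X} {q f Q} → (∀ k → k ℕ.≤ n → Anchor (adv d k q)) →
      Q x (adv d (suc n) q) f → Run (steps ⦃ F ⦄ d n) x (suc n) q f Q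
    steps-run n a k = wp-map (wp-pre (wp-carry (go-run n a k)))

    walk-fwd : ∀ {X : Set} {F : Finite X} {B d o n S E rs f} {x : X} {Q} → E ≡ adv d n S → Line B d o n S rs → Overlay f B (E ∷ S ∷ rs) →
      Q x E f → Run (walk ⦃ F ⦄ d) x (1 ℕ.+ n) S f Q
    walk-fwd {F = F} {B} {d} {o} {n} {S} {E} {rs} {f} {x} {Q} refl L ov k = go-n n refl (Line.long L)
      where
        go-n : ∀ i → i ≡ n → 2 ℕ.≤ i → Run (walk ⦃ F ⦄ d) x (1 ℕ.+ n) S f Q
        go-n (suc m) refl le = wp-⟫ {t₁ = 1} $ steps-run 0 (λ { zero _ → L .Line.anchor 0 ℕ.z≤n }) $ wp-map $ wp-pre $ wp-carry $
          fwd-run 1 m (λ k le → L .Line.anchor (suc k) (ℕ.s≤s le)) (λ k lt → line-clear L ov (suc k) (ℕ.s≤s ℕ.z≤n) (ℕ.s≤s lt)) (ov .on (here refl)) k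

    walk-back : ∀ {X : Set} {F : Finite X} {B d o n S E rs f} {x : X} {Q} → E ≡ adv d n S → Line B d o n S rs → Overlay f B (E ∷ S ∷ rs) →
      Q x S f → Run (walk ⦃ F ⦄ (opp d)) x (1 ℕ.+ n) E f Q
    walk-back {F = F} {B} {d} {o} {n} {S} {E} {rs} {f} {x} {Q} refl L ov k = go-n n refl (Line.long L)
      where
        go-n : ∀ i → i ≡ n → 2 ℕ.≤ i → Run (walk ⦃ F ⦄ (opp d)) x (1 ℕ.+ n) E f Q
        go-n (suc m) refl le = wp-⟫ {t₁ = 1} $ steps-run 0 (λ { zero _ → subst Anchor (sym (adv-zero (opp d) E)) (L .Line.anchor n ℕ.≤-refl) }) $
          wp-at (adv-opp d 1 m S) $ wp-map $ wp-pre $ wp-carry $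
          back-run m (λ k le → L .Line.anchor k (ℕ.m≤n⇒m≤1+n le)) (λ k 0<k le → line-clear L ov k 0<k (ℕ.s≤s le)) (ov .on (there (here refl)))
              (λ _ → k)

    record InMargin (x y : ℤ) (e : ℕ) : Set where
      constructor margin
      field
        lx : X⁻ - + e ≤ x
        ux : x ≤ X⁺ + + e
        ly : Y⁻ - + e ≤ y
        uy : y ≤ Y⁺ + + e

    anc : ∀ {x y} → InMargin x y 8 → Anchor (x , y)
    anc (margin a b c d) = big a b c d

    hLine : ∀ {B L o n xl xr y rs} → Perp right o → xr ≡ xl + + n → xl + + 2 ≤ xr → InMargin xl y 8 → InMargin xr y 8 →
      Legal B L → xr ≤ L → (∀ {r} → r ∈ rs → Off (proj₂ r) y) → Line B right o n (xl , y) rs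
    hLine {n = n} {xl} {y = y} pp refl h (margin a b c d) (margin a′ b′ c′ d′) lg le off = record
      { perp = pp
      ; long = ℤ.drop‿+≤+ (lin 2 (λ xl n → (κ 0 ≼ n) ∷ (xl ⊕ κ 2 ≼ xl ⊕ n) ∷ [] ⊢ κ 2 ≼ n) xl (+ n) (0≤+ n) h)
      ; anchor = λ k k≤n → big (lin 3 (λ X⁻ xl k → (κ 0 ≼ k) ∷ (X⁻ ⊖ κ 8 ≼ xl) ∷ [] ⊢ X⁻ ⊖ κ 8 ≼ xl ⊕ k) X⁻ xl (+ k) (0≤+ k) a)
          (lin 4 (λ X⁺ xl k n → (κ 0 ≼ k) ∷ (κ 0 ≼ n) ∷ (xl ⊕ n ≼ X⁺ ⊕ κ 8) ∷ (k ≼ n) ∷ [] ⊢ xl ⊕ k ≼ X⁺ ⊕ κ 8) X⁺ xl (+ k) (+ n) (0≤+ k) (0≤+ n) b′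
              (ℤ.+≤+ k≤n)) c d
      ; legal = λ k k≤n → lg _ y (ℤ.≤-trans (ℤ.+-monoʳ-≤ xl (ℤ.+≤+ k≤n)) le)
      ; apart = λ i k _ → inj₂ (off i) }

    vLine : ∀ {B L o n x yb yt rs} → Perp up o → yt ≡ yb + + n → yb + + 2 ≤ yt → InMargin x yb 8 → InMargin x yt 8 →
      Legal B L → x ≤ L → (∀ {r} → r ∈ rs → Off (proj₁ r) x) → Line B up o n (x , yb) rs
    vLine {n = n} {x} {yb} pp refl h (margin a b c d) (margin a′ b′ c′ d′) lg le off = record
      { perp = pp
      ; long = ℤ.drop‿+≤+ (lin 2 (λ yb n → (κ 0 ≼ n) ∷ (yb ⊕ κ 2 ≼ yb ⊕ n) ∷ [] ⊢ κ 2 ≼ n) yb (+ n) (0≤+ n) h)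
      ; anchor = λ k k≤n → big a b (lin 3 (λ Y⁻ yb k → (κ 0 ≼ k) ∷ (Y⁻ ⊖ κ 8 ≼ yb) ∷ [] ⊢ Y⁻ ⊖ κ 8 ≼ yb ⊕ k) Y⁻ yb (+ k) (0≤+ k) c)
          (lin 4 (λ Y⁺ yb k n → (κ 0 ≼ k) ∷ (κ 0 ≼ n) ∷ (yb ⊕ n ≼ Y⁺ ⊕ κ 8) ∷ (k ≼ n) ∷ [] ⊢ yb ⊕ k ≼ Y⁺ ⊕ κ 8) Y⁺ yb (+ k) (+ n) (0≤+ k) (0≤+ n) d′
              (ℤ.+≤+ k≤n))
      ; legal = λ k k≤n → lg x _ le
      ; apart = λ i k _ → inj₁ (off i) }

    hTarget : ∀ {o n xl xr y y′ rs} → move o (xl , y) ≡ (xl , y′) → move o (xr , y) ≡ (xr , y′) → xr ≡ xl + + n →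
      InMargin xl y′ 8 → InMargin xr y′ 8 → (∀ {r} → r ∈ rs → Off (proj₂ r) y′) → Target right o n (xl , y) rs
    hTarget e e′ refl m m′ off = record
      { anchorS = subst Anchor (sym e) (anc m) ; anchorE = subst Anchor (sym e′) (anc m′)
      ; apartS = λ i → subst (Far _) (sym e) (inj₂ (off i)) ; apartE = λ i → subst (Far _) (sym e′) (inj₂ (off i)) }

    vTarget : ∀ {o n x x′ yb yt rs} → move o (x , yb) ≡ (x′ , yb) → move o (x , yt) ≡ (x′ , yt) → yt ≡ yb + + n →
      InMargin x′ yb 8 → InMargin x′ yt 8 → (∀ {r} → r ∈ rs → Off (proj₁ r) x′) → Target up o n (x , yb) rs
    vTarget e e′ refl m m′ off = record
      { anchorS = subst Anchor (sym e) (anc m) ; anchorE = subst Anchor (sym e′) (anc m′)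
      ; apartS = λ i → subst (Far _) (sym e) (inj₁ (off i)) ; apartE = λ i → subst (Far _) (sym e′) (inj₁ (off i)) }

    length≤D : ∀ {xl xr n} → xr ≡ xl + + n → X⁻ - + 8 ≤ xl → xr ≤ X⁺ + + 8 → n ℕ.≤ D
    length≤D {xl} {n = n} refl a b = ℤ.drop‿+≤+ (lin 5 (λ X⁻ X⁺ xl n D → (κ 0 ≼ n) ∷ (κ 0 ≼ D) ∷ (X⁺ ⊖ X⁻ ⊕ κ 16 ≼ D) ∷ (X⁻ ⊖ κ 8 ≼ xl) ∷
        (xl ⊕ n ≼ X⁺ ⊕ κ 8) ∷ [] ⊢ n ≼ D) X⁻ X⁺ xl (+ n) (+ D) (0≤+ n) (0≤+ D) wide a b)

    height≤D : ∀ {yb yt n} → yt ≡ yb + + n → Y⁻ - + 8 ≤ yb → yt ≤ Y⁺ + + 8 → n ℕ.≤ D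
    height≤D {yb} {n = n} refl a b = ℤ.drop‿+≤+ (lin 5 (λ Y⁻ Y⁺ yb n D → (κ 0 ≼ n) ∷ (κ 0 ≼ D) ∷ (Y⁺ ⊖ Y⁻ ⊕ κ 16 ≼ D) ∷ (Y⁻ ⊖ κ 8 ≼ yb) ∷
        (yb ⊕ n ≼ Y⁺ ⊕ κ 8) ∷ [] ⊢ n ≼ D) Y⁻ Y⁺ yb (+ n) (+ D) (0≤+ n) (0≤+ D) tall a b)

    -- `e` is 6 before a cycle and 7 during it; the line to which a side moves then stays within the
    -- margin 8.
    record Rect (e : ℕ) (xl xr yb yt : ℤ) : Set where
      field
        gapx : xl + + 2 ≤ xr
        gapy : yb + + 2 ≤ yt
        lx : X⁻ - + e ≤ xl
        ux : xr ≤ X⁺ + + e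
        ly : Y⁻ - + e ≤ yb
        uy : yt ≤ Y⁺ + + e

    rect-mono : ∀ {e e′ xl xr yb yt} → e ℕ.≤ e′ → Rect e xl xr yb yt → Rect e′ xl xr yb yt
    rect-mono {e} {e′} {xl} {xr} {yb} {yt} le R = record
      { gapx = R .Rect.gapx ; gapy = R .Rect.gapy
      ; lx = lin 4 (λ X⁻ e f xl → (X⁻ ⊖ e ≼ xl) ∷ (e ≼ f) ∷ [] ⊢ X⁻ ⊖ f ≼ xl) X⁻ (+ e) (+ e′) xl (R .Rect.lx) (ℤ.+≤+ le)
      ; ux = lin 4 (λ X⁺ e f xr → (xr ≼ X⁺ ⊕ e) ∷ (e ≼ f) ∷ [] ⊢ xr ≼ X⁺ ⊕ f) X⁺ (+ e) (+ e′) xr (R .Rect.ux) (ℤ.+≤+ le)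
      ; ly = lin 4 (λ X⁻ e f xl → (X⁻ ⊖ e ≼ xl) ∷ (e ≼ f) ∷ [] ⊢ X⁻ ⊖ f ≼ xl) Y⁻ (+ e) (+ e′) yb (R .Rect.ly) (ℤ.+≤+ le)
      ; uy = lin 4 (λ X⁺ e f xr → (xr ≼ X⁺ ⊕ e) ∷ (e ≼ f) ∷ [] ⊢ xr ≼ X⁺ ⊕ f) Y⁺ (+ e) (+ e′) yt (R .Rect.uy) (ℤ.+≤+ le) }

    module _ {e xl xr yb yt} (R : Rect e xl xr yb yt) where
      open Rect R
      at-BL : InMargin xl yb e
      at-BL = margin lx (lin 3 (λ xl xr z → (xl ⊕ κ 2 ≼ xr) ∷ (xr ≼ z) ∷ [] ⊢ xl ≼ z) xl xr (X⁺ + + e) gapx ux) ly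
          (lin 3 (λ xl xr z → (xl ⊕ κ 2 ≼ xr) ∷ (xr ≼ z) ∷ [] ⊢ xl ≼ z) yb yt (Y⁺ + + e) gapy uy)
      at-BR : InMargin xr yb e
      at-BR = margin (lin 3 (λ xl xr z → (xl ⊕ κ 2 ≼ xr) ∷ (z ≼ xl) ∷ [] ⊢ z ≼ xr) xl xr (X⁻ - + e) gapx lx) ux ly
          (lin 3 (λ xl xr z → (xl ⊕ κ 2 ≼ xr) ∷ (xr ≼ z) ∷ [] ⊢ xl ≼ z) yb yt (Y⁺ + + e) gapy uy)
      at-TL : InMargin xl yt e
      at-TL = margin lx (lin 3 (λ xl xr z → (xl ⊕ κ 2 ≼ xr) ∷ (xr ≼ z) ∷ [] ⊢ xl ≼ z) xl xr (X⁺ + + e) gapx ux)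
          (lin 3 (λ xl xr z → (xl ⊕ κ 2 ≼ xr) ∷ (z ≼ xl) ∷ [] ⊢ z ≼ xr) yb yt (Y⁻ - + e) gapy ly) uy
      at-TR : InMargin xr yt e
      at-TR = margin (lin 3 (λ xl xr z → (xl ⊕ κ 2 ≼ xr) ∷ (z ≼ xl) ∷ [] ⊢ z ≼ xr) xl xr (X⁻ - + e) gapx lx) ux
          (lin 3 (λ xl xr z → (xl ⊕ κ 2 ≼ xr) ∷ (z ≼ xl) ∷ [] ⊢ z ≼ xr) yb yt (Y⁻ - + e) gapy ly) uy

    corners-of : ℤ → ℤ → ℤ → ℤ → List Pixel
    corners-of xl xr yb yt = (xl , yb) ∷ (xr , yb) ∷ (xl , yt) ∷ (xr , yt) ∷ []

    RowFree ColFree : Picture → ℤ → ℤ → ℤ → Set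
    RowFree B xl xr y = ∀ u → xl ≤ u → u ≤ xr → B (u , y) ≡ false
    ColFree B x yb yt = ∀ u → yb ≤ u → u ≤ yt → B (x , u) ≡ false

    -- Moving the four sides of the frame.

    module Growing (B : Picture) (legal : ∀ q → isPeb (win B q) ≡ false)
      (bounded : ∀ {x y} → B (x , y) ≡ true → (X⁻ ≤ x × x ≤ X⁺) × (Y⁻ ≤ y × y ≤ Y⁺)) where

      private
        legal≤ : ∀ L → Legal B L
        legal≤ L x y _ = legal (x , y)

        row-free : ∀ {xl xr n y} → xr ≡ xl + + n → (∀ k → k ℕ.≤ n → B (adv right k (xl , y)) ≡ false) → RowFree B xl xr y
        row-free {xl} {n = n} {y} refl h u a b with distance a
        ... | k , refl = h k (ℤ.drop‿+≤+ (lin 3 (λ xl k n → (κ 0 ≼ k) ∷ (κ 0 ≼ n) ∷ (xl ⊕ k ≼ xl ⊕ n) ∷ [] ⊢ k ≼ n) xl (+ k) (+ n) (0≤+ k) (0≤+ n) b))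

        col-free : ∀ {x yb yt n} → yt ≡ yb + + n → (∀ k → k ℕ.≤ n → B (adv up k (x , yb)) ≡ false) → ColFree B x yb yt
        col-free {x} {yb} {n = n} refl h u a b with distance a
        ... | k , refl = h k (ℤ.drop‿+≤+ (lin 3 (λ yb k n → (κ 0 ≼ k) ∷ (κ 0 ≼ n) ∷ (yb ⊕ k ≼ yb ⊕ n) ∷ [] ⊢ k ≼ n) yb (+ k) (+ n) (0≤+ k) (0≤+ n) b))

        pattern at₀ e = here e
        pattern at₁ e = there (here e)
        pattern at₂ e = there (there (here e))
        pattern at₃ e = there (there (there (here e)))

        module _ {f : Picture} {a b c e : Pixel} where
          left→ : Overlay f B (a ∷ b ∷ c ∷ e ∷ []) → Overlay f B (c ∷ a ∷ b ∷ e ∷ [])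
          left→ = reorder (λ { (at₀ r) → at₂ r ; (at₁ r) → at₀ r ; (at₂ r) → at₁ r ; (at₃ r) → at₃ r })
                          (λ { (at₀ r) → at₁ r ; (at₁ r) → at₂ r ; (at₂ r) → at₀ r ; (at₃ r) → at₃ r })
          left← : Overlay f B (c ∷ a ∷ b ∷ e ∷ []) → Overlay f B (a ∷ b ∷ c ∷ e ∷ [])
          left← = reorder (λ { (at₀ r) → at₁ r ; (at₁ r) → at₂ r ; (at₂ r) → at₀ r ; (at₃ r) → at₃ r })
                          (λ { (at₀ r) → at₂ r ; (at₁ r) → at₀ r ; (at₂ r) → at₁ r ; (at₃ r) → at₃ r })
          right→ : Overlay f B (a ∷ b ∷ c ∷ e ∷ []) → Overlay f B (e ∷ b ∷ a ∷ c ∷ [])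
          right→ = reorder (λ { (at₀ r) → at₃ r ; (at₁ r) → at₁ r ; (at₂ r) → at₀ r ; (at₃ r) → at₂ r })
                           (λ { (at₀ r) → at₂ r ; (at₁ r) → at₁ r ; (at₂ r) → at₃ r ; (at₃ r) → at₀ r })
          right← : Overlay f B (e ∷ b ∷ a ∷ c ∷ []) → Overlay f B (a ∷ b ∷ c ∷ e ∷ [])
          right← = reorder (λ { (at₀ r) → at₂ r ; (at₁ r) → at₁ r ; (at₂ r) → at₃ r ; (at₃ r) → at₀ r })
                           (λ { (at₀ r) → at₃ r ; (at₁ r) → at₁ r ; (at₂ r) → at₀ r ; (at₃ r) → at₂ r })
          top→ : Overlay f B (a ∷ b ∷ c ∷ e ∷ []) → Overlay f B (e ∷ c ∷ a ∷ b ∷ [])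
          top→ = reorder (λ { (at₀ r) → at₃ r ; (at₁ r) → at₂ r ; (at₂ r) → at₀ r ; (at₃ r) → at₁ r })
                         (λ { (at₀ r) → at₂ r ; (at₁ r) → at₃ r ; (at₂ r) → at₁ r ; (at₃ r) → at₀ r })
          top← : Overlay f B (e ∷ c ∷ a ∷ b ∷ []) → Overlay f B (a ∷ b ∷ c ∷ e ∷ [])
          top← = reorder (λ { (at₀ r) → at₂ r ; (at₁ r) → at₃ r ; (at₂ r) → at₁ r ; (at₃ r) → at₀ r })
                         (λ { (at₀ r) → at₃ r ; (at₁ r) → at₂ r ; (at₂ r) → at₀ r ; (at₃ r) → at₁ r })

          corner← : Overlay f B (c ∷ e ∷ b ∷ a ∷ []) → Overlay f B (a ∷ b ∷ c ∷ e ∷ [])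
          corner← = reorder (λ { (at₀ r) → at₃ r ; (at₁ r) → at₂ r ; (at₂ r) → at₀ r ; (at₃ r) → at₁ r })
                            (λ { (at₀ r) → at₂ r ; (at₁ r) → at₃ r ; (at₂ r) → at₁ r ; (at₃ r) → at₀ r })

        side-time : ∀ {n} → n ℕ.≤ D → 2 ℕ.+ (n ℕ.+ (6 ℕ.+ n)) ℕ.≤ 8 ℕ.+ (D ℕ.+ D)
        side-time {n} h = linℕ 2 (λ n D → (n ≼ D) ∷ [] ⊢ κ 2 ⊕ (n ⊕ (κ 6 ⊕ n)) ≼ κ 8 ⊕ (D ⊕ D)) n D h

      module _ {xl xr yb yt : ℤ} (R : Rect 7 xl xr yb yt) where
        open Rect R
        private
          R8 : Rect 8 xl xr yb yt
          R8 = rect-mono (ℕ.n≤1+n 7) R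
          n : ℕ
          n = proj₁ (distance (lin 2 (λ xl xr → (xl ⊕ κ 2 ≼ xr) ∷ [] ⊢ xl ≼ xr) xl xr gapx))
          n≡ : xr ≡ xl + + n
          n≡ = proj₂ (distance (lin 2 (λ xl xr → (xl ⊕ κ 2 ≼ xr) ∷ [] ⊢ xl ≼ xr) xl xr gapx))
          m : ℕ
          m = proj₁ (distance (lin 2 (λ xl xr → (xl ⊕ κ 2 ≼ xr) ∷ [] ⊢ xl ≼ xr) yb yt gapy))
          m≡ : yt ≡ yb + + m
          m≡ = proj₂ (distance (lin 2 (λ xl xr → (xl ⊕ κ 2 ≼ xr) ∷ [] ⊢ xl ≼ xr) yb yt gapy))
          n≤D : n ℕ.≤ D
          n≤D = length≤D n≡ (at-BL R8 .InMargin.lx) (at-BR R8 .InMargin.ux)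
          m≤D : m ℕ.≤ D
          m≤D = height≤D m≡ (at-BL R8 .InMargin.ly) (at-TL R8 .InMargin.uy)

        bottomL : Line B right down n (xl , yb) ((xl , yt) ∷ (xr , yt) ∷ [])
        bottomL = hLine right-down n≡ gapx (at-BL R8) (at-BR R8) (legal≤ xr) ℤ.≤-refl (λ { (at₀ refl) → inj₂ gapy ; (at₁ refl) → inj₂ gapy })
        topL : Line B right up n (xl , yt) ((xl , yb) ∷ (xr , yb) ∷ [])
        topL = hLine right-up n≡ gapx (at-TL R8) (at-TR R8) (legal≤ xr) ℤ.≤-refl (λ { (at₀ refl) → inj₁ gapy ; (at₁ refl) → inj₁ gapy })
        leftL : Line B up left m (xl , yb) ((xr , yb) ∷ (xr , yt) ∷ [])
        leftL = vLine up-left m≡ gapy (at-BL R8) (at-TL R8) (legal≤ xl) ℤ.≤-refl (λ { (at₀ refl) → inj₂ gapx ; (at₁ refl) → inj₂ gapx })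
        rightL : Line B up right m (xr , yb) ((xl , yb) ∷ (xl , yt) ∷ [])
        rightL = vLine up-right m≡ gapy (at-BR R8) (at-TR R8) (legal≤ xr) ℤ.≤-refl (λ { (at₀ refl) → inj₁ gapx ; (at₁ refl) → inj₁ gapx })

        -- Windows extend upwards, so the bottom side may react to a tile in row `yb + 1`, while the
        -- top side reacts only to tiles in row `yt` or beyond. The same asymmetry holds between
        -- left and right.
        bottom-run : ∀ {f force Q} → Overlay f B (corners-of xl xr yb yt) →
          (∀ {b yb′ f′} → Moved force (RowFree B xl xr yb) (Y⁻ ≤ yb + + 1) yb (yb - + 1) b yb′ →
            Overlay f′ B (corners-of xl xr yb′ yt) → Q (b , win B (xl , yb′) , win B (xr , yb′)) (xl , yb′) f′) →
          Run side (force , right , down , win B (xl , yb) , win B (xr , yb)) (8 ℕ.+ (D ℕ.+ D)) (xl , yb) f Q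
        bottom-run ov k = wp-mono (side-time n≤D) $ side-run (cong (_, yb) n≡) bottomL
          (hTarget refl refl n≡ (below (at-BL R)) (below (at-BR R)) (λ { (at₀ refl) → inj₂ far ; (at₁ refl) → inj₂ far }))
          (swap-peb ov) refl refl
          (λ s fr _ _ → k (stays s (row-free n≡ fr)) ov)
          (λ why o′ → k (moves (near why)) (swap-peb o′))
          where
            far : yb - + 1 + + 2 ≤ yt
            far = lin 2 (λ yb yt → (yb ⊕ κ 2 ≼ yt) ∷ [] ⊢ yb ⊖ κ 1 ⊕ κ 2 ≼ yt) yb yt gapy
            below : ∀ {x} → InMargin x yb 7 → InMargin x (yb - + 1) 8
            below {x} (margin a b c d) = margin (lin 2 (λ X⁻ x → (X⁻ ⊖ κ 7 ≼ x) ∷ [] ⊢ X⁻ ⊖ κ 8 ≼ x) X⁻ x a)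
                (lin 2 (λ X⁺ x → (x ≼ X⁺ ⊕ κ 7) ∷ [] ⊢ x ≼ X⁺ ⊕ κ 8) X⁺ x b)
              (lin 2 (λ Y⁻ yb → (Y⁻ ⊖ κ 7 ≼ yb) ∷ [] ⊢ Y⁻ ⊖ κ 8 ≼ yb ⊖ κ 1) Y⁻ yb c)
                  (lin 2 (λ Y⁺ yb → (yb ≼ Y⁺ ⊕ κ 7) ∷ [] ⊢ yb ⊖ κ 1 ≼ Y⁺ ⊕ κ 8) Y⁺ yb d)
            near : ∀ {F : Set} → F ⊎ (∃[ k ] (k ℕ.≤ n × ∃[ t ] (InWin (adv right k (xl , yb)) t × B t ≡ true))) → F ⊎ Y⁻ ≤ yb + + 1
            near (inj₁ e) = inj₁ e
            near (inj₂ (k , _ , t , (_ , (_ , h)) , e)) = inj₂ (ℤ.≤-trans (proj₁ (proj₂ (bounded e))) h)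

        top-run : ∀ {f force Q} → Overlay f B (corners-of xl xr yb yt) →
          (∀ {b yt′ f′} → Moved force (RowFree B xl xr yt) (yt ≤ Y⁺) yt (yt + + 1) b yt′ →
            Overlay f′ B (corners-of xl xr yb yt′) → Q (b , win B (xl , yt′) , win B (xr , yt′)) (xl , yt′) f′) →
          Run side (force , right , up , win B (xl , yt) , win B (xr , yt)) (8 ℕ.+ (D ℕ.+ D)) (xl , yt) f Q
        top-run ov k = wp-mono (side-time n≤D) $ side-run (cong (_, yt) n≡) topL
          (hTarget refl refl n≡ (above (at-TL R)) (above (at-TR R)) (λ { (at₀ refl) → inj₁ far ; (at₁ refl) → inj₁ far }))
          (top→ ov) refl refl
          (λ s fr _ _ → k (stays s (row-free n≡ fr)) ov)
          (λ why o′ → k (moves (near why)) (top← o′))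
          where
            far : yb + + 2 ≤ yt + + 1
            far = lin 2 (λ yb yt → (yb ⊕ κ 2 ≼ yt) ∷ [] ⊢ yb ⊕ κ 2 ≼ yt ⊕ κ 1) yb yt gapy
            above : ∀ {x} → InMargin x yt 7 → InMargin x (yt + + 1) 8
            above {x} (margin a b c d) = margin (lin 2 (λ X⁻ x → (X⁻ ⊖ κ 7 ≼ x) ∷ [] ⊢ X⁻ ⊖ κ 8 ≼ x) X⁻ x a)
                (lin 2 (λ X⁺ x → (x ≼ X⁺ ⊕ κ 7) ∷ [] ⊢ x ≼ X⁺ ⊕ κ 8) X⁺ x b)
              (lin 2 (λ Y⁻ yt → (Y⁻ ⊖ κ 7 ≼ yt) ∷ [] ⊢ Y⁻ ⊖ κ 8 ≼ yt ⊕ κ 1) Y⁻ yt c)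
                  (lin 2 (λ Y⁺ yt → (yt ≼ Y⁺ ⊕ κ 7) ∷ [] ⊢ yt ⊕ κ 1 ≼ Y⁺ ⊕ κ 8) Y⁺ yt d)
            near : ∀ {F : Set} → F ⊎ (∃[ k ] (k ℕ.≤ n × ∃[ t ] (InWin (adv right k (xl , yt)) t × B t ≡ true))) → F ⊎ yt ≤ Y⁺
            near (inj₁ e) = inj₁ e
            near (inj₂ (k , _ , t , (_ , (h , _)) , e)) = inj₂ (ℤ.≤-trans h (proj₂ (proj₂ (bounded e))))

        left-run : ∀ {f force Q} → Overlay f B (corners-of xl xr yb yt) →
          (∀ {b xl′ f′} → Moved force (ColFree B xl yb yt) (X⁻ ≤ xl + + 1) xl (xl - + 1) b xl′ →
            Overlay f′ B (corners-of xl′ xr yb yt) → Q (b , win B (xl′ , yb) , win B (xl′ , yt)) (xl′ , yb) f′) →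
          Run side (force , up , left , win B (xl , yb) , win B (xl , yt)) (8 ℕ.+ (D ℕ.+ D)) (xl , yb) f Q
        left-run ov k = wp-mono (side-time m≤D) $ side-run (cong (xl ,_) m≡) leftL
          (vTarget refl refl m≡ (before (at-BL R)) (before (at-TL R)) (λ { (at₀ refl) → inj₂ far ; (at₁ refl) → inj₂ far }))
          (left→ ov) refl refl
          (λ s fr _ _ → k (stays s (col-free m≡ fr)) ov)
          (λ why o′ → k (moves (near why)) (left← o′))
          where
            far : xl - + 1 + + 2 ≤ xr
            far = lin 2 (λ xl xr → (xl ⊕ κ 2 ≼ xr) ∷ [] ⊢ xl ⊖ κ 1 ⊕ κ 2 ≼ xr) xl xr gapx
            before : ∀ {y} → InMargin xl y 7 → InMargin (xl - + 1) y 8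
            before {y} (margin a b c d) = margin (lin 2 (λ X⁻ xl → (X⁻ ⊖ κ 7 ≼ xl) ∷ [] ⊢ X⁻ ⊖ κ 8 ≼ xl ⊖ κ 1) X⁻ xl a)
                (lin 2 (λ X⁺ xl → (xl ≼ X⁺ ⊕ κ 7) ∷ [] ⊢ xl ⊖ κ 1 ≼ X⁺ ⊕ κ 8) X⁺ xl b)
              (lin 2 (λ Y⁻ y → (Y⁻ ⊖ κ 7 ≼ y) ∷ [] ⊢ Y⁻ ⊖ κ 8 ≼ y) Y⁻ y c) (lin 2 (λ Y⁺ y → (y ≼ Y⁺ ⊕ κ 7) ∷ [] ⊢ y ≼ Y⁺ ⊕ κ 8) Y⁺ y d)
            near : ∀ {F : Set} → F ⊎ (∃[ k ] (k ℕ.≤ m × ∃[ t ] (InWin (adv up k (xl , yb)) t × B t ≡ true))) → F ⊎ X⁻ ≤ xl + + 1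
            near (inj₁ e) = inj₁ e
            near (inj₂ (k , _ , t , ((_ , h) , _) , e)) = inj₂ (ℤ.≤-trans (proj₁ (proj₁ (bounded e))) h)

        right-run : ∀ {f force Q} → Overlay f B (corners-of xl xr yb yt) →
          (∀ {b xr′ f′} → Moved force (ColFree B xr yb yt) (xr ≤ X⁺) xr (xr + + 1) b xr′ →
            Overlay f′ B (corners-of xl xr′ yb yt) → Q (b , win B (xr′ , yb) , win B (xr′ , yt)) (xr′ , yb) f′) →
          Run side (force , up , right , win B (xr , yb) , win B (xr , yt)) (8 ℕ.+ (D ℕ.+ D)) (xr , yb) f Q
        right-run ov k = wp-mono (side-time m≤D) $ side-run (cong (xr ,_) m≡) rightL
          (vTarget refl refl m≡ (after (at-BR R)) (after (at-TR R)) (λ { (at₀ refl) → inj₁ far ; (at₁ refl) → inj₁ far }))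
          (right→ ov) refl refl
          (λ s fr _ _ → k (stays s (col-free m≡ fr)) ov)
          (λ why o′ → k (moves (near why)) (right← o′))
          where
            far : xl + + 2 ≤ xr + + 1
            far = lin 2 (λ xl xr → (xl ⊕ κ 2 ≼ xr) ∷ [] ⊢ xl ⊕ κ 2 ≼ xr ⊕ κ 1) xl xr gapx
            after : ∀ {y} → InMargin xr y 7 → InMargin (xr + + 1) y 8
            after {y} (margin a b c d) = margin (lin 2 (λ X⁻ xr → (X⁻ ⊖ κ 7 ≼ xr) ∷ [] ⊢ X⁻ ⊖ κ 8 ≼ xr ⊕ κ 1) X⁻ xr a)
                (lin 2 (λ X⁺ xr → (xr ≼ X⁺ ⊕ κ 7) ∷ [] ⊢ xr ⊕ κ 1 ≼ X⁺ ⊕ κ 8) X⁺ xr b)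
              (lin 2 (λ Y⁻ y → (Y⁻ ⊖ κ 7 ≼ y) ∷ [] ⊢ Y⁻ ⊖ κ 8 ≼ y) Y⁻ y c) (lin 2 (λ Y⁺ y → (y ≼ Y⁺ ⊕ κ 7) ∷ [] ⊢ y ≼ Y⁺ ⊕ κ 8) Y⁺ y d)
            near : ∀ {F : Set} → F ⊎ (∃[ k ] (k ℕ.≤ m × ∃[ t ] (InWin (adv up k (xr , yb)) t × B t ≡ true))) → F ⊎ xr ≤ X⁺
            near (inj₁ e) = inj₁ e
            near (inj₂ (k , _ , t , ((h , _) , _) , e)) = inj₂ (ℤ.≤-trans h (proj₂ (proj₁ (bounded e))))

        module _ {X : Set} {F : Finite X} {x : X} {f : Picture} {Q : X → Pixel → Picture → Set} (ov : Overlay f B (corners-of xl xr yb yt)) where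
          walk-right : Q x (xr , yb) f → Run (walk ⦃ F ⦄ right) x (1 ℕ.+ D) (xl , yb) f Q
          walk-right k = wp-mono (ℕ.s≤s n≤D) $ walk-fwd (cong (_, yb) n≡) bottomL (swap-peb ov) k
          walk-left : Q x (xl , yb) f → Run (walk ⦃ F ⦄ left) x (1 ℕ.+ D) (xr , yb) f Q
          walk-left k = wp-mono (ℕ.s≤s n≤D) $ walk-back (cong (_, yb) n≡) bottomL (swap-peb ov) k
          walk-up : Q x (xl , yt) f → Run (walk ⦃ F ⦄ up) x (1 ℕ.+ D) (xl , yb) f Q
          walk-up k = wp-mono (ℕ.s≤s m≤D) $ walk-fwd (cong (xl ,_) m≡) leftL (left→ ov) k
          walk-down : Q x (xl , yb) f → Run (walk ⦃ F ⦄ down) x (1 ℕ.+ D) (xl , yt) f Q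
          walk-down k = wp-mono (ℕ.s≤s m≤D) $ walk-back (cong (xl ,_) m≡) leftL (left→ ov) k

      mem-of : ℤ → ℤ → ℤ → ℤ → Mem
      mem-of xl xr yb yt = win B (xl , yb) , win B (xr , yb) , win B (xl , yt) , win B (xr , yt)

      private
        moved-down : ∀ {s F N v b v′} → Moved s F N v (v - + 1) b v′ → v - + 1 ≤ v′ × v′ ≤ v
        moved-down {v = v} (stays _ _) = (lin 1 (λ v → [] ⊢ v ⊖ κ 1 ≼ v) v) , ℤ.≤-refl
        moved-down {v = v} (moves _)   = ℤ.≤-refl , (lin 1 (λ v → [] ⊢ v ⊖ κ 1 ≼ v) v)
        moved-up : ∀ {s F N v b v′} → Moved s F N v (v + + 1) b v′ → v ≤ v′ × v′ ≤ v + + 1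
        moved-up {v = v} (stays _ _) = ℤ.≤-refl , (lin 1 (λ v → [] ⊢ v ≼ v ⊕ κ 1) v)
        moved-up {v = v} (moves _)   = (lin 1 (λ v → [] ⊢ v ≼ v ⊕ κ 1) v) , ℤ.≤-refl

      cycle-time : ℕ
      cycle-time = 4 ℕ.* (8 ℕ.+ (D ℕ.+ D)) ℕ.+ 4 ℕ.* (1 ℕ.+ D)

      -- Each side is judged in the frame left by its predecessors, hence the mixture of old and new
      -- coordinates. In a cycle without moves they coincide, and all four sides are free at the
      -- same time.
      cycle-run : ∀ {xl xr yb yt f s v Q} → Rect 6 xl xr yb yt → Overlay f B (corners-of xl xr yb yt) →
        (∀ {b₁ b₂ b₃ b₄ xl′ xr′ yb′ yt′ f′} →
          Moved s (RowFree B xl xr yb) (Y⁻ ≤ yb + + 1) yb (yb - + 1) b₁ yb′ →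
          Moved s (ColFree B xl yb′ yt) (X⁻ ≤ xl + + 1) xl (xl - + 1) b₂ xl′ →
          Moved s (ColFree B xr yb′ yt) (xr ≤ X⁺) xr (xr + + 1) b₃ xr′ →
          Moved s (RowFree B xl′ xr′ yt) (yt ≤ Y⁺) yt (yt + + 1) b₄ yt′ →
          Overlay f′ B (corners-of xl′ xr′ yb′ yt′) →
          Q (s , (((v ∨ b₁) ∨ b₂) ∨ b₃) ∨ b₄ , mem-of xl′ xr′ yb′ yt′) (xl′ , yb′) f′) →
        Run cycle (s , v , mem-of xl xr yb yt) cycle-time (xl , yb) f Q
      cycle-run {xl} {xr} {yb} {yt} R ov k =
        wp-mono (linℕ 1 (λ D → [] ⊢ κ 8 ⊕ (D ⊕ D) ⊕ (κ 8 ⊕ (D ⊕ D) ⊕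
            (κ 1 ⊕ D ⊕ (κ 8 ⊕ (D ⊕ D) ⊕ (κ 1 ⊕ D ⊕ (κ 1 ⊕ D ⊕ (κ 8 ⊕ (D ⊕ D) ⊕ (κ 1 ⊕ D))))))) ≼ κ 8 ⊕ (D ⊕ D) ⊕
            (κ 8 ⊕ (D ⊕ D) ⊕ (κ 8 ⊕ (D ⊕ D) ⊕ (κ 8 ⊕ (D ⊕ D) ⊕ κ 0))) ⊕ (κ 1 ⊕ D ⊕ (κ 1 ⊕ D ⊕ (κ 1 ⊕ D ⊕ (κ 1 ⊕ D ⊕ κ 0))))) D) $
        wp-⟫ $ wp-map $ wp-pre $ wp-carry $ bottom-run (R₀ R) ov λ m₁ ov₁ →
        wp-⟫ $ wp-map $ wp-pre $ wp-carry $ left-run (R₁ R m₁) ov₁ λ m₂ ov₂ →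
        wp-⟫ $ walk-right (R₂ R m₁ m₂) ov₂ $
        wp-⟫ $ wp-map $ wp-pre $ wp-carry $ right-run (R₂ R m₁ m₂) ov₂ λ m₃ ov₃ →
        wp-⟫ $ walk-left (R₃ R m₁ m₂ m₃) ov₃ $
        wp-⟫ $ walk-up (R₃ R m₁ m₂ m₃) ov₃ $
        wp-⟫ $ wp-map $ wp-pre $ wp-carry $ top-run (R₃ R m₁ m₂ m₃) ov₃ λ m₄ ov₄ →
        walk-down (R₄ R m₁ m₂ m₃ m₄) ov₄ $ k m₁ m₂ m₃ m₄ ov₄
        where
          R₀ : ∀ {xl xr yb yt} → Rect 6 xl xr yb yt → Rect 7 xl xr yb yt
          R₀ = rect-mono (ℕ.n≤1+n 6)
          widen : ∀ {xl xr yb yt xl′ xr′ yb′ yt′} → Rect 6 xl xr yb yt → xl - + 1 ≤ xl′ × xl′ ≤ xl → xr ≤ xr′ × xr′ ≤ xr + + 1 →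
            yb - + 1 ≤ yb′ × yb′ ≤ yb → yt ≤ yt′ × yt′ ≤ yt + + 1 → Rect 7 xl′ xr′ yb′ yt′
          widen {xl} {xr} {yb} {yt} {xl′} {xr′} {yb′} {yt′} R (a , a′) (b , b′) (c , c′) (d , d′) = record
            { gapx = lin 4 (λ xl xr x z → (xl ⊕ κ 2 ≼ xr) ∷ (x ≼ xl) ∷ (xr ≼ z) ∷ [] ⊢ x ⊕ κ 2 ≼ z) xl xr xl′ xr′ gapx a′ b
            ; gapy = lin 4 (λ xl xr x z → (xl ⊕ κ 2 ≼ xr) ∷ (x ≼ xl) ∷ (xr ≼ z) ∷ [] ⊢ x ⊕ κ 2 ≼ z) yb yt yb′ yt′ gapy c′ d
            ; lx = lin 3 (λ X⁻ xl x → (X⁻ ⊖ κ 6 ≼ xl) ∷ (xl ⊖ κ 1 ≼ x) ∷ [] ⊢ X⁻ ⊖ κ 7 ≼ x) X⁻ xl xl′ lx a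
            ; ux = lin 3 (λ X⁺ xr x → (xr ≼ X⁺ ⊕ κ 6) ∷ (x ≼ xr ⊕ κ 1) ∷ [] ⊢ x ≼ X⁺ ⊕ κ 7) X⁺ xr xr′ ux b′
            ; ly = lin 3 (λ X⁻ xl x → (X⁻ ⊖ κ 6 ≼ xl) ∷ (xl ⊖ κ 1 ≼ x) ∷ [] ⊢ X⁻ ⊖ κ 7 ≼ x) Y⁻ yb yb′ ly c
            ; uy = lin 3 (λ X⁺ xr x → (xr ≼ X⁺ ⊕ κ 6) ∷ (x ≼ xr ⊕ κ 1) ∷ [] ⊢ x ≼ X⁺ ⊕ κ 7) Y⁺ yt yt′ uy d′ }
            where open Rect R
          still↓ : ∀ v → v - + 1 ≤ v × v ≤ v
          still↓ v = (lin 1 (λ v → [] ⊢ v ⊖ κ 1 ≼ v) v) , ℤ.≤-refl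
          still↑ : ∀ v → v ≤ v × v ≤ v + + 1
          still↑ v = ℤ.≤-refl , (lin 1 (λ v → [] ⊢ v ≼ v ⊕ κ 1) v)
          R₁ : ∀ {xl xr yb yt s F N b yb′} → Rect 6 xl xr yb yt → Moved s F N yb (yb - + 1) b yb′ → Rect 7 xl xr yb′ yt
          R₁ R m₁ = widen R (still↓ _) (still↑ _) (moved-down m₁) (still↑ _)
          R₂ : ∀ {xl xr yb yt s F N b yb′ F′ N′ b′ xl′} → Rect 6 xl xr yb yt → Moved s F N yb (yb - + 1) b yb′ → Moved s F′ N′ xl (xl - + 1) b′ xl′ →
              Rect 7 xl′ xr yb′ yt
          R₂ R m₁ m₂ = widen R (moved-down m₂) (still↑ _) (moved-down m₁) (still↑ _)
          R₃ : ∀ {xl xr yb yt s F N b yb′ F′ N′ b′ xl′ F″ N″ b″ xr′} → Rect 6 xl xr yb yt → Moved s F N yb (yb - + 1) b yb′ →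
            Moved s F′ N′ xl (xl - + 1) b′ xl′ → Moved s F″ N″ xr (xr + + 1) b″ xr′ → Rect 7 xl′ xr′ yb′ yt
          R₃ R m₁ m₂ m₃ = widen R (moved-down m₂) (moved-up m₃) (moved-down m₁) (still↑ _)
          R₄ : ∀ {xl xr yb yt s F N b yb′ F′ N′ b′ xl′ F″ N″ b″ xr′ F‴ N‴ b‴ yt′} → Rect 6 xl xr yb yt → Moved s F N yb (yb - + 1) b yb′ →
            Moved s F′ N′ xl (xl - + 1) b′ xl′ → Moved s F″ N″ xr (xr + + 1) b″ xr′ → Moved s F‴ N‴ yt (yt + + 1) b‴ yt′ → Rect 7 xl′ xr′ yb′ yt′
          R₄ R m₁ m₂ m₃ m₄ = widen R (moved-down m₂) (moved-up m₃) (moved-down m₁) (moved-up m₄)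

      place-run : ∀ {X : Set} {F : Finite X} {x : X} {q f rs Q} → Anchor q → Overlay f B rs → (∀ {r} → r ∈ rs → Far q r) →
        (∀ {f′} → Overlay f′ B (q ∷ rs) → Q (x , win B q) q f′) → Run (place ⦃ F ⦄) x 1 q f Q
      place-run {x = x} a ov far k = run-op a (cong (λ w → (x , w) , just peb , nothing) (read-win ov far)) (k (place-peb ov far))

      record Framed (xl xr yb yt : ℤ) : Set where
        field
          lx₁ : xl + + 3 ≤ X⁻
          lx₂ : X⁻ - + 4 ≤ xl
          ux₁ : X⁺ + + 3 ≤ xr
          ux₂ : xr ≤ X⁺ + + 3
          ly₁ : yb + + 3 ≤ Y⁻
          ly₂ : Y⁻ - + 4 ≤ yb
          uy₁ : Y⁺ + + 3 ≤ yt
          uy₂ : yt ≤ Y⁺ + + 3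

      -- Growth of the frame from the start until it encloses the polyomino.

      module Enclosing (a b : ℤ) (tile : B (a , b) ≡ true)
        (enclosed : ∀ {xl xr yb yt} → xl + + 1 ≤ a → a + + 1 ≤ xr → yb + + 1 ≤ b → b + + 1 ≤ yt →
          RowFree B xl xr yb → RowFree B xl xr yt → ColFree B xl yb yt → ColFree B xr yb yt →
          (xl + + 1 ≤ X⁻ × X⁺ + + 1 ≤ xr) × (yb + + 1 ≤ Y⁻ × Y⁺ + + 1 ≤ yt)) where

        private
          a⁻ : X⁻ ≤ a
          a⁻ = proj₁ (proj₁ (bounded tile))
          a⁺ : a ≤ X⁺
          a⁺ = proj₂ (proj₁ (bounded tile))
          b⁻ : Y⁻ ≤ b
          b⁻ = proj₁ (proj₂ (bounded tile))
          b⁺ : b ≤ Y⁺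
          b⁺ = proj₂ (proj₂ (bounded tile))

        -- Sides move only near tiles: on the left and below, where windows reach ahead towards the
        -- box, they get at most two pixels beyond it, on the right and above at most one.
        record Tight (xl xr yb yt : ℤ) : Set where
          field
            il : xl + + 1 ≤ a
            ir : a + + 1 ≤ xr
            ib : yb + + 1 ≤ b
            it : b + + 1 ≤ yt
            lx : X⁻ - + 2 ≤ xl
            ux : xr ≤ X⁺ + + 1
            ly : Y⁻ - + 2 ≤ yb
            uy : yt ≤ Y⁺ + + 1

        tight-rect : ∀ {xl xr yb yt} → Tight xl xr yb yt → Rect 6 xl xr yb yt
        tight-rect {xl} {xr} {yb} {yt} T = record
          { gapx = lin 3 (λ xl xr a → (xl ⊕ κ 1 ≼ a) ∷ (a ⊕ κ 1 ≼ xr) ∷ [] ⊢ xl ⊕ κ 2 ≼ xr) xl xr a il ir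
          ; gapy = lin 3 (λ xl xr a → (xl ⊕ κ 1 ≼ a) ∷ (a ⊕ κ 1 ≼ xr) ∷ [] ⊢ xl ⊕ κ 2 ≼ xr) yb yt b ib it
          ; lx = lin 2 (λ X⁻ xl → (X⁻ ⊖ κ 2 ≼ xl) ∷ [] ⊢ X⁻ ⊖ κ 6 ≼ xl) X⁻ xl lx ; ux = lin 2 (λ X⁺ xr → (xr ≼ X⁺ ⊕ κ 1) ∷ [] ⊢ xr ≼ X⁺ ⊕ κ 6) X⁺ xr
              ux
          ; ly = lin 2 (λ X⁻ xl → (X⁻ ⊖ κ 2 ≼ xl) ∷ [] ⊢ X⁻ ⊖ κ 6 ≼ xl) Y⁻ yb ly ; uy = lin 2 (λ X⁺ xr → (xr ≼ X⁺ ⊕ κ 1) ∷ [] ⊢ xr ≼ X⁺ ⊕ κ 6) Y⁺ yt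
              uy }
          where open Tight T

        private
          tight-down : ∀ {F Z v b v′} → Moved false F (Z ≤ v + + 1) v (v - + 1) b v′ → Z - + 2 ≤ v → Z - + 2 ≤ v′
          tight-down (stays _ _) h = h
          tight-down {Z = Z} {v} (moves (inj₂ n)) h = lin 2 (λ Z v → (Z ≼ v ⊕ κ 1) ∷ [] ⊢ Z ⊖ κ 2 ≼ v ⊖ κ 1) Z v n
          tight-up : ∀ {F Z v b v′} → Moved false F (v ≤ Z) v (v + + 1) b v′ → v ≤ Z + + 1 → v′ ≤ Z + + 1
          tight-up (stays _ _) h = h
          tight-up {Z = Z} {v} (moves (inj₂ n)) h = lin 2 (λ Z v → (v ≼ Z) ∷ [] ⊢ v ⊕ κ 1 ≼ Z ⊕ κ 1) Z v n

          -- Half the perimeter. Each cycle that moves a side increases it, and by `Tight` it is at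
          -- most `(X⁺ - X⁻) + (Y⁺ - Y⁻) + 6`, with 3 for either dimension; this bounds the number
          -- of cycles.
          perimeter : ℤ → ℤ → ℤ → ℤ → ℤ
          perimeter xl xr yb yt = (xr - xl) + (yt - yb)

          change : ∀ {xl xr yb yt b₁ b₂ b₃ b₄ xl′ xr′ yb′ yt′ F₁ N₁ F₂ N₂ F₃ N₃ F₄ N₄} →
            Moved false F₁ N₁ yb (yb - + 1) b₁ yb′ → Moved false F₂ N₂ xl (xl - + 1) b₂ xl′ →
            Moved false F₃ N₃ xr (xr + + 1) b₃ xr′ → Moved false F₄ N₄ yt (yt + + 1) b₄ yt′ →
            let c = (((false ∨ b₁) ∨ b₂) ∨ b₃) ∨ b₄ in
            (c ≡ false × ((xl ≡ xl′ × xr ≡ xr′) × (yb ≡ yb′ × yt ≡ yt′)) × ((F₁ × F₂) × (F₃ × F₄))) ⊎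
            (c ≡ true × perimeter xl xr yb yt + + 1 ≤ perimeter xl′ xr′ yb′ yt′)
          change (stays _ f₁) (stays _ f₂) (stays _ f₃) (stays _ f₄) = inj₁ (refl , ((refl , refl) , (refl , refl)) , ((f₁ , f₂) , (f₃ , f₄)))
          change {xl} {xr} {yb} {yt} {xl′ = l} {r} {yt′ = t} (moves _) m₂ m₃ m₄ = inj₂
              (refl , lin 7 (λ xl xr yb yt l r t → (l ≼ xl) ∷ (xr ≼ r) ∷ (yt ≼ t) ∷ [] ⊢ (xr ⊖ xl) ⊕ (yt ⊖ yb) ⊕ κ 1 ≼ (r ⊖ l) ⊕ (t ⊖ (yb ⊖ κ 1))) xl
              xr yb yt l r t
            (proj₂ (moved-down m₂)) (proj₁ (moved-up m₃)) (proj₁ (moved-up m₄)))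
          change {xl} {xr} {yb} {yt} {xl′ = l} {r} {yt′ = t} (stays _ _) (moves _) m₃ m₄ = inj₂
              (refl , lin 6 (λ xl xr yb yt r t → (xr ≼ r) ∷ (yt ≼ t) ∷ [] ⊢ (xr ⊖ xl) ⊕ (yt ⊖ yb) ⊕ κ 1 ≼ (r ⊖ (xl ⊖ κ 1)) ⊕ (t ⊖ yb)) xl xr yb yt r t
            (proj₁ (moved-up m₃)) (proj₁ (moved-up m₄)))
          change {xl} {xr} {yb} {yt} {xl′ = l} {r} {yt′ = t} (stays _ _) (stays _ _) (moves _) m₄ = inj₂
              (refl , lin 5 (λ xl xr yb yt t → (yt ≼ t) ∷ [] ⊢ (xr ⊖ xl) ⊕ (yt ⊖ yb) ⊕ κ 1 ≼ ((xr ⊕ κ 1) ⊖ xl) ⊕ (t ⊖ yb)) xl xr yb yt t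
            (proj₁ (moved-up m₄)))
          change {xl} {xr} {yb} {yt} (stays _ _) (stays _ _) (stays _ _) (moves _) = inj₂
              (refl , lin 4 (λ xl xr yb yt → [] ⊢ (xr ⊖ xl) ⊕ (yt ⊖ yb) ⊕ κ 1 ≼ (xr ⊖ xl) ⊕ ((yt ⊕ κ 1) ⊖ yb)) xl xr yb yt)

        grow-run : ∀ φ {xl xr yb yt f Q} → Tight xl xr yb yt → (X⁺ - X⁻) + (Y⁺ - Y⁻) + + 6 ≤ perimeter xl xr yb yt + + φ →
          Overlay f B (corners-of xl xr yb yt) →
          (∀ {xl xr yb yt f} → Tight xl xr yb yt → RowFree B xl xr yb → RowFree B xl xr yt → ColFree B xl yb yt → ColFree B xr yb yt →
            Overlay f B (corners-of xl xr yb yt) → Q (mem-of xl xr yb yt) (xl , yb) f) →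
          Run grow (mem-of xl xr yb yt) (suc φ ℕ.* cycle-time) (xl , yb) f Q
        grow-run φ {xl} {xr} {yb} {yt} {f} {Q} T fuel ov k = wp-loop $ wp-pre $ wp-map $ cycle-run (tight-rect T) ov
          λ {b₁} {b₂} {b₃} {b₄} m₁ m₂ m₃ m₄ ov′ → next ((((false ∨ b₁) ∨ b₂) ∨ b₃) ∨ b₄) refl φ fuel (tighter m₁ m₂ m₃ m₄) (change m₁ m₂ m₃ m₄) ov′
          where
            open Tight T
            tighter : ∀ {xl′ xr′ yb′ yt′ b₁ b₂ b₃ b₄ F₁ F₂ F₃ F₄} →
              Moved false F₁ (Y⁻ ≤ yb + + 1) yb (yb - + 1) b₁ yb′ → Moved false F₂ (X⁻ ≤ xl + + 1) xl (xl - + 1) b₂ xl′ →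
              Moved false F₃ (xr ≤ X⁺) xr (xr + + 1) b₃ xr′ → Moved false F₄ (yt ≤ Y⁺) yt (yt + + 1) b₄ yt′ → Tight xl′ xr′ yb′ yt′
            tighter {xl′} {xr′} {yb′} {yt′} m₁ m₂ m₃ m₄ = record
              { il = lin 3 (λ xl x a → (xl ⊕ κ 1 ≼ a) ∷ (x ≼ xl) ∷ [] ⊢ x ⊕ κ 1 ≼ a) xl xl′ a il (proj₂ (moved-down m₂))
              ; ir = ℤ.≤-trans ir (proj₁ (moved-up m₃))
              ; ib = lin 3 (λ xl x a → (xl ⊕ κ 1 ≼ a) ∷ (x ≼ xl) ∷ [] ⊢ x ⊕ κ 1 ≼ a) yb yb′ b ib (proj₂ (moved-down m₁))
              ; it = ℤ.≤-trans it (proj₁ (moved-up m₄))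
              ; lx = tight-down m₂ lx ; ux = tight-up m₃ ux ; ly = tight-down m₁ ly ; uy = tight-up m₄ uy }
            -- The flag is generalised to a variable `c`, so that the conditional of `growStep`
            -- reduces by matching on it.
            next : ∀ {xl′ xr′ yb′ yt′ f′} c {c′} → c ≡ c′ → ∀ φ → (X⁺ - X⁻) + (Y⁺ - Y⁻) + + 6 ≤ perimeter xl xr yb yt + + φ → Tight xl′ xr′ yb′ yt′ →
              (c′ ≡ false × ((xl ≡ xl′ × xr ≡ xr′) × (yb ≡ yb′ × yt ≡ yt′)) ×
                  ((RowFree B xl xr yb × ColFree B xl yb′ yt) × (ColFree B xr yb′ yt × RowFree B xl′ xr′ yt))) ⊎
                (c′ ≡ true × perimeter xl xr yb yt + + 1 ≤ perimeter xl′ xr′ yb′ yt′) →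
              Overlay f′ B (corners-of xl′ xr′ yb′ yt′) →
              Again {p = growStep} (φ ℕ.* cycle-time) Q (if c then inj₁ (mem-of xl′ xr′ yb′ yt′) else inj₂ (mem-of xl′ xr′ yb′ yt′)) (xl′ , yb′) f′
            next false refl φ fuel T′ (inj₁ (_ , ((refl , refl) , (refl , refl)) , ((f₁ , f₂) , (f₃ , f₄)))) ov′ = k T′ f₁ f₄ f₂ f₃ ov′
            next {xl′} {xr′} {yb′} {yt′} true refl (suc φ) fuel T′ (inj₂ (_ , h)) ov′ = grow-run φ T′
              (lin 4 (λ w p p′ φ → (κ 0 ≼ φ) ∷ (w ⊕ κ 6 ≼ p ⊕ (κ 1 ⊕ φ)) ∷ (p ⊕ κ 1 ≼ p′) ∷ [] ⊢ w ⊕ κ 6 ≼ p′ ⊕ φ) ((X⁺ - X⁻) + (Y⁺ - Y⁻))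
                  (perimeter xl xr yb yt) (perimeter xl′ xr′ yb′ yt′) (+ φ) (0≤+ φ) fuel h) ov′ k
            next {xl′} {xr′} {yb′} {yt′} true refl zero fuel T′ (inj₂ (_ , h)) ov′ = ⊥-elim
                (1≰0 (lin 9 (λ X⁻ X⁺ Y⁻ Y⁺ p l r b t → ((X⁺ ⊖ X⁻) ⊕ (Y⁺ ⊖ Y⁻) ⊕ κ 6 ≼ p ⊕ κ 0) ∷ (p ⊕ κ 1 ≼ (r ⊖ l) ⊕ (t ⊖ b)) ∷ (X⁻ ⊖ κ 2 ≼ l) ∷
                (r ≼ X⁺ ⊕ κ 1) ∷ (Y⁻ ⊖ κ 2 ≼ b) ∷ (t ≼ Y⁺ ⊕ κ 1) ∷ [] ⊢ κ 1 ≼ κ 0) X⁻ X⁺ Y⁻ Y⁺ (perimeter xl xr yb yt) xl′ xr′ yb′ yt′ fuel h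
                (T′ .Tight.lx) (T′ .Tight.ux) (T′ .Tight.ly) (T′ .Tight.uy)))

        forced-run : ∀ {xl xr yb yt f Q} → Rect 6 xl xr yb yt → Overlay f B (corners-of xl xr yb yt) →
          (∀ {f} → Overlay f B (corners-of (xl - + 1) (xr + + 1) (yb - + 1) (yt + + 1)) →
            Q (mem-of (xl - + 1) (xr + + 1) (yb - + 1) (yt + + 1)) (xl - + 1 , yb - + 1) f) →
          Run forced (mem-of xl xr yb yt) cycle-time (xl , yb) f Q
        forced-run {xl} {xr} {yb} {yt} {f} {Q} R ov k = wp-pre $ wp-map $ cycle-run R ov
          λ m₁ m₂ m₃ m₄ ov′ → done (forced-to m₂) (forced-to m₃) (forced-to m₁) (forced-to m₄) ov′
          where
            forced-to : ∀ {F N v w b v′} → Moved true F N v w b v′ → v′ ≡ w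
            forced-to (moves _) = refl
            done : ∀ {xl′ xr′ yb′ yt′ f} → xl′ ≡ xl - + 1 → xr′ ≡ xr + + 1 → yb′ ≡ yb - + 1 → yt′ ≡ yt + + 1 →
              Overlay f B (corners-of xl′ xr′ yb′ yt′) → Q (mem-of xl′ xr′ yb′ yt′) (xl′ , yb′) f
            done refl refl refl refl o = k o

        private
          xl₀ xr₀ yb₀ yt₀ : ℤ
          xl₀ = a - + 1
          xr₀ = a - + 1 + + 2
          yb₀ = b - + 1
          yt₀ = b - + 1 + + 2

        tight₀ : Tight xl₀ xr₀ yb₀ yt₀
        tight₀ = record
          { il = lin 1 (λ a → [] ⊢ a ⊖ κ 1 ⊕ κ 1 ≼ a) a ; ir = lin 1 (λ a → [] ⊢ a ⊕ κ 1 ≼ a ⊖ κ 1 ⊕ κ 2) a ; ib = lin 1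
              (λ a → [] ⊢ a ⊖ κ 1 ⊕ κ 1 ≼ a) b ; it = lin 1 (λ a → [] ⊢ a ⊕ κ 1 ≼ a ⊖ κ 1 ⊕ κ 2) b
          ; lx = lin 2 (λ a X⁻ → (X⁻ ≼ a) ∷ [] ⊢ X⁻ ⊖ κ 2 ≼ a ⊖ κ 1) a X⁻ a⁻ ; ux = lin 2 (λ a X⁺ → (a ≼ X⁺) ∷ [] ⊢ a ⊖ κ 1 ⊕ κ 2 ≼ X⁺ ⊕ κ 1) a X⁺ a⁺
          ; ly = lin 2 (λ a X⁻ → (X⁻ ≼ a) ∷ [] ⊢ X⁻ ⊖ κ 2 ≼ a ⊖ κ 1) b Y⁻ b⁻ ; uy = lin 2 (λ a X⁺ → (a ≼ X⁺) ∷ [] ⊢ a ⊖ κ 1 ⊕ κ 2 ≼ X⁺ ⊕ κ 1) b Y⁺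
              b⁺ }

        private
          near : ∀ {x y} → a - + 2 ≤ x → x ≤ a + + 2 → b - + 2 ≤ y → y ≤ b + + 2 → Anchor (x , y)
          near {x} {y} p q r s = big (lin 3 (λ X⁻ a x → (X⁻ ≼ a) ∷ (a ⊖ κ 2 ≼ x) ∷ [] ⊢ X⁻ ⊖ κ 8 ≼ x) X⁻ a x a⁻ p)
              (lin 3 (λ X⁺ a x → (a ≼ X⁺) ∷ (x ≼ a ⊕ κ 2) ∷ [] ⊢ x ≼ X⁺ ⊕ κ 8) X⁺ a x a⁺ q)
                                     (lin 3 (λ X⁻ a x → (X⁻ ≼ a) ∷ (a ⊖ κ 2 ≼ x) ∷ [] ⊢ X⁻ ⊖ κ 8 ≼ x) Y⁻ b y b⁻ r)
                                         (lin 3 (λ X⁺ a x → (a ≼ X⁺) ∷ (x ≼ a ⊕ κ 2) ∷ [] ⊢ x ≼ X⁺ ⊕ κ 8) Y⁺ b y b⁺ s)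

          lo : ∀ z → z - + 2 ≤ z - + 1
          lo z = lin 1 (λ z → [] ⊢ z ⊖ κ 2 ≼ z ⊖ κ 1) z
          lo′ : ∀ z → z - + 1 ≤ z + + 2
          lo′ z = lin 1 (λ z → [] ⊢ z ⊖ κ 1 ≼ z ⊕ κ 2) z
          hi : ∀ z → z - + 2 ≤ z - + 1 + + 2
          hi z = lin 1 (λ z → [] ⊢ z ⊖ κ 2 ≼ z ⊖ κ 1 ⊕ κ 2) z
          hi′ : ∀ z → z - + 1 + + 2 ≤ z + + 2
          hi′ z = lin 1 (λ z → [] ⊢ z ⊖ κ 1 ⊕ κ 2 ≼ z ⊕ κ 2) z

          out⁺ : ∀ z k → k ℕ.≤ 1 → (z - + 2 ≤ z - + 1 + + k) × (z - + 1 + + k ≤ z + + 2)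
          out⁺ z k h = (lin 2 (λ z k → (κ 0 ≼ k) ∷ [] ⊢ z ⊖ κ 2 ≼ z ⊖ κ 1 ⊕ k) z (+ k) (0≤+ k)) ,
              (lin 2 (λ z k → (κ 0 ≼ k) ∷ (k ≼ κ 1) ∷ [] ⊢ z ⊖ κ 1 ⊕ k ≼ z ⊕ κ 2) z (+ k) (0≤+ k) (ℤ.+≤+ h))
          out⁻ : ∀ z k → k ℕ.≤ 1 → (z - + 2 ≤ z - + 1 + + 2 - + k) × (z - + 1 + + 2 - + k ≤ z + + 2)
          out⁻ z k h = (lin 2 (λ z k → (κ 0 ≼ k) ∷ (k ≼ κ 1) ∷ [] ⊢ z ⊖ κ 2 ≼ z ⊖ κ 1 ⊕ κ 2 ⊖ k) z (+ k) (0≤+ k) (ℤ.+≤+ h)) ,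
              (lin 2 (λ z k → (κ 0 ≼ k) ∷ [] ⊢ z ⊖ κ 1 ⊕ κ 2 ⊖ k ≼ z ⊕ κ 2) z (+ k) (0≤+ k))
          back₂ : ∀ z → z - + 1 + + 2 - + 2 ≡ z - + 1
          back₂ z = lin 1 (λ z → [] ⊢ z ⊖ κ 1 ⊕ κ 2 ⊖ κ 2 ≐ z ⊖ κ 1) z

        bare : Overlay B B []
        bare = record { on = λ () ; off = λ _ _ → refl }

        corners-run : ∀ {Q} → (∀ {f} → Overlay f B (corners-of xl₀ xr₀ yb₀ yt₀) → Q (mem-of xl₀ xr₀ yb₀ yt₀) (xl₀ , yb₀) f) →
          Run corners tt 14 (a , b) B Q
        corners-run {Q} k =
          wp-⟫ {t₁ = 1} $ steps-run 0 (λ { zero _ → near (lin 1 (λ a → [] ⊢ a ⊖ κ 2 ≼ a ⊖ κ 0) a) (lin 1 (λ a → [] ⊢ a ⊖ κ 0 ≼ a ⊕ κ 2) a)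
              (lin 1 (λ b → [] ⊢ b ⊖ κ 2 ≼ b) b) (lin 1 (λ b → [] ⊢ b ≼ b ⊕ κ 2) b) }) $
          wp-⟫ {t₁ = 1} $ steps-run 0 (λ { zero _ → near (lo a) (lo′ a) (lin 1 (λ b → [] ⊢ b ⊖ κ 2 ≼ b ⊖ κ 0) b)
              (lin 1 (λ b → [] ⊢ b ⊖ κ 0 ≼ b ⊕ κ 2) b) }) $
          wp-⟫ {t₁ = 1} $ place-run (near (lo a) (lo′ a) (lo b) (lo′ b)) bare (λ ()) λ ov₁ →
          wp-⟫ {t₁ = 2} $ steps-run 1 (λ k le → near (proj₁ (out⁺ a k le)) (proj₂ (out⁺ a k le)) (lo b) (lo′ b)) $
          wp-⟫ {t₁ = 1} $ place-run (near (hi a) (hi′ a) (lo b) (lo′ b)) ov₁ (λ { (at₀ refl) → inj₁ (inj₂ ℤ.≤-refl) }) λ ov₂ →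
          wp-⟫ {t₁ = 2} $ steps-run 1 (λ k le → near (hi a) (hi′ a) (proj₁ (out⁺ b k le)) (proj₂ (out⁺ b k le))) $
          wp-⟫ {t₁ = 1} $ place-run (near (hi a) (hi′ a) (hi b) (hi′ b)) ov₂
              (λ { (at₀ refl) → inj₂ (inj₂ ℤ.≤-refl) ; (at₁ refl) → inj₂ (inj₂ ℤ.≤-refl) }) λ ov₃ →
          wp-⟫ {t₁ = 2} $ steps-run 1 (λ k le → near (proj₁ (out⁻ a k le)) (proj₂ (out⁻ a k le)) (hi b) (hi′ b)) $
          wp-at (cong (_, yt₀) (back₂ a)) $
          wp-⟫ {t₁ = 1} $ place-run (near (lo a) (lo′ a) (hi b) (hi′ b)) ov₃
            (λ { (at₀ refl) → inj₁ (inj₁ ℤ.≤-refl) ; (at₁ refl) → inj₁ (inj₁ ℤ.≤-refl) ; (at₂ refl) → inj₂ (inj₂ ℤ.≤-refl) }) λ {f₄} ov₄ →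
          wp-map $ steps-run 1 (λ k le → near (lo a) (lo′ a) (proj₁ (out⁻ b k le)) (proj₂ (out⁻ b k le))) $
          subst (λ z → Q (mem-of xl₀ xr₀ yb₀ yt₀) (xl₀ , z) f₄) (sym (back₂ b)) $
          k (corner← ov₄)

        enclose-time : ℕ
        enclose-time = 14 ℕ.+ (suc (D ℕ.+ D) ℕ.* cycle-time ℕ.+ (cycle-time ℕ.+ cycle-time))

        enclose-run : ∀ {Q} → (∀ {xl xr yb yt f} → Framed xl xr yb yt → Overlay f B (corners-of xl xr yb yt) → Q (mem-of xl xr yb yt) (xl , yb) f) →
          Run enclose tt enclose-time (a , b) B Q
        enclose-run k = wp-⟫ {t₁ = 14} $ corners-run λ ov →
          wp-⟫ $ grow-run (D ℕ.+ D) tight₀ fuel ov λ {xl} {xr} {yb} {yt} T fb ft fl fr ov →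
          wp-⟫ $ forced-run (tight-rect T) ov λ ov → forced-run (rect₁ T) ov λ ov → k
              (framed T (enclosed (T .Tight.il) (T .Tight.ir) (T .Tight.ib) (T .Tight.it) fb ft fl fr)) ov
          where
            fuel : (X⁺ - X⁻) + (Y⁺ - Y⁻) + + 6 ≤ perimeter xl₀ xr₀ yb₀ yt₀ + + (D ℕ.+ D)
            fuel = lin 7 (λ X⁻ X⁺ Y⁻ Y⁺ a b D → (κ 0 ≼ D) ∷ (X⁺ ⊖ X⁻ ⊕ κ 16 ≼ D) ∷ (Y⁺ ⊖ Y⁻ ⊕ κ 16 ≼ D) ∷ [] ⊢ (X⁺ ⊖ X⁻) ⊕ (Y⁺ ⊖ Y⁻) ⊕ κ 6 ≼
                ((a ⊖ κ 1 ⊕ κ 2) ⊖ (a ⊖ κ 1)) ⊕ ((b ⊖ κ 1 ⊕ κ 2) ⊖ (b ⊖ κ 1)) ⊕ (D ⊕ D)) X⁻ X⁺ Y⁻ Y⁺ a b (+ D) (0≤+ D) wide tall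
            rect₁ : ∀ {xl xr yb yt} → Tight xl xr yb yt → Rect 6 (xl - + 1) (xr + + 1) (yb - + 1) (yt + + 1)
            rect₁ {xl} {xr} {yb} {yt} T = record
              { gapx = lin 3 (λ xl xr a → (xl ⊕ κ 1 ≼ a) ∷ (a ⊕ κ 1 ≼ xr) ∷ [] ⊢ xl ⊖ κ 1 ⊕ κ 2 ≼ xr ⊕ κ 1) xl xr a il ir
              ; gapy = lin 3 (λ xl xr a → (xl ⊕ κ 1 ≼ a) ∷ (a ⊕ κ 1 ≼ xr) ∷ [] ⊢ xl ⊖ κ 1 ⊕ κ 2 ≼ xr ⊕ κ 1) yb yt b ib it
              ; lx = lin 2 (λ X⁻ xl → (X⁻ ⊖ κ 2 ≼ xl) ∷ [] ⊢ X⁻ ⊖ κ 6 ≼ xl ⊖ κ 1) X⁻ xl lx ; ux = lin 2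
                  (λ X⁺ xr → (xr ≼ X⁺ ⊕ κ 1) ∷ [] ⊢ xr ⊕ κ 1 ≼ X⁺ ⊕ κ 6) X⁺ xr ux
              ; ly = lin 2 (λ X⁻ xl → (X⁻ ⊖ κ 2 ≼ xl) ∷ [] ⊢ X⁻ ⊖ κ 6 ≼ xl ⊖ κ 1) Y⁻ yb ly ; uy = lin 2
                  (λ X⁺ xr → (xr ≼ X⁺ ⊕ κ 1) ∷ [] ⊢ xr ⊕ κ 1 ≼ X⁺ ⊕ κ 6) Y⁺ yt uy }
              where open Tight T
            framed : ∀ {xl xr yb yt} → Tight xl xr yb yt → (xl + + 1 ≤ X⁻ × X⁺ + + 1 ≤ xr) × (yb + + 1 ≤ Y⁻ × Y⁺ + + 1 ≤ yt) →
              Framed (xl - + 1 - + 1) (xr + + 1 + + 1) (yb - + 1 - + 1) (yt + + 1 + + 1)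
            framed {xl} {xr} {yb} {yt} T ((p , q) , (r , s)) = record
              { lx₁ = lin 2 (λ X⁻ xl → (xl ⊕ κ 1 ≼ X⁻) ∷ [] ⊢ xl ⊖ κ 1 ⊖ κ 1 ⊕ κ 3 ≼ X⁻) X⁻ xl p ; lx₂ = lin 2
                  (λ X⁻ xl → (X⁻ ⊖ κ 2 ≼ xl) ∷ [] ⊢ X⁻ ⊖ κ 4 ≼ xl ⊖ κ 1 ⊖ κ 1) X⁻ xl lx
              ; ux₁ = lin 2 (λ X⁺ xr → (X⁺ ⊕ κ 1 ≼ xr) ∷ [] ⊢ X⁺ ⊕ κ 3 ≼ xr ⊕ κ 1 ⊕ κ 1) X⁺ xr q ; ux₂ = lin 2
                  (λ X⁺ xr → (xr ≼ X⁺ ⊕ κ 1) ∷ [] ⊢ xr ⊕ κ 1 ⊕ κ 1 ≼ X⁺ ⊕ κ 3) X⁺ xr ux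
              ; ly₁ = lin 2 (λ X⁻ xl → (xl ⊕ κ 1 ≼ X⁻) ∷ [] ⊢ xl ⊖ κ 1 ⊖ κ 1 ⊕ κ 3 ≼ X⁻) Y⁻ yb r ; ly₂ = lin 2
                  (λ X⁻ xl → (X⁻ ⊖ κ 2 ≼ xl) ∷ [] ⊢ X⁻ ⊖ κ 4 ≼ xl ⊖ κ 1 ⊖ κ 1) Y⁻ yb ly
              ; uy₁ = lin 2 (λ X⁺ xr → (X⁺ ⊕ κ 1 ≼ xr) ∷ [] ⊢ X⁺ ⊕ κ 3 ≼ xr ⊕ κ 1 ⊕ κ 1) Y⁺ yt s ; uy₂ = lin 2
                  (λ X⁺ xr → (xr ≼ X⁺ ⊕ κ 1) ∷ [] ⊢ xr ⊕ κ 1 ⊕ κ 1 ≼ X⁺ ⊕ κ 3) Y⁺ yt uy }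
              where open Tight T

open Enclosure

-- Finding a leftmost tile, and erasing the input.

module Sweeping where

  open import Data.Integer using (_+_; _-_; _≤_)

  setBit₀ : Bool → Win → Win
  setBit₀ b (mkW _ c d e) = mkW b c d e

  poke-same : ∀ b q f → paint q (setBit₀ b (win f q)) f q ≡ b
  poke-same b q f = cong bit₀ (paint-win q (setBit₀ b (win f q)) f)

  poke-other : ∀ b q f {r} → r ≢ q → paint q (setBit₀ b (win f q)) f r ≡ f r
  poke-other b q f {r} ne with inWin? q r
  ... | no ¬i = paint-off (setBit₀ b (win f q)) f ¬i
  ... | yes i with inWin-cases i
  ...   | inj₁ e                  = ⊥-elim (ne e)
  ...   | inj₂ (inj₁ refl)        = cong bit₁ (paint-win q (setBit₀ b (win f q)) f)
  ...   | inj₂ (inj₂ (inj₁ refl)) = cong bit₂ (paint-win q (setBit₀ b (win f q)) f)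
  ...   | inj₂ (inj₂ (inj₂ refl)) = cong bit₃ (paint-win q (setBit₀ b (win f q)) f)

  findStep : ⊤ → Win → (⊤ ⊎ Bool) × Maybe Win × Maybe Dir
  findStep _ w = if isPeb w then (inj₂ false , nothing , nothing) else
                 if bit₀ w then (inj₂ true , nothing , nothing) else (inj₁ tt , nothing , just up)

  find : Prog ⊤ Bool
  find = loop (op findStep)

  -- Moves the left side of the frame to the right until it meets a tile, where it
  -- leaves a pebble.
  seekStep : Prog ⊤ (⊤ ⊎ Win)
  seekStep = steps up 1 ⟫ find ⟫ pre (λ s → branch (tt , s)) (choice
    (post (λ (_ , w) → inj₂ w) place)
    (post (λ _ → inj₁ tt) (pre (λ _ → up , right , blank , blank) shift)))

  seek : Prog ⊤ Win
  seek = loop seekStep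

  eraseStep : ⊤ → Win → (⊤ ⊎ ⊤) × Maybe Win × Maybe Dir
  eraseStep _ w = if isPeb w then (inj₂ tt , nothing , nothing) else (inj₁ tt , just (setBit₀ false w) , just up)

  erase : Prog ⊤ ⊤
  erase = loop (op eraseStep)

  wipe : Prog ⊤ ⊤
  wipe = op (λ _ _ → tt , just blank , nothing)

  -- A look two pixels to the right tells whether a further shift would bring the left pebbles too
  -- close to the right ones. The sweep may end there: by `X⁺ + 3 ≤ xr` the remaining columns hold
  -- no tiles of the polyomino.
  clearStep : Prog ⊤ (⊤ ⊎ ⊤)
  clearStep = steps up 1 ⟫ erase ⟫ steps right 1 ⟫ op (λ _ w → isPeb w , nothing , nothing) ⟫ steps left 1
    ⟫ pre (λ s → branch (tt , s)) (choice
        (op (λ _ _ → inj₂ tt , nothing , nothing))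
        (post (λ _ → inj₁ tt) (pre (λ _ → up , right , blank , blank) shift)))

  -- Erases column after column between the left and the right side of the frame,
  -- and finally the frame.
  clear : Prog ⊤ ⊤
  clear = loop clearStep ⟫ wipe ⟫ steps right 1 ⟫ wipe ⟫ walk down ⟫ wipe ⟫ steps left 1 ⟫ wipe

  cut : ℤ → Picture → Picture
  cut x B (u , w) with x ℤ.≤? u
  ... | yes _ = B (u , w)
  ... | no _  = false

  cut-≥ : ∀ {x u w} B → x ≤ u → cut x B (u , w) ≡ B (u , w)
  cut-≥ {x} {u} B h with x ℤ.≤? u
  ... | yes _ = refl
  ... | no ¬h = ⊥-elim (¬h h)

  cut-< : ∀ {x u w} B → u + + 1 ≤ x → cut x B (u , w) ≡ false
  cut-< {x} {u} B h with x ℤ.≤? u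
  ... | yes h′ = ⊥-elim (1≰0 (lin 2 (λ x u → (u ⊕ κ 1 ≼ x) ∷ (x ≼ u) ∷ [] ⊢ κ 1 ≼ κ 0) x u h h′))
  ... | no _  = refl

  ≤-or-> : ∀ x u → x ≤ u ⊎ u + + 1 ≤ x
  ≤-or-> x u with x ℤ.≤? u
  ... | yes h = inj₁ h
  ... | no ¬h = inj₂ (subst (_≤ x) (ℤ.+-comm (+ 1) u) (ℤ.i<j⇒suc[i]≤j (ℤ.≰⇒> ¬h)))

  cut-true : ∀ {x u w} B → cut x B (u , w) ≡ true → x ≤ u × B (u , w) ≡ true
  cut-true {x} {u} B e with x ℤ.≤? u
  ... | yes h = h , e

  -- Of the tiles of a pebble pattern one lies in the left column of the window, so
  -- cutting off columns on the left creates no such pattern.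
  cut-legal : ∀ x B {L} → Legal B L → Legal (cut x B) L
  cut-legal x B lg u w le with ≤-or-> x u
  ... | inj₁ h = trans (cong isPeb (win-ext {cut x B} {B} (u , w) (λ (s , t) ((i , _) , _) → cut-≥ B (ℤ.≤-trans h i)))) (lg u w le)
  ... | inj₂ h with isPeb (win (cut x B) (u , w)) in e
  ...   | false = refl
  ...   | true with trans (sym (cut-< {w = w + + 1} B h)) (cong bit₃ (isPeb⇒≡ (win (cut x B) (u , w)) e))
  ...     | ()

  record Sides (sur : Surroundings) : Set where
    constructor sides
    open Surroundings sur
    field
      xr yb yt : ℤ
      Y⁻≤Y⁺ : Y⁻ ≤ Y⁺
      ux₁ : X⁺ + + 3 ≤ xr
      ux₂ : xr ≤ X⁺ + + 3
      ly₁ : yb + + 3 ≤ Y⁻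
      ly₂ : Y⁻ - + 4 ≤ yb
      uy₁ : Y⁺ + + 3 ≤ yt
      uy₂ : yt ≤ Y⁺ + + 3

  module Columns (sur : Surroundings) (sid : Sides sur) where
    open Surroundings sur
    open Sides sid
    open Frames sur public

    -- Assumptions on the left part alone, since the copy begins at `xr + 3`.
    record Ground (B : Picture) : Set where
      field
        legal  : Legal B xr
        bounds : ∀ {x y} → x ≤ xr + + 2 → B (x , y) ≡ true → (X⁻ ≤ x × x ≤ X⁺) × (Y⁻ ≤ y × y ≤ Y⁺)

    tallness : ∃[ m ] yt ≡ yb + + m
    tallness = distance (lin 4 (λ yb Y⁻ Y⁺ yt → (yb ⊕ κ 3 ≼ Y⁻) ∷ (Y⁻ ≼ Y⁺) ∷ (Y⁺ ⊕ κ 3 ≼ yt) ∷ [] ⊢ yb ≼ yt) yb Y⁻ Y⁺ yt ly₁ Y⁻≤Y⁺ uy₁)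
    m : ℕ
    m = proj₁ tallness
    m≡ : yt ≡ yb + + m
    m≡ = proj₂ tallness
    m≤D : m ℕ.≤ D
    m≤D = height≤D m≡ (lin 2 (λ Y⁻ yb → (Y⁻ ⊖ κ 4 ≼ yb) ∷ [] ⊢ Y⁻ ⊖ κ 8 ≼ yb) Y⁻ yb ly₂)
        (lin 2 (λ Y⁺ yt → (yt ≼ Y⁺ ⊕ κ 3) ∷ [] ⊢ yt ≼ Y⁺ ⊕ κ 8) Y⁺ yt uy₂)
    6≤m : 6 ℕ.≤ m
    6≤m = ℤ.drop‿+≤+ (lin 5 (λ yb Y⁻ Y⁺ yt m → (κ 0 ≼ m) ∷ (yb ⊕ κ 3 ≼ Y⁻) ∷ (Y⁻ ≼ Y⁺) ∷ (Y⁺ ⊕ κ 3 ≼ yt) ∷ (yt ≐ yb ⊕ m) ∷ [] ⊢ κ 6 ≼ m) yb Y⁻ Y⁺ yt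
        (+ m) (0≤+ m) ly₁ Y⁻≤Y⁺ uy₁ m≡)

    tileless : ∀ {B x y} → Ground B → x ≤ xr + + 2 → y + + 1 ≤ Y⁻ ⊎ Y⁺ + + 1 ≤ y → B (x , y) ≡ false
    tileless {B} {x} {y} G h out with B (x , y) in e
    ... | false = refl
    ... | true with Ground.bounds G h e | out
    ...   | _ , (a , b) | inj₁ c = ⊥-elim (1≰0 (lin 2 (λ y z → (y ⊕ κ 1 ≼ z) ∷ (z ≼ y) ∷ [] ⊢ κ 1 ≼ κ 0) y Y⁻ c a))
    ...   | _ , (a , b) | inj₂ c = ⊥-elim (1≰0 (lin 2 (λ y z → (z ⊕ κ 1 ≼ y) ∷ (y ≼ z) ∷ [] ⊢ κ 1 ≼ κ 0) y Y⁺ c b))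

    blank-win : ∀ {B x y} → Ground B → x ≤ xr → y + + 2 ≤ Y⁻ ⊎ Y⁺ + + 1 ≤ y → blank ≡ win B (x , y)
    blank-win {B} {x} {y} G h out = sym (win-ext {B} {λ _ → false} (x , y) λ (u , w) ((_ , i) , (j , j′)) →
      tileless G (lin 3 (λ x u xr → (x ≼ xr) ∷ (u ≼ x ⊕ κ 1) ∷ [] ⊢ u ≼ xr ⊕ κ 2) x u xr h i) (shifted out j j′))
      where
        shifted : ∀ {w} → y + + 2 ≤ Y⁻ ⊎ Y⁺ + + 1 ≤ y → y ≤ w → w ≤ y + + 1 → w + + 1 ≤ Y⁻ ⊎ Y⁺ + + 1 ≤ w
        shifted {w} (inj₁ c) j j′ = inj₁ (lin 3 (λ y w Y⁻ → (y ⊕ κ 2 ≼ Y⁻) ∷ (w ≼ y ⊕ κ 1) ∷ [] ⊢ w ⊕ κ 1 ≼ Y⁻) y w Y⁻ c j′)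
        shifted {w} (inj₂ c) j j′ = inj₂ (ℤ.≤-trans c j)

    bottom-blank : ∀ {B x} → Ground B → x ≤ xr → blank ≡ win B (x , yb)
    bottom-blank G h = blank-win G h (inj₁ (lin 2 (λ yb Y⁻ → (yb ⊕ κ 3 ≼ Y⁻) ∷ [] ⊢ yb ⊕ κ 2 ≼ Y⁻) yb Y⁻ ly₁))

    top-blank : ∀ {B x} → Ground B → x ≤ xr → blank ≡ win B (x , yt)
    top-blank G h = blank-win G h (inj₂ (lin 2 (λ yt Y⁺ → (Y⁺ ⊕ κ 3 ≼ yt) ∷ [] ⊢ Y⁺ ⊕ κ 1 ≼ yt) yt Y⁺ uy₁))

    at-bottom : ∀ {x} → X⁻ - + 8 ≤ x → x ≤ X⁺ + + 8 → InMargin x yb 8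
    at-bottom a b = margin a b (lin 2 (λ Y⁻ yb → (Y⁻ ⊖ κ 4 ≼ yb) ∷ [] ⊢ Y⁻ ⊖ κ 8 ≼ yb) Y⁻ yb ly₂)
        (lin 3 (λ yb Y⁻ Y⁺ → (yb ⊕ κ 3 ≼ Y⁻) ∷ (Y⁻ ≼ Y⁺) ∷ [] ⊢ yb ≼ Y⁺ ⊕ κ 8) yb Y⁻ Y⁺ ly₁ Y⁻≤Y⁺)
    at-top : ∀ {x} → X⁻ - + 8 ≤ x → x ≤ X⁺ + + 8 → InMargin x yt 8
    at-top a b = margin a b (lin 3 (λ yt Y⁻ Y⁺ → (Y⁺ ⊕ κ 3 ≼ yt) ∷ (Y⁻ ≼ Y⁺) ∷ [] ⊢ Y⁻ ⊖ κ 8 ≼ yt) yt Y⁻ Y⁺ uy₁ Y⁻≤Y⁺)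
        (lin 2 (λ Y⁺ yt → (yt ≼ Y⁺ ⊕ κ 3) ∷ [] ⊢ yt ≼ Y⁺ ⊕ κ 8) Y⁺ yt uy₂)

    rights : List Pixel
    rights = (xr , yb) ∷ (xr , yt) ∷ []

    x≤⁺ : ∀ {x} → x + + 2 ≤ xr → x ≤ X⁺ + + 8
    x≤⁺ {x} h = lin 3 (λ x xr X⁺ → (x ⊕ κ 2 ≼ xr) ∷ (xr ≼ X⁺ ⊕ κ 3) ∷ [] ⊢ x ≼ X⁺ ⊕ κ 8) x xr X⁺ h ux₂

    colLine : ∀ {B x} → Ground B → X⁻ - + 8 ≤ x → x + + 2 ≤ xr → Line B up right m (x , yb) rights
    colLine {B} {x} G h h′ = vLine up-right m≡ (lin 4 (λ yb Y⁻ Y⁺ yt → (yb ⊕ κ 3 ≼ Y⁻) ∷ (Y⁻ ≼ Y⁺) ∷ (Y⁺ ⊕ κ 3 ≼ yt) ∷ [] ⊢ yb ⊕ κ 2 ≼ yt) yb Y⁻ Y⁺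
        yt ly₁ Y⁻≤Y⁺ uy₁)
      (at-bottom h (x≤⁺ h′)) (at-top h (x≤⁺ h′)) (Ground.legal G) (lin 2 (λ x xr → (x ⊕ κ 2 ≼ xr) ∷ [] ⊢ x ≼ xr) x xr h′)
      (λ { (here refl) → inj₂ h′ ; (there (here refl)) → inj₂ h′ })

    shift-col : ∀ {B x f Q} → Ground B → X⁻ - + 8 ≤ x → x + + 3 ≤ xr → Overlay f B ((x , yt) ∷ (x , yb) ∷ rights) →
      (∀ {w f′} → Overlay f′ B ((x + + 1 , yt) ∷ (x + + 1 , yb) ∷ rights) → Q w (x + + 1 , yb) f′) →
      Run shift (up , right , blank , blank) (6 ℕ.+ D) (x , yt) f Q
    shift-col {B} {x} {f} {Q} G h h′ ov k = wp-mono (ℕ.+-monoʳ-≤ 6 m≤D) $ wp-at (cong (x ,_) m≡) $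
      shift-run (colLine G h h₂) (vTarget refl refl m≡ (at-bottom h₁ (x≤⁺ h₃)) (at-top h₁ (x≤⁺ h₃))
          (λ { (here refl) → inj₂ h₃ ; (there (here refl)) → inj₂ h₃ }))
        (subst (λ z → Overlay f B ((x , z) ∷ (x , yb) ∷ rights)) m≡ ov)
        (bottom-blank G x≤) (trans (top-blank G x≤) (cong (λ z → win B (x , z)) m≡))
        (λ {f′} o′ → k (subst (λ z → Overlay f′ B ((x + + 1 , z) ∷ (x + + 1 , yb) ∷ rights)) (sym m≡) o′))
      where
        h₁ : X⁻ - + 8 ≤ x + + 1
        h₁ = lin 2 (λ X⁻ x → (X⁻ ⊖ κ 8 ≼ x) ∷ [] ⊢ X⁻ ⊖ κ 8 ≼ x ⊕ κ 1) X⁻ x h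
        h₂ : x + + 2 ≤ xr
        h₂ = lin 2 (λ x xr → (x ⊕ κ 3 ≼ xr) ∷ [] ⊢ x ⊕ κ 2 ≼ xr) x xr h′
        h₃ : x + + 1 + + 2 ≤ xr
        h₃ = lin 2 (λ x xr → (x ⊕ κ 3 ≼ xr) ∷ [] ⊢ x ⊕ κ 1 ⊕ κ 2 ≼ xr) x xr h′
        x≤ : x ≤ xr
        x≤ = lin 2 (λ x xr → (x ⊕ κ 3 ≼ xr) ∷ [] ⊢ x ≼ xr) x xr h′

    between-eq : ∀ {B x f} → x + + 2 ≤ xr → Overlay f B ((x , yt) ∷ (x , yb) ∷ rights) → ∀ k → 2 ℕ.≤ k → k ℕ.< m → f (x , yb + + k) ≡ B (x , yb + + k)
    between-eq {B} {x} h ov k le lt = ov .off (x , yb + + k) λ where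
      (here refl) (_ , (i , _)) → 1≰0 (lin 4 (λ yb yt k m → (κ 0 ≼ k) ∷ (κ 0 ≼ m) ∷ (yt ≐ yb ⊕ m) ∷ (κ 1 ⊕ k ≼ m) ∷ (yt ≼ yb ⊕ k) ∷ [] ⊢ κ 1 ≼ κ 0)
          yb yt (+ k) (+ m) (0≤+ k) (0≤+ m) m≡ (ℤ.+≤+ lt) i)
      (there (here refl)) (_ , (_ , i)) → 1≰0 (lin 2 (λ yb k → (κ 0 ≼ k) ∷ (κ 2 ≼ k) ∷ (yb ⊕ k ≼ yb ⊕ κ 1) ∷ [] ⊢ κ 1 ≼ κ 0) yb (+ k) (0≤+ k)
          (ℤ.+≤+ le) i)
      (there (there (here refl))) ((i , _) , _) → 1≰0 (lin 2 (λ x xr → (x ⊕ κ 2 ≼ xr) ∷ (xr ≼ x) ∷ [] ⊢ κ 1 ≼ κ 0) x xr h i)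
      (there (there (there (here refl)))) ((i , _) , _) → 1≰0 (lin 2 (λ x xr → (x ⊕ κ 2 ≼ xr) ∷ (xr ≼ x) ∷ [] ⊢ κ 1 ≼ κ 0) x xr h i)

    find-run : ∀ n {q f Q} → (∀ k → k ℕ.< n → Anchor (adv up k q) × isPeb (win f (adv up k q)) ≡ false) →
      Anchor (adv up n q) → win f (adv up n q) ≡ peb →
      ((∀ k → k ℕ.< n → f (adv up k q) ≡ false) → Q false (adv up n q) f) →
      (∀ k → k ℕ.< n → f (adv up k q) ≡ true → Q true (adv up k q) f) →
      Run find tt (suc n) q f Q
    find-run zero {q} {f} {Q} h a e none some = wp-loop {t₁ = 1} {t₂ = 0} $
      run-op (subst Anchor (adv-zero up q) a) (cong (findStep tt) (trans (cong (win f) (sym (adv-zero up q))) e))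
        (subst (λ z → Q false z f) (adv-zero up q) (none λ k ()))
    find-run (suc n) {q} {f} {Q} h a e none some = wp-loop {t₁ = 1} {t₂ = suc n} (look (f q) refl)
      where
        a₀ : Anchor q
        a₀ = subst Anchor (adv-zero up q) (proj₁ (h 0 (ℕ.s≤s ℕ.z≤n)))
        not-peb : isPeb (win f q) ≡ false
        not-peb = trans (cong (isPeb ∘ win f) (sym (adv-zero up q))) (proj₂ (h 0 (ℕ.s≤s ℕ.z≤n)))
        decide-step : ∀ c → f q ≡ c → findStep tt (win f q) ≡ (if c then (inj₂ true , nothing , nothing) else (inj₁ tt , nothing , just up))
        decide-step c e = cong₂ (λ p c → if p then (inj₂ false , nothing , nothing) else if c then (inj₂ true , nothing , nothing) else
            (inj₁ tt , nothing , just up)) not-peb e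
        look : ∀ c → f q ≡ c → Run (op findStep) tt 1 q f (Again {p = op findStep} (suc n) Q)
        look true  e′ = run-op a₀ (decide-step true e′) (subst (λ z → Q true z f) (adv-zero up q)
            (some 0 (ℕ.s≤s ℕ.z≤n) (trans (cong f (adv-zero up q)) e′)))
        look false e′ = run-op a₀ (decide-step false e′) (find-run n
          (λ j lt → subst (λ z → Anchor z × isPeb (win f z) ≡ false) (sym (adv-move up j q)) (h (suc j) (ℕ.s≤s lt)))
          (subst Anchor (sym (adv-move up n q)) a) (trans (cong (win f) (adv-move up n q)) e)
          (λ g → subst (λ z → Q false z f) (sym (adv-move up n q))
              (none λ { zero _ → trans (cong f (adv-zero up q)) e′ ; (suc k) (ℕ.s≤s lt) → trans (cong f (sym (adv-move up k q))) (g k lt) }))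
          (λ k lt t → subst (λ z → Q true z f) (sym (adv-move up k q)) (some (suc k) (ℕ.s≤s lt) (trans (cong f (sym (adv-move up k q))) t))))

    m-2 : ∃[ l ] m ≡ 2 ℕ.+ l
    m-2 = let l , e = ℕ.m≤n⇒∃[o]m+o≡n (ℕ.≤-trans (linℕ 0 ([] ⊢ κ 2 ≼ κ 6) ) 6≤m) in l , sym e

    -- The test begins two pixels up, past the window of the lower pebble. It misses no tile because
    -- of `yb + 3 ≤ Y⁻`.
    seek-step : ∀ {B x f} {R : ⊤ ⊎ Win → Pixel → Picture → Set} → Ground B → (∃[ y ] B (X⁻ , y) ≡ true) → X⁻ - + 8 ≤ x → x ≤ X⁻ → X⁻ ≤ X⁺ →
      Overlay f B ((x , yt) ∷ (x , yb) ∷ rights) →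
      (x + + 1 ≤ X⁻ → ∀ {f′} → Overlay f′ B ((x + + 1 , yt) ∷ (x + + 1 , yb) ∷ rights) → R (inj₁ tt) (x + + 1 , yb) f′) →
      (∀ {y f′} → B (X⁻ , y) ≡ true → Overlay f′ B ((X⁻ , y) ∷ (X⁻ , yt) ∷ (X⁻ , yb) ∷ rights) → R (inj₂ (win B (X⁻ , y))) (X⁻ , y) f′) →
      Run seekStep tt (20 ℕ.+ (D ℕ.+ D)) (x , yb) f R
    seek-step {B} {x} {f} {R} G (y₀ , tile) h h′ X⁻≤X⁺ ov onward k =
      wp-mono (linℕ 2 (λ l D → (κ 2 ⊕ l ≼ D) ∷ [] ⊢ κ 2 ⊕ ((κ 1 ⊕ l) ⊕ (κ 6 ⊕ D)) ≼ κ 20 ⊕ (D ⊕ D)) l D (subst (ℕ._≤ D) (proj₂ m-2) m≤D)) $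
      wp-⟫ {t₁ = 2} $ steps-run 1 (λ k le → L .Line.anchor k (ℕ.≤-trans le (ℕ.≤-trans (linℕ 0 ([] ⊢ κ 1 ≼ κ 6) ) 6≤m))) $
      wp-⟫ {t₁ = 1 ℕ.+ l} $ find-run l
        (λ k lt → subst (λ z → Anchor z × isPeb (win f z) ≡ false) (sym (adv-adv up 2 k S))
            (L .Line.anchor (2 ℕ.+ k) (ℕ.<⇒≤ (inside lt)) , line-clear L ov′ (2 ℕ.+ k) (ℕ.s≤s ℕ.z≤n) (inside lt)))
        (subst Anchor (sym E≡) (L .Line.anchor m ℕ.≤-refl)) (trans (cong (win f) E≡) (ov′ .on (here refl)))
        (λ none → wp-pre $ wp-choice₂ $ wp-map $ wp-pre $ wp-at (trans E≡ (cong (x ,_) (sym m≡))) $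
          shift-col G h (lin 4 (λ x X⁻ X⁺ xr → (x ≼ X⁻) ∷ (X⁻ ≼ X⁺) ∷ (X⁺ ⊕ κ 3 ≼ xr) ∷ [] ⊢ x ⊕ κ 3 ≼ xr) x X⁻ X⁺ xr h′ X⁻≤X⁺ ux₁) ov
              (onward (not-here none)))
        (λ j lt t → wp-mono (ℕ.m≤m+n 1 (5 ℕ.+ D)) $ wp-pre $ wp-choice₁ $ wp-map $ wp-at (adv-adv up 2 j S) $ found j lt
            (trans (cong f (sym (adv-adv up 2 j S))) t))
      where
        l : ℕ
        l = proj₁ m-2
        S : Pixel
        S = x , yb
        x2 : x + + 2 ≤ xr
        x2 = lin 4 (λ x X⁻ X⁺ xr → (x ≼ X⁻) ∷ (X⁻ ≼ X⁺) ∷ (X⁺ ⊕ κ 3 ≼ xr) ∷ [] ⊢ x ⊕ κ 2 ≼ xr) x X⁻ X⁺ xr h′ X⁻≤X⁺ ux₁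
        L : Line B up right m S rights
        L = colLine G h x2
        ov′ : Overlay f B (adv up m S ∷ S ∷ rights)
        ov′ = subst (λ z → Overlay f B ((x , z) ∷ S ∷ rights)) m≡ ov
        inside : ∀ {k} → k ℕ.< l → 2 ℕ.+ k ℕ.< m
        inside lt = subst (_ ℕ.<_) (sym (proj₂ m-2)) (ℕ.s≤s (ℕ.s≤s lt))
        E≡ : adv up l (adv up 2 S) ≡ adv up m S
        E≡ = trans (adv-adv up 2 l S) (cong (λ z → adv up z S) (sym (proj₂ m-2)))
        no-tile : (∀ k → k ℕ.< l → f (adv up k (adv up 2 S)) ≡ false) → ∀ {y} → B (x , y) ≡ true → ⊥
        no-tile none {y} t = absurd (distance (lin 3 (λ yb Y⁻ y → (yb ⊕ κ 3 ≼ Y⁻) ∷ (Y⁻ ≼ y) ∷ [] ⊢ yb ⊕ κ 2 ≼ y) yb Y⁻ y ly₁ (proj₁ (proj₂ bd))))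
          where
            bd : (X⁻ ≤ x × x ≤ X⁺) × (Y⁻ ≤ y × y ≤ Y⁺)
            bd = Ground.bounds G (lin 2 (λ x xr → (x ⊕ κ 2 ≼ xr) ∷ [] ⊢ x ≼ xr ⊕ κ 2) x xr x2) t
            false≢true : false ≢ true
            false≢true ()
            absurd : ∃[ j ] y ≡ yb + + 2 + + j → ⊥
            absurd (j , e) = false≢true (trans (sym (none j (ℕ.+-cancelˡ-< 2 _ _ (subst (2 ℕ.+ j ℕ.<_) (proj₂ m-2) j<))))
              (trans (cong f (adv-adv up 2 j S)) (trans (between-eq x2 ov (2 ℕ.+ j) (ℕ.s≤s (ℕ.s≤s ℕ.z≤n)) j<)
                  (trans (cong (λ z → B (x , z)) (sym e₂)) t))))
              where
                e₂ : y ≡ yb + + (2 ℕ.+ j)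
                e₂ = trans e (lin 2 (λ yb j → (κ 0 ≼ j) ∷ [] ⊢ yb ⊕ κ 2 ⊕ j ≐ yb ⊕ (κ 2 ⊕ j)) yb (+ j) (0≤+ j))
                j< : 2 ℕ.+ j ℕ.< m
                j< = ℤ.drop‿+≤+ (lin 6 (λ yb yt y Y⁺ j m → (κ 0 ≼ j) ∷ (κ 0 ≼ m) ∷ (y ≐ yb ⊕ (κ 2 ⊕ j)) ∷ (yt ≐ yb ⊕ m) ∷ (y ≼ Y⁺) ∷ (Y⁺ ⊕ κ 3 ≼ yt)
                    ∷ [] ⊢ κ 1 ⊕ (κ 2 ⊕ j) ≼ m) yb yt y Y⁺ (+ j) (+ m) (0≤+ j) (0≤+ m) e₂ m≡ (proj₂ (proj₂ bd)) uy₁)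
        not-here : (∀ k → k ℕ.< l → f (adv up k (adv up 2 S)) ≡ false) → x + + 1 ≤ X⁻
        not-here none with ≤-or-> X⁻ x
        ... | inj₂ lt = lt
        ... | inj₁ ge = ⊥-elim (no-tile none (subst (λ z → B (z , y₀) ≡ true) (ℤ.≤-antisym ge h′) tile))
        found : ∀ j → j ℕ.< l → f (x , yb + + (2 ℕ.+ j)) ≡ true → Run place tt 1 (x , yb + + (2 ℕ.+ j)) f (λ b → R (inj₂ (proj₂ b)))
        found j lt t = run-op (L .Line.anchor (2 ℕ.+ j) (ℕ.<⇒≤ (inside lt))) (cong (λ w → (tt , w) , just peb , nothing) (read-win ov far))
            (done here-tile (ℤ.≤-antisym h′ (proj₁ (proj₁ bd))) (place-peb ov far))
          where
            here-tile : B (x , yb + + (2 ℕ.+ j)) ≡ true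
            here-tile = trans (sym (between-eq x2 ov (2 ℕ.+ j) (ℕ.s≤s (ℕ.s≤s ℕ.z≤n)) (inside lt))) t
            bd : (X⁻ ≤ x × x ≤ X⁺) × (Y⁻ ≤ yb + + (2 ℕ.+ j) × yb + + (2 ℕ.+ j) ≤ Y⁺)
            bd = Ground.bounds G (lin 2 (λ x xr → (x ⊕ κ 2 ≼ xr) ∷ [] ⊢ x ≼ xr ⊕ κ 2) x xr x2) here-tile
            y : ℤ
            y = yb + + (2 ℕ.+ j)
            far : ∀ {r} → r ∈ (x , yt) ∷ (x , yb) ∷ rights → Far (x , y) r
            far (here refl) = inj₂ (inj₁ (lin 3 (λ y yt Y⁺ → (y ≼ Y⁺) ∷ (Y⁺ ⊕ κ 3 ≼ yt) ∷ [] ⊢ y ⊕ κ 2 ≼ yt) y yt Y⁺ (proj₂ (proj₂ bd)) uy₁))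
            far (there (here refl)) = inj₂ (inj₂ (lin 3 (λ y yb Y⁻ → (Y⁻ ≼ y) ∷ (yb ⊕ κ 3 ≼ Y⁻) ∷ [] ⊢ yb ⊕ κ 2 ≼ y) y yb Y⁻ (proj₁ (proj₂ bd)) ly₁))
            far (there (there (here refl))) = inj₁ (inj₁ x2)
            far (there (there (there (here refl)))) = inj₁ (inj₁ x2)
            done : ∀ {f′ z} → B (z , y) ≡ true → z ≡ X⁻ → Overlay f′ B ((z , y) ∷ (z , yt) ∷ (z , yb) ∷ rights) → R (inj₂ (win B (z , y))) (z , y) f′
            done t refl o′ = k t o′

    -- `φ` bounds the distance still to be covered to the column `X⁻`.
    seek-run : ∀ φ {B x f Q} → Ground B → (∃[ y ] B (X⁻ , y) ≡ true) → X⁻ - + 8 ≤ x → x ≤ X⁻ → X⁻ ≤ X⁺ → X⁻ ≤ x + + φ →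
      Overlay f B ((x , yt) ∷ (x , yb) ∷ rights) →
      (∀ {y f′} → B (X⁻ , y) ≡ true → Overlay f′ B ((X⁻ , y) ∷ (X⁻ , yt) ∷ (X⁻ , yb) ∷ rights) → Q (win B (X⁻ , y)) (X⁻ , y) f′) →
      Run seek tt (suc φ ℕ.* (20 ℕ.+ (D ℕ.+ D))) (x , yb) f Q
    seek-run zero {x = x} G tile h h′ X⁻≤X⁺ fuel ov k = wp-loop {t₁ = 20 ℕ.+ (D ℕ.+ D)} {t₂ = 0} (seek-step G tile h h′ X⁻≤X⁺ ov
      (λ lt _ → ⊥-elim (1≰0 (lin 2 (λ x X⁻ → (X⁻ ≼ x ⊕ κ 0) ∷ (x ⊕ κ 1 ≼ X⁻) ∷ [] ⊢ κ 1 ≼ κ 0) x X⁻ fuel lt))) k)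
    seek-run (suc φ) {x = x} G tile h h′ X⁻≤X⁺ fuel ov k = wp-loop {t₁ = 20 ℕ.+ (D ℕ.+ D)} {t₂ = suc φ ℕ.* (20 ℕ.+ (D ℕ.+ D))}
        (seek-step G tile h h′ X⁻≤X⁺ ov
      (λ lt o′ → seek-run φ G tile (lin 2 (λ x X⁻ → (X⁻ ⊖ κ 8 ≼ x) ∷ [] ⊢ X⁻ ⊖ κ 8 ≼ x ⊕ κ 1) x X⁻ h) lt X⁻≤X⁺
          (lin 3 (λ x X⁻ φ → (κ 0 ≼ φ) ∷ (X⁻ ≼ x ⊕ (κ 1 ⊕ φ)) ∷ [] ⊢ X⁻ ≼ x ⊕ κ 1 ⊕ φ) x X⁻ (+ φ) (0≤+ φ) fuel) o′ k) k)

    erase-run : ∀ n {q f Q} → (∀ k → k ℕ.< n → Anchor (adv up k q) × isPeb (win f (adv up k q)) ≡ false) →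
      Anchor (adv up n q) → win f (adv up n q) ≡ peb →
      (∀ {f′} → (∀ k → k ℕ.< n → f′ (adv up k q) ≡ false) → (∀ r → (∀ k → k ℕ.< n → r ≢ adv up k q) → f′ r ≡ f r) → Q tt (adv up n q) f′) →
      Run erase tt (suc n) q f Q
    erase-run zero {q} {f} {Q} h a e k = wp-loop {t₁ = 1} {t₂ = 0} $
      run-op (subst Anchor (adv-zero up q) a) (cong (eraseStep tt) (trans (cong (win f) (sym (adv-zero up q))) e))
        (subst (λ z → Q tt z f) (adv-zero up q) (k (λ _ ()) (λ _ _ → refl)))
    erase-run (suc n) {q} {f} {Q} h a e k = wp-loop {t₁ = 1} {t₂ = suc n} $
      run-op a₀ (cong (λ p → if p then (inj₂ tt , nothing , nothing) else (inj₁ tt , just (setBit₀ false (win f q)) , just up)) not-peb) $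
      erase-run n (λ j lt → subst (λ z → Anchor z × isPeb (win f₁ z) ≡ false) (sym (adv-move up j q))
          (proj₁ (h (suc j) (ℕ.s≤s lt)) , trans (cong isPeb (above j)) (proj₂ (h (suc j) (ℕ.s≤s lt)))))
        (subst Anchor (sym (adv-move up n q)) a) (trans (cong (win f₁) (adv-move up n q)) (trans (above n) e))
        (λ {f′} cl same → subst (λ z → Q tt z f′) (sym (adv-move up n q)) (k
          (λ { zero _ → trans (cong f′ (adv-zero up q)) (trans (same q (λ i lt e → different i (trans e (adv-move up i q)))) (poke-same false q f))
             ; (suc i) (ℕ.s≤s lt) → trans (cong f′ (sym (adv-move up i q))) (cl i lt) })
          (λ r ne → trans (same r (λ i lt e → ne (suc i) (ℕ.s≤s lt) (trans e (adv-move up i q))))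
            (poke-other false q f (λ e → ne 0 (ℕ.s≤s ℕ.z≤n) (trans e (sym (adv-zero up q))))))))
      where
        a₀ : Anchor q
        a₀ = subst Anchor (adv-zero up q) (proj₁ (h 0 (ℕ.s≤s ℕ.z≤n)))
        not-peb : isPeb (win f q) ≡ false
        not-peb = trans (cong (isPeb ∘ win f) (sym (adv-zero up q))) (proj₂ (h 0 (ℕ.s≤s ℕ.z≤n)))
        f₁ : Picture
        f₁ = paint q (setBit₀ false (win f q)) f
        y : ℤ
        y = proj₂ q
        different : ∀ i → q ≢ adv up (suc i) q
        different i e = 1≰0 (lin 2 (λ y i → (κ 0 ≼ i) ∷ (y ≐ y ⊕ (κ 1 ⊕ i)) ∷ [] ⊢ κ 1 ≼ κ 0) y (+ i) (0≤+ i) (cong proj₂ e))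
        above : ∀ j → win f₁ (adv up (suc j) q) ≡ win f (adv up (suc j) q)
        above j = win-ext {f₁} {f} (adv up (suc j) q) λ r (_ , (i , _)) → poke-other false q f λ
            { refl → 1≰0 (lin 2 (λ y j → (κ 0 ≼ j) ∷ (y ⊕ (κ 1 ⊕ j) ≼ y) ∷ [] ⊢ κ 1 ≼ κ 0) y (+ j) (0≤+ j) i) }

    cut-ground : ∀ x {B} → Ground B → Ground (cut x B)
    cut-ground x {B} G = record { legal = cut-legal x B (Ground.legal G) ; bounds = λ {u} {w} h e → Ground.bounds G h
        (proj₂ (cut-true {x} {u} {w} B e)) }

    private
      columns : ℤ → List Pixel
      columns x = (x , yt) ∷ (x , yb) ∷ rights

      -- Only the part of the column above the window of the lower pebble and below the upper pebble
      -- is erased; the rest of the column lies outside the rows of the box and was empty.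
      erased : ∀ {B x l f f′} → Ground B → m ≡ 2 ℕ.+ l → x + + 2 ≤ xr → Overlay f (cut x B) (columns x) →
        (∀ k → k ℕ.< l → f′ (adv up k (x , yb + + 2)) ≡ false) → (∀ r → (∀ k → k ℕ.< l → r ≢ adv up k (x , yb + + 2)) → f′ r ≡ f r) →
        Overlay f′ (cut (x + + 1) B) (columns x)
      erased {B} {x} {l} {f} {f′} G ml x2 ov cl same = record { on = on′ ; off = off′ }
        where
          kept : ∀ {r} → r ∈ columns x → ∀ p → InWin r p → ∀ k → k ℕ.< l → p ≢ adv up k (x , yb + + 2)
          kept (here refl) p (_ , (i , _)) k lt refl = 1≰0 (lin 5
              (λ yb yt m l k → (κ 0 ≼ m) ∷ (κ 0 ≼ l) ∷ (κ 0 ≼ k) ∷ (yt ≐ yb ⊕ m) ∷ (m ≐ κ 2 ⊕ l) ∷ (κ 1 ⊕ k ≼ l) ∷ (yt ≼ yb ⊕ κ 2 ⊕ k) ∷ [] ⊢ κ 1 ≼ κ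
              0) yb yt (+ m) (+ l) (+ k) (0≤+ m) (0≤+ l) (0≤+ k) m≡ (cong (λ z → + z) ml) (ℤ.+≤+ lt) i)
          kept (there (here refl)) p (_ , (_ , i)) k lt refl = 1≰0
              (lin 2 (λ yb k → (κ 0 ≼ k) ∷ (yb ⊕ κ 2 ⊕ k ≼ yb ⊕ κ 1) ∷ [] ⊢ κ 1 ≼ κ 0) yb (+ k) (0≤+ k) i)
          kept (there (there (here refl))) p ((i , _) , _) k lt refl = 1≰0 (lin 2 (λ x xr → (x ⊕ κ 2 ≼ xr) ∷ (xr ≼ x) ∷ [] ⊢ κ 1 ≼ κ 0) x xr x2 i)
          kept (there (there (there (here refl)))) p ((i , _) , _) k lt refl = 1≰0
              (lin 2 (λ x xr → (x ⊕ κ 2 ≼ xr) ∷ (xr ≼ x) ∷ [] ⊢ κ 1 ≼ κ 0) x xr x2 i)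
          on′ : ∀ {r} → r ∈ columns x → win f′ r ≡ peb
          on′ {r} i = trans (win-ext {f′} {f} r (λ p j → same p (kept i p j))) (ov .on i)
          off′ : ∀ q → (∀ {r} → r ∈ columns x → ¬ InWin r q) → f′ q ≡ cut (x + + 1) B q
          off′ (u , w) ¬in with ≤-or-> (x + + 1) u
          ... | inj₁ h = trans (same (u , w) (λ k lt e → 1≰0 (lin 2 (λ x u → (x ⊕ κ 1 ≼ u) ∷ (u ≐ x) ∷ [] ⊢ κ 1 ≼ κ 0) x u h (cong proj₁ e))))
                (trans (ov .off (u , w) ¬in) (trans (cut-≥ B (lin 2 (λ x u → (x ⊕ κ 1 ≼ u) ∷ [] ⊢ x ≼ u) x u h)) (sym (cut-≥ B h))))
          ... | inj₂ h with ≤-or-> (yb + + 2) w | ≤-or-> yt w | u ℤ.≟ x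
          ...   | _ | _ | no ne = trans (same (u , w) (λ k lt e → ne (cong proj₁ e))) (trans (ov .off (u , w) ¬in)
                  (trans (cut-< B (lower ne)) (sym (cut-< B h))))
            where lower : u ≢ x → u + + 1 ≤ x
                  lower ne with ≤-or-> x u
                  ... | inj₂ h′ = h′
                  ... | inj₁ h′ = ⊥-elim (ne (ℤ.≤-antisym (lin 2 (λ x u → (u ⊕ κ 1 ≼ x ⊕ κ 1) ∷ [] ⊢ u ≼ x) x u h) h′))
          ...   | inj₁ a | inj₂ b | yes refl = trans (hit (distance a)) (sym (cut-< B h))
            where hit : ∃[ k ] w ≡ yb + + 2 + + k → f′ (u , w) ≡ false
                  hit (k , refl) = cl k (ℤ.drop‿+≤+ (lin 5 (λ yb yt m l k → (κ 0 ≼ m) ∷ (κ 0 ≼ l) ∷ (κ 0 ≼ k) ∷ (yt ≐ yb ⊕ m) ∷ (m ≐ κ 2 ⊕ l) ∷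
                      (yb ⊕ κ 2 ⊕ k ⊕ κ 1 ≼ yt) ∷ [] ⊢ κ 1 ⊕ k ≼ l) yb yt (+ m) (+ l) (+ k) (0≤+ m) (0≤+ l) (0≤+ k) m≡ (cong (λ z → + z) ml) b))
          ...   | inj₂ a | _ | yes refl = trans (same (u , w)
              (λ { k lt refl → 1≰0 (lin 2 (λ yb k → (κ 0 ≼ k) ∷ (yb ⊕ κ 2 ⊕ k ⊕ κ 1 ≼ yb ⊕ κ 2) ∷ [] ⊢ κ 1 ≼ κ 0) yb (+ k) (0≤+ k) a) }))
                  (trans (ov .off (u , w) ¬in) (trans (cut-≥ B ℤ.≤-refl)
                      (trans (tileless G (lin 2 (λ u xr → (u ⊕ κ 2 ≼ xr) ∷ [] ⊢ u ≼ xr ⊕ κ 2) u xr x2)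
                      (inj₁ (lin 3 (λ w yb Y⁻ → (w ⊕ κ 1 ≼ yb ⊕ κ 2) ∷ (yb ⊕ κ 3 ≼ Y⁻) ∷ [] ⊢ w ⊕ κ 1 ≼ Y⁻) w yb Y⁻ a ly₁))) (sym (cut-< B h)))))
          ...   | _ | inj₁ b | yes refl = trans (same (u , w)
              (λ { k lt refl → 1≰0 (lin 5 (λ yb yt m l k → (κ 0 ≼ m) ∷ (κ 0 ≼ l) ∷ (κ 0 ≼ k) ∷ (yt ≐ yb ⊕ m) ∷ (m ≐ κ 2 ⊕ l) ∷ (κ 1 ⊕ k ≼ l) ∷
              (yt ≼ yb ⊕ κ 2 ⊕ k) ∷ [] ⊢ κ 1 ≼ κ 0) yb yt (+ m) (+ l) (+ k) (0≤+ m) (0≤+ l) (0≤+ k) m≡ (cong (λ z → + z) ml) (ℤ.+≤+ lt) b) }))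
                  (trans (ov .off (u , w) ¬in) (trans (cut-≥ B ℤ.≤-refl)
                      (trans (tileless G (lin 2 (λ u xr → (u ⊕ κ 2 ≼ xr) ∷ [] ⊢ u ≼ xr ⊕ κ 2) u xr x2)
                      (inj₂ (lin 3 (λ w yt Y⁺ → (yt ≼ w) ∷ (Y⁺ ⊕ κ 3 ≼ yt) ∷ [] ⊢ Y⁺ ⊕ κ 1 ≼ w) w yt Y⁺ b uy₁))) (sym (cut-< B h)))))

    clear-step : ∀ {B x f} {R : ⊤ ⊎ ⊤ → Pixel → Picture → Set} → Ground B → X⁻ - + 8 ≤ x → x + + 2 ≤ xr → Overlay f (cut x B) (columns x) →
      (x + + 3 ≤ xr → ∀ {f′} → Overlay f′ (cut (x + + 1) B) (columns (x + + 1)) → R (inj₁ tt) (x + + 1 , yb) f′) →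
      (xr ≡ x + + 2 → ∀ {f′} → Overlay f′ (cut (x + + 1) B) (columns x) → R (inj₂ tt) (x , yt) f′) →
      Run clearStep tt (20 ℕ.+ (D ℕ.+ D)) (x , yb) f R
    clear-step {B} {x} {f} {R} G h x2 ov onward k =
      wp-mono (linℕ 2 (λ l D → (κ 2 ⊕ l ≼ D) ∷ [] ⊢ κ 2 ⊕ ((κ 1 ⊕ l) ⊕ (κ 2 ⊕ (κ 1 ⊕ (κ 2 ⊕ (κ 6 ⊕ D))))) ≼ κ 20 ⊕ (D ⊕ D)) l D
          (subst (ℕ._≤ D) (proj₂ m-2) m≤D)) $
      wp-⟫ {t₁ = 2} $ steps-run 1 (λ k le → L .Line.anchor k (ℕ.≤-trans le (ℕ.≤-trans (linℕ 0 ([] ⊢ κ 1 ≼ κ 6) ) 6≤m))) $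
      wp-⟫ {t₁ = 1 ℕ.+ l} $ erase-run l
        (λ k lt → subst (λ z → Anchor z × isPeb (win f z) ≡ false) (sym (adv-adv up 2 k S))
            (L .Line.anchor (2 ℕ.+ k) (ℕ.<⇒≤ (inside lt)) , line-clear L ov′ (2 ℕ.+ k) (ℕ.s≤s ℕ.z≤n) (inside lt)))
        (subst Anchor (sym E≡) (L .Line.anchor m ℕ.≤-refl)) (trans (cong (win f) E≡) (ov′ .on (here refl))) λ cl same →
      wp-at (trans E≡ (cong (x ,_) (sym m≡))) $
      wp-⟫ {t₁ = 2} $ steps-run 1 (λ k le → anc (at-top (lin 3 (λ X⁻ x k → (κ 0 ≼ k) ∷ (X⁻ ⊖ κ 8 ≼ x) ∷ [] ⊢ X⁻ ⊖ κ 8 ≼ x ⊕ k) X⁻ x (+ k) (0≤+ k) h)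
          (lin 4 (λ x xr X⁺ k → (κ 0 ≼ k) ∷ (x ⊕ κ 2 ≼ xr) ∷ (xr ≼ X⁺ ⊕ κ 3) ∷ (k ≼ κ 1) ∷ [] ⊢ x ⊕ k ≼ X⁺ ⊕ κ 8) x xr X⁺ (+ k) (0≤+ k) x2 ux₂
          (ℤ.+≤+ le)))) $
      look (erased G (proj₂ m-2) x2 ov cl same)
      where
        l : ℕ
        l = proj₁ m-2
        S : Pixel
        S = x , yb
        L : Line (cut x B) up right m S rights
        L = colLine (cut-ground x G) h x2
        ov′ : Overlay f (cut x B) (adv up m S ∷ S ∷ rights)
        ov′ = subst (λ z → Overlay f (cut x B) ((x , z) ∷ S ∷ rights)) m≡ ov
        inside : ∀ {k} → k ℕ.< l → 2 ℕ.+ k ℕ.< m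
        inside lt = subst (_ ℕ.<_) (sym (proj₂ m-2)) (ℕ.s≤s (ℕ.s≤s lt))
        E≡ : adv up l (adv up 2 S) ≡ adv up m S
        E≡ = trans (adv-adv up 2 l S) (cong (λ z → adv up z S) (sym (proj₂ m-2)))
        rest : Prog ⊤ (⊤ ⊎ ⊤)
        rest = op (λ _ w → isPeb w , nothing , nothing) ⟫ steps left 1
          ⟫ pre (λ s → branch (tt , s)) (choice (op (λ _ _ → inj₂ tt , nothing , nothing))
              (post (λ _ → inj₁ tt) (pre (λ _ → up , right , blank , blank) shift)))
        a₂ : Anchor (x + + 2 , yt)
        a₂ = anc (at-top (lin 2 (λ X⁻ x → (X⁻ ⊖ κ 8 ≼ x) ∷ [] ⊢ X⁻ ⊖ κ 8 ≼ x ⊕ κ 2) X⁻ x h)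
            (lin 3 (λ x xr X⁺ → (x ⊕ κ 2 ≼ xr) ∷ (xr ≼ X⁺ ⊕ κ 3) ∷ [] ⊢ x ⊕ κ 2 ≼ X⁺ ⊕ κ 8) x xr X⁺ x2 ux₂))
        left-anc : ∀ k → k ℕ.≤ 1 → Anchor (x + + 2 - + k , yt)
        left-anc k le = anc (at-top (lin 3 (λ X⁻ x k → (κ 0 ≼ k) ∷ (X⁻ ⊖ κ 8 ≼ x) ∷ (k ≼ κ 1) ∷ [] ⊢ X⁻ ⊖ κ 8 ≼ x ⊕ κ 2 ⊖ k) X⁻ x (+ k) (0≤+ k) h
            (ℤ.+≤+ le)) (lin 4 (λ x xr X⁺ k → (κ 0 ≼ k) ∷ (x ⊕ κ 2 ≼ xr) ∷ (xr ≼ X⁺ ⊕ κ 3) ∷ [] ⊢ x ⊕ κ 2 ⊖ k ≼ X⁺ ⊕ κ 8) x xr X⁺ (+ k) (0≤+ k) x2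
            ux₂))
        home : (x + + 2 - + 2 , yt) ≡ (x , yt)
        home = cong (_, yt) (lin 1 (λ x → [] ⊢ x ⊕ κ 2 ⊖ κ 2 ≐ x) x)
        clear-at : x + + 3 ≤ xr → ∀ {r} → r ∈ columns x → Clear r (x + + 2 , yt)
        clear-at x3 (here refl) = inj₁ (inj₁ (inj₁ ℤ.≤-refl))
        clear-at x3 (there (here refl)) = inj₁ (inj₁ (inj₁ ℤ.≤-refl))
        clear-at x3 (there (there (here refl))) = inj₁ (inj₂ (inj₁
            (lin 4 (λ yb Y⁻ Y⁺ yt → (yb ⊕ κ 3 ≼ Y⁻) ∷ (Y⁻ ≼ Y⁺) ∷ (Y⁺ ⊕ κ 3 ≼ yt) ∷ [] ⊢ yb ⊕ κ 2 ≼ yt) yb Y⁻ Y⁺ yt ly₁ Y⁻≤Y⁺ uy₁)))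
        clear-at x3 (there (there (there (here refl)))) with ≤-or-> (x + + 4) xr
        ... | inj₁ x4 = inj₁ (inj₁ (inj₂ (lin 2 (λ x xr → (x ⊕ κ 4 ≼ xr) ∷ [] ⊢ x ⊕ κ 2 ⊕ κ 2 ≼ xr) x xr x4)))
        -- For `xr = x + 3` the inspected position is the left neighbour of the upper right pebble.
        -- This is a straight neighbour, so it is not mistaken for a pebble.
        ... | inj₂ x4 = inj₂ (left , cong (_, yt) (lin 2 (λ x xr → (x ⊕ κ 3 ≼ xr) ∷ (xr ⊕ κ 1 ≼ x ⊕ κ 4) ∷ [] ⊢ x ⊕ κ 2 ≐ xr ⊖ κ 1) x xr x3 x4))
        look : ∀ {f′} → Overlay f′ (cut (x + + 1) B) (columns x) → Run rest tt (1 ℕ.+ (2 ℕ.+ (6 ℕ.+ D))) (x + + 2 , yt) f′ R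
        look {f′} o′ = [ near , last ]′ (≤-or-> (x + + 3) xr)
          where
            near : x + + 3 ≤ xr → Run rest tt (1 ℕ.+ (2 ℕ.+ (6 ℕ.+ D))) (x + + 2 , yt) f′ R
            near x3 = wp-⟫ {t₁ = 1} $ run-op a₂ (cong (λ z → z , nothing , nothing)
                (no-peb {B = cut (x + + 1) B} o′ (cut-legal (x + + 1) B (Ground.legal G) (x + + 2) yt x2) (clear-at x3))) $
              wp-⟫ {t₁ = 2} $ steps-run 1 left-anc $ wp-at home $ wp-pre $ wp-choice₂ $ wp-map $ wp-pre $ shift-col (cut-ground (x + + 1) G) h x3 o′
                  (onward x3)
            last : xr + + 1 ≤ x + + 3 → Run rest tt (1 ℕ.+ (2 ℕ.+ (6 ℕ.+ D))) (x + + 2 , yt) f′ R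
            last x3 = wp-⟫ {t₁ = 1} $ run-op a₂ (cong (λ w → isPeb w , nothing , nothing)
                (trans (cong (λ z → win f′ (z , yt)) (sym e)) (o′ .on (there (there (there (here refl))))))) $
              wp-⟫ {t₁ = 2} $ steps-run 1 left-anc $ wp-at home $ wp-mono (ℕ.m≤m+n 1 (5 ℕ.+ D)) $ wp-pre $ wp-choice₁ $
              run-op (anc (at-top h (lin 3 (λ x xr X⁺ → (x ⊕ κ 2 ≼ xr) ∷ (xr ≼ X⁺ ⊕ κ 3) ∷ [] ⊢ x ≼ X⁺ ⊕ κ 8) x xr X⁺ x2 ux₂))) refl (k e o′)
              where e : xr ≡ x + + 2
                    e = ℤ.≤-antisym (lin 2 (λ x xr → (xr ⊕ κ 1 ≼ x ⊕ κ 3) ∷ [] ⊢ xr ≼ x ⊕ κ 2) x xr x3) x2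

    clear-loop : ∀ φ {B x f Q} → Ground B → X⁻ - + 8 ≤ x → x + + 2 ≤ xr → xr ≤ x + + 2 + + φ → Overlay f (cut x B) (columns x) →
      (∀ {x f′} → X⁻ - + 8 ≤ x → xr ≡ x + + 2 → Overlay f′ (cut (x + + 1) B) (columns x) → Q tt (x , yt) f′) →
      Run (loop clearStep) tt (suc φ ℕ.* (20 ℕ.+ (D ℕ.+ D))) (x , yb) f Q
    clear-loop zero {x = x} G h x2 fuel ov k = wp-loop {t₁ = 20 ℕ.+ (D ℕ.+ D)} {t₂ = 0} (clear-step G h x2 ov
      (λ x3 _ → ⊥-elim (1≰0 (lin 2 (λ x xr → (xr ≼ x ⊕ κ 2 ⊕ κ 0) ∷ (x ⊕ κ 3 ≼ xr) ∷ [] ⊢ κ 1 ≼ κ 0) x xr fuel x3))) (λ e o → k h e o))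
    clear-loop (suc φ) {x = x} G h x2 fuel ov k = wp-loop {t₁ = 20 ℕ.+ (D ℕ.+ D)} {t₂ = suc φ ℕ.* (20 ℕ.+ (D ℕ.+ D))} (clear-step G h x2 ov
      (λ x3 o′ → clear-loop φ G (lin 2 (λ X⁻ x → (X⁻ ⊖ κ 8 ≼ x) ∷ [] ⊢ X⁻ ⊖ κ 8 ≼ x ⊕ κ 1) X⁻ x h)
          (lin 2 (λ x xr → (x ⊕ κ 3 ≼ xr) ∷ [] ⊢ x ⊕ κ 1 ⊕ κ 2 ≼ xr) x xr x3)
        (lin 3 (λ x xr φ → (κ 0 ≼ φ) ∷ (xr ≼ x ⊕ κ 2 ⊕ (κ 1 ⊕ φ)) ∷ [] ⊢ xr ≼ x ⊕ κ 1 ⊕ κ 2 ⊕ φ) x xr (+ φ) (0≤+ φ) fuel) o′ k) (λ e o → k h e o))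

    wipe-run : ∀ {B q f rs Q} → Anchor q → Overlay f B (q ∷ rs) → (∀ {r} → r ∈ rs → Far q r) → blank ≡ win B q →
      (∀ {f′} → Overlay f′ B rs → Q tt q f′) → Run wipe tt 1 q f Q
    wipe-run a ov far e k = run-op a refl (k (lift-peb ov far e))

    clear-time : ℕ
    clear-time = suc D ℕ.* (20 ℕ.+ (D ℕ.+ D)) ℕ.+ (20 ℕ.+ D)

    clear-run : ∀ {B f Q} → Ground B → X⁻ ≤ X⁺ → Overlay f B (columns X⁻) →
      (∀ {q f′} → Anchor q → (∀ p → f′ p ≡ cut (xr - + 1) B p) → Q tt q f′) → Run clear tt clear-time (X⁻ , yb) f Q
    clear-run {B} {f} {Q} G X⁻≤X⁺ ov k =
      wp-⟫ {t₁ = suc D ℕ.* (20 ℕ.+ (D ℕ.+ D))} $ clear-loop D G (lin 1 (λ X⁻ → [] ⊢ X⁻ ⊖ κ 8 ≼ X⁻) X⁻)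
          (lin 3 (λ X⁻ X⁺ xr → (X⁻ ≼ X⁺) ∷ (X⁺ ⊕ κ 3 ≼ xr) ∷ [] ⊢ X⁻ ⊕ κ 2 ≼ xr) X⁻ X⁺ xr X⁻≤X⁺ ux₁)
        (lin 4 (λ X⁻ X⁺ xr D → (κ 0 ≼ D) ∷ (X⁺ ⊖ X⁻ ⊕ κ 16 ≼ D) ∷ (xr ≼ X⁺ ⊕ κ 3) ∷ [] ⊢ xr ≼ X⁻ ⊕ κ 2 ⊕ D) X⁻ X⁺ xr (+ D) (0≤+ D) wide ux₂)
            (start ov) finish
      where
        start : Overlay f B (columns X⁻) → Overlay f (cut X⁻ B) (columns X⁻)
        start o = record { on = o .on ; off = λ (u , w) ¬in → trans (o .off (u , w) ¬in) (same u w) }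
          where
            same : ∀ u w → B (u , w) ≡ cut X⁻ B (u , w)
            same u w with ≤-or-> X⁻ u
            ... | inj₁ h = sym (cut-≥ B h)
            ... | inj₂ h with B (u , w) in e
            ...   | false = sym (cut-< B h)
            ...   | true  = ⊥-elim (1≰0 (lin 2 (λ X⁻ u → (u ⊕ κ 1 ≼ X⁻) ∷ (X⁻ ≼ u) ∷ [] ⊢ κ 1 ≼ κ 0) X⁻ u h
                (proj₁ (proj₁ (Ground.bounds G (lin 4 (λ X⁻ X⁺ xr u → (u ⊕ κ 1 ≼ X⁻) ∷ (X⁻ ≼ X⁺) ∷ (X⁺ ⊕ κ 3 ≼ xr) ∷ [] ⊢ u ≼ xr ⊕ κ 2) X⁻ X⁺ xr u h
                X⁻≤X⁺ ux₁) e)))))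
        finish : ∀ {x f′} → X⁻ - + 8 ≤ x → xr ≡ x + + 2 → Overlay f′ (cut (x + + 1) B) (columns x) →
          Run (wipe ⟫ steps right 1 ⟫ wipe ⟫ walk down ⟫ wipe ⟫ steps left 1 ⟫ wipe) tt (20 ℕ.+ D) (x , yt) f′ Q
        finish {x} {f′} h e o =
          wp-mono (ℕ.≤-trans (linℕ 1 (λ m → [] ⊢ κ 1 ⊕ (κ 2 ⊕ (κ 1 ⊕ ((κ 1 ⊕ m) ⊕ (κ 1 ⊕ (κ 2 ⊕ κ 1))))) ≼ κ 20 ⊕ m) m) (ℕ.+-monoʳ-≤ 20 m≤D)) $
          wp-⟫ {t₁ = 1} $ wipe-run (anc (at-top h x≤)) o (λ { (here refl) → inj₂ (inj₂ gap) ; (there (here refl)) → inj₁ (inj₁ x2) ;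
              (there (there (here refl))) → inj₁ (inj₁ x2) }) (top-blank G′ (≤xr x2)) λ o →
          wp-⟫ {t₁ = 2} $ steps-run 1 (λ k le → anc (at-top (lin 3 (λ X⁻ x k → (κ 0 ≼ k) ∷ (X⁻ ⊖ κ 8 ≼ x) ∷ [] ⊢ X⁻ ⊖ κ 8 ≼ x ⊕ k) X⁻ x (+ k) (0≤+ k)
              h) (lin 4 (λ x xr X⁺ k → (κ 0 ≼ k) ∷ (x ⊕ κ 2 ≼ xr) ∷ (xr ≼ X⁺ ⊕ κ 3) ∷ (k ≼ κ 1) ∷ [] ⊢ x ⊕ k ≼ X⁺ ⊕ κ 8) x xr X⁺ (+ k) (0≤+ k) x2 ux₂
              (ℤ.+≤+ le)))) $
          wp-at (cong (_, yt) (sym e)) $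
          wp-⟫ {t₁ = 1} $ wipe-run (anc (at-top xr⁻ xr⁺)) (order o) (λ { (here refl) → inj₂ (inj₂ gap) ; (there (here refl)) → inj₁ (inj₂ x2) })
              (top-blank G′ ℤ.≤-refl) λ {f₂} o →
          wp-⟫ {t₁ = 1 ℕ.+ m} $ descend m refl (ℕ.≤-trans (linℕ 0 ([] ⊢ κ 1 ≼ κ 6) ) 6≤m) o $
          wp-⟫ {t₁ = 1} $ wipe-run (anc (at-bottom xr⁻ xr⁺)) o (λ { (here refl) → inj₁ (inj₂ x2) }) (bottom-blank G′ ℤ.≤-refl) λ o →
          wp-⟫ {t₁ = 2} $ steps-run 1 (λ k le → anc (at-bottom
              (lin 4 (λ X⁻ x xr k → (κ 0 ≼ k) ∷ (X⁻ ⊖ κ 8 ≼ x) ∷ (x ⊕ κ 2 ≼ xr) ∷ (k ≼ κ 1) ∷ [] ⊢ X⁻ ⊖ κ 8 ≼ xr ⊖ k) X⁻ x xr (+ k) (0≤+ k) h x2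
              (ℤ.+≤+ le)) (lin 3 (λ xr X⁺ k → (κ 0 ≼ k) ∷ (xr ≼ X⁺ ⊕ κ 3) ∷ [] ⊢ xr ⊖ k ≼ X⁺ ⊕ κ 8) xr X⁺ (+ k) (0≤+ k) ux₂))) $
          wp-at (cong (_, yb) (lin 2 (λ x xr → (xr ≐ x ⊕ κ 2) ∷ [] ⊢ xr ⊖ κ 2 ≐ x) x xr e)) $
          wipe-run (anc (at-bottom h x≤)) o (λ ()) (bottom-blank G′ (≤xr x2)) λ o →
          k (anc (at-bottom h x≤)) λ p → trans (o .off p (λ ()))
              (cong (λ z → cut z B p) (lin 2 (λ x xr → (xr ≐ x ⊕ κ 2) ∷ [] ⊢ x ⊕ κ 1 ≐ xr ⊖ κ 1) x xr e))
          where
            x2 : x + + 2 ≤ xr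
            x2 = ℤ.≤-reflexive (sym e)
            ≤xr : ∀ {x} → x + + 2 ≤ xr → x ≤ xr
            ≤xr {x} h = lin 2 (λ x xr → (x ⊕ κ 2 ≼ xr) ∷ [] ⊢ x ≼ xr) x xr h
            x≤ : x ≤ X⁺ + + 8
            x≤ = x≤⁺ x2
            xr⁻ : X⁻ - + 8 ≤ xr
            xr⁻ = lin 3 (λ X⁻ x xr → (X⁻ ⊖ κ 8 ≼ x) ∷ (x ⊕ κ 2 ≼ xr) ∷ [] ⊢ X⁻ ⊖ κ 8 ≼ xr) X⁻ x xr h x2
            xr⁺ : xr ≤ X⁺ + + 8
            xr⁺ = lin 2 (λ xr X⁺ → (xr ≼ X⁺ ⊕ κ 3) ∷ [] ⊢ xr ≼ X⁺ ⊕ κ 8) xr X⁺ ux₂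
            gap : yb + + 2 ≤ yt
            gap = lin 4 (λ yb Y⁻ Y⁺ yt → (yb ⊕ κ 3 ≼ Y⁻) ∷ (Y⁻ ≼ Y⁺) ∷ (Y⁺ ⊕ κ 3 ≼ yt) ∷ [] ⊢ yb ⊕ κ 2 ≼ yt) yb Y⁻ Y⁺ yt ly₁ Y⁻≤Y⁺ uy₁
            G′ : Ground (cut (x + + 1) B)
            G′ = cut-ground (x + + 1) G
            order : ∀ {f a b c} → Overlay f (cut (x + + 1) B) (a ∷ b ∷ c ∷ []) → Overlay f (cut (x + + 1) B) (c ∷ b ∷ a ∷ [])
            order = reorder (λ { (here r) → there (there (here r)) ; (there (here r)) → there (here r) ; (there (there (here r))) → here r })
                            (λ { (here r) → there (there (here r)) ; (there (here r)) → there (here r) ; (there (there (here r))) → here r })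
            descend : ∀ {f Q} i → i ≡ m → 1 ℕ.≤ i → Overlay f (cut (x + + 1) B) ((xr , yb) ∷ (x , yb) ∷ []) → Q tt (xr , yb) f → Run (walk down) tt
                (1 ℕ.+ m) (xr , yt) f Q
            descend {f} {Q} (suc i) e _ o k = subst (λ z → Run (walk down) tt (1 ℕ.+ z) (xr , yt) f Q) e $ wp-⟫ {t₁ = 1} $
              steps-run 0 (λ { zero _ → subst Anchor (sym (adv-zero down (xr , yt))) (anc (at-top xr⁻ xr⁺)) }) $
              wp-at (trans (cong (λ z → adv down 1 (xr , z)) yt≡) (adv-opp up 1 i (xr , yb))) $ wp-map $ wp-pre $ wp-carry $
              back-run i (λ k le → big xr⁻ xr⁺ (lin 3 (λ Y⁻ yb k → (κ 0 ≼ k) ∷ (Y⁻ ⊖ κ 4 ≼ yb) ∷ [] ⊢ Y⁻ ⊖ κ 8 ≼ yb ⊕ k) Y⁻ yb (+ k) (0≤+ k) ly₂)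
                  (lin 5 (λ Y⁺ yb yt k i → (κ 0 ≼ k) ∷ (κ 0 ≼ i) ∷ (yt ≐ yb ⊕ (κ 1 ⊕ i)) ∷ (k ≼ i) ∷ (yt ≼ Y⁺ ⊕ κ 3) ∷ [] ⊢ yb ⊕ k ≼ Y⁺ ⊕ κ 8) Y⁺ yb
                  yt (+ k) (+ i) (0≤+ k) (0≤+ i) yt≡ (ℤ.+≤+ le) uy₂))
                (λ k 0<k le → clear-line {B = cut (x + + 1) B} {d = up} k 0<k o (G′ .Ground.legal xr (yb + + k) ℤ.≤-refl)
                    (λ { (here refl) → inj₁ (inj₁ (inj₁ x2)) })) (o .on (here refl)) (λ _ → k)
              where yt≡ : yt ≡ yb + + suc i
                    yt≡ = trans m≡ (cong (λ z → yb + + z) (sym e))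

open Sweeping

-- The copy as the memory of the search.

module ScaledCopy where

  open import Data.Integer using (_+_; _-_; _≤_; _*_)
  open import Data.Integer.Tactic.RingSolver using (solve-∀)

  -- A cell of the copy is empty, full, or on the current path; in the last case it
  -- points to a neighbouring cell of the path, or is an end of it.
  data Code : Set where
    empty full stop : Code
    ptr : Dir → Code

  -- The four single tiles encode `stop` and three pointers; the fourth pointer takes a row of two.
  -- The full window is left to completed cells, whose pixels are all tiles.
  codeWin : Code → Win
  codeWin empty       = mkW false false false false
  codeWin full        = mkW true true true true
  codeWin stop        = mkW true false false false
  codeWin (ptr right) = mkW false true false false
  codeWin (ptr up)    = mkW false false true false
  codeWin (ptr left)  = mkW false false false true
  codeWin (ptr down)  = mkW true true false false

  decode : Win → Code
  decode (mkW true  true  true  true)  = full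
  decode (mkW true  false false false) = stop
  decode (mkW false true  false false) = ptr right
  decode (mkW false false true  false) = ptr up
  decode (mkW false false false true)  = ptr left
  decode (mkW true  true  false false) = ptr down
  -- Besides the blank window this covers windows that never occur at the lower left corner of a
  -- cell.
  decode _                             = empty

  decode-code : ∀ k → decode (codeWin k) ≡ k
  decode-code empty       = refl
  decode-code full        = refl
  decode-code stop        = refl
  decode-code (ptr right) = refl
  decode-code (ptr up)    = refl
  decode-code (ptr left)  = refl
  decode-code (ptr down)  = refl

  isFull isEmpty : Code → Bool
  isFull full   = true
  isFull _      = false
  isEmpty empty = true
  isEmpty _     = false

  -- The code is shown in the four pixels at the lower left corner of a cell.
  bitAt : Code → ℕ → ℕ → Bool
  bitAt k 0 0 = bit₀ (codeWin k)
  bitAt k 1 0 = bit₁ (codeWin k)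
  bitAt k 1 1 = bit₂ (codeWin k)
  bitAt k 0 1 = bit₃ (codeWin k)
  bitAt k _ _ = isFull k

  bitAt-full : ∀ i j → bitAt full i j ≡ true
  bitAt-full 0 0 = refl
  bitAt-full 0 1 = refl
  bitAt-full 1 0 = refl
  bitAt-full 1 1 = refl
  bitAt-full 0 (suc (suc j)) = refl
  bitAt-full 1 (suc (suc j)) = refl
  bitAt-full (suc (suc i)) j = refl

  bitAt-empty : ∀ i j → bitAt empty i j ≡ false
  bitAt-empty 0 0 = refl
  bitAt-empty 0 1 = refl
  bitAt-empty 1 0 = refl
  bitAt-empty 1 1 = refl
  bitAt-empty 0 (suc (suc j)) = refl
  bitAt-empty 1 (suc (suc j)) = refl
  bitAt-empty (suc (suc i)) j = refl

  Store : Set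
  Store = Pixel → Code

  opaque
    upd : Pixel → Code → Store → Store
    upd p k M r with p ≟P r
    ... | yes _ = k
    ... | no _  = M r

    upd-same : ∀ p k M → upd p k M p ≡ k
    upd-same p k M with p ≟P p
    ... | yes _ = refl
    ... | no ne = ⊥-elim (ne refl)

    upd-other : ∀ {p r} k M → r ≢ p → upd p k M r ≡ M r
    upd-other {p} {r} k M ne with p ≟P r
    ... | yes e = ⊥-elim (ne (sym e))
    ... | no _  = refl

  upd-ext : ∀ p k {M M′ : Store} → (∀ r → r ≢ p → M r ≡ M′ r) → upd p k M ≗ upd p k M′
  upd-ext p k {M} {M′} e r with r ≟P p
  ... | yes refl = trans (upd-same p k M) (sym (upd-same p k M′))
  ... | no ne    = trans (upd-other k M ne) (trans (e r ne) (sym (upd-other k M′ ne)))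

  upd-swap : ∀ {p q} k l M → p ≢ q → upd p k (upd q l M) ≗ upd q l (upd p k M)
  upd-swap {p} {q} k l M ne r with r ≟P p | r ≟P q
  ... | yes refl | yes refl = ⊥-elim (ne refl)
  ... | yes refl | no n     = trans (upd-same p k _) (sym (trans (upd-other l _ n) (upd-same p k M)))
  ... | no n     | yes refl = trans (upd-other k _ n) (trans (upd-same q l M) (sym (upd-same q l _)))
  ... | no n     | no n′    = trans (upd-other k _ n) (trans (upd-other l M n′) (sym (trans (upd-other l _ n′) (upd-other k M n))))

  upd-id : ∀ {p k M} → M p ≡ k → upd p k M ≗ M
  upd-id {p} {k} {M} e r with r ≟P p
  ... | yes refl = trans (upd-same p k M) (sym e)
  ... | no ne    = upd-other k M ne

  -- The current path: ds lists its steps, the last one first.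

  module Path (root : Pixel) where

    tip : List Dir → Pixel
    tip []       = root
    tip (d ∷ ds) = move d (tip ds)

    below : List Dir → List Pixel
    below []       = []
    below (d ∷ ds) = tip ds ∷ below ds

    previous : List Dir → Maybe Dir
    previous []      = nothing
    previous (d ∷ _) = just (opp d)

  backCode : Maybe Dir → Code
  backCode nothing  = stop
  backCode (just e) = ptr e

  data Ans : Set where
    extended refused done : Ans
    finished : Dir → Ans

  instance
    finite-Ans : Finite Ans
    finite-Ans = retract {B = Dir ⊎ Maybe Bool} finite-⊎
      (λ { extended → inj₂ (just true) ; refused → inj₂ (just false) ; done → inj₂ nothing ; (finished d) → inj₁ d })
      (λ { (inj₂ (just true)) → extended ; (inj₂ (just false)) → refused ; (inj₂ nothing) → done ; (inj₁ d) → finished d })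
      (λ { extended → refl ; refused → refl ; done → refl ; (finished d) → refl })

  -- Programs acting on the path.

  module CopyProgram (c₁ : ℕ) where

    -- `go c₁` makes `c₁ + 1 = c` moves, the distance of neighbouring cells.
    hop : Prog Dir Dir
    hop = post proj₁ (pre (λ d → d , d) (carry Dir (go c₁)))

    -- Pointer reversal in the manner of Deutsch, Schorr and Waite: `pv` leads back to the previous
    -- cell. At the root it is `nothing`, which is written as `stop` and lets the way back recognise
    -- its end; the `stop` at the tip ends the ascent.
    followCase : Maybe Dir → Code → (Dir ⊎ Maybe Dir) × Maybe Win × Maybe Dir
    followCase pv (ptr d) = inj₁ d , just (codeWin (backCode pv)) , nothing
    followCase pv _       = inj₂ pv , nothing , nothing

    follow : Maybe Dir → Win → (Dir ⊎ Maybe Dir) × Maybe Win × Maybe Dir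
    follow pv w = followCase pv (decode w)

    ascendStep : Prog (Maybe Dir) (Maybe Dir ⊎ Maybe Dir)
    ascendStep = op follow ⟫ choice (post (λ d → inj₁ (just (opp d))) hop) (op (λ pv _ → inj₂ pv , nothing , nothing))

    -- Follows the pointers from the root, reversing them.
    ascend : Prog (Maybe Dir) (Maybe Dir)
    ascend = loop ascendStep

    prevOf : Code → Maybe Dir
    prevOf (ptr e) = just e
    prevOf _       = nothing

    -- The cell reached by a move `e` originally pointed to the cell just left, hence the restored
    -- pointer `opp e`; its reversed pointer tells where to go next.
    unwind : Dir → Win → (Maybe Dir ⊎ ⊤) × Maybe Win × Maybe Dir
    unwind e w = inj₁ (prevOf (decode w)) , just (codeWin (ptr (opp e))) , nothing

    toward : Maybe Dir → Dir ⊎ ⊤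
    toward (just e) = inj₁ e
    toward nothing  = inj₂ tt

    retStep : Prog (Maybe Dir) (Maybe Dir ⊎ ⊤)
    retStep = pre toward (choice (hop ⟫ op unwind) (op (λ _ _ → inj₂ tt , nothing , nothing)))

    -- Returns to the root, restoring the pointers.
    ret : Prog (Maybe Dir) ⊤
    ret = loop retStep

    tryCase : Dir × Maybe Dir → Bool → ((Bool × Dir × Maybe Dir) × Dir) × Maybe Win × Maybe Dir
    tryCase (d , pv) true  = ((true , d , pv) , opp d) , just (codeWin stop) , nothing
    tryCase (d , pv) false = ((false , d , pv) , opp d) , nothing , nothing

    answer : Bool × Dir × Maybe Dir → (Ans × Maybe Dir) × Maybe Win × Maybe Dir
    answer (true  , d , pv) = (extended , pv) , just (codeWin (ptr d)) , nothing
    answer (false , d , pv) = (refused , pv) , nothing , nothing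

    -- Extends the path into the neighbouring cell if that is empty.
    attempt : Prog (Dir × Maybe Dir) (Ans × Maybe Dir)
    attempt = pre (λ (d , pv) → (d , pv) , d) (carry (Dir × Maybe Dir) (go c₁))
      ⟫ op (λ (x , _) w → tryCase x (isEmpty (decode w)))
      ⟫ carry (Bool × Dir × Maybe Dir) (go c₁)
      ⟫ op (λ (x , _) _ → answer x)

    fillRow : ℕ → Prog ⊤ ⊤
    fillRow zero    = op (λ _ w → tt , just (setBit₀ true w) , just right)
    fillRow (suc n) = op (λ _ w → tt , just (setBit₀ true w) , just right) ⟫ fillRow n

    fillLine : Prog ⊤ ⊤
    fillLine = fillRow c₁ ⟫ steps left c₁ ⟫ steps up 0

    fillLines : ℕ → Prog ⊤ ⊤
    fillLines zero    = fillLine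
    fillLines (suc n) = fillLine ⟫ fillLines n

    fill : Prog ⊤ ⊤
    fill = fillLines c₁ ⟫ steps down c₁

    shorten : Dir → Code → (Ans × Maybe Dir) × Maybe Win × Maybe Dir
    shorten e (ptr e′) = (finished e , just e′) , just (codeWin stop) , nothing
    -- The parent is the root. Its reversed code is `stop` already, as required of a tip, so nothing
    -- is written.
    shorten e _        = (finished e , nothing) , nothing , nothing

    -- Completes the last cell of the path and removes it from the path.
    complete : Prog (Maybe Dir) (Ans × Maybe Dir)
    complete = post proj₁ (pre (_, tt) (carry (Maybe Dir) fill))
      ⟫ pre toward (choice (hop ⟫ op (λ e w → shorten e (decode w))) (op (λ _ _ → (done , nothing) , nothing , nothing)))

    request : Maybe Dir × Maybe Dir → (Dir × Maybe Dir) ⊎ Maybe Dir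
    request (just d  , pv) = inj₁ (d , pv)
    request (nothing , pv) = inj₂ pv

    -- A request `just d` asks for an extension of the path in direction `d`, the request `nothing`
    -- for the completion of its tip.
    serve : Prog (Maybe Dir) Ans
    serve = pre (_, nothing) (carry (Maybe Dir) ascend) ⟫ pre request (choice attempt complete) ⟫ post proj₁ (carry Ans ret)

  private
    -- Uniqueness of quotient and remainder.
    scaled-unique : ∀ c a {x x′ i i′} → i ℕ.< c → i′ ℕ.< c → a + + c * x + + i ≡ a + + c * x′ + + i′ → x ≡ x′ × i ≡ i′
    scaled-unique c a {x} {x′} {i} {i′} lt lt′ e with ≤-or-> x x′ | ≤-or-> x′ x
    ... | inj₁ p | inj₁ q with ℤ.≤-antisym p q
    ...   | refl = refl , ℤ.+-injective (lin 3 (λ z i j → (z ⊕ i ≐ z ⊕ j) ∷ [] ⊢ i ≐ j) (a + + c * x) (+ i) (+ i′) e)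
    scaled-unique c a {x} {x′} {i} {i′} lt lt′ e | inj₂ p | _ = ⊥-elim
        (1≰0 (lin 6 (λ a c u v i j → (κ 0 ≼ j) ∷ (v ⊕ c ≼ u) ∷ (κ 1 ⊕ j ≼ c) ∷ (a ⊕ u ⊕ i ≐ a ⊕ v ⊕ j) ∷ (κ 0 ≼ i) ∷ [] ⊢ κ 1 ≼ κ 0) a (+ c)
        (+ c * x) (+ c * x′) (+ i) (+ i′) (0≤+ i′)
      (subst (_≤ + c * x) (lem (+ c) x′) (ℤ.*-monoˡ-≤-nonNeg (+ c) p)) (ℤ.+≤+ lt′) e (0≤+ i)))
      where lem : ∀ c x → c * (x + + 1) ≡ c * x + c
            lem = solve-∀
    scaled-unique c a {x} {x′} {i} {i′} lt lt′ e | _ | inj₂ p = ⊥-elim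
        (1≰0 (lin 6 (λ a c u v i j → (κ 0 ≼ i) ∷ (u ⊕ c ≼ v) ∷ (κ 1 ⊕ i ≼ c) ∷ (a ⊕ u ⊕ i ≐ a ⊕ v ⊕ j) ∷ (κ 0 ≼ j) ∷ [] ⊢ κ 1 ≼ κ 0) a (+ c)
        (+ c * x) (+ c * x′) (+ i) (+ i′) (0≤+ i)
      (subst (_≤ + c * x′) (lem (+ c) x) (ℤ.*-monoˡ-≤-nonNeg (+ c) p)) (ℤ.+≤+ lt) e (0≤+ i′)))
      where lem : ∀ c x → c * (x + + 1) ≡ c * x + c
            lem = solve-∀

  -- Cells, and what they show of the store.

  module Cells (Anchor : Pixel → Set) (c₁ : ℕ) (1≤c₁ : 1 ℕ.≤ c₁) (a b : ℤ) (Cell : Pixel → Set)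
    (cell-anchor : ∀ {x y} → Cell (x , y) → ∀ i j → i ℕ.≤ suc c₁ → j ℕ.≤ suc c₁ →
      Anchor (a + + suc c₁ * x + + i , b + + suc c₁ * y + + j)) where
    open Walks Anchor
    open CopyProgram c₁

    c : ℕ
    c = suc c₁

    base : Pixel → Pixel
    base (x , y) = a + + c * x , b + + c * y

    pix : Pixel → ℕ → ℕ → Pixel
    pix (x , y) i j = a + + c * x + + i , b + + c * y + + j

    record Rendered (f : Picture) (M : Store) : Set where
      field
        shown : ∀ {p} → Cell p → ∀ i j → i ℕ.< c → j ℕ.< c → f (pix p i j) ≡ bitAt (M p) i j
    open Rendered public

    record Outside (f f₀ : Picture) : Set where
      field
        kept : ∀ q → (∀ {p} → Cell p → ∀ i j → i ℕ.< c → j ℕ.< c → q ≢ pix p i j) → f q ≡ f₀ q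
    open Outside public

    private
      +0 : ∀ z → z + + 0 ≡ z
      +0 = ℤ.+-identityʳ

      pix₀₀ : ∀ p → pix p 0 0 ≡ base p
      pix₀₀ (x , y) = cong₂ _,_ (+0 _) (+0 _)
      pix₁₀ : ∀ p → pix p 1 0 ≡ corner₁ (base p)
      pix₁₀ (x , y) = cong₂ _,_ refl (+0 _)
      pix₁₁ : ∀ p → pix p 1 1 ≡ corner₂ (base p)
      pix₁₁ (x , y) = refl
      pix₀₁ : ∀ p → pix p 0 1 ≡ corner₃ (base p)
      pix₀₁ (x , y) = cong₂ _,_ (+0 _) refl

      1<c : 1 ℕ.< c
      1<c = ℕ.s≤s 1≤c₁
      0<c : 0 ℕ.< c
      0<c = ℕ.s≤s ℕ.z≤n

      pix-unique : ∀ {p p′ i j i′ j′} → i ℕ.< c → j ℕ.< c → i′ ℕ.< c → j′ ℕ.< c → pix p i j ≡ pix p′ i′ j′ → p ≡ p′ × (i ≡ i′ × j ≡ j′)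
      pix-unique {x , y} {x′ , y′} li lj li′ lj′ e =
        let ex , ei = scaled-unique c a {x} {x′} li li′ (cong proj₁ e) ; ey , ej = scaled-unique c b {y} {y′} lj lj′ (cong proj₂ e)
        in cong₂ _,_ ex ey , ei , ej

      corner-pix : ∀ p q → InWin (base p) q → ∃[ i ] ∃[ j ] (i ℕ.< c × j ℕ.< c × q ≡ pix p i j)
      corner-pix p q i with inWin-cases i
      ... | inj₁ refl                = 0 , 0 , 0<c , 0<c , sym (pix₀₀ p)
      ... | inj₂ (inj₁ refl)         = 1 , 0 , 1<c , 0<c , sym (pix₁₀ p)
      ... | inj₂ (inj₂ (inj₁ refl))  = 1 , 1 , 1<c , 1<c , sym (pix₁₁ p)
      ... | inj₂ (inj₂ (inj₂ refl))  = 0 , 1 , 0<c , 1<c , sym (pix₀₁ p)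

    rendered-cong : ∀ {f M M′} → M ≗ M′ → Rendered f M → Rendered f M′
    rendered-cong e r .shown {p} cp i j li lj = trans (r .shown cp i j li lj) (cong (λ k → bitAt k i j) (e p))

    read-cell : ∀ {f M p} → Rendered f M → Cell p → win f (base p) ≡ codeWin (M p)
    read-cell {f} {M} {p} r cp = trans (bits (M p) e₀ e₁ e₂ e₃) refl
      where
        e₀ : f (base p) ≡ bitAt (M p) 0 0
        e₀ = trans (cong f (sym (pix₀₀ p))) (r .shown cp 0 0 0<c 0<c)
        e₁ : f (corner₁ (base p)) ≡ bitAt (M p) 1 0
        e₁ = trans (cong f (sym (pix₁₀ p))) (r .shown cp 1 0 1<c 0<c)
        e₂ : f (corner₂ (base p)) ≡ bitAt (M p) 1 1
        e₂ = trans (cong f (sym (pix₁₁ p))) (r .shown cp 1 1 1<c 1<c)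
        e₃ : f (corner₃ (base p)) ≡ bitAt (M p) 0 1
        e₃ = trans (cong f (sym (pix₀₁ p))) (r .shown cp 0 1 0<c 1<c)
        eta : ∀ w → mkW (bit₀ w) (bit₁ w) (bit₂ w) (bit₃ w) ≡ w
        eta (mkW _ _ _ _) = refl
        bits : ∀ {s t u v} k → s ≡ bitAt k 0 0 → t ≡ bitAt k 1 0 → u ≡ bitAt k 1 1 → v ≡ bitAt k 0 1 → mkW s t u v ≡ codeWin k
        bits k refl refl refl refl = eta (codeWin k)

    outside-paint : ∀ {f f₀ p w} → Cell p → Outside f f₀ → Outside (paint (base p) w f) f₀
    outside-paint {f} {p = p} {w} cp out .kept q ne = trans (paint-off w f λ i → let i′ , j′ , li , lj , e = corner-pix p q i in ne cp i′ j′ li lj e) (out .kept q ne)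

    -- Neither the old nor the new code is `full`, so outside its 2×2 corner the cell is empty
    -- before and after. The passage to `full` is the subject of `fill-run`.
    write-cell : ∀ {f M p} k → Rendered f M → Cell p → isFull (M p) ≡ false → isFull k ≡ false →
      Rendered (paint (base p) (codeWin k) f) (upd p k M)
    write-cell {f} {M} {p} k r cp nf nk .shown {p′} cp′ i j li lj with p′ ≟P p
    ... | no ne = trans (paint-off (codeWin k) f λ inw → let i′ , j′ , li′ , lj′ , e = corner-pix p _ inw in ne (proj₁ (pix-unique {p′} {p} li lj li′ lj′ e)))
                    (trans (r .shown cp′ i j li lj) (cong (λ k → bitAt k i j) (sym (upd-other k M ne))))
    ... | yes refl = trans (inside i j li lj) (cong (λ k → bitAt k i j) (sym (upd-same p k M)))
      where
        F : Picture
        F = paint (base p) (codeWin k) f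
        W : win F (base p) ≡ codeWin k
        W = paint-win (base p) (codeWin k) f
        rest : ∀ i j → i ℕ.< c → j ℕ.< c → (∀ {i′ j′} → i′ ℕ.< 2 → j′ ℕ.< 2 → ¬ (i ≡ i′ × j ≡ j′)) → bitAt (M p) i j ≡ false → F (pix p i j) ≡ false
        rest i j li lj ne e = trans (paint-off (codeWin k) f λ inw → notin (inWin-cases inw)) (trans (r .shown cp i j li lj) e)
          where
            notin : pix p i j ≡ base p ⊎ pix p i j ≡ corner₁ (base p) ⊎ pix p i j ≡ corner₂ (base p) ⊎ pix p i j ≡ corner₃ (base p) → ⊥
            notin (inj₁ h) = ne (ℕ.s≤s ℕ.z≤n) (ℕ.s≤s ℕ.z≤n) (proj₂ (pix-unique {p} {p} li lj 0<c 0<c (trans h (sym (pix₀₀ p)))))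
            notin (inj₂ (inj₁ h)) = ne (ℕ.s≤s (ℕ.s≤s ℕ.z≤n)) (ℕ.s≤s ℕ.z≤n) (proj₂ (pix-unique {p} {p} li lj 1<c 0<c (trans h (sym (pix₁₀ p)))))
            notin (inj₂ (inj₂ (inj₁ h))) = ne (ℕ.s≤s (ℕ.s≤s ℕ.z≤n)) (ℕ.s≤s (ℕ.s≤s ℕ.z≤n))
                (proj₂ (pix-unique {p} {p} li lj 1<c 1<c (trans h (sym (pix₁₁ p)))))
            notin (inj₂ (inj₂ (inj₂ h))) = ne (ℕ.s≤s ℕ.z≤n) (ℕ.s≤s (ℕ.s≤s ℕ.z≤n)) (proj₂ (pix-unique {p} {p} li lj 0<c 1<c (trans h (sym (pix₀₁ p)))))
        inside : ∀ i j → i ℕ.< c → j ℕ.< c → F (pix p i j) ≡ bitAt k i j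
        inside 0 0 li lj = trans (cong F (pix₀₀ p)) (cong bit₀ W)
        inside 1 0 li lj = trans (cong F (pix₁₀ p)) (cong bit₁ W)
        inside 1 1 li lj = trans (cong F (pix₁₁ p)) (cong bit₂ W)
        inside 0 1 li lj = trans (cong F (pix₀₁ p)) (cong bit₃ W)
        inside 0 (suc (suc j)) li lj = trans (rest 0 (suc (suc j)) li lj (λ { _ (ℕ.s≤s (ℕ.s≤s ())) (_ , refl) }) nf) (sym nk)
        inside 1 (suc (suc j)) li lj = trans (rest 1 (suc (suc j)) li lj (λ { _ (ℕ.s≤s (ℕ.s≤s ())) (_ , refl) }) nf) (sym nk)
        inside (suc (suc i)) j li lj = trans (rest (suc (suc i)) j li lj (λ { (ℕ.s≤s (ℕ.s≤s ())) _ (refl , _) }) nf) (sym nk)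

    base-anchor : ∀ {p} → Cell p → Anchor (base p)
    base-anchor {p} cp = subst Anchor (pix₀₀ p) (cell-anchor cp 0 0 ℕ.z≤n ℕ.z≤n)

    base-move : ∀ d p → adv d c (base p) ≡ base (move d p)
    base-move right (x , y) = cong (_, b + + c * y) (lem a (+ c) x)
      where lem : ∀ a c x → a + c * x + c ≡ a + c * (x + + 1)
            lem = solve-∀
    base-move up (x , y) = cong (a + + c * x ,_) (lem b (+ c) y)
      where lem : ∀ a c x → a + c * x + c ≡ a + c * (x + + 1)
            lem = solve-∀
    base-move left (x , y) = cong (_, b + + c * y) (lem a (+ c) x)
      where lem : ∀ a c x → a + c * x - c ≡ a + c * (x - + 1)
            lem = solve-∀
    base-move down (x , y) = cong (a + + c * x ,_) (lem b (+ c) y)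
      where lem : ∀ a c x → a + c * x - c ≡ a + c * (x - + 1)
            lem = solve-∀

    private
      back-step : ∀ a x k → k ℕ.≤ c → a + + c * (x - + 1) + + (c ℕ.∸ k) ≡ a + + c * x - + k
      back-step a x k le = trans (cong (λ z → a + + c * (x - + 1) + z) e) (lem a (+ c) x (+ k))
        where
          e : + (c ℕ.∸ k) ≡ + c - + k
          e = trans (sym (ℤ.⊖-≥ le)) (sym (ℤ.m-n≡m⊖n c k))
          lem : ∀ a c x k → a + c * (x - + 1) + (c - k) ≡ a + c * x - k
          lem = solve-∀

    -- To the left and downwards the pixels passed are addressed from the neighbouring cell, hence
    -- the offsets `c ∸ k`.
    hop-anchor : ∀ {p} d → Cell p → Cell (move d p) → ∀ k → k ℕ.≤ c₁ → Anchor (adv d k (base p))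
    hop-anchor {x , y} right cp cp′ k le = subst (λ z → Anchor (_ , z)) (+0 _) (cell-anchor cp k 0 (ℕ.m≤n⇒m≤1+n le) ℕ.z≤n)
    hop-anchor {x , y} up cp cp′ k le = subst (λ z → Anchor (z , _)) (+0 _) (cell-anchor cp 0 k ℕ.z≤n (ℕ.m≤n⇒m≤1+n le))
    hop-anchor {x , y} left cp cp′ k le = subst₂ (λ u v → Anchor (u , v)) (back-step a x k (ℕ.m≤n⇒m≤1+n le)) (+0 _)
        (cell-anchor cp′ (c ℕ.∸ k) 0 (ℕ.m∸n≤m c k) ℕ.z≤n)
    hop-anchor {x , y} down cp cp′ k le = subst₂ (λ u v → Anchor (u , v)) (+0 _) (back-step b y k (ℕ.m≤n⇒m≤1+n le))
        (cell-anchor cp′ 0 (c ℕ.∸ k) ℕ.z≤n (ℕ.m∸n≤m c k))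

    go-cell : ∀ {d p f Q} → Cell p → Cell (move d p) → Q tt (base (move d p)) f → Run (go c₁) d c (base p) f Q
    go-cell {d} {p} {f} {Q} cp cp′ k = go-run c₁ (hop-anchor d cp cp′) (subst (λ z → Q tt z f) (sym (base-move d p)) k)

    hop-run : ∀ {d p f Q} → Cell p → Cell (move d p) → Q d (base (move d p)) f → Run hop d c (base p) f Q
    hop-run cp cp′ k = wp-map (wp-pre (wp-carry (go-cell cp cp′ k)))

    fillRow-run : ∀ n {q f Q} → (∀ i → i ℕ.≤ n → Anchor (adv right i q)) →
      (∀ {f′} → (∀ i → i ℕ.≤ n → f′ (adv right i q) ≡ true) → (∀ r → (∀ i → i ℕ.≤ n → r ≢ adv right i q) → f′ r ≡ f r) → Q tt (adv right (suc n) q)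
          f′) →
      Run (fillRow n) tt (suc n) q f Q
    fillRow-run zero {q} {f} {Q} an k = run-op (subst Anchor (adv-zero right q) (an 0 ℕ.z≤n)) refl
      (k (λ { zero _ → trans (cong (paint q (setBit₀ true (win f q)) f) (adv-zero right q)) (poke-same true q f) })
         (λ r ne → poke-other true q f (λ e → ne 0 ℕ.z≤n (trans e (sym (adv-zero right q))))))
    fillRow-run (suc n) {q} {f} {Q} an k = wp-⟫ {t₁ = 1} $ run-op (subst Anchor (adv-zero right q) (an 0 ℕ.z≤n)) refl $
      fillRow-run n (λ i le → subst Anchor (sym (adv-move right i q)) (an (suc i) (ℕ.s≤s le))) λ {f′} tr same →
      subst (λ z → Q tt z f′) (sym (adv-move right (suc n) q)) (k
        (λ { zero _ → trans (cong f′ (adv-zero right q)) (trans (same q (λ i le e → different i (trans e (adv-move right i q)))) (poke-same true q f))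
           ; (suc i) (ℕ.s≤s le) → trans (cong f′ (sym (adv-move right i q))) (tr i le) })
        (λ r ne → trans (same r (λ i le e → ne (suc i) (ℕ.s≤s le) (trans e (adv-move right i q))))
          (poke-other true q f (λ e → ne 0 ℕ.z≤n (trans e (sym (adv-zero right q)))))))
      where
        x : ℤ
        x = proj₁ q
        different : ∀ i → q ≢ adv right (suc i) q
        different i e = 1≰0 (lin 2 (λ x i → (κ 0 ≼ i) ∷ (x ≐ x ⊕ (κ 1 ⊕ i)) ∷ [] ⊢ κ 1 ≼ κ 0) x (+ i) (0≤+ i) (cong proj₁ e))

    private
      Grid : ℕ → Pixel → Set
      Grid n q = ∀ i j → i ℕ.≤ c → j ℕ.≤ n → Anchor (adv right i (adv up j q))

      Filled : ℕ → Pixel → Picture → Picture → Set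
      Filled n q f f′ = (∀ i j → i ℕ.≤ c₁ → j ℕ.≤ n → f′ (adv right i (adv up j q)) ≡ true) ×
                        (∀ r → (∀ i j → i ℕ.≤ c₁ → j ℕ.≤ n → r ≢ adv right i (adv up j q)) → f′ r ≡ f r)

      row₀ : ∀ i q → adv right i (adv up 0 q) ≡ adv right i q
      row₀ i q = cong (adv right i) (adv-zero up q)

      row-suc : ∀ i j q → adv right i (adv up j (move up q)) ≡ adv right i (adv up (suc j) q)
      row-suc i j q = cong (adv right i) (adv-move up j q)

    line-time : ℕ
    line-time = c ℕ.+ (c ℕ.+ 1)

    fillLine-run : ∀ {q f Q} → Grid 1 q → (∀ {f′} → Filled 0 q f f′ → Q tt (move up q) f′) → Run fillLine tt line-time q f Q
    fillLine-run {q} {f} {Q} an k = wp-⟫ {t₁ = c} $ fillRow-run c₁ (λ i le → row i (ℕ.m≤n⇒m≤1+n le)) λ {f′} tr same →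
      wp-⟫ {t₁ = c} $ wp-map $ wp-pre $ wp-carry $ go-run c₁ (λ j le → subst Anchor (sym (leftward j (ℕ.m≤n⇒m≤1+n le)))
          (row (c ℕ.∸ j) (ℕ.m∸n≤m c j))) $
      wp-at (trans (leftward c ℕ.≤-refl) (trans (cong (λ z → adv right z q) (ℕ.n∸n≡0 c)) (adv-zero right q))) $
      wp-map $ wp-pre $ wp-carry $ go-run 0 (λ { zero _ → subst Anchor (sym (adv-zero up q)) (subst Anchor (adv-zero right q) (row 0 ℕ.z≤n)) }) $
      subst (λ z → Q tt z f′) (trans (sym (adv-zero up (move up q))) (adv-move up 0 q)) $
      k ((λ { i zero li _ → trans (cong f′ (row₀ i q)) (tr i li) }) , λ r ne → same r (λ i li e → ne i 0 li ℕ.z≤n (trans e (sym (row₀ i q)))))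
      where
        row : ∀ i → i ℕ.≤ c → Anchor (adv right i q)
        row i le = subst Anchor (row₀ i q) (an i 0 le ℕ.z≤n)
        leftward : ∀ j → j ℕ.≤ c → adv left j (adv right c q) ≡ adv right (c ℕ.∸ j) q
        leftward j le = trans (cong (λ z → adv left j (adv right z q)) (sym (ℕ.m+[n∸m]≡n le))) (adv-opp right j (c ℕ.∸ j) q)

    fillLines-run : ∀ n {q f Q} → Grid (suc n) q → (∀ {f′} → Filled n q f f′ → Q tt (adv up (suc n) q) f′) →
      Run (fillLines n) tt (suc n ℕ.* line-time) q f Q
    fillLines-run zero {q} {f} {Q} an k = wp-mono (ℕ.≤-reflexive (sym (ℕ.+-identityʳ line-time))) $ fillLine-run an λ {f′} fl →
      subst (λ z → Q tt z f′) (sym (trans (sym (adv-move up 0 q)) (adv-zero up (move up q)))) (k fl)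
    fillLines-run (suc n) {q} {f} {Q} an k = wp-⟫ {t₁ = line-time} $ fillLine-run (λ i j li lj → an i j li (ℕ.≤-trans lj (ℕ.s≤s ℕ.z≤n))) λ {f₁}
        (tr₁ , same₁) →
      fillLines-run n (λ i j li lj → subst Anchor (sym (row-suc i j q)) (an i (suc j) li (ℕ.s≤s lj))) λ {f′} (tr , same) →
      subst (λ z → Q tt z f′) (sym (adv-move up (suc n) q)) (k
        ((λ { i zero li _ → trans (same (adv right i (adv up 0 q)) (λ i′ j′ _ _ e → different i i′ j′ (trans e (row-suc i′ j′ q)))) (tr₁ i 0 li ℕ.z≤n)
            ; i (suc j) li (ℕ.s≤s lj) → trans (cong f′ (sym (row-suc i j q))) (tr i j li lj) }) ,
         λ r ne → trans (same r (λ i j li lj e → ne i (suc j) li (ℕ.s≤s lj) (trans e (row-suc i j q))))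
             (same₁ r (λ { i zero li _ e → ne i 0 li ℕ.z≤n e }))))
      where
        y : ℤ
        y = proj₂ q
        different : ∀ i i′ j′ → adv right i (adv up 0 q) ≢ adv right i′ (adv up (suc j′) q)
        different i i′ j′ e = 1≰0 (lin 2 (λ y j → (κ 0 ≼ j) ∷ (y ⊕ κ 0 ≐ y ⊕ (κ 1 ⊕ j)) ∷ [] ⊢ κ 1 ≼ κ 0) y (+ j′) (0≤+ j′) (cong proj₂ e))

    fill-time : ℕ
    fill-time = c ℕ.* line-time ℕ.+ c

    fill-run : ∀ {p M f f₀ Q} → Cell p → Rendered f M → Outside f f₀ →
      (∀ {f′} → Rendered f′ (upd p full M) → Outside f′ f₀ → Q tt (base p) f′) → Run fill tt fill-time (base p) f Q
    fill-run {p} {M} {f} {f₀} {Q} cp rd out k = wp-⟫ {t₁ = c ℕ.* line-time} $ fillLines-run c₁ (λ i j li lj → cell-anchor cp i j li lj) λ {f′}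
        (tr , same) →
      wp-map $ wp-pre $ wp-carry $ go-run c₁ (λ j le → subst Anchor (sym (downward j (ℕ.m≤n⇒m≤1+n le)))
          (subst (λ z → Anchor (z , b + + c * proj₂ p + + (c ℕ.∸ j))) (+0 _) (cell-anchor cp 0 (c ℕ.∸ j) ℕ.z≤n (ℕ.m∸n≤m c j)))) $
      subst (λ z → Q tt z f′) (sym (trans (downward c ℕ.≤-refl) (trans (cong (λ z → adv up z (base p)) (ℕ.n∸n≡0 c)) (adv-zero up (base p))))) $
      k (record { shown = λ {p′} → rendered {f′} tr same p′ (p′ ≟P p) })
          (record { kept = λ q ne → trans (same q (λ i j li lj → ne cp i j (ℕ.s≤s li) (ℕ.s≤s lj))) (out .kept q ne) })
      where
        downward : ∀ j → j ℕ.≤ c → adv down j (adv up c (base p)) ≡ adv up (c ℕ.∸ j) (base p)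
        downward j le = trans (cong (λ z → adv down j (adv up z (base p))) (sym (ℕ.m+[n∸m]≡n le))) (adv-opp up j (c ℕ.∸ j) (base p))
        rendered : ∀ {f′} → (∀ i j → i ℕ.≤ c₁ → j ℕ.≤ c₁ → f′ (pix p i j) ≡ true) →
            (∀ r → (∀ i j → i ℕ.≤ c₁ → j ℕ.≤ c₁ → r ≢ pix p i j) → f′ r ≡ f r) →
          ∀ p′ → Dec (p′ ≡ p) → Cell p′ → ∀ i j → i ℕ.< c → j ℕ.< c → f′ (pix p′ i j) ≡ bitAt (upd p full M p′) i j
        rendered tr same p′ (yes refl) cp′ i j (ℕ.s≤s li) (ℕ.s≤s lj) = trans (tr i j li lj)
            (sym (trans (cong (λ k → bitAt k i j) (upd-same p full M)) (bitAt-full i j)))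
        rendered tr same p′ (no ne) cp′ i j li lj = trans (same (pix p′ i j)
            (λ i′ j′ li′ lj′ e → ne (proj₁ (pix-unique {p′} {p} li lj (ℕ.s≤s li′) (ℕ.s≤s lj′) e))))
          (trans (rd .shown cp′ i j li lj) (cong (λ k → bitAt k i j) (sym (upd-other full M ne))))

    -- Reversing and restoring the pointers along the path.

    module Walking (root : Pixel) where
      open Path root

      -- Rev M₀ ds M: M arises from M₀ by reversing the pointers below the tip.
      data Rev (M₀ : Store) : List Dir → Store → Set where
        none : ∀ {M} → M ≗ M₀ → Rev M₀ [] M
        turn : ∀ {d ds M₁ M} → Rev M₀ ds M₁ → M₁ (tip ds) ≡ ptr d → M ≗ upd (tip ds) (backCode (previous ds)) M₁ → Rev M₀ (d ∷ ds) M

      rev-get : ∀ {M₀ ds M q} → Rev M₀ ds M → q ∉ below ds → M q ≡ M₀ q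
      rev-get (none e) ne = e _
      rev-get {q = q} (turn {ds = ds} {M₁} r _ e) ne = trans (e q) (trans (upd-other _ M₁ (λ h → ne (here h))) (rev-get r (ne ∘ there)))

      -- Updates away from the reversed part commute with the reversal. So a change made at the tip
      -- while the pointers are reversed becomes a change of the original store once they are
      -- restored.
      rev-upd : ∀ {M₀ ds M q k} → Rev M₀ ds M → q ∉ below ds → Rev (upd q k M₀) ds (upd q k M)
      rev-upd {q = q} {k} (none e) ne = none (upd-ext q k (λ r _ → e r))
      rev-upd {q = q} {k} (turn {ds = ds} {M₁} r h e) ne = turn (rev-upd r (ne ∘ there)) (trans (upd-other k M₁ (λ x → ne (here (sym x)))) h)
        (λ s → trans (upd-ext q k (λ t _ → e t) s) (upd-swap k _ M₁ (λ x → ne (here x)) s))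

      -- Holding for all prefixes, `fresh` excludes repetitions on the path, so one pointer per cell
      -- suffices.
      record Sound (ds : List Dir) : Set where
        constructor sound
        field
          cell  : Cell (tip ds)
          fresh : tip ds ∉ below ds
      open Sound public

      -- The path seen from a point on it: `ds` has been walked, `es` lies ahead. An ascent consumes
      -- the first step first, while `ds` has the last step at its head; hence the reversals by
      -- `_ʳ++_`.
      data Ahead (M₀ : Store) : List Dir → List Dir → Set where
        end : ∀ {ds} → Sound ds → M₀ (tip ds) ≡ stop → Ahead M₀ ds []
        via : ∀ {ds e es} → Sound ds → M₀ (tip ds) ≡ ptr e → Ahead M₀ (e ∷ ds) es → Ahead M₀ ds (e ∷ es)

      ahead-cell : ∀ {M₀ ds es} → Ahead M₀ ds es → Cell (tip ds)
      ahead-cell (end s _)  = cell s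
      ahead-cell (via s _ _) = cell s

      data Chain (M : Store) : List Dir → Set where
        []  : Chain M []
        _∷_ : ∀ {d ds} → Sound ds × M (tip ds) ≡ ptr d → Chain M ds → Chain M (d ∷ ds)

      chain-ahead : ∀ {M ds es} → Chain M ds → Ahead M ds es → Ahead M [] (ds ʳ++ es)
      chain-ahead []             a = a
      chain-ahead ((s , e) ∷ ch) a = chain-ahead ch (via s e a)

      private
        live : ∀ pv → isFull (backCode pv) ≡ false
        live nothing  = refl
        live (just _) = refl

        follow-eq : ∀ {f M p k} pv → Rendered f M → Cell p → M p ≡ k → follow pv (win f (base p)) ≡ followCase pv k
        follow-eq {M = M} {p} pv rd cp e = cong (followCase pv) (trans (cong decode (read-cell rd cp)) (trans (decode-code (M p)) e))

      ascend-run : ∀ es {ds M₀ M f f₀ Q} → Rev M₀ ds M → Ahead M₀ ds es → Rendered f M → Outside f f₀ →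
        (∀ {M f} → Rev M₀ (es ʳ++ ds) M → Rendered f M → Outside f f₀ → Q (previous (es ʳ++ ds)) (base (tip (es ʳ++ ds))) f) →
        Run ascend (previous ds) (suc (length es) ℕ.* (1 ℕ.+ c)) (base (tip ds)) f Q
      ascend-run [] {ds} rv (end s e) rd out k = wp-loop {t₁ = 1 ℕ.+ c} {t₂ = 0} $ wp-mono (ℕ.s≤s (ℕ.s≤s ℕ.z≤n)) $ wp-⟫ {t₁ = 1} {t₂ = 1} $
        run-op (base-anchor (cell s)) (follow-eq (previous ds) rd (cell s) (trans (rev-get rv (fresh s)) e)) $
        wp-choice₂ $ run-op (base-anchor (cell s)) refl (k rv rd out)
      ascend-run (e ∷ es) {ds} {M = M} rv (via s h a) rd out k = wp-loop {t₁ = 1 ℕ.+ c} {t₂ = suc (length es) ℕ.* (1 ℕ.+ c)} $ wp-⟫ {t₁ = 1} $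
        run-op (base-anchor (cell s)) (follow-eq (previous ds) rd (cell s) (trans (rev-get rv (fresh s)) h)) $
        wp-choice₁ $ wp-map $ hop-run (cell s) (ahead-cell a) $
        ascend-run es (turn rv M≡ (λ _ → refl)) a
          (write-cell (backCode (previous ds)) rd (cell s) (cong isFull M≡) (live (previous ds))) (outside-paint (cell s) out) k
        where M≡ : M (tip ds) ≡ ptr e
              M≡ = trans (rev-get rv (fresh s)) h

      prevOf-back : ∀ pv → prevOf (backCode pv) ≡ pv
      prevOf-back nothing  = refl
      prevOf-back (just e) = refl

      ret-run : ∀ ds {M₀ M f f₀ Q} → Rev M₀ ds M → (∀ {q} → q ∈ tip ds ∷ below ds → Cell q) → Rendered f M → Outside f f₀ →
        (∀ {f} → Rendered f M₀ → Outside f f₀ → Q tt (base root) f) →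
        Run ret (previous ds) (suc (length ds) ℕ.* (1 ℕ.+ c)) (base (tip ds)) f Q
      ret-run [] (none e) cells rd out k = wp-loop {t₁ = 1 ℕ.+ c} {t₂ = 0} $ wp-mono (ℕ.s≤s ℕ.z≤n) $ wp-pre $ wp-choice₂ {t = 1} $
        run-op (base-anchor (cells (here refl))) refl (k (rendered-cong e rd) out)
      ret-run (d ∷ ds) {M = M} {f} {f₀} (turn {M₁ = M₁} rv h e) cells rd out k = wp-loop {t₁ = 1 ℕ.+ c} {t₂ = suc (length ds) ℕ.* (1 ℕ.+ c)} $
        wp-mono (ℕ.≤-reflexive (ℕ.+-comm c 1)) $ wp-pre $ wp-choice₁ $ wp-⟫ {t₁ = c} $ hop-run (cells (here refl)) (subst Cell (sym here≡) cp) $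
        wp-at (cong base here≡) $ run-op (base-anchor cp) eq $
        ret-run ds rv (cells ∘ there) (rendered-cong restored (write-cell (ptr d) rd cp (trans (cong isFull M≡) (live (previous ds))) refl))
            (outside-paint cp out) k
        where
          here≡ : move (opp d) (move d (tip ds)) ≡ tip ds
          here≡ = move-opp d (tip ds)
          cp : Cell (tip ds)
          cp = cells (there (here refl))
          M≡ : M (tip ds) ≡ backCode (previous ds)
          M≡ = trans (e (tip ds)) (upd-same (tip ds) _ M₁)
          eq : unwind (opp d) (win f (base (tip ds))) ≡ (inj₁ (previous ds) , just (codeWin (ptr d)) , nothing)
          eq = trans (cong₂ (λ k d → inj₁ (prevOf k) , just (codeWin (ptr d)) , nothing)
              (trans (cong decode (read-cell rd cp)) (trans (decode-code (M (tip ds))) M≡)) (opp-opp d))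
            (cong (λ pv → inj₁ pv , just (codeWin (ptr d)) , nothing) (prevOf-back (previous ds)))
          restored : upd (tip ds) (ptr d) M ≗ M₁
          restored r = trans (upd-ext (tip ds) (ptr d) (λ t ne → trans (e t) (upd-other _ M₁ ne)) r) (upd-id h r)

      -- Reversal turns pointers into pointers or `stop`, so a cell can be tested for emptiness
      -- while the pointers are reversed.
      rev-empty : ∀ {M₀ ds M} → Rev M₀ ds M → ∀ q → isEmpty (M q) ≡ isEmpty (M₀ q)
      rev-empty (none e) q = cong isEmpty (e q)
      rev-empty (turn {d} {ds} {M₁} r h e) q with q ≟P tip ds
      ... | no ne    = trans (cong isEmpty (trans (e q) (upd-other _ M₁ ne))) (rev-empty r q)
      ... | yes refl = trans (trans (cong isEmpty (trans (e q) (upd-same q _ M₁))) (busy (previous ds)))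
          (trans (sym (cong isEmpty h)) (rev-empty r q))
        where busy : ∀ pv → isEmpty (backCode pv) ≡ false
              busy nothing  = refl
              busy (just _) = refl

      rev-congʳ : ∀ {M₀ ds M M′} → M ≗ M′ → Rev M₀ ds M → Rev M₀ ds M′
      rev-congʳ e (none h)     = none (λ r → trans (sym (e r)) (h r))
      rev-congʳ e (turn r h g) = turn r h (λ s → trans (sym (e s)) (g s))

      private
        empty-code : ∀ {k} → isEmpty k ≡ true → k ≡ empty
        empty-code {empty} _ = refl

      attempt-run : ∀ {ds M₀ M f f₀ d Q} → Rev M₀ ds M → Sound ds → M₀ (tip ds) ≡ stop → Cell (move d (tip ds)) →
        (M₀ (move d (tip ds)) ≡ empty → move d (tip ds) ∉ below ds) → Rendered f M → Outside f f₀ →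
        (M₀ (move d (tip ds)) ≡ empty → ∀ {M f} → Rev (upd (tip ds) (ptr d) (upd (move d (tip ds)) stop M₀)) ds M → Rendered f M → Outside f f₀ →
          Q (extended , previous ds) (base (tip ds)) f) →
        (isEmpty (M₀ (move d (tip ds))) ≡ false → Q (refused , previous ds) (base (tip ds)) f) →
        Run attempt (d , previous ds) (c ℕ.+ (1 ℕ.+ (c ℕ.+ 1))) (base (tip ds)) f Q
      attempt-run {ds} {M₀} {M} {f} {f₀} {d} {Q} rv s top cn new rd out kx kr =
        wp-⟫ {t₁ = c} $ wp-pre $ wp-carry $ go-cell (cell s) cn $ look (isEmpty (M₀ n)) refl
        where
          n : Pixel
          n = move d (tip ds)
          home : move (opp d) n ≡ tip ds
          home = move-opp d (tip ds)
          rest : Prog ((Dir × Maybe Dir) × ⊤) (Ans × Maybe Dir)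
          rest = op (λ (x , _) w → tryCase x (isEmpty (decode w))) ⟫ carry (Bool × Dir × Maybe Dir) (go c₁) ⟫ op (λ (x , _) _ → answer x)
          eq : ∀ v → isEmpty (M₀ n) ≡ v → tryCase (d , previous ds) (isEmpty (decode (win f (base n)))) ≡ tryCase (d , previous ds) v
          eq v e = cong (tryCase (d , previous ds)) (trans (cong isEmpty (trans (cong decode (read-cell rd cn)) (decode-code (M n))))
              (trans (rev-empty rv n) e))
          M-tip : M (tip ds) ≡ stop
          M-tip = trans (rev-get rv (fresh s)) top
          look : ∀ v → isEmpty (M₀ n) ≡ v → Run rest ((d , previous ds) , tt) (1 ℕ.+ (c ℕ.+ 1)) (base n) f Q
          look false e = wp-⟫ {t₁ = 1} $ run-op (base-anchor cn) (eq false e) $ wp-⟫ {t₁ = c} $ wp-carry $ go-cell cn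
              (subst Cell (sym home) (cell s)) $
            wp-at (cong base home) $ run-op (base-anchor (cell s)) refl (kr e)
          look true e = wp-⟫ {t₁ = 1} $ run-op (base-anchor cn) (eq true e) $ wp-⟫ {t₁ = c} $ wp-carry $ go-cell cn (subst Cell (sym home) (cell s)) $
            wp-at (cong base home) $ run-op (base-anchor (cell s)) refl $
            kx (empty-code e) (rev-upd (rev-upd rv (new (empty-code e))) (fresh s))
              (write-cell (ptr d) (write-cell stop rd cn (trans (cong isFull Mn) refl) refl) (cell s)
                  (trans (cong isFull (trans (upd-other stop M tip≢n) M-tip)) refl) refl)
              (outside-paint (cell s) (outside-paint cn out))
            where
              Mn : M n ≡ empty
              Mn = empty-code (trans (rev-empty rv n) e)
              tip≢n : tip ds ≢ n
              tip≢n h with trans (sym M-tip) (trans (cong M h) Mn)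
              ... | ()

      shorten-time : ℕ
      shorten-time = fill-time ℕ.+ (c ℕ.+ 1)

      complete-last : ∀ {M₀ M f f₀ Q} → Rev M₀ [] M → Sound [] → Rendered f M → Outside f f₀ →
        (∀ {f} → Rendered f (upd root full M₀) → Outside f f₀ → Q (done , nothing) (base root) f) →
        Run complete nothing shorten-time (base root) f Q
      complete-last (none e) s rd out k = wp-⟫ {t₁ = fill-time} $ wp-map $ wp-pre $ wp-carry $ fill-run (cell s) rd out λ rd′ out′ →
        wp-mono (ℕ.m≤n+m 1 c) $ wp-pre $ wp-choice₂ $ run-op (base-anchor (cell s)) refl
            (k (rendered-cong (upd-ext root full (λ r _ → e r)) rd′) out′)

      -- The reversed pointer of the parent is exactly the information needed for the return from
      -- the shortened path. It is read before `stop` overwrites it.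
      complete-run : ∀ {d ds M₀ M f f₀ Q} → Rev M₀ (d ∷ ds) M → Sound (d ∷ ds) → Sound ds → Rendered f M → Outside f f₀ →
        (∀ {M f} → Rev (upd (tip ds) stop (upd (tip (d ∷ ds)) full M₀)) ds M → Rendered f M → Outside f f₀ →
          Q (finished (opp d) , previous ds) (base (tip ds)) f) →
        Run complete (just (opp d)) shorten-time (base (tip (d ∷ ds))) f Q
      complete-run {d} {ds} {M₀} {M} {f} {f₀} {Q} (turn {M₁ = M₁} rv h e) s s′ rd out k =
        wp-⟫ {t₁ = fill-time} $ wp-map $ wp-pre $ wp-carry $ fill-run (cell s) rd out λ rd′ out′ →
        wp-pre $ wp-choice₁ $ wp-⟫ {t₁ = c} $ hop-run (cell s) (subst Cell (sym home) (cell s′)) $ wp-at (cong base home) $ last ds refl rd′ out′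
        where
          home : move (opp d) (tip (d ∷ ds)) ≡ tip ds
          home = move-opp d (tip ds)
          t≢ : tip ds ≢ tip (d ∷ ds)
          t≢ x = fresh s (here (sym x))
          F : Store
          F = upd (tip (d ∷ ds)) full M
          F≡ : F (tip ds) ≡ backCode (previous ds)
          F≡ = trans (upd-other full M t≢) (trans (e (tip ds)) (upd-same (tip ds) _ M₁))
          target : upd (tip ds) stop F ≗ upd (tip ds) stop (upd (tip (d ∷ ds)) full M₁)
          target = upd-ext (tip ds) stop agree
            where
              agree : ∀ r → r ≢ tip ds → upd (tip (d ∷ ds)) full M r ≡ upd (tip (d ∷ ds)) full M₁ r
              agree r ne with r ≟P tip (d ∷ ds)
              ... | yes refl = trans (upd-same r full M) (sym (upd-same r full M₁))
              ... | no ne′   = trans (upd-other full M ne′) (trans (trans (e r) (upd-other _ M₁ ne)) (sym (upd-other full M₁ ne′)))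
          rv′ : Rev (upd (tip ds) stop (upd (tip (d ∷ ds)) full M₀)) ds (upd (tip ds) stop (upd (tip (d ∷ ds)) full M₁))
          rv′ = rev-upd (rev-upd rv (fresh s ∘ there)) (fresh s′)
          eq : ∀ {f} pv → backCode (previous ds) ≡ backCode pv → Rendered f F → shorten (opp d) (decode (win f (base (tip ds)))) ≡ shorten (opp d)
              (backCode pv)
          eq pv h rd = cong (shorten (opp d)) (trans (cong decode (read-cell rd (cell s′))) (trans (decode-code (F (tip ds))) (trans F≡ h)))
          last : ∀ {f} es → es ≡ ds → Rendered f F → Outside f f₀ → Run (op (λ e w → shorten e (decode w))) (opp d) 1 (base (tip ds)) f Q
          -- With the root as parent the code `stop` is in place, and the update is the identity by
          -- `upd-id`.
          last [] refl rd out = run-op (base-anchor (cell s′)) (eq nothing refl rd)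
            (k (rev-congʳ (λ r → sym (target r)) rv′) (rendered-cong (λ r → sym (upd-id F≡ r)) rd) out)
          last (e′ ∷ es) refl rd out = run-op (base-anchor (cell s′)) (eq (just (opp e′)) refl rd)
            (k (rev-congʳ (λ r → sym (target r)) rv′) (write-cell stop rd (cell s′) (cong isFull F≡) refl) (outside-paint (cell s′) out))

      record Standing (M : Store) (ds : List Dir) : Set where
        field
          ok    : Sound ds
          top   : M (tip ds) ≡ stop
          chain : Chain M ds

      path-cell : ∀ {M ds} → Standing M ds → ∀ {q} → q ∈ tip ds ∷ below ds → Cell q
      path-cell st (here refl) = cell (Standing.ok st)
      path-cell st (there i)   = lower (Standing.chain st) i
        where lower : ∀ {M ds q} → Chain M ds → q ∈ below ds → Cell q
              lower ((s , _) ∷ ch) (here refl) = cell s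
              lower (_ ∷ ch)       (there i)   = lower ch i

      serve-time : ℕ → ℕ
      serve-time l = suc l ℕ.* (1 ℕ.+ c) ℕ.+ ((c ℕ.+ (1 ℕ.+ (c ℕ.+ 1)) ℕ.+ shorten-time) ℕ.+ suc l ℕ.* (1 ℕ.+ c))

      private
        ascended : ∀ {ds M f Q t} {r : Prog (Maybe Dir × Maybe Dir) Ans} req → Standing M ds → Rendered f M →
          (∀ {M′ f′} → Rev M ds M′ → Rendered f′ M′ → Outside f′ f → Run r (req , previous ds) t (base (tip ds)) f′ Q) →
          Run (pre (_, nothing) (carry (Maybe Dir) ascend) ⟫ r) req (suc (length ds) ℕ.* (1 ℕ.+ c) ℕ.+ t) (base root) f Q
        ascended {ds} {M} {f} {Q} {t} {r} req st rd k = wp-⟫ $ wp-pre $ wp-carry $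
          wp-mono (ℕ.≤-reflexive (cong (λ n → suc n ℕ.* (1 ℕ.+ c)) (trans (length-ʳ++ ds) (ℕ.+-identityʳ _)))) $
          ascend-run (ds ʳ++ []) (none λ _ → refl) (chain-ahead (Standing.chain st) (end (Standing.ok st) (Standing.top st))) rd
              (record { kept = λ _ _ → refl }) $
          subst (λ z → ∀ {M′ f′} → Rev M z M′ → Rendered f′ M′ → Outside f′ f → Run r (req , previous z) t (base (tip z)) f′ Q)
            (sym (trans (ʳ++-ʳ++ ds {[]} {[]}) (++-identityʳ ds))) k

        returned : ∀ {ds M₀ M f f₀ Q l ans} → Rev M₀ ds M → (∀ {q} → q ∈ tip ds ∷ below ds → Cell q) → Rendered f M → Outside f f₀ → length ds ℕ.≤ l →
          (∀ {f} → Rendered f M₀ → Outside f f₀ → Q ans (base root) f) →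
          Run (post proj₁ (carry Ans ret)) (ans , previous ds) (suc l ℕ.* (1 ℕ.+ c)) (base (tip ds)) f Q
        returned {ds} rv cells rd out le k = wp-mono (ℕ.*-monoˡ-≤ (1 ℕ.+ c) (ℕ.s≤s le)) $ wp-map $ wp-carry $ ret-run ds rv cells rd out k

      serve-try : ∀ {ds M f d Q} → Standing M ds → Cell (move d (tip ds)) → (M (move d (tip ds)) ≡ empty → move d (tip ds) ∉ below ds) → Rendered f
          M →
        (M (move d (tip ds)) ≡ empty → ∀ {f′} → Rendered f′ (upd (tip ds) (ptr d) (upd (move d (tip ds)) stop M)) → Outside f′ f → Q extended
            (base root) f′) →
        (isEmpty (M (move d (tip ds))) ≡ false → ∀ {f′} → Rendered f′ M → Outside f′ f → Q refused (base root) f′) →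
        Run serve (just d) (serve-time (length ds)) (base root) f Q
      serve-try {ds} {d = d} st cn new rd kx kr = ascended (just d) st rd λ rv rd out →
        wp-⟫ {t₁ = c ℕ.+ (1 ℕ.+ (c ℕ.+ 1)) ℕ.+ shorten-time} $ wp-mono (ℕ.m≤m+n _ shorten-time) $ wp-pre $ wp-choice₁ $
        attempt-run rv (Standing.ok st) (Standing.top st) cn new rd out
          (λ e rv rd out → returned rv (path-cell st) rd out ℕ.≤-refl (kx e))
          (λ e → returned rv (path-cell st) rd out ℕ.≤-refl (kr e))

      serve-last : ∀ {M f Q} → Standing M [] → Rendered f M →
        (∀ {f′} → Rendered f′ (upd root full M) → Outside f′ f → Q done (base root) f′) →
        Run serve nothing (serve-time 0) (base root) f Q
      serve-last st rd k = ascended nothing st rd λ rv rd out →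
        wp-⟫ {t₁ = c ℕ.+ (1 ℕ.+ (c ℕ.+ 1)) ℕ.+ shorten-time} $ wp-mono (ℕ.m≤n+m shorten-time (c ℕ.+ (1 ℕ.+ (c ℕ.+ 1)))) $ wp-pre $ wp-choice₂ $
        complete-last rv (Standing.ok st) rd out λ rd out → returned {ds = []} (none λ _ → refl) (path-cell st) rd out ℕ.≤-refl k

      serve-finish : ∀ {d ds M f Q} → Standing M (d ∷ ds) → Rendered f M →
        (∀ {f′} → Rendered f′ (upd (tip ds) stop (upd (tip (d ∷ ds)) full M)) → Outside f′ f → Q (finished (opp d)) (base root) f′) →
        Run serve nothing (serve-time (suc (length ds))) (base root) f Q
      serve-finish {d} {ds} st rd k = ascended nothing st rd λ rv rd out →
        wp-⟫ {t₁ = c ℕ.+ (1 ℕ.+ (c ℕ.+ 1)) ℕ.+ shorten-time} $ wp-mono (ℕ.m≤n+m shorten-time (c ℕ.+ (1 ℕ.+ (c ℕ.+ 1)))) $ wp-pre $ wp-choice₂ $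
        complete-run rv (Standing.ok st) (first-sound (Standing.chain st)) rd out λ rv rd out → returned rv (path-cell st ∘ there) rd out (ℕ.n≤1+n _)
            k
        where first-sound : ∀ {M} → Chain M (d ∷ ds) → Sound ds
              first-sound ((s , _) ∷ _) = s

open ScaledCopy

-- Depth-first search over the tiles.

module DepthFirstSearch where

  open import Data.Integer using (_+_; _-_; _≤_; _*_)

  -- A horizontal move shifts the tile pebble and its shadow as the two ends of a line; a vertical
  -- one concerns the tile pebble alone. Both kinds leave the robot at the shadow. The shadow hides
  -- nothing but a `blank` window.
  orient : Dir × Win → Ctx ⊎ (Dir × Win)
  orient (up    , w) = inj₂ (up , w)
  orient (down  , w) = inj₂ (down , w)
  orient (left  , w) = inj₁ (up , left , blank , w)
  orient (right , w) = inj₁ (up , right , blank , w)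

  -- Moves the pebble on the current tile, and its shadow on the bottom side of the
  -- frame, in the given direction.
  moveTo : Prog (Dir × Win) Win
  moveTo = pre orient (choice (post proj₂ shift)
        (op (λ (d , w) _ → d , just w , just d) ⟫ op (λ _ w → w , just peb , nothing) ⟫ steps down 1
          ⟫ post proj₁ (pre (λ w → w , down , false) (carry Win scan))))
      ⟫ walk up

  -- After every extension or completion the trial starts over with `right`. This costs a constant
  -- factor: neighbours seen before are refused, since their cells are not empty.
  nextDir : Dir → Maybe Dir
  nextDir right = just up
  nextDir up    = just left
  nextDir left  = just down
  nextDir down  = nothing

  -- Runs a program at the root of the copy.
  trip : ∀ {A B X : Set} → ⦃ Finite A ⦄ → ⦃ Finite B ⦄ → ⦃ Finite X ⦄ → Prog A B → Prog (X × A) (X × B)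
  trip {X = X} p = walk down ⟫ walk right ⟫ steps right 2 ⟫ carry X p ⟫ steps left 2 ⟫ walk left ⟫ walk up

  module SearchProgram (c₁ : ℕ) where
    open CopyProgram c₁

    visit : ∀ {X : Set} → ⦃ Finite X ⦄ → Prog (X × Maybe Dir) (X × Ans)
    visit {X} ⦃ F ⦄ = trip ⦃ finite-Maybe ⦄ ⦃ finite-Ans ⦄ ⦃ F ⦄ serve

    occupied? : Dir × Win → (Dir × Win) ⊎ (Dir × Win)
    occupied? (d , w) = branch ((d , w) , bit₀ w)

    outcome : (Dir × Win) × Ans → Win ⊎ (Dir × Win)
    outcome ((d , w) , extended) = inj₁ w
    outcome ((d , w) , _)        = inj₂ (d , w)

    -- The pebble moves before it is known whether a tile is there: the window hidden at the new
    -- place, remembered on arrival, gives the answer, and after a refusal the pebble moves back.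
    explore : Prog (Dir × Win) (Win × Maybe Dir)
    explore = pre (λ (d , w) → d , d , w) (carry Dir moveTo)
      ⟫ pre occupied? (choice (pre (λ (d , w) → (d , w) , just d) visit) (op (λ x _ → (x , refused) , nothing , nothing)))
      ⟫ pre outcome (choice (op (λ w _ → (w , just right) , nothing , nothing))
          (post (λ (d , w) → w , nextDir d) (pre (λ (d , w) → d , opp d , w) (carry Dir moveTo))))

    settle : Win × Ans → Win ⊎ (Dir × Win)
    settle (w , finished e) = inj₂ (e , w)
    settle (w , _)          = inj₁ w

    leave : Prog Win ((Win × Maybe Dir) ⊎ Win)
    leave = pre (_, nothing) visit
      ⟫ pre settle (choice (op (λ w _ → inj₂ w , nothing , nothing)) (post (λ w → inj₁ (w , just right)) moveTo))

    task : Win × Maybe Dir → (Dir × Win) ⊎ Win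
    task (w , just d)  = inj₁ (d , w)
    task (w , nothing) = inj₂ w

    searchStep : Prog (Win × Maybe Dir) ((Win × Maybe Dir) ⊎ Win)
    searchStep = pre task (choice (post inj₁ explore) leave)

    search : Prog (Win × Maybe Dir) Win
    search = loop searchStep

  record Instance (sur : Surroundings) (sid : Sides sur) : Set where
    constructor inst
    open Surroundings sur
    open Sides sid
    field
      X⁻≤X⁺ : X⁻ ≤ X⁺
      T : Picture
      legal : ∀ q → isPeb (win T q) ≡ false
      bounded : ∀ {x y} → T (x , y) ≡ true → (X⁻ ≤ x × x ≤ X⁺) × (Y⁻ ≤ y × y ≤ Y⁺)
      y₀ : ℤ
      root-tile : T (X⁻ , y₀) ≡ true
      c₁ : ℕ
      1≤c₁ : 1 ℕ.≤ c₁
      cell-anchor : ∀ {x y} → T (x , y) ≡ true → ∀ i j → i ℕ.≤ suc c₁ → j ℕ.≤ suc c₁ →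
        Anchor (xr + + 3 - + suc c₁ * X⁻ + + suc c₁ * x + + i , yb - + suc c₁ * y₀ + + suc c₁ * y + + j)

  -- The configuration of pebbles and copy during the search.

  module Searching (sur : Surroundings) (sid : Sides sur) (ins : Instance sur sid) where
    open Surroundings sur
    open Sides sid
    open Instance ins

    open Columns sur sid public
    open CopyProgram c₁
    open SearchProgram c₁ public

    -- Chosen so that the cell of `root` begins three pixels to the right of the lower right pebble,
    -- past its window. The copy may extend below the bottom side, but not to the left of that cell.
    a b : ℤ
    a = xr + + 3 - + suc c₁ * X⁻
    b = yb - + suc c₁ * y₀

    Cell : Pixel → Set
    Cell q = T q ≡ true

    root : Pixel
    root = X⁻ , y₀

    open Cells Anchor c₁ 1≤c₁ a b Cell cell-anchor public
    open Walking root public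
    open Path root public

    base-root : base root ≡ (xr + + 3 , yb)
    base-root = cong₂ _,_ (lin 2 (λ z u → [] ⊢ z ⊖ u ⊕ u ≐ z) (xr + + 3) (+ suc c₁ * X⁻)) (lin 2 (λ z u → [] ⊢ z ⊖ u ⊕ u ≐ z) yb (+ suc c₁ * y₀))

    -- The polyomino on the left, the given picture on the right.
    bg : Picture → Picture
    bg f (x , y) with x ℤ.≤? xr + + 2
    ... | yes _ = T (x , y)
    ... | no _  = f (x , y)

    bg-left : ∀ f {x y} → x ≤ xr + + 2 → bg f (x , y) ≡ T (x , y)
    bg-left f {x} h with x ℤ.≤? xr + + 2
    ... | yes _ = refl
    ... | no ¬h = ⊥-elim (¬h h)

    bg-right : ∀ f {x y} → xr + + 3 ≤ x → bg f (x , y) ≡ f (x , y)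
    bg-right f {x} h with x ℤ.≤? xr + + 2
    ... | yes h′ = ⊥-elim (1≰0 (lin 2 (λ x xr → (xr ⊕ κ 3 ≼ x) ∷ (x ≼ xr ⊕ κ 2) ∷ [] ⊢ κ 1 ≼ κ 0) x xr h h′))
    ... | no _   = refl

    side-of : ∀ x → x ≤ xr + + 2 ⊎ xr + + 3 ≤ x
    side-of x with ≤-or-> (xr + + 3) x
    ... | inj₁ h = inj₂ h
    ... | inj₂ h = inj₁ (lin 2 (λ x xr → (x ⊕ κ 1 ≼ xr ⊕ κ 3) ∷ [] ⊢ x ≼ xr ⊕ κ 2) x xr h)

    bg-win : ∀ f {x y} → x ≤ xr → win (bg f) (x , y) ≡ win T (x , y)
    bg-win f {x} {y} h = win-ext {bg f} {T} (x , y) λ (u , w) ((_ , i) , _) → bg-left f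
        (lin 3 (λ x u xr → (x ≼ xr) ∷ (u ≼ x ⊕ κ 1) ∷ [] ⊢ u ≼ xr ⊕ κ 2) x u xr h i)

    ground : ∀ f → Ground (bg f)
    ground f = record
      { legal = λ x y h → trans (cong isPeb (bg-win f h)) (legal (x , y))
      ; bounds = λ h e → bounded (trans (sym (bg-left f h)) e) }

    -- The shadow is the lower left pebble of the frame, displaced along the bottom side. When the
    -- search is back at the root, the frame is complete again and ready for the sweep.
    pebs : Pixel → List Pixel
    pebs (x , y) = (x , y) ∷ (x , yb) ∷ (X⁻ , yt) ∷ rights

    Agree : Picture → Picture → Set
    Agree f f′ = ∀ x y → xr + + 3 ≤ x → f′ (x , y) ≡ f (x , y)

    -- Wide enough to include the neighbours of tiles, which the search enters before it knows
    -- whether they are tiles.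
    record Near (p : Pixel) : Set where
      constructor near
      field
        l : X⁻ - + 1 ≤ proj₁ p
        r : proj₁ p ≤ X⁺ + + 1
        d : Y⁻ - + 1 ≤ proj₂ p
        u : proj₂ p ≤ Y⁺ + + 1

    near-cell : ∀ {p} → Cell p → Near p
    near-cell {x , y} t = let (h₁ , h₂) , (h₃ , h₄) = bounded t in
      near (lin 2 (λ X⁻ x → (X⁻ ≼ x) ∷ [] ⊢ X⁻ ⊖ κ 1 ≼ x) X⁻ x h₁) (lin 2 (λ X⁺ x → (x ≼ X⁺) ∷ [] ⊢ x ≼ X⁺ ⊕ κ 1) X⁺ x h₂)
          (lin 2 (λ X⁻ x → (X⁻ ≼ x) ∷ [] ⊢ X⁻ ⊖ κ 1 ≼ x) Y⁻ y h₃) (lin 2 (λ X⁺ x → (x ≼ X⁺) ∷ [] ⊢ x ≼ X⁺ ⊕ κ 1) Y⁺ y h₄)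

    near-move : ∀ {p} d → Cell p → Near (move d p)
    near-move {x , y} d t = beside d (bounded t)
      where
        beside : ∀ d → (X⁻ ≤ x × x ≤ X⁺) × (Y⁻ ≤ y × y ≤ Y⁺) → Near (move d (x , y))
        beside right ((h₁ , h₂) , (h₃ , h₄)) = near (lin 2 (λ X⁻ x → (X⁻ ≼ x) ∷ [] ⊢ X⁻ ⊖ κ 1 ≼ x ⊕ κ 1) X⁻ x h₁)
            (lin 2 (λ X⁺ x → (x ≼ X⁺) ∷ [] ⊢ x ⊕ κ 1 ≼ X⁺ ⊕ κ 1) X⁺ x h₂) (lin 2 (λ X⁻ x → (X⁻ ≼ x) ∷ [] ⊢ X⁻ ⊖ κ 1 ≼ x) Y⁻ y h₃)
            (lin 2 (λ X⁺ x → (x ≼ X⁺) ∷ [] ⊢ x ≼ X⁺ ⊕ κ 1) Y⁺ y h₄)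
        beside left  ((h₁ , h₂) , (h₃ , h₄)) = near (lin 2 (λ X⁻ x → (X⁻ ≼ x) ∷ [] ⊢ X⁻ ⊖ κ 1 ≼ x ⊖ κ 1) X⁻ x h₁)
            (lin 2 (λ X⁺ x → (x ≼ X⁺) ∷ [] ⊢ x ⊖ κ 1 ≼ X⁺ ⊕ κ 1) X⁺ x h₂) (lin 2 (λ X⁻ x → (X⁻ ≼ x) ∷ [] ⊢ X⁻ ⊖ κ 1 ≼ x) Y⁻ y h₃)
            (lin 2 (λ X⁺ x → (x ≼ X⁺) ∷ [] ⊢ x ≼ X⁺ ⊕ κ 1) Y⁺ y h₄)
        beside up    ((h₁ , h₂) , (h₃ , h₄)) = near (lin 2 (λ X⁻ x → (X⁻ ≼ x) ∷ [] ⊢ X⁻ ⊖ κ 1 ≼ x) X⁻ x h₁)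
            (lin 2 (λ X⁺ x → (x ≼ X⁺) ∷ [] ⊢ x ≼ X⁺ ⊕ κ 1) X⁺ x h₂) (lin 2 (λ X⁻ x → (X⁻ ≼ x) ∷ [] ⊢ X⁻ ⊖ κ 1 ≼ x ⊕ κ 1) Y⁻ y h₃)
            (lin 2 (λ X⁺ x → (x ≼ X⁺) ∷ [] ⊢ x ⊕ κ 1 ≼ X⁺ ⊕ κ 1) Y⁺ y h₄)
        beside down  ((h₁ , h₂) , (h₃ , h₄)) = near (lin 2 (λ X⁻ x → (X⁻ ≼ x) ∷ [] ⊢ X⁻ ⊖ κ 1 ≼ x) X⁻ x h₁)
            (lin 2 (λ X⁺ x → (x ≼ X⁺) ∷ [] ⊢ x ≼ X⁺ ⊕ κ 1) X⁺ x h₂) (lin 2 (λ X⁻ x → (X⁻ ≼ x) ∷ [] ⊢ X⁻ ⊖ κ 1 ≼ x ⊖ κ 1) Y⁻ y h₃)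
            (lin 2 (λ X⁺ x → (x ≼ X⁺) ∷ [] ⊢ x ⊖ κ 1 ≼ X⁺ ⊕ κ 1) Y⁺ y h₄)

    near-anchor : ∀ {p} → Near p → Anchor p
    near-anchor {x , y} (near l r d u) = big (lin 2 (λ x X⁻ → (X⁻ ⊖ κ 1 ≼ x) ∷ [] ⊢ X⁻ ⊖ κ 8 ≼ x) x X⁻ l)
        (lin 2 (λ x X⁺ → (x ≼ X⁺ ⊕ κ 1) ∷ [] ⊢ x ≼ X⁺ ⊕ κ 8) x X⁺ r)
      (lin 2 (λ x X⁻ → (X⁻ ⊖ κ 1 ≼ x) ∷ [] ⊢ X⁻ ⊖ κ 8 ≼ x) y Y⁻ d) (lin 2 (λ x X⁺ → (x ≼ X⁺ ⊕ κ 1) ∷ [] ⊢ x ≼ X⁺ ⊕ κ 8) y Y⁺ u)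

    -- To the right of the frame the background is read off from `f` itself, so `At` says nothing
    -- about the copy and is preserved when the copy changes.
    At : Pixel → Picture → Set
    At p f = Overlay f (bg f) (pebs p)

    private
      on-left : ∀ {p} → Near p → ∀ {r} → r ∈ pebs p → proj₁ r ≤ xr
      on-left {x , y} n (here refl) = lin 3 (λ x xr X⁺ → (x ≼ X⁺ ⊕ κ 1) ∷ (X⁺ ⊕ κ 3 ≼ xr) ∷ [] ⊢ x ≼ xr) x xr X⁺ (Near.r n) ux₁
      on-left {x , y} n (there (here refl)) = lin 3 (λ x xr X⁺ → (x ≼ X⁺ ⊕ κ 1) ∷ (X⁺ ⊕ κ 3 ≼ xr) ∷ [] ⊢ x ≼ xr) x xr X⁺ (Near.r n) ux₁
      on-left n (there (there (here refl))) = lin 3 (λ X⁻ X⁺ xr → (X⁻ ≼ X⁺) ∷ (X⁺ ⊕ κ 3 ≼ xr) ∷ [] ⊢ X⁻ ≼ xr) X⁻ X⁺ xr X⁻≤X⁺ ux₁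
      on-left n (there (there (there (here refl)))) = ℤ.≤-refl
      on-left n (there (there (there (there (here refl))))) = ℤ.≤-refl

    -- All pebbles lie left of the copy, so moving them does not change the right part, and the
    -- background may be read off anew from `f′`.
    settled : ∀ {p f f′} → Near p → Overlay f′ (bg f) (pebs p) → At p f′ × Agree f f′
    settled {p} {f} {f′} n o = record { on = o .on ; off = λ (x , y) ¬in → trans (o .off (x , y) ¬in) (same x y (side-of x)) } , agree
      where
        agree : Agree f f′
        agree x y h = trans (o .off (x , y) (λ {r} i ((_ , j) , _) → 1≰0
            (lin 3 (λ x xr s → (xr ⊕ κ 3 ≼ x) ∷ (x ≼ s ⊕ κ 1) ∷ (s ≼ xr) ∷ [] ⊢ κ 1 ≼ κ 0) x xr (proj₁ r) h j (on-left n i)))) (bg-right f h)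
        same : ∀ x y → x ≤ xr + + 2 ⊎ xr + + 3 ≤ x → bg f (x , y) ≡ bg f′ (x , y)
        same x y (inj₁ h) = trans (bg-left f h) (sym (bg-left f′ h))
        same x y (inj₂ h) = trans (bg-right f h) (trans (sym (agree x y h)) (sym (bg-right f′ h)))

    cells-right : ∀ {p} i j → Cell p → xr + + 3 ≤ proj₁ (pix p i j)
    cells-right {x , y} i j t = lin 4 (λ z u v i → (κ 0 ≼ i) ∷ (u ≼ v) ∷ [] ⊢ z ≼ z ⊖ u ⊕ v ⊕ i) (xr + + 3) (+ c * X⁻) (+ c * x) (+ i) (0≤+ i)
        (ℤ.*-monoˡ-≤-nonNeg (+ c) (proj₁ (proj₁ (bounded t))))

    outside-left : ∀ {f f′ x y} → Outside f′ f → x ≤ xr + + 2 → f′ (x , y) ≡ f (x , y)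
    outside-left {x = x} o h = o .kept _ λ {p} t i j _ _ e → 1≰0
        (lin 3 (λ x xr z → (x ≼ xr ⊕ κ 2) ∷ (xr ⊕ κ 3 ≼ z) ∷ (x ≐ z) ∷ [] ⊢ κ 1 ≼ κ 0) x xr (proj₁ (pix p i j)) h (cells-right i j t) (cong proj₁ e))

    copied : ∀ {p f f′} → Near p → Outside f′ f → At p f → At p f′
    copied {p} {f} {f′} n o at = record
      { on = λ {r} i → trans (win-ext {f′} {f} r λ (u , w) ((_ , j) , _) → outside-left o
          (lin 3 (λ u xr s → (u ≼ s ⊕ κ 1) ∷ (s ≼ xr) ∷ [] ⊢ u ≼ xr ⊕ κ 2) u xr (proj₁ r) j (on-left n i))) (at .on i)
      ; off = λ (x , y) ¬in → left-or-right x y ¬in (side-of x) }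
      where
        left-or-right : ∀ x y → (∀ {r} → r ∈ pebs p → ¬ InWin r (x , y)) → x ≤ xr + + 2 ⊎ xr + + 3 ≤ x → f′ (x , y) ≡ bg f′ (x , y)
        left-or-right x y ¬in (inj₁ h) = trans (outside-left o h) (trans (at .off (x , y) ¬in) (trans (bg-left f h) (sym (bg-left f′ h))))
        left-or-right x y ¬in (inj₂ h) = sym (bg-right f′ h)

    above : ∀ {p} → Near p → ∃[ n ] (proj₂ p ≡ yb + + n)
    above {x , y} n = distance (lin 3 (λ y yb Y⁻ → (Y⁻ ⊖ κ 1 ≼ y) ∷ (yb ⊕ κ 3 ≼ Y⁻) ∷ [] ⊢ yb ≼ y) y yb Y⁻ (Near.d n) ly₁)

    standLine : ∀ {x y n o} f → Perp up o → Near (x , y) → y ≡ yb + + n → Line (bg f) up o n (x , yb) ((X⁻ , yt) ∷ rights)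
    standLine {x} {y} {n} f pp (near l r d u) e = record
      { perp = pp
      ; long = ℤ.drop‿+≤+ (lin 4 (λ y yb Y⁻ n → (κ 0 ≼ n) ∷ (y ≐ yb ⊕ n) ∷ (Y⁻ ⊖ κ 1 ≼ y) ∷ (yb ⊕ κ 3 ≼ Y⁻) ∷ [] ⊢ κ 2 ≼ n) y yb Y⁻ (+ n) (0≤+ n) e d
          ly₁)
      ; anchor = λ k k≤n → big (lin 2 (λ x X⁻ → (X⁻ ⊖ κ 1 ≼ x) ∷ [] ⊢ X⁻ ⊖ κ 8 ≼ x) x X⁻ l)
          (lin 2 (λ x X⁺ → (x ≼ X⁺ ⊕ κ 1) ∷ [] ⊢ x ≼ X⁺ ⊕ κ 8) x X⁺ r)
          (lin 3 (λ yb Y⁻ k → (κ 0 ≼ k) ∷ (Y⁻ ⊖ κ 4 ≼ yb) ∷ [] ⊢ Y⁻ ⊖ κ 8 ≼ yb ⊕ k) yb Y⁻ (+ k) (0≤+ k) ly₂)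
              (lin 5 (λ y yb Y⁺ n k → (κ 0 ≼ n) ∷ (κ 0 ≼ k) ∷ (y ≐ yb ⊕ n) ∷ (k ≼ n) ∷ (y ≼ Y⁺ ⊕ κ 1) ∷ [] ⊢ yb ⊕ k ≼ Y⁺ ⊕ κ 8) y yb Y⁺ (+ n) (+ k)
              (0≤+ n) (0≤+ k) e (ℤ.+≤+ k≤n) u)
      ; legal = λ k k≤n → Ground.legal (ground f) x _ (lin 3 (λ x xr X⁺ → (x ≼ X⁺ ⊕ κ 1) ∷ (X⁺ ⊕ κ 3 ≼ xr) ∷ [] ⊢ x ≼ xr) x xr X⁺ r ux₁)
      ; apart = λ { (here refl) k k≤n → inj₂ (inj₂ (lin 6 (λ y yb yt Y⁺ n k → (κ 0 ≼ n) ∷ (κ 0 ≼ k) ∷ (y ≐ yb ⊕ n) ∷ (k ≼ n) ∷ (y ≼ Y⁺ ⊕ κ 1) ∷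
          (Y⁺ ⊕ κ 3 ≼ yt) ∷ [] ⊢ yb ⊕ k ⊕ κ 2 ≼ yt) y yb yt Y⁺ (+ n) (+ k) (0≤+ n) (0≤+ k) e (ℤ.+≤+ k≤n) u uy₁))
                  ; (there (here refl)) k k≤n → inj₁ (inj₂ x2)
                  ; (there (there (here refl))) k k≤n → inj₁ (inj₂ x2) } }
      where x2 : x + + 2 ≤ xr
            x2 = lin 3 (λ x xr X⁺ → (x ≼ X⁺ ⊕ κ 1) ∷ (X⁺ ⊕ κ 3 ≼ xr) ∷ [] ⊢ x ⊕ κ 2 ≼ xr) x xr X⁺ r ux₁

    n≤D : ∀ {x y n} → Near (x , y) → y ≡ yb + + n → n ℕ.≤ D
    n≤D {x} {y} {n} N e = height≤D e (lin 2 (λ yb Y⁻ → (Y⁻ ⊖ κ 4 ≼ yb) ∷ [] ⊢ Y⁻ ⊖ κ 8 ≼ yb) yb Y⁻ ly₂)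
        (lin 2 (λ y Y⁺ → (y ≼ Y⁺ ⊕ κ 1) ∷ [] ⊢ y ≼ Y⁺ ⊕ κ 8) y Y⁺ (Near.u N))

    climb : ∀ {X : Set} {F : Finite X} {z : X} {p f Q} → Near p → At p f → Q z p f → Run (walk ⦃ F ⦄ up) z (1 ℕ.+ D) (proj₁ p , yb) f Q
    climb {p = p} {f} N at k = let n , e = above N in wp-mono (ℕ.s≤s (n≤D N e)) $ walk-fwd (cong (proj₁ p ,_) e) (standLine f up-right N e) at k

    drop : ∀ {X : Set} {F : Finite X} {z : X} {p f Q} → Near p → At p f → Q z (proj₁ p , yb) f → Run (walk ⦃ F ⦄ down) z (1 ℕ.+ D) p f Q
    drop {p = p} {f} N at k = let n , e = above N in wp-mono (ℕ.s≤s (n≤D N e)) $ walk-back (cong (proj₁ p ,_) e) (standLine f up-right N e) at k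

    floorLine : ∀ {x y n} f → Near (x , y) → xr ≡ x + + n → Line (bg f) right up n (x , yb) ((x , y) ∷ (X⁻ , yt) ∷ (xr , yt) ∷ [])
    floorLine {x} {y} f (near l r d u) e = hLine right-up e (lin 3 (λ x xr X⁺ → (x ≼ X⁺ ⊕ κ 1) ∷ (X⁺ ⊕ κ 3 ≼ xr) ∷ [] ⊢ x ⊕ κ 2 ≼ xr) x xr X⁺ r ux₁)
      (at-bottom (lin 2 (λ x X⁻ → (X⁻ ⊖ κ 1 ≼ x) ∷ [] ⊢ X⁻ ⊖ κ 8 ≼ x) x X⁻ l) (lin 2 (λ x X⁺ → (x ≼ X⁺ ⊕ κ 1) ∷ [] ⊢ x ≼ X⁺ ⊕ κ 8) x X⁺ r))
      (at-bottom (lin 3 (λ X⁻ X⁺ xr → (X⁻ ≼ X⁺) ∷ (X⁺ ⊕ κ 3 ≼ xr) ∷ [] ⊢ X⁻ ⊖ κ 8 ≼ xr) X⁻ X⁺ xr X⁻≤X⁺ ux₁)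
          (lin 2 (λ xr X⁺ → (xr ≼ X⁺ ⊕ κ 3) ∷ [] ⊢ xr ≼ X⁺ ⊕ κ 8) xr X⁺ ux₂))
      (Ground.legal (ground f)) ℤ.≤-refl
      (λ { (here refl) → inj₂ (lin 3 (λ y yb Y⁻ → (Y⁻ ⊖ κ 1 ≼ y) ∷ (yb ⊕ κ 3 ≼ Y⁻) ∷ [] ⊢ yb ⊕ κ 2 ≼ y) y yb Y⁻ d ly₁)
         ; (there (here refl)) → inj₂ gap ; (there (there (here refl))) → inj₂ gap })
      where gap : yb + + 2 ≤ yt
            gap = lin 4 (λ yb Y⁻ Y⁺ yt → (yb ⊕ κ 3 ≼ Y⁻) ∷ (Y⁻ ≼ Y⁺) ∷ (Y⁺ ⊕ κ 3 ≼ yt) ∷ [] ⊢ yb ⊕ κ 2 ≼ yt) yb Y⁻ Y⁺ yt ly₁ Y⁻≤Y⁺ uy₁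

    private
      floor-order : ∀ {f B p s t u v} → Overlay f B (p ∷ s ∷ t ∷ u ∷ v ∷ []) → Overlay f B (u ∷ s ∷ p ∷ t ∷ v ∷ [])
      floor-order = reorder
        (λ { (here r) → there (there (there (here r))) ; (there (here r)) → there (here r) ; (there (there (here r))) → here r
           ; (there (there (there (here r)))) → there (there (here r)) ; (there (there (there (there (here r))))) → there
               (there (there (there (here r)))) })
        (λ { (here r) → there (there (here r)) ; (there (here r)) → there (here r) ; (there (there (here r))) → there (there (there (here r)))
           ; (there (there (there (here r)))) → here r ; (there (there (there (there (here r))))) → there (there (there (there (here r)))) })

      reach-xr : ∀ {p} → Near p → ∃[ n ] xr ≡ proj₁ p + + n
      reach-xr {x , y} N = distance (lin 3 (λ x xr X⁺ → (x ≼ X⁺ ⊕ κ 1) ∷ (X⁺ ⊕ κ 3 ≼ xr) ∷ [] ⊢ x ≼ xr) x xr X⁺ (Near.r N) ux₁)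

      len≤D : ∀ {x y n} → Near (x , y) → xr ≡ x + + n → n ℕ.≤ D
      len≤D {x} N e = length≤D e (lin 2 (λ x X⁻ → (X⁻ ⊖ κ 1 ≼ x) ∷ [] ⊢ X⁻ ⊖ κ 8 ≼ x) x X⁻ (Near.l N))
          (lin 2 (λ xr X⁺ → (xr ≼ X⁺ ⊕ κ 3) ∷ [] ⊢ xr ≼ X⁺ ⊕ κ 8) xr X⁺ ux₂)

    outward : ∀ {X : Set} {F : Finite X} {z : X} {p f Q} → Near p → At p f → Q z (xr , yb) f → Run (walk ⦃ F ⦄ right) z (1 ℕ.+ D) (proj₁ p , yb) f Q
    outward {p = p} {f} N at k = let n , e = reach-xr N in wp-mono (ℕ.s≤s (len≤D N e)) $ walk-fwd (cong (_, yb) e) (floorLine f N e) (floor-order at) k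

    inward : ∀ {X : Set} {F : Finite X} {z : X} {p f Q} → Near p → At p f → Q z (proj₁ p , yb) f → Run (walk ⦃ F ⦄ left) z (1 ℕ.+ D) (xr , yb) f Q
    inward {p = p} {f} N at k = let n , e = reach-xr N in wp-mono (ℕ.s≤s (len≤D N e)) $ walk-back (cong (_, yb) e) (floorLine f N e) (floor-order at) k

    visit-time : ℕ → ℕ
    visit-time t = (1 ℕ.+ D) ℕ.+ ((1 ℕ.+ D) ℕ.+ (3 ℕ.+ (t ℕ.+ (3 ℕ.+ ((1 ℕ.+ D) ℕ.+ (1 ℕ.+ D))))))

    -- Going left along the bottom side, the first pebble is the shadow, and going up from there the
    -- first one marks the current tile. So the robot finds back without storing any distance.
    trip-run : ∀ {A B X : Set} {FA : Finite A} {FB : Finite B} {FX : Finite X} {pr : Prog A B} {z : X} {p f req t Q} {R : B → Picture → Set} → Near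
        p → At p f →
      Run pr req t (base root) f (λ ans q f′ → q ≡ base root × Outside f′ f × R ans f′) →
      (∀ {ans f′} → Outside f′ f → R ans f′ → At p f′ → Q (z , ans) p f′) →
      Run (trip ⦃ FA ⦄ ⦃ FB ⦄ ⦃ FX ⦄ pr) (z , req) (visit-time t) p f Q
    trip-run {z = z} {p} {f} {t = t} N at sv k =
      wp-⟫ $ drop N at $ wp-⟫ $ outward N at $
      wp-⟫ {t₁ = 3} $ steps-run 2 (λ i le → corridor⁺ i (ℕ.m≤n⇒m≤1+n le)) $ wp-at (sym base-root) $
      wp-⟫ {t₁ = t} $ wp-carry $ wp-post (λ {ans} {q} {f′} (e , o , r) → wp-at (trans e base-root) $
        wp-⟫ {t₁ = 3} $ steps-run 2 (λ i le → corridor⁻ i (ℕ.m≤n⇒m≤1+n le)) $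
        wp-at (cong (_, yb) (lin 1 (λ xr → [] ⊢ xr ⊕ κ 3 ⊖ κ 3 ≐ xr) xr)) $
        wp-⟫ $ inward N (copied N o at) $ climb N (copied N o at) $ k o r (copied N o at)) sv
      where
        corridor⁺ : ∀ i → i ℕ.≤ 3 → Anchor (xr + + i , yb)
        corridor⁺ i le = anc (at-bottom (lin 4 (λ X⁻ X⁺ xr i → (κ 0 ≼ i) ∷ (X⁻ ≼ X⁺) ∷ (X⁺ ⊕ κ 3 ≼ xr) ∷ [] ⊢ X⁻ ⊖ κ 8 ≼ xr ⊕ i) X⁻ X⁺ xr (+ i)
            (0≤+ i) X⁻≤X⁺ ux₁) (lin 3 (λ xr X⁺ i → (κ 0 ≼ i) ∷ (xr ≼ X⁺ ⊕ κ 3) ∷ (i ≼ κ 3) ∷ [] ⊢ xr ⊕ i ≼ X⁺ ⊕ κ 8) xr X⁺ (+ i) (0≤+ i) ux₂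
            (ℤ.+≤+ le)))
        corridor⁻ : ∀ i → i ℕ.≤ 3 → Anchor (xr + + 3 - + i , yb)
        corridor⁻ i le = anc (at-bottom (lin 4 (λ X⁻ X⁺ xr i → (κ 0 ≼ i) ∷ (X⁻ ≼ X⁺) ∷ (X⁺ ⊕ κ 3 ≼ xr) ∷ (i ≼ κ 3) ∷ [] ⊢ X⁻ ⊖ κ 8 ≼ xr ⊕ κ 3 ⊖ i) X⁻
            X⁺ xr (+ i) (0≤+ i) X⁻≤X⁺ ux₁ (ℤ.+≤+ le)) (lin 3 (λ xr X⁺ i → (κ 0 ≼ i) ∷ (xr ≼ X⁺ ⊕ κ 3) ∷ [] ⊢ xr ⊕ κ 3 ⊖ i ≼ X⁺ ⊕ κ 8) xr X⁺ (+ i)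
            (0≤+ i) ux₂))

    visit-run : ∀ {X : Set} {F : Finite X} {z : X} {p f req t Q} {R : Ans → Picture → Set} → Near p → At p f →
      Run serve req t (base root) f (λ ans q f′ → q ≡ base root × Outside f′ f × R ans f′) →
      (∀ {ans f′} → Outside f′ f → R ans f′ → At p f′ → Q (z , ans) p f′) →
      Run (visit ⦃ F ⦄) (z , req) (visit-time t) p f Q
    visit-run {F = F} {z} {p} {f} {req} {t} {Q} {R} N at sv k =
      trip-run {FA = finite-Maybe} {FB = finite-Ans} {FX = F} {pr = serve} {z = z} {p} {f} {req} {t} {Q} {R} N at sv k

    moveTo-time : ℕ
    moveTo-time = (6 ℕ.+ D) ℕ.+ (1 ℕ.+ D)

    private
      blank-floor : ∀ {p} f → Near p → blank ≡ win (bg f) (proj₁ p , yb)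
      blank-floor {x , y} f N = bottom-blank (ground f) (on-left {x , y} N (here refl))

      hidden : ∀ {p} f → Near p → win T p ≡ win (bg f) p
      hidden {x , y} f N = sym (bg-win f (on-left {x , y} N (here refl)))

      slide : ∀ {x y d f Q} → Perp up d → Near (x , y) → Near (move d (x , y)) → proj₁ (move d (x , yb)) ≡ proj₁ (move d (x , y)) → proj₂
          (move d (x , y)) ≡ y → proj₂ (move d (x , yb)) ≡ yb →
        At (x , y) f → (∀ {f′} → Overlay f′ (bg f) (pebs (move d (x , y))) → Q (win (bg f) (proj₁ (move d (x , y)) , yb) , win T (move d (x , y)))
            (proj₁ (move d (x , y)) , yb) f′) →
        Run shift (up , d , blank , win T (x , y)) (6 ℕ.+ D) (x , y) f Q
      slide {x} {y} {d} {f} {Q} pp N N′ ex ey es at k = let n , e = above N in wp-mono (ℕ.+-monoʳ-≤ 6 (n≤D N e)) $ wp-at (cong (x ,_) e) $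
        shift-run (standLine f pp N e) (target n e) (subst (λ z → Overlay f (bg f) ((x , z) ∷ (x , yb) ∷ (X⁻ , yt) ∷ rights)) e at)
          (blank-floor f N) (trans (hidden f N) (cong (λ z → win (bg f) (x , z)) e))
          (λ {f′} o → finish n e o)
        where
          S′ : move d (x , yb) ≡ (proj₁ (move d (x , y)) , yb)
          S′ = cong₂ _,_ ex es
          finish : ∀ n → y ≡ yb + + n → ∀ {f′} → Overlay f′ (bg f) (move d (x , yb + + n) ∷ move d (x , yb) ∷ (X⁻ , yt) ∷ rights) →
            Q (win (bg f) (move d (x , yb)) , win (bg f) (move d (x , yb + + n))) (move d (x , yb)) f′
          finish n e {f′} o = subst (λ z → Q (win (bg f) z , win (bg f) (move d (x , yb + + n))) z f′) (sym S′)
            (subst (λ w → Q (win (bg f) (proj₁ (move d (x , y)) , yb) , w) (proj₁ (move d (x , y)) , yb) f′)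
                (trans (hidden f N′) (cong (λ z → win (bg f) (move d (x , z))) e))
              (k (subst₂ (λ s t → Overlay f′ (bg f) (s ∷ t ∷ (X⁻ , yt) ∷ rights)) (cong (λ z → move d (x , z)) (sym e)) S′ o)))
          x′ : ℤ
          x′ = proj₁ (move d (x , y))
          x2 : x′ + + 2 ≤ xr
          x2 = lin 3 (λ x′ xr X⁺ → (x′ ≼ X⁺ ⊕ κ 1) ∷ (X⁺ ⊕ κ 3 ≼ xr) ∷ [] ⊢ x′ ⊕ κ 2 ≼ xr) x′ xr X⁺ (Near.r N′) ux₁
          gap : yb + + 2 ≤ yt
          gap = lin 4 (λ yb Y⁻ Y⁺ yt → (yb ⊕ κ 3 ≼ Y⁻) ∷ (Y⁻ ≼ Y⁺) ∷ (Y⁺ ⊕ κ 3 ≼ yt) ∷ [] ⊢ yb ⊕ κ 2 ≼ yt) yb Y⁻ Y⁺ yt ly₁ Y⁻≤Y⁺ uy₁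
          farS : ∀ {r} → r ∈ (X⁻ , yt) ∷ rights → Far r (x′ , yb)
          farS (here refl) = inj₂ (inj₂ gap)
          farS (there (here refl)) = inj₁ (inj₂ x2)
          farS (there (there (here refl))) = inj₁ (inj₂ x2)
          farE : ∀ {r} → r ∈ (X⁻ , yt) ∷ rights → Far r (x′ , y)
          farE (here refl) = inj₂ (inj₂ (lin 3 (λ y yt Y⁺ → (y ≼ Y⁺ ⊕ κ 1) ∷ (Y⁺ ⊕ κ 3 ≼ yt) ∷ [] ⊢ y ⊕ κ 2 ≼ yt) y yt Y⁺ (Near.u N) uy₁))
          farE (there (here refl)) = inj₁ (inj₂ x2)
          farE (there (there (here refl))) = inj₁ (inj₂ x2)
          bx : X⁻ - + 8 ≤ x′
          bx = lin 2 (λ x′ X⁻ → (X⁻ ⊖ κ 1 ≼ x′) ∷ [] ⊢ X⁻ ⊖ κ 8 ≼ x′) x′ X⁻ (Near.l N′)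
          bx′ : x′ ≤ X⁺ + + 8
          bx′ = lin 2 (λ x′ X⁺ → (x′ ≼ X⁺ ⊕ κ 1) ∷ [] ⊢ x′ ≼ X⁺ ⊕ κ 8) x′ X⁺ (Near.r N′)
          target : ∀ n → y ≡ yb + + n → Target up d n (x , yb) ((X⁻ , yt) ∷ rights)
          target n e = record
            { anchorS = subst Anchor (sym S′) (anc (at-bottom bx bx′))
            ; anchorE = subst Anchor E′ (big bx bx′ (lin 2 (λ y Y⁻ → (Y⁻ ⊖ κ 1 ≼ y) ∷ [] ⊢ Y⁻ ⊖ κ 8 ≼ y) y Y⁻ (Near.d N))
                (lin 2 (λ y Y⁺ → (y ≼ Y⁺ ⊕ κ 1) ∷ [] ⊢ y ≼ Y⁺ ⊕ κ 8) y Y⁺ (Near.u N)))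
            ; apartS = λ i → subst (Far _) (sym S′) (farS i)
            ; apartE = λ i → subst (Far _) E′ (farE i) }
            where E′ : (x′ , y) ≡ move d (x , yb + + n)
                  E′ = trans (cong (x′ ,_) (sym ey)) (cong (λ z → move d (x , z)) e)

      hoist : ∀ {x y y′ d f Q} → Near (x , y) → Near (x , y′) → move d (x , y) ≡ (x , y′) → At (x , y) f →
        (∀ {f′} → Overlay f′ (bg f) (pebs (x , y′)) → Q (win T (x , y′)) (x , yb) f′) →
        Run (op (λ (d , w) _ → d , just w , just d) ⟫ op (λ _ w → w , just peb , nothing) ⟫ steps down 1
          ⟫ post proj₁ (pre (λ w → w , down , false) (carry Win scan))) (d , win T (x , y)) (6 ℕ.+ D) (x , y) f Q
      hoist {x} {y} {y′} {d} {f} {Q} N N′ e at k = go-n (above N′)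
        where
          rest : List Pixel
          rest = (x , yb) ∷ (X⁻ , yt) ∷ rights
          far : ∀ {y} → Near (x , y) → ∀ {r} → r ∈ rest → Far (x , y) r
          far {y} N (here refl) = inj₂ (inj₂ (lin 3 (λ y yb Y⁻ → (Y⁻ ⊖ κ 1 ≼ y) ∷ (yb ⊕ κ 3 ≼ Y⁻) ∷ [] ⊢ yb ⊕ κ 2 ≼ y) y yb Y⁻ (Near.d N) ly₁))
          far {y} N (there (here refl)) = inj₂ (inj₁ (lin 3 (λ y yt Y⁺ → (y ≼ Y⁺ ⊕ κ 1) ∷ (Y⁺ ⊕ κ 3 ≼ yt) ∷ [] ⊢ y ⊕ κ 2 ≼ yt) y yt Y⁺ (Near.u N)
              uy₁))
          far {y} N (there (there (here refl))) = inj₁ (inj₁ (lin 3 (λ x xr X⁺ → (x ≼ X⁺ ⊕ κ 1) ∷ (X⁺ ⊕ κ 3 ≼ xr) ∷ [] ⊢ x ⊕ κ 2 ≼ xr) x xr X⁺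
              (Near.r N) ux₁))
          far {y} N (there (there (there (here refl)))) = inj₁
              (inj₁ (lin 3 (λ x xr X⁺ → (x ≼ X⁺ ⊕ κ 1) ∷ (X⁺ ⊕ κ 3 ≼ xr) ∷ [] ⊢ x ⊕ κ 2 ≼ xr) x xr X⁺ (Near.r N) ux₁))
          f₁ : Picture
          f₁ = paint (x , y) (win T (x , y)) f
          ov₁ : Overlay f₁ (bg f) rest
          ov₁ = lift-peb at (far N) (hidden f N)
          f₂ : Picture
          f₂ = paint (x , y′) peb f₁
          ov₂ : Overlay f₂ (bg f) (pebs (x , y′))
          ov₂ = place-peb ov₁ (far N′)
          Goal : Set
          Goal = Run (op (λ (d , w) _ → d , just w , just d) ⟫ op (λ _ w → w , just peb , nothing) ⟫ steps down 1
            ⟫ post proj₁ (pre (λ w → w , down , false) (carry Win scan))) (d , win T (x , y)) (6 ℕ.+ D) (x , y) f Q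
          go-n : ∃[ n ] (y′ ≡ yb + + n) → Goal
          go-n (n , e′) = go-m n e′ (Line.long L)
            where
              L : Line (bg f) up right n (x , yb) ((X⁻ , yt) ∷ rights)
              L = standLine f up-right N′ e′
              go-m : ∀ n → y′ ≡ yb + + n → 2 ℕ.≤ n → Goal
              go-m (suc zero) e″ (ℕ.s≤s ())
              go-m (suc (suc m)) e″ _ = wp-mono (linℕ 2 (λ m D → (κ 2 ⊕ m ≼ D) ∷ [] ⊢ κ 1 ⊕ (κ 1 ⊕ (κ 2 ⊕ (κ 1 ⊕ m))) ≼ κ 6 ⊕ D) m D (n≤D N′ e″)) $
                wp-⟫ {t₁ = 1} $ run-op (near-anchor N) refl $ wp-at e $
                wp-⟫ {t₁ = 1} $ run-op (near-anchor N′) (cong (λ w → w , just peb , nothing) (trans (read-win ov₁ (far N′)) (sym (hidden f N′)))) $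
                wp-⟫ {t₁ = 2} $ wp-at (cong (x ,_) e″) $ steps-run 1 down-anc $ wp-at (adv-opp up 2 m (x , yb)) $
                wp-map $ wp-pre $ wp-carry $ back-run m (λ i le → L′ .Line.anchor i (ℕ.≤-trans le (linℕ 1 (λ m → [] ⊢ m ≼ κ 2 ⊕ m) m)))
                  (λ i 0<i le → line-clear L′ (subst (λ z → Overlay f₂ (bg f) ((x , z) ∷ (x , yb) ∷ (X⁻ , yt) ∷ rights)) e″ ov₂) i 0<i
                      (ℕ.≤-trans (ℕ.s≤s le) (linℕ 1 (λ m → [] ⊢ κ 1 ⊕ m ≼ κ 2 ⊕ m) m)))
                  (ov₂ .on (there (here refl))) (λ _ → k ov₂)
                where
                  L′ : Line (bg f) up right (suc (suc m)) (x , yb) ((X⁻ , yt) ∷ rights)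
                  L′ = standLine f up-right N′ e″
                  down-anc : ∀ i → i ℕ.≤ 1 → Anchor (adv down i (adv up (suc (suc m)) (x , yb)))
                  down-anc zero       _ = subst Anchor (sym (adv-zero down _)) (L′ .Line.anchor (suc (suc m)) ℕ.≤-refl)
                  down-anc (suc zero) _ = subst Anchor (sym (adv-opp up 1 (suc m) (x , yb))) (L′ .Line.anchor (suc m) (ℕ.n≤1+n _))
                  down-anc (suc (suc i)) (ℕ.s≤s ())

    moveTo-run : ∀ {p d f Q} → Near p → Near (move d p) → At p f →
      (∀ {f′} → At (move d p) f′ → Agree f f′ → Q (win T (move d p)) (move d p) f′) →
      Run moveTo (d , win T p) moveTo-time p f Q
    moveTo-run {x , y} {right} N N′ at k = wp-⟫ {t₁ = 6 ℕ.+ D} $ wp-pre $ wp-choice₁ $ wp-map $ slide up-right N N′ refl refl refl at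
      λ o → climb N′ (proj₁ (settled N′ o)) (k (proj₁ (settled N′ o)) (proj₂ (settled N′ o)))
    moveTo-run {x , y} {left} N N′ at k = wp-⟫ {t₁ = 6 ℕ.+ D} $ wp-pre $ wp-choice₁ $ wp-map $ slide up-left N N′ refl refl refl at
      λ o → climb N′ (proj₁ (settled N′ o)) (k (proj₁ (settled N′ o)) (proj₂ (settled N′ o)))
    moveTo-run {x , y} {up} N N′ at k = wp-⟫ {t₁ = 6 ℕ.+ D} $ wp-pre $ wp-choice₂ $ hoist N N′ refl at
      λ o → climb N′ (proj₁ (settled N′ o)) (k (proj₁ (settled N′ o)) (proj₂ (settled N′ o)))
    moveTo-run {x , y} {down} N N′ at k = wp-⟫ {t₁ = 6 ℕ.+ D} $ wp-pre $ wp-choice₂ $ hoist N N′ refl at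
      λ o → climb N′ (proj₁ (settled N′ o)) (k (proj₁ (settled N′ o)) (proj₂ (settled N′ o)))

    Clean : Picture → Set
    Clean f = ∀ x y → xr + + 3 ≤ x → (∀ {p} → Cell p → ∀ i j → i ℕ.< c → j ℕ.< c → (x , y) ≢ pix p i j) → f (x , y) ≡ false

    clean-agree : ∀ {f f′} → Agree f f′ → Clean f → Clean f′
    clean-agree ag cl x y h ne = trans (ag x y h) (cl x y h ne)

    clean-outside : ∀ {f f′} → Outside f′ f → Clean f → Clean f′
    clean-outside o cl x y h ne = trans (o .kept (x , y) ne) (cl x y h ne)

    rendered-agree : ∀ {f f′ M} → Agree f f′ → Rendered f M → Rendered f′ M
    rendered-agree ag rd .shown {p} t i j li lj = trans (ag _ _ (cells-right i j t)) (rd .shown t i j li lj)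

    todo : Maybe Dir → ℕ
    todo (just right) = 4
    todo (just up)    = 3
    todo (just left)  = 2
    todo (just down)  = 1
    todo nothing      = 0

    private
      todo-next : ∀ d → suc (todo (nextDir d)) ≡ todo (just d)
      todo-next right = refl
      todo-next up    = refl
      todo-next left  = refl
      todo-next down  = refl

      todo-pos : ∀ d → 1 ℕ.≤ todo (just d)
      todo-pos d = subst (1 ℕ.≤_) (todo-next d) (ℕ.s≤s ℕ.z≤n)

      todo≤4 : ∀ j → todo j ℕ.≤ 4
      todo≤4 nothing      = ℕ.z≤n
      todo≤4 (just right) = ℕ.≤-refl
      todo≤4 (just up)    = linℕ 0 ([] ⊢ κ 3 ≼ κ 4) 
      todo≤4 (just left)  = linℕ 0 ([] ⊢ κ 2 ≼ κ 4) 
      todo≤4 (just down)  = linℕ 0 ([] ⊢ κ 1 ≼ κ 4) 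

      dirOf : ℕ → Dir
      dirOf 1 = down
      dirOf 2 = left
      dirOf 3 = up
      dirOf _ = right

      dirOf-todo : ∀ d → dirOf (todo (just d)) ≡ d
      dirOf-todo right = refl
      dirOf-todo up    = refl
      dirOf-todo left  = refl
      dirOf-todo down  = refl

      order : ∀ d d′ → todo (nextDir d) ℕ.< todo (just d′) → d′ ≡ d ⊎ todo (just d) ℕ.< todo (just d′)
      order d d′ lt with ℕ.m≤n⇒m<n∨m≡n (subst (ℕ._≤ todo (just d′)) (todo-next d) lt)
      ... | inj₁ lt′ = inj₂ lt′
      ... | inj₂ e   = inj₁ (trans (sym (dirOf-todo d′)) (trans (cong dirOf (sym e)) (dirOf-todo d)))

      chain-upd : ∀ {M ds q k} → q ∉ below ds → Chain M ds → Chain (upd q k M) ds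
      chain-upd ne [] = []
      chain-upd {M} {k = k} ne ((s , e) ∷ ch) = (s , trans (upd-other k M (λ h → ne (here (sym h)))) e) ∷ chain-upd (ne ∘ there) ch

      path-busy : ∀ {M ds} → Standing M ds → ∀ {q} → q ∈ tip ds ∷ below ds → isEmpty (M q) ≡ false
      path-busy st (here refl) = cong isEmpty (Standing.top st)
      path-busy st (there i)   = lower (Standing.chain st) i
        where lower : ∀ {M ds q} → Chain M ds → q ∈ below ds → isEmpty (M q) ≡ false
              lower ((s , e) ∷ ch) (here refl) = cong isEmpty e
              lower (_ ∷ ch)       (there i)   = lower ch i

      busy-upd : ∀ {M p q k} → isEmpty k ≡ false → isEmpty (M q) ≡ false → isEmpty (upd p k M q) ≡ false
      busy-upd {M} {p} {q} {k} ek e with q ≟P p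
      ... | yes refl = trans (cong isEmpty (upd-same p k M)) ek
      ... | no ne    = trans (cong isEmpty (upd-other k M ne)) e

      is-empty : ∀ {k} → isEmpty k ≡ false → k ≢ empty
      is-empty () refl

    -- Invariant, termination and completeness of the search.

    module Depth (N : ℕ) (few : ∀ {V} → Unique V → (∀ {q} → q ∈ V → Cell q) → length V ℕ.≤ N)
      (connected : ∀ (S : Pixel → Set) → S root → (∀ {q} d → Cell q → S q → Cell (move d q) → S (move d q)) → ∀ {q} → Cell q → S q) where

      -- `V` is a ghost list of visited tiles; with `few` it bounds the length of the path and the
      -- number of steps. `closed` is the usual invariant that a completed tile has only visited
      -- neighbours, and `tried` is what has been established of it for the tip.
      record Inv (ds : List Dir) (V : List Pixel) (M : Store) (j : Maybe Dir) (f : Picture) : Set where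
        field
          st     : Standing M ds
          at     : At (tip ds) f
          rd     : Rendered f M
          clean  : Clean f
          uniq   : Unique V
          vcell  : ∀ {q} → q ∈ V → Cell q
          vbusy  : ∀ {q} → q ∈ V → isEmpty (M q) ≡ false
          kinds  : ∀ {q} → Cell q → isEmpty (M q) ≡ false → M q ≡ full ⊎ q ∈ tip ds ∷ below ds
          closed : ∀ {q} → Cell q → M q ≡ full → ∀ d → Cell (move d q) → isEmpty (M (move d q)) ≡ false
          tried  : ∀ d → todo j ℕ.< todo (just d) → Cell (move d (tip ds)) → isEmpty (M (move d (tip ds))) ≡ false
          count  : suc (length ds) ℕ.≤ length V

      measure : List Dir → List Pixel → Maybe Dir → ℕ
      measure ds V j = 5 ℕ.* (2 ℕ.* (N ℕ.∸ length V) ℕ.+ length ds) ℕ.+ todo j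

      tip-cell : ∀ {ds V M j f} → Inv ds V M j f → Cell (tip ds)
      tip-cell I = cell (Standing.ok (Inv.st I))

      depth≤N : ∀ {ds V M j f} → Inv ds V M j f → length ds ℕ.≤ N
      depth≤N I = ℕ.≤-trans (ℕ.n≤1+n _) (ℕ.≤-trans (Inv.count I) (few (Inv.uniq I) (Inv.vcell I)))

      extend-inv : ∀ {ds V M d f f′} → Inv ds V M (just d) f → Cell (move d (tip ds)) → M (move d (tip ds)) ≡ empty → At (move d (tip ds)) f′ →
        Rendered f′ (upd (tip ds) (ptr d) (upd (move d (tip ds)) stop M)) → Clean f′ →
        Inv (d ∷ ds) (move d (tip ds) ∷ V) (upd (tip ds) (ptr d) (upd (move d (tip ds)) stop M)) (just right) f′ ×
        suc (measure (d ∷ ds) (move d (tip ds) ∷ V) (just right)) ℕ.≤ measure ds V (just d)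
      extend-inv {ds} {V} {M} {d} {f} {f′} I cn en at′ rd′ cl′ = record
        { st = record
            { ok = sound cn n∉path
            ; top = trans (upd-other (ptr d) _ n≢tip) (upd-same n stop M)
            ; chain = (Standing.ok st , upd-same (tip ds) (ptr d) _) ∷ chain-upd (fresh (Standing.ok st))
                (chain-upd (n∉path ∘ there) (Standing.chain st)) }
        ; at = at′ ; rd = rd′ ; clean = cl′
        ; uniq = All.tabulate (λ i e → n∉V (subst (_∈ V) (sym e) i)) ∷ uniq
        ; vcell = vcell′
        ; vbusy = λ { (here refl) → n-busy ; (there i) → busy-upd {_} {tip ds} refl (busy-upd {M} {n} refl (vbusy i)) }
        ; kinds = kinds′
        ; closed = λ {q} cq e d′ c′ → old-busy (closed cq (was-full e) d′ c′)
        ; tried = λ d′ lt _ → ⊥-elim (ℕ.<⇒≱ lt (todo≤4 (just d′)))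
        ; count = ℕ.s≤s count } , decreases (ℕ.m≤n⇒∃[o]m+o≡n (few (All.tabulate (λ i e → n∉V (subst (_∈ V) (sym e) i)) ∷ uniq) vcell′))
        where
          open Inv I
          n : Pixel
          n = move d (tip ds)
          M′ : Store
          M′ = upd (tip ds) (ptr d) (upd n stop M)
          n∉path : n ∉ tip ds ∷ below ds
          n∉path i = is-empty (path-busy st i) en
          n∉V : n ∉ V
          n∉V i = is-empty (vbusy i) en
          n≢tip : n ≢ tip ds
          n≢tip e = n∉path (here e)
          n-busy : isEmpty (M′ n) ≡ false
          n-busy = cong isEmpty (trans (upd-other (ptr d) _ n≢tip) (upd-same n stop M))
          old-busy : ∀ {q} → isEmpty (M q) ≡ false → isEmpty (M′ q) ≡ false
          old-busy e = busy-upd {_} {tip ds} refl (busy-upd {M} {n} refl e)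
          vcell′ : ∀ {q} → q ∈ n ∷ V → Cell q
          vcell′ (here refl) = cn
          vcell′ (there i)   = vcell i
          was-full : ∀ {q} → M′ q ≡ full → M q ≡ full
          was-full {q} e with q ≟P tip ds | q ≟P n
          ... | yes refl | _ with trans (sym (upd-same (tip ds) (ptr d) (upd n stop M))) e
          ...   | ()
          was-full {q} e | no ne | yes refl with trans (sym (trans (upd-other (ptr d) (upd n stop M) ne) (upd-same n stop M))) e
          ...   | ()
          was-full {q} e | no ne | no ne′ = trans (sym (trans (upd-other (ptr d) (upd n stop M) ne) (upd-other stop M ne′))) e
          kinds′ : ∀ {q} → Cell q → isEmpty (M′ q) ≡ false → M′ q ≡ full ⊎ q ∈ n ∷ tip ds ∷ below ds
          kinds′ {q} cq e with q ≟P tip ds | q ≟P n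
          ... | yes refl | _        = inj₂ (there (here refl))
          ... | no _     | yes refl = inj₂ (here refl)
          ... | no ne    | no ne′ with kinds cq (trans (cong isEmpty (sym (trans (upd-other (ptr d) (upd n stop M) ne) (upd-other stop M ne′)))) e)
          ...   | inj₁ h = inj₁ (trans (trans (upd-other (ptr d) (upd n stop M) ne) (upd-other stop M ne′)) h)
          ...   | inj₂ i = inj₂ (there i)
          decreases : ∃[ o ] (suc (length V) ℕ.+ o ≡ N) → suc (measure (d ∷ ds) (n ∷ V) (just right)) ℕ.≤ measure ds V (just d)
          decreases (o , e) = subst (λ z → suc (5 ℕ.* (2 ℕ.* (z ℕ.∸ suc (length V)) ℕ.+ suc (length ds)) ℕ.+ 4) ℕ.≤ 5 ℕ.*
              (2 ℕ.* (z ℕ.∸ length V) ℕ.+ length ds) ℕ.+ todo (just d)) e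
            (subst₂ (λ s t → suc (5 ℕ.* (2 ℕ.* s ℕ.+ suc (length ds)) ℕ.+ 4) ℕ.≤ 5 ℕ.* (2 ℕ.* t ℕ.+ length ds) ℕ.+ todo (just d))
              (sym (ℕ.m+n∸m≡n (suc (length V)) o)) (sym (trans (cong (ℕ._∸ length V) (sym (ℕ.+-suc (length V) o))) (ℕ.m+n∸m≡n (length V) (suc o))))
              (arith o (length ds) (todo (just d)) (todo-pos d)))
            where
              arith : ∀ o l t → 1 ℕ.≤ t → suc (5 ℕ.* (2 ℕ.* o ℕ.+ suc l) ℕ.+ 4) ℕ.≤ 5 ℕ.* (2 ℕ.* suc o ℕ.+ l) ℕ.+ t
              arith o l t h = linℕ 3 (λ o l t → (κ 1 ≼ t) ∷ [] ⊢ κ 1 ⊕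
                  (((o ⊕ (o ⊕ κ 0)) ⊕ (κ 1 ⊕ l)) ⊕ (((o ⊕ (o ⊕ κ 0)) ⊕ (κ 1 ⊕ l)) ⊕
                  (((o ⊕ (o ⊕ κ 0)) ⊕ (κ 1 ⊕ l)) ⊕ (((o ⊕ (o ⊕ κ 0)) ⊕ (κ 1 ⊕ l)) ⊕ (((o ⊕ (o ⊕ κ 0)) ⊕ (κ 1 ⊕ l)) ⊕ κ 0)))) ⊕ κ 4)
                ≼ (((κ 1 ⊕ o) ⊕ ((κ 1 ⊕ o) ⊕ κ 0)) ⊕ l) ⊕ ((((κ 1 ⊕ o) ⊕ ((κ 1 ⊕ o) ⊕ κ 0)) ⊕ l) ⊕
                    ((((κ 1 ⊕ o) ⊕ ((κ 1 ⊕ o) ⊕ κ 0)) ⊕ l) ⊕ ((((κ 1 ⊕ o) ⊕ ((κ 1 ⊕ o) ⊕ κ 0)) ⊕ l) ⊕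
                    ((((κ 1 ⊕ o) ⊕ ((κ 1 ⊕ o) ⊕ κ 0)) ⊕ l) ⊕ κ 0)))) ⊕ t) o l t h

      refuse-inv : ∀ {ds V M d f f′} → Inv ds V M (just d) f → (Cell (move d (tip ds)) → isEmpty (M (move d (tip ds))) ≡ false) → At (tip ds) f′ →
        Rendered f′ M → Clean f′ → Inv ds V M (nextDir d) f′ × suc (measure ds V (nextDir d)) ℕ.≤ measure ds V (just d)
      refuse-inv {ds} {V} {M} {d} I busy at′ rd′ cl′ = record
        { st = st ; at = at′ ; rd = rd′ ; clean = cl′ ; uniq = uniq ; vcell = vcell ; vbusy = vbusy ; kinds = kinds ; closed = closed
        ; tried = λ d′ lt → [ (λ { refl → busy }) , tried d′ ]′ (order d d′ lt)
        ; count = count } ,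
        ℕ.≤-reflexive (trans (sym (ℕ.+-suc (5 ℕ.* (2 ℕ.* (N ℕ.∸ length V) ℕ.+ length ds)) (todo (nextDir d))))
            (cong (5 ℕ.* (2 ℕ.* (N ℕ.∸ length V) ℕ.+ length ds) ℕ.+_) (todo-next d)))
        where open Inv I

      finish-inv : ∀ {d ds V M f f′} → Inv (d ∷ ds) V M nothing f → At (tip ds) f′ →
        Rendered f′ (upd (tip ds) stop (upd (tip (d ∷ ds)) full M)) → Clean f′ →
        Inv ds V (upd (tip ds) stop (upd (tip (d ∷ ds)) full M)) (just right) f′ × suc (measure ds V (just right)) ℕ.≤ measure (d ∷ ds) V nothing
      finish-inv {d} {ds} {V} {M} I at′ rd′ cl′ = record
        { st = record
            { ok = s′ (Standing.chain st)
            ; top = upd-same (tip ds) stop _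
            ; chain = chain-upd (fresh (s′ (Standing.chain st))) (chain-upd (fresh (Standing.ok st) ∘ there) (rest (Standing.chain st))) }
        ; at = at′ ; rd = rd′ ; clean = cl′ ; uniq = uniq ; vcell = vcell
        ; vbusy = λ i → old-busy (vbusy i)
        ; kinds = kinds′
        ; closed = λ {q} cq e d′ c′ → old-busy (closed′ cq e d′ c′)
        ; tried = λ d′ lt _ → ⊥-elim (ℕ.<⇒≱ lt (todo≤4 (just d′)))
        ; count = ℕ.≤-trans (ℕ.n≤1+n _) count } ,
        (linℕ 2 (λ a l → [] ⊢ κ 1 ⊕ ((a ⊕ l) ⊕ ((a ⊕ l) ⊕ ((a ⊕ l) ⊕ ((a ⊕ l) ⊕ ((a ⊕ l) ⊕ κ 0)))) ⊕ κ 4) ≼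
            ((a ⊕ (κ 1 ⊕ l)) ⊕ ((a ⊕ (κ 1 ⊕ l)) ⊕ ((a ⊕ (κ 1 ⊕ l)) ⊕ ((a ⊕ (κ 1 ⊕ l)) ⊕ ((a ⊕ (κ 1 ⊕ l)) ⊕ κ 0))))) ⊕ κ 0) (2 ℕ.* (N ℕ.∸ length V))
            (length ds))
        where
          open Inv I
          t : Pixel
          t = tip (d ∷ ds)
          M′ : Store
          M′ = upd (tip ds) stop (upd t full M)
          s′ : ∀ {M} → Chain M (d ∷ ds) → Sound ds
          s′ ((s , _) ∷ _) = s
          rest : ∀ {M} → Chain M (d ∷ ds) → Chain M ds
          rest (_ ∷ ch) = ch
          t≢ : t ≢ tip ds
          t≢ e = fresh (Standing.ok st) (here e)
          old-busy : ∀ {q} → isEmpty (M q) ≡ false → isEmpty (M′ q) ≡ false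
          old-busy e = busy-upd {_} {tip ds} refl (busy-upd {M} {t} refl e)
          kinds′ : ∀ {q} → Cell q → isEmpty (M′ q) ≡ false → M′ q ≡ full ⊎ q ∈ tip ds ∷ below ds
          kinds′ {q} cq e with q ≟P tip ds | q ≟P t
          ... | yes refl | _        = inj₂ (here refl)
          ... | no ne    | yes refl = inj₁ (trans (upd-other stop _ ne) (upd-same t full M))
          ... | no ne    | no ne′ with kinds cq (trans (cong isEmpty (sym (trans (upd-other stop (upd t full M) ne) (upd-other full M ne′)))) e)
          ...   | inj₁ h = inj₁ (trans (trans (upd-other stop (upd t full M) ne) (upd-other full M ne′)) h)
          ...   | inj₂ (here h)  = ⊥-elim (ne′ h)
          ...   | inj₂ (there i) = inj₂ i
          closed′ : ∀ {q} → Cell q → M′ q ≡ full → ∀ d′ → Cell (move d′ q) → isEmpty (M (move d′ q)) ≡ false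
          closed′ {q} cq e d′ c′ with q ≟P tip ds | q ≟P t
          ... | yes refl | _ with trans (sym (upd-same (tip ds) stop (upd t full M))) e
          ...   | ()
          closed′ {q} cq e d′ c′ | no ne | yes refl = tried d′ (todo-pos d′) c′
          closed′ {q} cq e d′ c′ | no ne | no ne′ = closed cq (trans (sym (trans (upd-other stop (upd t full M) ne) (upd-other full M ne′))) e) d′ c′

      -- With only the root on the path, `kinds` makes every visited tile full or the root. `closed`
      -- and `tried` pass being visited on to the neighbours, and connectivity reaches all tiles.
      all-full : ∀ {V M f} → Inv [] V M nothing f → ∀ {q} → Cell q → upd root full M q ≡ full
      all-full {V} {M} I = connected (λ q → upd root full M q ≡ full) (upd-same root full M) λ {q} d cq e c′ → turned d cq e c′ (q ≟P root)
        where
          open Inv I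
          settle-down : ∀ {q} → Cell q → isEmpty (M q) ≡ false → upd root full M q ≡ full
          settle-down {q} cq e with q ≟P root
          ... | yes refl = upd-same root full M
          ... | no ne with kinds cq e
          ...   | inj₁ h        = trans (upd-other full M ne) h
          ...   | inj₂ (here h) = ⊥-elim (ne h)
          turned : ∀ {q} d → Cell q → upd root full M q ≡ full → Cell (move d q) → Dec (q ≡ root) → upd root full M (move d q) ≡ full
          turned d cq e c′ (yes refl) = settle-down c′ (tried d (todo-pos d) c′)
          turned d cq e c′ (no ne)    = settle-down c′ (closed cq (trans (sym (upd-other full M ne)) e) d c′)

      step-time : ℕ
      step-time = moveTo-time ℕ.+ (visit-time (serve-time N) ℕ.+ moveTo-time)

      private
        serve-mono : ∀ {l} → l ℕ.≤ N → serve-time l ℕ.≤ serve-time N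
        serve-mono {l} le = ℕ.+-mono-≤ walks (ℕ.+-monoʳ-≤ (c ℕ.+ (1 ℕ.+ (c ℕ.+ 1)) ℕ.+ shorten-time) walks)
          where walks : suc l ℕ.* (1 ℕ.+ c) ℕ.≤ suc N ℕ.* (1 ℕ.+ c)
                walks = ℕ.*-monoˡ-≤ (1 ℕ.+ c) (ℕ.s≤s le)

      Next : (Win × Maybe Dir → Pixel → Picture → Set) → List Dir → List Pixel → Maybe Dir → Set
      Next R ds V j = ∀ {ds′ V′ M′ j′ f′} → Inv ds′ V′ M′ j′ f′ → suc (measure ds′ V′ j′) ℕ.≤ measure ds V j → R (win T (tip ds′) , j′) (tip ds′) f′

      explore-run : ∀ {ds V M d f R} → Inv ds V M (just d) f → Next R ds V (just d) →
        Run explore (d , win T (tip ds)) step-time (tip ds) f R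
      explore-run {ds} {V} {M} {d} {f} {R} I k = wp-⟫ {t₁ = moveTo-time} $ wp-pre $ wp-carry $ moveTo-run (near-cell (tip-cell I)) N′ (Inv.at I) λ
          at₁ ag₁ →
        look (T n) refl at₁ ag₁
        where
          open Inv I
          n : Pixel
          n = move d (tip ds)
          N′ : Near n
          N′ = near-move d (tip-cell I)
          home : move (opp d) n ≡ tip ds
          home = move-opp d (tip ds)
          part₃ : Prog ((Dir × Win) × Ans) (Win × Maybe Dir)
          part₃ = pre outcome (choice (op (λ w _ → (w , just right) , nothing , nothing))
            (post (λ (d , w) → w , nextDir d) (pre (λ (d , w) → d , opp d , w) (carry Dir moveTo))))
          part₂ : Prog (Dir × Win) (Win × Maybe Dir)
          part₂ = pre occupied? (choice (pre (λ (d , w) → (d , w) , just d) visit) (op (λ x _ → (x , refused) , nothing , nothing))) ⟫ part₃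
          retreat : ∀ {f₂} → (Cell n → isEmpty (M n) ≡ false) → At n f₂ → Rendered f₂ M → Clean f₂ → Run part₃ ((d , win T n) , refused) moveTo-time
              n f₂ R
          retreat busy at₂ rd₂ cl₂ = wp-pre $ wp-choice₂ $ wp-map $ wp-pre $ wp-carry $ moveTo-run N′
              (subst Near (sym home) (near-cell (tip-cell I))) at₂ λ {f₃} at₃ ag₃ →
            subst (λ z → R (win T z , nextDir d) z f₃) (sym home) $
            let I′ , lt = refuse-inv I busy (subst (λ z → At z f₃) home at₃) (rendered-agree ag₃ rd₂) (clean-agree ag₃ cl₂) in k I′ lt
          Result : Picture → Ans → Picture → Set
          Result f₁ ans f₂ = (ans ≡ extended × M n ≡ empty × Rendered f₂ (upd (tip ds) (ptr d) (upd n stop M))) ⊎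
              (ans ≡ refused × isEmpty (M n) ≡ false × Rendered f₂ M)
          after : ∀ {f₁ f₂ ans} → Cell n → Outside f₂ f₁ → Clean f₁ → Result f₁ ans f₂ → At n f₂ → Run part₃ ((d , win T n) , ans) moveTo-time n f₂ R
          after cn o cl (inj₁ (refl , en , rd₂)) at₂ = wp-mono (ℕ.s≤s ℕ.z≤n) $ wp-pre $ wp-choice₁ $ run-op {md = nothing}
              (near-anchor (near-cell cn)) refl $
            let I′ , lt = extend-inv I cn en at₂ rd₂ (clean-outside o cl) in k I′ lt
          after cn o cl (inj₂ (refl , bn , rd₂)) at₂ = retreat (λ _ → bn) at₂ rd₂ (clean-outside o cl)
          chosen : ∀ {Q t q f} {p₁ p₂ : Prog (Dir × Win) ((Dir × Win) × Ans)} v → T n ≡ v →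
            WP (choice p₁ p₂) Q t (Data.Sum.map (Prog.enter p₁) (Prog.enter p₂) (branch ((d , win T n) , v))) q f →
            WP (choice p₁ p₂) Q t (Data.Sum.map (Prog.enter p₁) (Prog.enter p₂) (branch ((d , win T n) , T n))) q f
          chosen v refl x = x
          look : ∀ v {f₁} → T n ≡ v → At n f₁ → Agree f f₁ → Run part₂ (d , win T n) (visit-time (serve-time N) ℕ.+ moveTo-time) n f₁ R
          look true {f₁} e at₁ ag₁ = wp-⟫ {t₁ = visit-time (serve-time N)} $ wp-pre $ chosen true e $ wp-choice₁ $ wp-pre $
            visit-run {F = finite-× ⦃ finite-Dir ⦄ ⦃ finite-Win ⦄} {z = d , win T n} {p = n} {f = f₁} {req = just d} {t = serve-time N}
                {R = Result f₁} N′ at₁ (wp-mono (serve-mono (depth≤N I)) $ serve-try st e (λ en i → is-empty (path-busy st (there i)) en)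
                (rendered-agree ag₁ rd)
              (λ en rd₂ o → refl , o , inj₁ (refl , en , rd₂)) (λ bn rd₂ o → refl , o , inj₂ (refl , bn , rd₂)))
              λ o r at₂ → after e o (clean-agree ag₁ clean) r at₂
          look false {f₁} e at₁ ag₁ = wp-⟫ {t₁ = visit-time (serve-time N)} $ wp-mono (ℕ.s≤s ℕ.z≤n) $ wp-pre $ chosen false e $ wp-choice₂ $
            run-op {md = nothing} (near-anchor N′) refl $ retreat (λ t → ⊥-elim (absurd (trans (sym t) e))) at₁ (rendered-agree ag₁ rd)
                (clean-agree ag₁ clean)
            where
              absurd : true ≢ false
              absurd ()

      Complete : Picture → Set
      Complete f = ∀ {q} → Cell q → ∀ i j → i ℕ.< c → j ℕ.< c → f (pix q i j) ≡ true

      leave-run : ∀ ds {V M f} {R : (Win × Maybe Dir) ⊎ Win → Pixel → Picture → Set} → Inv ds V M nothing f → Next (R ∘ inj₁) ds V nothing →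
        (∀ {f′} → At root f′ → Complete f′ → Clean f′ → R (inj₂ (win T root)) root f′) →
        Run leave (win T (tip ds)) step-time (tip ds) f R
      leave-run [] {V} {M} {f} {R} I k fin = wp-mono (ℕ.m≤n+m (visit-time (serve-time N) ℕ.+ moveTo-time) moveTo-time) $ wp-⟫
          {t₁ = visit-time (serve-time N)} $ wp-pre $
        visit-run {F = finite-Win} {z = win T root} {p = root} {f = f} {req = nothing} {t = serve-time N}
            {R = λ ans f₂ → ans ≡ done × Rendered f₂ (upd root full M)} (near-cell (tip-cell I)) at
          (wp-mono (serve-mono ℕ.z≤n) $ serve-last st rd λ rd₂ o → refl , o , refl , rd₂)
          λ o (e , rd₂) at₂ → after o e rd₂ at₂
        where
          open Inv I
          after : ∀ {f₂ ans} → Outside f₂ f → ans ≡ done → Rendered f₂ (upd root full M) → At root f₂ →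
            Run (pre settle (choice (op (λ w _ → inj₂ w , nothing , nothing)) (post (λ w → inj₁ (w , just right)) moveTo))) (win T root , ans)
                moveTo-time root f₂ R
          after o refl rd₂ at₂ = wp-mono (ℕ.s≤s ℕ.z≤n) $ wp-pre $ wp-choice₁ $ run-op {md = nothing} (near-anchor (near-cell (tip-cell I))) refl $
            fin at₂ (λ {q} cq i j li lj → trans (rd₂ .shown cq i j li lj) (trans (cong (λ k → bitAt k i j) (all-full I cq)) (bitAt-full i j)))
                (clean-outside o clean)
      leave-run (d ∷ ds) {V} {M} {f} {R} I k fin = wp-mono (ℕ.m≤n+m (visit-time (serve-time N) ℕ.+ moveTo-time) moveTo-time) $ wp-⟫
          {t₁ = visit-time (serve-time N)} $ wp-pre $
        visit-run {F = finite-Win} {z = win T (tip (d ∷ ds))} {p = tip (d ∷ ds)} {f = f} {req = nothing} {t = serve-time N}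
            {R = λ ans f₂ → ans ≡ finished (opp d) × Rendered f₂ (upd (tip ds) stop (upd (tip (d ∷ ds)) full M))} (near-cell (tip-cell I)) at
          (wp-mono (serve-mono (depth≤N I)) $ serve-finish st rd λ rd₂ o → refl , o , refl , rd₂)
          λ o (e , rd₂) at₂ → after o e rd₂ at₂
        where
          open Inv I
          t : Pixel
          t = tip (d ∷ ds)
          home : move (opp d) t ≡ tip ds
          home = move-opp d (tip ds)
          parent : Cell (tip ds)
          parent = path-cell st (there (here refl))
          after : ∀ {f₂ ans} → Outside f₂ f → ans ≡ finished (opp d) → Rendered f₂ (upd (tip ds) stop (upd t full M)) → At t f₂ →
            Run (pre settle (choice (op (λ w _ → inj₂ w , nothing , nothing)) (post (λ w → inj₁ (w , just right)) moveTo))) (win T t , ans)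
                moveTo-time t f₂ R
          after o refl rd₂ at₂ = wp-pre $ wp-choice₂ $ wp-map $ moveTo-run (near-cell (tip-cell I)) (subst Near (sym home) (near-cell parent)) at₂ λ
              {f₃} at₃ ag₃ →
            subst (λ z → R (inj₁ (win T z , just right)) z f₃) (sym home) $
            let I′ , lt = finish-inv I (subst (λ z → At z f₃) home at₃) (rendered-agree ag₃ rd₂) (clean-agree ag₃ (clean-outside o clean)) in k I′ lt

      search-step : ∀ j {ds V M f} {R : (Win × Maybe Dir) ⊎ Win → Pixel → Picture → Set} → Inv ds V M j f → Next (R ∘ inj₁) ds V j →
        (∀ {f′} → At root f′ → Complete f′ → Clean f′ → R (inj₂ (win T root)) root f′) →
        Run searchStep (win T (tip ds) , j) step-time (tip ds) f R
      search-step (just d) I k fin = wp-pre $ wp-choice₁ $ wp-map $ explore-run I k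
      search-step nothing {ds} I k fin = wp-pre $ wp-choice₂ $ leave-run ds I k fin

      search-run : ∀ φ {ds V M j f Q} → Inv ds V M j f → measure ds V j ℕ.≤ φ →
        (∀ {f′} → At root f′ → Complete f′ → Clean f′ → Q (win T root) root f′) →
        Run search (win T (tip ds) , j) (suc φ ℕ.* step-time) (tip ds) f Q
      search-run zero {j = j} I le fin = wp-loop {t₁ = step-time} {t₂ = 0} $
        search-step j I (λ _ lt → ⊥-elim (ℕ.n≮0 (ℕ.≤-trans lt le))) fin
      search-run (suc φ) {j = j} I le fin = wp-loop {t₁ = step-time} {t₂ = suc φ ℕ.* step-time} $
        search-step j I (λ I′ lt → search-run φ I′ (ℕ.≤-pred (ℕ.≤-trans lt le)) fin) fin

      start-inv : ∀ {f} → At root f → Rendered f (upd root stop (λ _ → empty)) → Clean f → Inv [] (root ∷ []) (upd root stop (λ _ → empty))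
          (just right) f
      start-inv at rd cl = record
        { st = record { ok = sound root-tile (λ ()) ; top = upd-same root stop _ ; chain = [] }
        ; at = at ; rd = rd ; clean = cl
        ; uniq = All.[] ∷ []
        ; vcell = λ { (here refl) → root-tile }
        ; vbusy = λ { (here refl) → cong isEmpty (upd-same root stop _) }
        ; kinds = λ {q} cq e → inj₂ (here (only q e (q ≟P root)))
        ; closed = λ {q} cq e → ⊥-elim (not-full q e (q ≟P root))
        ; tried = λ d′ lt _ → ⊥-elim (ℕ.<⇒≱ lt (todo≤4 (just d′)))
        ; count = ℕ.≤-refl }
        where
          M₀ : Store
          M₀ = upd root stop (λ _ → empty)
          true≢false : true ≢ false
          true≢false ()
          only : ∀ q → isEmpty (M₀ q) ≡ false → Dec (q ≡ root) → q ≡ root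
          only q e (yes h) = h
          only q e (no ne) = ⊥-elim (true≢false (trans (sym (cong isEmpty (upd-other stop (λ _ → empty) ne))) e))
          not-full : ∀ q → M₀ q ≡ full → Dec (q ≡ root) → ⊥
          not-full q e (yes refl) with trans (sym (upd-same root stop (λ _ → empty))) e
          ... | ()
          not-full q e (no ne) with trans (sym (upd-other stop (λ _ → empty) ne)) e
          ... | ()

open DepthFirstSearch

-- The complete program and its running time.

module Scaler where

  open import Data.Nat.Tactic.RingSolver as ℕSolver using ()
  open import Data.Integer using (_+_; _-_; _≤_; _*_)

  infix 4 _≲_·_
  infixr 6 _⊞_
  infixr 7 _⊠_

  -- A record rather than a synonym, so that the three numbers are inferred without unfolding k * z.
  record _≲_·_ (x k z : ℕ) : Set where
    constructor ⌈_⌉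
    field bound : x ℕ.≤ k ℕ.* z

  open _≲_·_ public

  _⊞_ : ∀ {x y a b z} → x ≲ a · z → y ≲ b · z → x ℕ.+ y ≲ a ℕ.+ b · z
  _⊞_ {a = a} {b} {z} ⌈ p ⌉ ⌈ q ⌉ = ⌈ ℕ.≤-trans (ℕ.+-mono-≤ p q) (ℕ.≤-reflexive (sym (ℕ.*-distribʳ-+ z a b))) ⌉

  _⊠_ : ∀ {x y a b n z} → x ≲ a · n → y ≲ b · z → x ℕ.* y ≲ a ℕ.* b · z ℕ.* n
  _⊠_ {a = a} {b} {n} {z} ⌈ p ⌉ ⌈ q ⌉ = ⌈ ℕ.≤-trans (ℕ.*-mono-≤ p q) (ℕ.≤-reflexive (lem a b n z)) ⌉
    where lem : ∀ a b n z → a ℕ.* n ℕ.* (b ℕ.* z) ≡ a ℕ.* b ℕ.* (z ℕ.* n)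
          lem = ℕSolver.solve-∀

  times : ∀ k {x a z} → x ≲ a · z → k ℕ.* x ≲ k ℕ.* a · z
  times k {x} {a} {z} ⌈ p ⌉ = ⌈ ℕ.≤-trans (ℕ.*-monoʳ-≤ k p) (ℕ.≤-reflexive (sym (ℕ.*-assoc k a z))) ⌉

  grow-factor : ∀ m n → 1 ℕ.≤ n → m ℕ.≤ m ℕ.* n
  grow-factor m n 1≤n = ℕ.≤-trans (ℕ.≤-reflexive (sym (ℕ.*-identityʳ m))) (ℕ.*-monoʳ-≤ m 1≤n)

  constant : ∀ k {z} → 1 ℕ.≤ z → k ≲ k · z
  constant k {z} 1≤z = ⌈ grow-factor k z 1≤z ⌉

  once : ∀ {x z} → x ℕ.≤ z → x ≲ 1 · z
  once {z = z} p = ⌈ ℕ.≤-trans p (ℕ.≤-reflexive (sym (ℕ.*-identityˡ z))) ⌉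

  relax : ∀ {x k z z′} → z ℕ.≤ z′ → x ≲ k · z → x ≲ k · z′
  relax {k = k} le ⌈ p ⌉ = ⌈ ℕ.≤-trans p (ℕ.*-monoʳ-≤ k le) ⌉

  below : ∀ {x y k z} → x ℕ.≤ y → y ≲ k · z → x ≲ k · z
  below le ⌈ p ⌉ = ⌈ ℕ.≤-trans le p ⌉

  -- The multiplicities are closed numerals, compared by evaluation, so the constants in the bounds
  -- below need no derivation by hand.
  weaken : ∀ {x x′ k k′ z} → x ≲ k · z → x ≡ x′ → Data.Bool.T (k ℕ.≤ᵇ k′) → x′ ≲ k′ · z
  weaken {k = k} {k′} {z} ⌈ p ⌉ refl le = ⌈ ℕ.≤-trans p (ℕ.*-monoˡ-≤ z (ℕ.≤ᵇ⇒≤ k k′ le)) ⌉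

  prepare : Prog ⊤ Win
  prepare = enclose ⟫ pre (λ _ → tt) seek

  planting : Prog ⊤ ⊤
  planting = op (λ _ _ → tt , just (codeWin stop) , nothing)

  plant : Prog Win Win
  plant = post proj₁ (pre (_, tt) (trip planting))

  module _ (c₁ : ℕ) where
    open SearchProgram c₁

    -- Planting `stop` in the cell of the root creates the path of length 0 with which the search
    -- begins.
    reproduce : Prog Win ⊤
    reproduce = plant ⟫ pre (_, just right) search ⟫ op (λ w _ → tt , just w , nothing) ⟫ walk down ⟫ clear

    scaler : Prog ⊤ ⊤
    scaler = prepare ⟫ reproduce

  data Margin (X⁻ X⁺ Y⁻ Y⁺ : ℤ) : Pixel → Set where
    inMargin : ∀ {x y} → X⁻ - + 8 ≤ x → x ≤ X⁺ + + 8 → Y⁻ - + 8 ≤ y → y ≤ Y⁺ + + 8 → Margin X⁻ X⁺ Y⁻ Y⁺ (x , y)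

  -- The two phases of the program.

  module Whole (X⁻ X⁺ Y⁻ Y⁺ : ℤ) (D : ℕ)
    (wide : X⁺ - X⁻ + + 16 ≤ + D) (tall : Y⁺ - Y⁻ + + 16 ≤ + D)
    (T : Picture) (legal : ∀ q → isPeb (win T q) ≡ false)
    (bounded : ∀ {x y} → T (x , y) ≡ true → (X⁻ ≤ x × x ≤ X⁺) × (Y⁻ ≤ y × y ≤ Y⁺))
    (leftmost : ∃[ y ] T (X⁻ , y) ≡ true)
    (sx sy : ℤ) (start : T (sx , sy) ≡ true)
    (enclosed : ∀ {xl xr yb yt} → xl + + 1 ≤ sx → sx + + 1 ≤ xr → yb + + 1 ≤ sy → sy + + 1 ≤ yt →
      (∀ u → xl ≤ u → u ≤ xr → T (u , yb) ≡ false) → (∀ u → xl ≤ u → u ≤ xr → T (u , yt) ≡ false) →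
      (∀ u → yb ≤ u → u ≤ yt → T (xl , u) ≡ false) → (∀ u → yb ≤ u → u ≤ yt → T (xr , u) ≡ false) →
      (xl + + 1 ≤ X⁻ × X⁺ + + 1 ≤ xr) × (yb + + 1 ≤ Y⁻ × Y⁺ + + 1 ≤ yt))
    (c₁ : ℕ) (1≤c₁ : 1 ℕ.≤ c₁)
    (N : ℕ) (few : ∀ {V} → Unique V → (∀ {q} → q ∈ V → T q ≡ true) → length V ℕ.≤ N)
    (connected : ∀ {r} → T r ≡ true → ∀ (S : Pixel → Set) → S r → (∀ {q} d → T q ≡ true → S q → T (move d q) ≡ true → S (move d q)) → ∀ {q} → T q ≡
        true → S q) where

    X⁻≤X⁺ : X⁻ ≤ X⁺
    X⁻≤X⁺ = let (h₁ , h₂) , _ = bounded start in ℤ.≤-trans h₁ h₂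
    Y⁻≤Y⁺ : Y⁻ ≤ Y⁺
    Y⁻≤Y⁺ = let _ , (h₁ , h₂) = bounded start in ℤ.≤-trans h₁ h₂

    -- The coordinates are existential, for they depend on the growth of the frame: its bottom side,
    -- for instance, may lie three or four rows below the box.
    record Prepared (w : Win) (q : Pixel) (f : Picture) : Set where
      field
        xr yb yt y₀ : ℤ
        ux₁ : X⁺ + + 3 ≤ xr
        ux₂ : xr ≤ X⁺ + + 3
        ly₁ : yb + + 3 ≤ Y⁻
        ly₂ : Y⁻ - + 4 ≤ yb
        uy₁ : Y⁺ + + 3 ≤ yt
        uy₂ : yt ≤ Y⁺ + + 3
        tile : T (X⁻ , y₀) ≡ true
        overlay : Overlay f T ((X⁻ , y₀) ∷ (X⁻ , yt) ∷ (X⁻ , yb) ∷ (xr , yb) ∷ (xr , yt) ∷ [])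
        memory : w ≡ win T (X⁻ , y₀)
        position : q ≡ (X⁻ , y₀)

    module First (Anchor : Pixel → Set) (big : ∀ {x y} → X⁻ - + 8 ≤ x → x ≤ X⁺ + + 8 → Y⁻ - + 8 ≤ y → y ≤ Y⁺ + + 8 → Anchor (x , y)) where
      open Frames (surroundings Anchor X⁻ X⁺ Y⁻ Y⁺ D wide tall big)
      open Growing T legal bounded
      open Enclosing sx sy start enclosed

      prepare-time : ℕ
      prepare-time = enclose-time ℕ.+ 5 ℕ.* (20 ℕ.+ (D ℕ.+ D))

      -- The number of cycles and the duration of a cycle are both linear in `D`. The first is
      -- charged to `N` and the second to `Z`, which is why both bounds on `D` are assumed.
      prepare-bound : ∀ {Z} → 1 ℕ.≤ Z → 1 ℕ.≤ N → D ≲ 18 · Z → D ≲ 18 · N → prepare-time ≲ 10122 · Z ℕ.* N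
      prepare-bound {Z} 1≤Z 1≤N D≤Z D≤N = weaken ((repeated (cst 14) ⊞ (constant 1 1≤N ⊞ (D≤N ⊞ D≤N)) ⊠ cycling ⊞ repeated (cycling ⊞ cycling)) ⊞
          repeated (times 5 (cst 20 ⊞ D≤Z ⊞ D≤Z))) refl tt
        where
          cst : ∀ k → k ≲ k · Z
          cst k = constant k 1≤Z
          repeated : ∀ {x k} → x ≲ k · Z → x ≲ k · Z ℕ.* N
          repeated = relax (grow-factor Z N 1≤N)
          cycling : cycle-time ≲ 252 · Z
          cycling = weaken (times 4 (cst 8 ⊞ D≤Z ⊞ D≤Z) ⊞ times 4 (cst 1 ⊞ D≤Z)) refl tt

      prepare-run : Run prepare tt prepare-time (sx , sy) T Prepared
      prepare-run = wp-⟫ $ enclose-run λ {xl} {xr} {yb} {yt} {f} F ov → wp-pre (found F ov)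
        where
          found : ∀ {xl xr yb yt f} → Framed xl xr yb yt → Overlay f T (corners-of xl xr yb yt) →
            Run seek tt (5 ℕ.* (20 ℕ.+ (D ℕ.+ D))) (xl , yb) f Prepared
          -- At most four shifts, since `X⁻ - 4 ≤ xl`.
          found {xl} {xr} {yb} {yt} {f} F ov = C.seek-run 4 G leftmost (lin 2 (λ X⁻ xl → (X⁻ ⊖ κ 4 ≼ xl) ∷ [] ⊢ X⁻ ⊖ κ 8 ≼ xl) X⁻ xl lx₂)
              (lin 2 (λ X⁻ xl → (xl ⊕ κ 3 ≼ X⁻) ∷ [] ⊢ xl ≼ X⁻) X⁻ xl lx₁) X⁻≤X⁺
              (lin 2 (λ X⁻ xl → (X⁻ ⊖ κ 4 ≼ xl) ∷ [] ⊢ X⁻ ≼ xl ⊕ κ 4) X⁻ xl lx₂) (order ov) λ t o → record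
              { xr = xr ; yb = yb ; yt = yt ; y₀ = _ ; ux₁ = ux₁ ; ux₂ = ux₂ ; ly₁ = ly₁ ; ly₂ = ly₂ ; uy₁ = uy₁ ; uy₂ = uy₂
              ; tile = t ; overlay = o ; memory = refl ; position = refl }
            where
              open Framed F
              module C = Columns (surroundings Anchor X⁻ X⁺ Y⁻ Y⁺ D wide tall big) (sides xr yb yt Y⁻≤Y⁺ ux₁ ux₂ ly₁ ly₂ uy₁ uy₂)
              G : C.Ground T
              G = record { legal = λ x y _ → legal (x , y) ; bounds = λ _ → bounded }
              order : ∀ {f a b c e} → Overlay f T (a ∷ b ∷ c ∷ e ∷ []) → Overlay f T (c ∷ a ∷ b ∷ e ∷ [])
              order = reorder
                (λ { (here r) → there (there (here r)) ; (there (here r)) → here r ; (there (there (here r))) → there (here r) ;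
                    (there (there (there (here r)))) → there (there (there (here r))) })
                (λ { (here r) → there (here r) ; (there (here r)) → there (there (here r)) ; (there (there (here r))) → here r ;
                    (there (there (there (here r)))) → there (there (there (here r))) })

    module Second (Anchor : Pixel → Set) (big : ∀ {x y} → X⁻ - + 8 ≤ x → x ≤ X⁺ + + 8 → Y⁻ - + 8 ≤ y → y ≤ Y⁺ + + 8 → Anchor (x , y))
      {w₀ q₀ f₀} (pr : Prepared w₀ q₀ f₀)
      (cell-anchor : ∀ {x y} → T (x , y) ≡ true → ∀ i j → i ℕ.≤ suc c₁ → j ℕ.≤ suc c₁ →
        Anchor (Prepared.xr pr + + 3 - + suc c₁ * X⁻ + + suc c₁ * x + + i , Prepared.yb pr - + suc c₁ * Prepared.y₀ pr + + suc c₁ * y + + j)) where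
      open Prepared pr

      open Searching (surroundings Anchor X⁻ X⁺ Y⁻ Y⁺ D wide tall big) (sides xr yb yt Y⁻≤Y⁺ ux₁ ux₂ ly₁ ly₂ uy₁ uy₂)
          (inst X⁻≤X⁺ T legal bounded y₀ tile c₁ 1≤c₁ cell-anchor)
      open Depth N few (connected tile)

      record Scaled (f : Picture) : Set where
        field
          filled : ∀ {p} → Cell p → ∀ i j → i ℕ.< c → j ℕ.< c → f (pix p i j) ≡ true
          clean  : ∀ q → (∀ {p} → Cell p → ∀ i j → i ℕ.< c → j ℕ.< c → q ≢ pix p i j) → f q ≡ false

      private
        far-right : ∀ {x y} → xr + + 3 ≤ x → T (x , y) ≡ false
        far-right {x} {y} h with T (x , y) in e
        ... | false = refl
        ... | true  = ⊥-elim (1≰0 (lin 3 (λ x xr X⁺ → (xr ⊕ κ 3 ≼ x) ∷ (X⁺ ⊕ κ 3 ≼ xr) ∷ (x ≼ X⁺) ∷ [] ⊢ κ 1 ≼ κ 0) x xr X⁺ h ux₁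
            (proj₂ (proj₁ (bounded e)))))

        right-same : ∀ {x y} → xr + + 3 ≤ x → f₀ (x , y) ≡ T (x , y)
        right-same {x} {y} h = overlay .off (x , y) λ {r} i ((_ , j) , _) → 1≰0
            (lin 3 (λ x xr s → (xr ⊕ κ 3 ≼ x) ∷ (x ≼ s ⊕ κ 1) ∷ (s ≼ xr) ∷ [] ⊢ κ 1 ≼ κ 0) x xr (proj₁ r) h j (on-left i))
          where
            on-left : ∀ {r} → r ∈ (X⁻ , y₀) ∷ (X⁻ , yt) ∷ (X⁻ , yb) ∷ (xr , yb) ∷ (xr , yt) ∷ [] → proj₁ r ≤ xr
            X⁻≤xr : X⁻ ≤ xr
            X⁻≤xr = lin 3 (λ X⁻ X⁺ xr → (X⁻ ≼ X⁺) ∷ (X⁺ ⊕ κ 3 ≼ xr) ∷ [] ⊢ X⁻ ≼ xr) X⁻ X⁺ xr X⁻≤X⁺ ux₁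
            on-left (here refl) = X⁻≤xr
            on-left (there (here refl)) = X⁻≤xr
            on-left (there (there (here refl))) = X⁻≤xr
            on-left (there (there (there (here refl)))) = ℤ.≤-refl
            on-left (there (there (there (there (here refl))))) = ℤ.≤-refl

        swap₂₃ : ∀ {f B p s t rs} → Overlay f B (p ∷ s ∷ t ∷ rs) → Overlay f B (p ∷ t ∷ s ∷ rs)
        swap₂₃ = reorder
          (λ { (here r) → here r ; (there (here r)) → there (there (here r)) ; (there (there (here r))) → there (here r) ;
              (there (there (there i))) → there (there (there i)) })
          (λ { (here r) → here r ; (there (here r)) → there (there (here r)) ; (there (there (here r))) → there (here r) ;
              (there (there (there i))) → there (there (there i)) })

        at₀ : At root f₀
        at₀ = record { on = o .on ; off = λ (x , y) ¬in → trans (o .off (x , y) ¬in) (same x y (side-of x)) }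
          where
            o : Overlay f₀ T (pebs root)
            o = swap₂₃ overlay
            same : ∀ x y → x ≤ xr + + 2 ⊎ xr + + 3 ≤ x → T (x , y) ≡ bg f₀ (x , y)
            same x y (inj₁ h) = sym (bg-left f₀ h)
            same x y (inj₂ h) = trans (sym (right-same h)) (sym (bg-right f₀ h))

        rendered₀ : Rendered f₀ (λ _ → empty)
        rendered₀ .shown {p} t i j li lj = trans (right-same (cells-right i j t)) (trans (far-right (cells-right i j t)) (sym (bitAt-empty i j)))

        clean₀ : Clean f₀
        clean₀ x y h _ = trans (right-same h) (far-right h)

        rooted : Near root
        rooted = near-cell tile

      reproduce-time : ℕ
      reproduce-time = visit-time 1 ℕ.+ (suc (measure [] (root ∷ []) (just right)) ℕ.* step-time ℕ.+ (1 ℕ.+ ((1 ℕ.+ D) ℕ.+ clear-time)))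

      -- The initial measure is linear in `N`. A round costs a multiple of `Z`: `D` for the trips
      -- between tile and copy, `N * c` for walking along the path, and `c * c` for filling a cell.
      -- The sweep is charged like the growth of the frame, with `D` columns to `N` and the cost of
      -- a column to `Z`.
      reproduce-bound : ∀ {Z} → 1 ℕ.≤ N → c ℕ.* c ℕ.≤ Z → N ℕ.* c ℕ.≤ Z → D ≲ 18 · Z → D ≲ 18 · N → reproduce-time ≲ 4000 · Z ℕ.* N
      reproduce-bound {Z} 1≤N cc≤Z Nc≤Z D≤Z D≤N = weaken
        (repeated (visits (cst 1)) ⊞ rounds ⊠ (moving ⊞ visits service ⊞ moving) ⊞ repeated (cst 1) ⊞ repeated walking ⊞ (constant 1 1≤N ⊞ D≤N) ⊠
            (cst 20 ⊞ D≤Z ⊞ D≤Z) ⊞ repeated (cst 20 ⊞ D≤Z)) refl tt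
        where
          1≤c : 1 ℕ.≤ c
          1≤c = ℕ.s≤s ℕ.z≤n
          c≤Z : c ℕ.≤ Z
          c≤Z = ℕ.≤-trans (grow-factor c c 1≤c) cc≤Z
          c≤c : c ≲ 1 · c
          c≤c = once ℕ.≤-refl
          cst : ∀ k → k ≲ k · Z
          cst k = constant k (ℕ.≤-trans 1≤c c≤Z)
          repeated : ∀ {x k} → x ≲ k · Z → x ≲ k · Z ℕ.* N
          repeated = relax (grow-factor Z N 1≤N)
          walking : 1 ℕ.+ D ≲ 19 · Z
          walking = weaken (cst 1 ⊞ D≤Z) refl tt
          trips : suc N ℕ.* (1 ℕ.+ c) ≲ 4 · Z
          trips = weaken (relax (ℕ.≤-trans (ℕ.≤-reflexive (ℕ.*-comm c N)) Nc≤Z) ((constant 1 1≤N ⊞ once (ℕ.≤-refl {N})) ⊠ (constant 1 1≤c ⊞ c≤c)))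
              refl tt
          lines : c ℕ.* line-time ≲ 3 · Z
          lines = weaken (relax cc≤Z (c≤c ⊠ (c≤c ⊞ c≤c ⊞ constant 1 1≤c))) refl tt
          service : serve-time N ≲ 18 · Z
          service = weaken (trips ⊞ ((once c≤Z ⊞ cst 1 ⊞ once c≤Z ⊞ cst 1) ⊞ (lines ⊞ once c≤Z) ⊞ once c≤Z ⊞ cst 1) ⊞ trips) refl tt
          visits : ∀ {t k} → t ≲ k · Z → visit-time t ≲ 19 ℕ.+ (19 ℕ.+ (3 ℕ.+ (k ℕ.+ 41))) · Z
          visits le = walking ⊞ walking ⊞ cst 3 ⊞ le ⊞ cst 3 ⊞ walking ⊞ walking
          moving : moveTo-time ≲ 43 · Z
          moving = weaken ((cst 6 ⊞ D≤Z) ⊞ walking) refl tt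
          rounds : suc (measure [] (root ∷ []) (just right)) ≲ 15 · N
          rounds = weaken (constant 1 1≤N ⊞ times 5 (times 2 (once (ℕ.m∸n≤m N 1)) ⊞ constant 0 1≤N) ⊞ constant 4 1≤N) refl tt

      reproduce-run : Run (reproduce c₁) w₀ reproduce-time q₀ f₀ (λ _ q f → Anchor q × Scaled f)
      reproduce-run = wp-at position $ wp-⟫ {t₁ = visit-time 1} $ wp-map $ wp-pre $
        trip-run {FA = finite-⊤} {FB = finite-⊤} {FX = finite-Win} {pr = planting} {R = λ _ f → Rendered f (upd root stop (λ _ → empty))} rooted at₀
          (run-op (base-anchor tile) refl (refl , outside-paint tile (record { kept = λ _ _ → refl }) , write-cell stop rendered₀ tile refl refl))
        λ o rd at → wp-⟫ {t₁ = suc (measure [] (root ∷ []) (just right)) ℕ.* step-time} $ wp-pre $ remember memory $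
        search-run _ (start-inv at rd (clean-outside o clean₀)) ℕ.≤-refl λ {f} at cp cl →
        wp-⟫ {t₁ = 1} $ run-op (near-anchor rooted) refl $ finish f cp cl (lift-peb at lift-far (sym (bg-win f X⁻≤xr)))
        where
          X⁻≤xr : X⁻ ≤ xr
          X⁻≤xr = lin 3 (λ X⁻ X⁺ xr → (X⁻ ≼ X⁺) ∷ (X⁺ ⊕ κ 3 ≼ xr) ∷ [] ⊢ X⁻ ≼ xr) X⁻ X⁺ xr X⁻≤X⁺ ux₁
          X⁻2 : X⁻ + + 2 ≤ xr
          X⁻2 = lin 3 (λ X⁻ X⁺ xr → (X⁻ ≼ X⁺) ∷ (X⁺ ⊕ κ 3 ≼ xr) ∷ [] ⊢ X⁻ ⊕ κ 2 ≼ xr) X⁻ X⁺ xr X⁻≤X⁺ ux₁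
          remember : ∀ {Q t q f v} → w₀ ≡ v → Run search (v , just right) t q f Q → Run search (w₀ , just right) t q f Q
          remember refl x = x
          y-bounds : Y⁻ ≤ y₀ × y₀ ≤ Y⁺
          y-bounds = proj₂ (bounded tile)
          lift-far : ∀ {r} → r ∈ (X⁻ , yb) ∷ (X⁻ , yt) ∷ rights → Far (X⁻ , y₀) r
          lift-far (here refl) = inj₂ (inj₂ (lin 3 (λ y₀ yb Y⁻ → (Y⁻ ≼ y₀) ∷ (yb ⊕ κ 3 ≼ Y⁻) ∷ [] ⊢ yb ⊕ κ 2 ≼ y₀) y₀ yb Y⁻ (proj₁ y-bounds) ly₁))
          lift-far (there (here refl)) = inj₂ (inj₁ (lin 3 (λ y₀ yt Y⁺ → (y₀ ≼ Y⁺) ∷ (Y⁺ ⊕ κ 3 ≼ yt) ∷ [] ⊢ y₀ ⊕ κ 2 ≼ yt) y₀ yt Y⁺ (proj₂ y-bounds)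
              uy₁))
          lift-far (there (there (here refl))) = inj₁ (inj₁ X⁻2)
          lift-far (there (there (there (here refl)))) = inj₁ (inj₁ X⁻2)
          finish : ∀ {f₂} f → Complete f → Clean f → Overlay f₂ (bg f) ((X⁻ , yb) ∷ (X⁻ , yt) ∷ rights) →
            Run (walk down ⟫ clear) tt ((1 ℕ.+ D) ℕ.+ clear-time) (X⁻ , y₀) f₂ (λ _ q f → Anchor q × Scaled f)
          finish {f₂} f cp cl o = wp-⟫ {t₁ = 1 ℕ.+ D} $ fall (above rooted) $ clear-run (ground f) X⁻≤X⁺ (swap-peb o) λ {q} {f₃} aq e → aq , record
            { filled = λ {p} t i j li lj → trans (e (pix p i j)) (trans (kept-right (cells-right i j t)) (cp t i j li lj))
            ; clean = λ (x , y) ne → trans (e (x , y)) (gone x y ne (side-of x)) }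
            where
              kept-right : ∀ {x y} → xr + + 3 ≤ x → cut (xr - + 1) (bg f) (x , y) ≡ f (x , y)
              kept-right {x} h = trans (cut-≥ (bg f) (lin 2 (λ x xr → (xr ⊕ κ 3 ≼ x) ∷ [] ⊢ xr ⊖ κ 1 ≼ x) x xr h)) (bg-right f h)
              gone : ∀ x y → (∀ {p} → Cell p → ∀ i j → i ℕ.< c → j ℕ.< c → (x , y) ≢ pix p i j) → x ≤ xr + + 2 ⊎ xr + + 3 ≤ x → cut (xr - + 1) (bg f)
                  (x , y) ≡ false
              gone x y ne (inj₂ h) = trans (kept-right h) (cl x y h ne)
              gone x y ne (inj₁ h) with cut (xr - + 1) (bg f) (x , y) in e
              ... | false = refl
              ... | true  = ⊥-elim (1≰0 (lin 3 (λ x xr X⁺ → (xr ⊖ κ 1 ≼ x) ∷ (X⁺ ⊕ κ 3 ≼ xr) ∷ (x ≼ X⁺) ∷ [] ⊢ κ 1 ≼ κ 0) x xr X⁺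
                  (proj₁ (cut-true {xr - + 1} {x} {y} (bg f) e)) ux₁
                      (proj₂ (proj₁ (bounded (trans (sym (bg-left f {x} {y} h)) (proj₂ (cut-true {xr - + 1} {x} {y} (bg f) e))))))))
              fall : ∀ {Q} → ∃[ n ] (y₀ ≡ yb + + n) → Q tt (X⁻ , yb) f₂ → Run (walk down) tt (1 ℕ.+ D) (X⁻ , y₀) f₂ Q
              fall {Q} (zero , e) k = ⊥-elim (1≰0 (lin 3 (λ y₀ yb Y⁻ → (y₀ ≐ yb ⊕ κ 0) ∷ (Y⁻ ≼ y₀) ∷ (yb ⊕ κ 3 ≼ Y⁻) ∷ [] ⊢ κ 1 ≼ κ 0) y₀ yb Y⁻ e
                  (proj₁ y-bounds) ly₁))
              fall {Q} (suc i , e) k = wp-mono (ℕ.s≤s (n≤D rooted e)) $ wp-⟫ {t₁ = 1} $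
                steps-run 0 (λ { zero _ → subst Anchor (sym (adv-zero down (X⁻ , y₀))) (near-anchor rooted) }) $
                wp-at (trans (cong (λ z → adv down 1 (X⁻ , z)) e) (adv-opp up 1 i (X⁻ , yb))) $ wp-map $ wp-pre $ wp-carry $
                back-run i (λ k le → L .Line.anchor k (ℕ.m≤n⇒m≤1+n le))
                    (λ k 0<k le → clear-line {B = bg f} {d = up} k 0<k o (L .Line.legal k (ℕ.m≤n⇒m≤1+n le))
                    (λ r → inj₁ (L .Line.apart r k (ℕ.m≤n⇒m≤1+n le))))
                  (o .on (here refl)) (λ _ → k)
                where
                  L : Line (bg f) up right (suc i) (X⁻ , yb) ((X⁻ , yt) ∷ rights)
                  L = standLine f up-right rooted e

open Scaler

-- Counting pixels, and the geometry of polyominoes.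

module PolyominoGeometry where

  open import Data.Integer using (_+_; _-_; _≤_; _*_; _⊓_; _⊔_; ∣_∣)

  -- The pigeonhole principle: each element of `xs` uses up one entry of `ys`. It yields the bounds
  -- on visited tiles, space and additional tiles, and also `w ≤ N` and `N ≤ w * h`.
  length-⊆ : ∀ {A : Set} {xs ys : List A} → Unique xs → (∀ {x} → x ∈ xs → x ∈ ys) → length xs ℕ.≤ length ys
  length-⊆ {xs = []}     u        sub = ℕ.z≤n
  length-⊆ {A} {xs = x ∷ xs} {ys} (x∉ ∷ u) sub with ∈-∃++ (sub (here refl))
  ... | as , bs , refl = ℕ.≤-trans (ℕ.s≤s (length-⊆ u sub′)) (ℕ.≤-reflexive lengths)
    where
      sub′ : ∀ {y} → y ∈ xs → y ∈ as ++ bs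
      sub′ {y} i with ∈-++⁻ as (sub (there i))
      ... | inj₁ j         = ∈-++⁺ˡ j
      ... | inj₂ (here refl) = ⊥-elim (All¬⇒¬Any x∉ i)
      ... | inj₂ (there j) = ∈-++⁺ʳ as j
      lengths : suc (length (as ++ bs)) ≡ length (as ++ x ∷ bs)
      lengths = trans (cong suc (length-++ as)) (trans (sym (ℕ.+-suc (length as) (length bs))) (sym (length-++ as)))

  grid : ℤ → ℤ → ℕ → ℕ → List Pixel
  grid x y m n = cartesianProductWith (λ i j → x + + i , y + + j) (upTo m) (upTo n)

  length-product : ∀ {A B C : Set} (f : A → B → C) xs ys → length (cartesianProductWith f xs ys) ≡ length xs ℕ.* length ys
  length-product f []       ys = refl
  length-product f (x ∷ xs) ys = trans (length-++ (map (f x) ys)) (cong₂ ℕ._+_ (length-map (f x) ys) (length-product f xs ys))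

  length-grid : ∀ x y m n → length (grid x y m n) ≡ m ℕ.* n
  length-grid x y m n = trans (length-product _ (upTo m) (upTo n)) (cong₂ ℕ._*_ (length-upTo m) (length-upTo n))

  ∈-grid : ∀ x y {m n} i j → i ℕ.< m → j ℕ.< n → (x + + i , y + + j) ∈ grid x y m n
  ∈-grid x y i j li lj = ∈-cartesianProductWith⁺ (λ i j → x + + i , y + + j) (∈-upTo⁺ li) (∈-upTo⁺ lj)

  grid∋ : ∀ {x y m n u w} → x ≤ u → u + + 1 ≤ x + + m → y ≤ w → w + + 1 ≤ y + + n → (u , w) ∈ grid x y m n
  grid∋ {x} {y} {m} {n} a b c d with distance a | distance c
  ... | i , refl | j , refl = ∈-grid x y i j (ℤ.drop‿+≤+ (lin 3 (λ x i m → (κ 0 ≼ i) ∷ (κ 0 ≼ m) ∷ (x ⊕ i ⊕ κ 1 ≼ x ⊕ m) ∷ [] ⊢ κ 1 ⊕ i ≼ m) x (+ i)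
      (+ m) (0≤+ i) (0≤+ m) b)) (ℤ.drop‿+≤+ (lin 3 (λ x i m → (κ 0 ≼ i) ∷ (κ 0 ≼ m) ∷ (x ⊕ i ⊕ κ 1 ≼ x ⊕ m) ∷ [] ⊢ κ 1 ⊕ i ≼ m) y (+ j) (+ n) (0≤+ j)
      (0≤+ n) d))

  grid⁻ : ∀ {x y m n q} → q ∈ grid x y m n → ∃[ i ] ∃[ j ] (i ℕ.< m × j ℕ.< n × q ≡ (x + + i , y + + j))
  grid⁻ {m = m} {n} h with ∈-cartesianProductWith⁻ _ (upTo m) (upTo n) h
  ... | i , j , hi , hj , e = i , j , ∈-upTo⁻ hi , ∈-upTo⁻ hj , e

  ∈-blocks⁺ : ∀ {A : Set} (g : A → List Pixel) {p q ps} → p ∈ ps → q ∈ g p → q ∈ concatMap g ps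
  ∈-blocks⁺ g {ps = _ ∷ ps} (here refl) h = ∈-++⁺ˡ h
  ∈-blocks⁺ g {ps = p ∷ ps} (there i)   h = ∈-++⁺ʳ (g p) (∈-blocks⁺ g i h)

  ∈-blocks⁻ : ∀ {A : Set} (g : A → List Pixel) {q} ps → q ∈ concatMap g ps → ∃[ p ] (p ∈ ps × q ∈ g p)
  ∈-blocks⁻ g (p ∷ ps) h with ∈-++⁻ (g p) h
  ... | inj₁ i = p , here refl , i
  ... | inj₂ i = let p′ , j , k = ∈-blocks⁻ g ps i in p′ , there j , k

  length-blocks : ∀ {A : Set} (g : A → List Pixel) k → (∀ p → length (g p) ≡ k) → ∀ ps → length (concatMap g ps) ≡ length ps ℕ.* k
  length-blocks g k e []       = refl
  length-blocks g k e (p ∷ ps) = trans (length-++ (g p)) (cong₂ ℕ._+_ (e p) (length-blocks g k e ps))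

  minL-≤ : ∀ {xs x} → x ∈ xs → minL xs ≤ x
  minL-≤ {z ∷ zs} i = go-≤ zs i
    where
      go-≤ : ∀ zs {x} → x ∈ z ∷ zs → foldr _⊓_ z zs ≤ x
      go-≤ []       (here refl)         = ℤ.≤-refl
      go-≤ (y ∷ zs) (here refl)         = ℤ.≤-trans (ℤ.i⊓j≤j y _) (go-≤ zs (here refl))
      go-≤ (y ∷ zs) (there (here refl)) = ℤ.i⊓j≤i y _
      go-≤ (y ∷ zs) (there (there i))   = ℤ.≤-trans (ℤ.i⊓j≤j y _) (go-≤ zs (there i))

  maxL-≥ : ∀ {xs x} → x ∈ xs → x ≤ maxL xs
  maxL-≥ {z ∷ zs} i = go-≥ zs i
    where
      go-≥ : ∀ zs {x} → x ∈ z ∷ zs → x ≤ foldr _⊔_ z zs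
      go-≥ []       (here refl)         = ℤ.≤-refl
      go-≥ (y ∷ zs) (here refl)         = ℤ.≤-trans (go-≥ zs (here refl)) (ℤ.i≤j⊔i y _)
      go-≥ (y ∷ zs) (there (here refl)) = ℤ.i≤i⊔j y _
      go-≥ (y ∷ zs) (there (there i))   = ℤ.≤-trans (go-≥ zs (there i)) (ℤ.i≤j⊔i y _)

  minL-∈ : ∀ {xs x} → x ∈ xs → minL xs ∈ xs
  minL-∈ {z ∷ zs} _ = pick zs
    where
      pick : ∀ zs → foldr _⊓_ z zs ∈ z ∷ zs
      pick [] = here refl
      pick (y ∷ zs) with ℤ.⊓-sel y (foldr _⊓_ z zs) | pick zs
      ... | inj₁ e | _       = there (here e)
      ... | inj₂ e | here h  = here (trans e h)
      ... | inj₂ e | there i = there (there (subst (_∈ zs) (sym e) i))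

  maxL-∈ : ∀ {xs x} → x ∈ xs → maxL xs ∈ xs
  maxL-∈ {z ∷ zs} _ = pick zs
    where
      pick : ∀ zs → foldr _⊔_ z zs ∈ z ∷ zs
      pick [] = here refl
      pick (y ∷ zs) with ℤ.⊔-sel y (foldr _⊔_ z zs) | pick zs
      ... | inj₁ e | _       = there (here e)
      ... | inj₂ e | here h  = here (trans e h)
      ... | inj₂ e | there i = there (there (subst (_∈ zs) (sym e) i))

  private
    ∣i∣≡1 : ∀ i → ∣ i ∣ ≡ 1 → i ≡ + 1 ⊎ i ≡ ℤ.- (+ 1)
    ∣i∣≡1 (+ .1)          refl = inj₁ refl
    ∣i∣≡1 (ℤ.negsuc zero) refl = inj₂ refl

    sum≡1 : ∀ m n → m ℕ.+ n ≡ 1 → (m ≡ 0 × n ≡ 1) ⊎ (m ≡ 1 × n ≡ 0)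
    sum≡1 zero       n    e    = inj₁ (refl , e)
    sum≡1 (suc zero) zero refl = inj₂ (refl , refl)

  adjacent-move : ∀ {p q} → Adjacent p q → ∃[ d ] q ≡ move d p
  adjacent-move {x , y} {u , w} e with sum≡1 ∣ x - u ∣ ∣ y - w ∣ e
  ... | inj₁ (ex , ey) with ℤ.i-j≡0⇒i≡j x u (ℤ.∣i∣≡0⇒i≡0 ex) | ∣i∣≡1 (y - w) ey
  ...   | refl | inj₁ h = down , cong (x ,_) (lin 3 (λ y w z → (z ≐ y ⊖ w) ∷ (z ≐ κ 1) ∷ [] ⊢ w ≐ y ⊖ κ 1) y w (y - w) refl h)
  ...   | refl | inj₂ h = up , cong (x ,_) (lin 3 (λ y w z → (z ≐ y ⊖ w) ∷ (z ≐ κ 0 ⊖ κ 1) ∷ [] ⊢ w ≐ y ⊕ κ 1) y w (y - w) refl h)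
  adjacent-move {x , y} {u , w} e | inj₂ (ex , ey) with ℤ.i-j≡0⇒i≡j y w (ℤ.∣i∣≡0⇒i≡0 ey) | ∣i∣≡1 (x - u) ex
  ...   | refl | inj₁ h = left , cong (_, y) (lin 3 (λ y w z → (z ≐ y ⊖ w) ∷ (z ≐ κ 1) ∷ [] ⊢ w ≐ y ⊖ κ 1) x u (x - u) refl h)
  ...   | refl | inj₂ h = right , cong (_, y) (lin 3 (λ y w z → (z ≐ y ⊖ w) ∷ (z ≐ κ 0 ⊖ κ 1) ∷ [] ⊢ w ≐ y ⊕ κ 1) x u (x - u) refl h)

  -- The only common neighbours of the two tiles of a pebble pattern are the other
  -- two pixels of the window.
  window-legal : ∀ {P} → IsPolyomino P → ∀ q → isPeb (win (pic P) q) ≡ false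
  window-legal {P} poly q with isPeb (win (pic P) q) in e
  ... | false = refl
  ... | true = ⊥-elim (conflict (IsPolyomino.diagonal poly (pic⇒∈ (cong bit₁ W)) (pic⇒∈ (cong bit₃ W)) diag))
    where
      x y : ℤ
      x = proj₁ q
      y = proj₂ q
      W : win (pic P) q ≡ peb
      W = isPeb⇒≡ (win (pic P) q) e
      diag : Diagonal (x + + 1 , y) (x , y + + 1)
      diag = cong ∣_∣ (lin 1 (λ x → [] ⊢ x ⊕ κ 1 ⊖ x ≐ κ 1) x) , cong ∣_∣ (lin 1 (λ y → [] ⊢ y ⊖ (y ⊕ κ 1) ≐ κ 0 ⊖ κ 1) y)
      true≢false : true ≢ false
      true≢false ()
      absent : ∀ {t} → t ∈ P → t ≡ q ⊎ t ≡ corner₂ q → ⊥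
      absent t (inj₁ refl) = true≢false (trans (sym (∈⇒pic t)) (cong bit₀ W))
      absent t (inj₂ refl) = true≢false (trans (sym (∈⇒pic t)) (cong bit₂ W))
      common : ∀ {t} → (∃[ d ] (x + + 1 , y) ≡ move d t) → (∃[ d ] (x , y + + 1) ≡ move d t) → t ≡ q ⊎ t ≡ corner₂ q
      common {u , w} (right , e₁) (_ , e₂) = inj₁ (cong₂ _,_ (lin 2 (λ u x → (x ⊕ κ 1 ≐ u ⊕ κ 1) ∷ [] ⊢ u ≐ x) u x (cong proj₁ e₁))
          (sym (cong proj₂ e₁)))
      common {u , w} (up , e₁) (left , e₂) = ⊥-elim (1≰0 (lin 2 (λ w y → (y ≐ w ⊕ κ 1) ∷ (y ⊕ κ 1 ≐ w) ∷ [] ⊢ κ 1 ≼ κ 0) w y (cong proj₂ e₁)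
          (cong proj₂ e₂)))
      common {u , w} (up , e₁) (right , e₂) = ⊥-elim (1≰0 (lin 2 (λ w y → (y ≐ w ⊕ κ 1) ∷ (y ⊕ κ 1 ≐ w) ∷ [] ⊢ κ 1 ≼ κ 0) w y (cong proj₂ e₁)
          (cong proj₂ e₂)))
      common {u , w} (up , e₁) (up , e₂) = ⊥-elim (1≰0 (lin 2 (λ w y → (y ≐ w ⊕ κ 1) ∷ (y ⊕ κ 1 ≐ w ⊕ κ 1) ∷ [] ⊢ κ 1 ≼ κ 0) w y (cong proj₂ e₁)
          (cong proj₂ e₂)))
      common {u , w} (up , e₁) (down , e₂) = ⊥-elim (1≰0 (lin 2 (λ u x → (x ⊕ κ 1 ≐ u) ∷ (x ≐ u) ∷ [] ⊢ κ 1 ≼ κ 0) u x (cong proj₁ e₁)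
          (cong proj₁ e₂)))
      common {u , w} (down , e₁) (_ , e₂) = inj₂ (cong₂ _,_ (sym (cong proj₁ e₁))
          (lin 2 (λ w y → (y ≐ w ⊖ κ 1) ∷ [] ⊢ w ≐ y ⊕ κ 1) w y (cong proj₂ e₁)))
      common {u , w} (left , e₁) (left , e₂) = ⊥-elim (1≰0 (lin 2 (λ u x → (x ⊕ κ 1 ≐ u ⊖ κ 1) ∷ (x ≐ u ⊖ κ 1) ∷ [] ⊢ κ 1 ≼ κ 0) u x (cong proj₁ e₁)
          (cong proj₁ e₂)))
      common {u , w} (left , e₁) (right , e₂) = ⊥-elim (1≰0 (lin 2 (λ u x → (x ⊕ κ 1 ≐ u ⊖ κ 1) ∷ (x ≐ u ⊕ κ 1) ∷ [] ⊢ κ 1 ≼ κ 0) u x (cong proj₁ e₁)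
          (cong proj₁ e₂)))
      common {u , w} (left , e₁) (up , e₂) = ⊥-elim (1≰0 (lin 2 (λ u x → (x ⊕ κ 1 ≐ u ⊖ κ 1) ∷ (x ≐ u) ∷ [] ⊢ κ 1 ≼ κ 0) u x (cong proj₁ e₁)
          (cong proj₁ e₂)))
      common {u , w} (left , e₁) (down , e₂) = ⊥-elim (1≰0 (lin 2 (λ u x → (x ⊕ κ 1 ≐ u ⊖ κ 1) ∷ (x ≐ u) ∷ [] ⊢ κ 1 ≼ κ 0) u x (cong proj₁ e₁)
          (cong proj₁ e₂)))
      conflict : ∃[ t ] (t ∈ P × Adjacent t (x + + 1 , y) × Adjacent t (x , y + + 1)) → ⊥
      conflict (t , i , a₁ , a₂) = absent i (common (adjacent-move a₁) (adjacent-move a₂))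

  -- Dimensions and connectivity of a polyomino.

  module Facts {P : List Pixel} (poly : IsPolyomino P) where
    open IsPolyomino poly

    X⁻ X⁺ Y⁻ Y⁺ : ℤ
    X⁻ = minX P
    X⁺ = maxX P
    Y⁻ = minY P
    Y⁺ = maxY P

    T : Picture
    T = pic P

    bounded : ∀ {x y} → T (x , y) ≡ true → (X⁻ ≤ x × x ≤ X⁺) × (Y⁻ ≤ y × y ≤ Y⁺)
    bounded {x} {y} t = let i = pic⇒∈ {x , y} {P} t in
      (minL-≤ (∈-map⁺ proj₁ i) , maxL-≥ (∈-map⁺ proj₁ i)) , (minL-≤ (∈-map⁺ proj₂ i) , maxL-≥ (∈-map⁺ proj₂ i))

    private
      attained : ∀ {z} (g : Pixel → ℤ) → z ∈ map g P → ∃[ p ] (T p ≡ true × g p ≡ z)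
      attained g i = let p , j , e = ∈-map⁻ g i in p , ∈⇒pic j , sym e
      someX : proj₁ (proj₁ nonempty) ∈ map proj₁ P
      someX = ∈-map⁺ proj₁ (proj₂ nonempty)
      someY : proj₂ (proj₁ nonempty) ∈ map proj₂ P
      someY = ∈-map⁺ proj₂ (proj₂ nonempty)

    atX⁻ : ∃[ p ] (T p ≡ true × proj₁ p ≡ X⁻)
    atX⁻ = attained proj₁ (minL-∈ someX)
    atX⁺ : ∃[ p ] (T p ≡ true × proj₁ p ≡ X⁺)
    atX⁺ = attained proj₁ (maxL-∈ someX)
    atY⁻ : ∃[ p ] (T p ≡ true × proj₂ p ≡ Y⁻)
    atY⁻ = attained proj₂ (minL-∈ someY)
    atY⁺ : ∃[ p ] (T p ≡ true × proj₂ p ≡ Y⁺)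
    atY⁺ = attained proj₂ (maxL-∈ someY)

    leftmost : ∃[ y ] T (X⁻ , y) ≡ true
    leftmost = let (x , y) , t , e = atX⁻ in y , subst (λ z → T (z , y) ≡ true) e t

    N w h : ℕ
    N = length P
    w = width P
    h = Defs.height P

    few : ∀ {V} → Unique V → (∀ {q} → q ∈ V → T q ≡ true) → length V ℕ.≤ N
    few u sub = length-⊆ u (λ i → pic⇒∈ (sub i))

    -- Connectivity as an induction principle along paths, the only form in which it is used.
    connected′ : ∀ {r} → T r ≡ true → ∀ (S : Pixel → Set) → S r → (∀ {q} d → T q ≡ true → S q → T (move d q) ≡ true → S (move d q)) → ∀ {q} → T q ≡
        true → S q
    connected′ {r} tr S s spread {q} tq = along tr s (connected (pic⇒∈ tr) (pic⇒∈ tq))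
      where
        along : ∀ {p q} → T p ≡ true → S p → PathIn P p q → S q
        along tp s here = s
        along {p} tp s (PathIn.step {q = q} adj i path) with adjacent-move {p} {q} adj
        ... | d , refl = along (∈⇒pic i) (spread d tp s (∈⇒pic i)) path

    -- A step from tile to tile that left the open interior would land on a side, and the sides
    -- carry no tiles.
    enclosed : ∀ {sx sy} → T (sx , sy) ≡ true → ∀ {xl xr yb yt} → xl + + 1 ≤ sx → sx + + 1 ≤ xr → yb + + 1 ≤ sy → sy + + 1 ≤ yt →
      (∀ u → xl ≤ u → u ≤ xr → T (u , yb) ≡ false) → (∀ u → xl ≤ u → u ≤ xr → T (u , yt) ≡ false) →
      (∀ u → yb ≤ u → u ≤ yt → T (xl , u) ≡ false) → (∀ u → yb ≤ u → u ≤ yt → T (xr , u) ≡ false) →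
      (xl + + 1 ≤ X⁻ × X⁺ + + 1 ≤ xr) × (yb + + 1 ≤ Y⁻ × Y⁺ + + 1 ≤ yt)
    enclosed {sx} {sy} ts {xl} {xr} {yb} {yt} h₁ h₂ h₃ h₄ fb ft fl fr =
      (at atX⁻ (λ i → proj₁ (proj₁ i)) , at′ atX⁺ (λ i → proj₂ (proj₁ i))) , (at₂ atY⁻ (λ i → proj₁ (proj₂ i)) , at₂′ atY⁺ (λ i → proj₂ (proj₂ i)))
      where
        In : Pixel → Set
        In (x , y) = (xl + + 1 ≤ x × x + + 1 ≤ xr) × (yb + + 1 ≤ y × y + + 1 ≤ yt)
        true≢false : true ≢ false
        true≢false ()
        weak : ∀ {a b} → a + + 1 ≤ b → a ≤ b
        weak {a} {b} h = lin 2 (λ a b → (a ⊕ κ 1 ≼ b) ∷ [] ⊢ a ≼ b) a b h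
        stay : ∀ {q} d → T q ≡ true → In q → T (move d q) ≡ true → In (move d q)
        stay {x , y} right t ((a , b) , (c , d)) t′ = (lin 2 (λ xl x → (xl ⊕ κ 1 ≼ x) ∷ [] ⊢ xl ⊕ κ 1 ≼ x ⊕ κ 1) xl x a , [
            (λ k → ⊥-elim (true≢false (trans (sym t′) (trans (cong (λ z → T (z , y)) (ℤ.≤-antisym b k)) (fr y (weak c) (weak d)))))) , id ]′
            (≤-or-> xr (x + + 1))) , (c , d)
        stay {x , y} left t ((a , b) , (c , d)) t′ = ([ (λ k → ⊥-elim
            (true≢false (trans (sym t′) (trans (cong (λ z → T (z , y)) (ℤ.≤-antisym k (lin 2 (λ xl x → (xl ⊕ κ 1 ≼ x) ∷ [] ⊢ xl ≼ x ⊖ κ 1) xl x a)))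
            (fl y (weak c) (weak d)))))) , id ]′ (≤-or-> (x - + 1) xl) , lin 2 (λ x xr → (x ⊕ κ 1 ≼ xr) ∷ [] ⊢ x ⊖ κ 1 ⊕ κ 1 ≼ xr) x xr b) , (c , d)
        stay {x , y} up t ((a , b) , (c , d)) t′ = (a , b) , (lin 2 (λ xl x → (xl ⊕ κ 1 ≼ x) ∷ [] ⊢ xl ⊕ κ 1 ≼ x ⊕ κ 1) yb y c , [
            (λ k → ⊥-elim (true≢false (trans (sym t′) (trans (cong (λ z → T (x , z)) (ℤ.≤-antisym d k)) (ft x (weak a) (weak b)))))) , id ]′
            (≤-or-> yt (y + + 1)))
        stay {x , y} down t ((a , b) , (c , d)) t′ = (a , b) ,
            ([ (λ k → ⊥-elim (true≢false (trans (sym t′) (trans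
            (cong (λ z → T (x , z)) (ℤ.≤-antisym k (lin 2 (λ xl x → (xl ⊕ κ 1 ≼ x) ∷ [] ⊢ xl ≼ x ⊖ κ 1) yb y c))) (fb x (weak a) (weak b)))))) , id
            ]′ (≤-or-> (y - + 1) yb) , lin 2 (λ x xr → (x ⊕ κ 1 ≼ xr) ∷ [] ⊢ x ⊖ κ 1 ⊕ κ 1 ≼ xr) y yt d)
        inside : ∀ {q} → T q ≡ true → In q
        inside = connected′ ts In ((h₁ , h₂) , (h₃ , h₄)) (λ {q} → stay {q})
        at : ∀ {z v} → ∃[ p ] (T p ≡ true × proj₁ p ≡ z) → (∀ {p} → In p → v ≤ proj₁ p) → v ≤ z
        at (p , t , refl) k = k (inside t)
        at′ : ∀ {z v} → ∃[ p ] (T p ≡ true × proj₁ p ≡ z) → (∀ {p} → In p → proj₁ p + + 1 ≤ v) → z + + 1 ≤ v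
        at′ (p , t , refl) k = k (inside t)
        at₂ : ∀ {z v} → ∃[ p ] (T p ≡ true × proj₂ p ≡ z) → (∀ {p} → In p → v ≤ proj₂ p) → v ≤ z
        at₂ (p , t , refl) k = k (inside t)
        at₂′ : ∀ {z v} → ∃[ p ] (T p ≡ true × proj₂ p ≡ z) → (∀ {p} → In p → proj₂ p + + 1 ≤ v) → z + + 1 ≤ v
        at₂′ (p , t , refl) k = k (inside t)

    private
      X⁻≤X⁺ : X⁻ ≤ X⁺
      X⁻≤X⁺ = let p , t , e = atX⁻ in ℤ.≤-trans (ℤ.≤-reflexive (sym e)) (proj₂ (proj₁ (bounded t)))
      Y⁻≤Y⁺ : Y⁻ ≤ Y⁺
      Y⁻≤Y⁺ = let p , t , e = atY⁻ in ℤ.≤-trans (ℤ.≤-reflexive (sym e)) (proj₂ (proj₂ (bounded t)))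

    w≡ : X⁻ + + w ≡ X⁺ + + 1
    w≡ = trans (cong (λ z → X⁻ + (+ 1 + z)) (ℤ.0≤i⇒+∣i∣≡i (ℤ.i≤j⇒0≤j-i X⁻≤X⁺))) (lin 2 (λ a b → [] ⊢ a ⊕ (κ 1 ⊕ (b ⊖ a)) ≐ b ⊕ κ 1) X⁻ X⁺)
    h≡ : Y⁻ + + h ≡ Y⁺ + + 1
    h≡ = trans (cong (λ z → Y⁻ + (+ 1 + z)) (ℤ.0≤i⇒+∣i∣≡i (ℤ.i≤j⇒0≤j-i Y⁻≤Y⁺))) (lin 2 (λ a b → [] ⊢ a ⊕ (κ 1 ⊕ (b ⊖ a)) ≐ b ⊕ κ 1) Y⁻ Y⁺)

    private
      between-move : ∀ d (g : Pixel → ℤ) → (∀ p → g (move d p) ≤ g p + + 1) → ∀ lo {q} → (∀ v → lo ≤ v → v ≤ g q → ∃[ p ] (T p ≡ true × g p ≡ v)) →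
        T (move d q) ≡ true → ∀ v → lo ≤ v → v ≤ g (move d q) → ∃[ p ] (T p ≡ true × g p ≡ v)
      between-move d g slow lo {q} ih t v a b with ≤-or-> v (g q)
      ... | inj₁ k = ih v a k
      ... | inj₂ k = move d q , t , ℤ.≤-antisym (ℤ.≤-trans (slow q) k) b

      slowX : ∀ d p → proj₁ (move d p) ≤ proj₁ p + + 1
      slowX up    (x , y) = ℤ.i≤i+j x (+ 1)
      slowX down  (x , y) = ℤ.i≤i+j x (+ 1)
      slowX left  (x , y) = lin 1 (λ x → [] ⊢ x ⊖ κ 1 ≼ x ⊕ κ 1) x
      slowX right (x , y) = ℤ.≤-refl
      slowY : ∀ d p → proj₂ (move d p) ≤ proj₂ p + + 1
      slowY up    (x , y) = ℤ.≤-refl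
      slowY down  (x , y) = lin 1 (λ y → [] ⊢ y ⊖ κ 1 ≼ y ⊕ κ 1) y
      slowY left  (x , y) = ℤ.i≤i+j y (+ 1)
      slowY right (x , y) = ℤ.i≤i+j y (+ 1)

      -- A discrete intermediate value theorem: along a path the coordinate `g` grows by at most one
      -- per step.
      everywhere : (g : Pixel → ℤ) → (∀ d p → g (move d p) ≤ g p + + 1) → ∀ {lo hi} → (∃[ p ] (T p ≡ true × g p ≡ lo)) →
          (∃[ p ] (T p ≡ true × g p ≡ hi)) →
        ∀ v → lo ≤ v → v ≤ hi → ∃[ p ] (T p ≡ true × g p ≡ v)
      everywhere g slow {lo} (p , t , refl) (q , t′ , refl) =
        connected′ t (λ q → ∀ v → lo ≤ v → v ≤ g q → ∃[ p ] (T p ≡ true × g p ≡ v)) (λ v a b → p , t , ℤ.≤-antisym a b)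
          (λ {q} d _ ih t → between-move d g (slow d) lo {q} ih t) t′

      enough : (g : Pixel → ℤ) → ∀ {lo hi} n → lo + + n ≡ hi + + 1 → (∀ v → lo ≤ v → v ≤ hi → ∃[ p ] (T p ≡ true × g p ≡ v)) → n ℕ.≤ N
      enough g {lo} {hi} n e ev = subst₂ ℕ._≤_ (trans (length-map _ (upTo n)) (length-upTo n)) (length-map g P)
        (length-⊆ (Unique.map⁺ inj (Unique.upTo⁺ n)) sub)
        where
          inj : ∀ {i j} → lo + + i ≡ lo + + j → i ≡ j
          inj {i} {j} e = ℤ.+-injective (lin 3 (λ lo i j → (lo ⊕ i ≐ lo ⊕ j) ∷ [] ⊢ i ≐ j) lo (+ i) (+ j) e)
          sub : ∀ {z} → z ∈ map (λ i → lo + + i) (upTo n) → z ∈ map g P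
          sub z∈ =
            let i , i∈ , e₁ = ∈-map⁻ (λ i → lo + + i) z∈
                p , t , e₂ = ev (lo + + i) (ℤ.i≤i+j lo (+ i))
                    (lin 4 (λ lo hi i n → (κ 0 ≼ i) ∷ (κ 0 ≼ n) ∷ (lo ⊕ n ≐ hi ⊕ κ 1) ∷ (κ 1 ⊕ i ≼ n) ∷ [] ⊢ lo ⊕ i ≼ hi) lo hi (+ i) (+ n) (0≤+ i)
                    (0≤+ n) e (ℤ.+≤+ (∈-upTo⁻ i∈)))
            in subst (_∈ map g P) (trans e₂ (sym e₁)) (∈-map⁺ g (pic⇒∈ t))

    -- Every column of the box contains a tile. This is what lets a factor `D` in the running time
    -- be charged to `N`.
    w≤N : w ℕ.≤ N
    w≤N = enough proj₁ w w≡ (everywhere proj₁ slowX atX⁻ atX⁺)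
    h≤N : h ℕ.≤ N
    h≤N = enough proj₂ h h≡ (everywhere proj₂ slowY atY⁻ atY⁺)

    boxList : List Pixel
    boxList = grid X⁻ Y⁻ w h

    box∋ : ∀ {q} → inBox P q → q ∈ boxList
    box∋ {x , y} ((a , b) , (c , d)) = grid∋ a (lin 3 (λ x l r → (l ≐ r ⊕ κ 1) ∷ (x ≼ r) ∷ [] ⊢ x ⊕ κ 1 ≼ l) x (X⁻ + + w) X⁺ w≡ b) c
        (lin 3 (λ x l r → (l ≐ r ⊕ κ 1) ∷ (x ≼ r) ∷ [] ⊢ x ⊕ κ 1 ≼ l) y (Y⁻ + + h) Y⁺ h≡ d)

    N≤wh : N ℕ.≤ w ℕ.* h
    N≤wh = subst (N ℕ.≤_) (length-grid X⁻ Y⁻ w h) (length-⊆ unique (λ i → box∋ (bounded (∈⇒pic i))))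

    1≤N : 1 ℕ.≤ N
    1≤N = ℕ.≤-trans (ℕ.s≤s ℕ.z≤n) w≤N

open PolyominoGeometry

-- Space, tiles, and the proof of the theorem.

module Analysis where

  open import Data.Integer using (_+_; _-_; _≤_; _*_)
  import Data.Fin as Fin

  set-unique : ∀ p b {ts} → Unique ts → Unique (setPixel p b ts)
  set-unique p false u = Unique.filter⁺ (λ t → ¬? (p ≟P t)) u
  set-unique p true {ts} u with occupied p ts in e
  ... | true  = u
  ... | false = All.tabulate (λ {x} i h → absurd (trans (sym e) (∈⇒pic (subst (_∈ ts) (sym h) i)))) ∷ u
    where absurd : false ≢ true
          absurd ()

  set-∈ : ∀ p b {ts q} → q ∈ setPixel p b ts → q ∈ ts ⊎ q ≡ p
  set-∈ p false {ts} i = inj₁ (proj₁ (∈-filter⁻ (λ t → ¬? (p ≟P t)) {xs = ts} i))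
  set-∈ p true {ts} i with occupied p ts | i
  ... | true  | j       = inj₁ j
  ... | false | here e  = inj₂ e
  ... | false | there j = inj₁ j

  module Trajectory (R : Robot) (Region : Pixel → Set) (P : List Pixel) where
    open Trace R Region

    -- The robot places tiles only where it stands, so the number of tiles is bounded by a number of
    -- pixels, provided that the list has no duplicates.
    Tidy : Config R → Set
    Tidy C = Unique (tiles C) × (∀ {q} → q ∈ tiles C → q ∈ P ⊎ Region q)

    tidy-step : ∀ C → Region (pos C) → Tidy C → Tidy (stepR R C)
    tidy-step (config s p ts) reg (u , sub) with Robot.δ R s (occupied p ts)
    ... | s′ , b , d = set-unique p b u , λ i → [ sub , (λ { refl → inj₂ reg }) ]′ (set-∈ p b i)

    tidy-run : ∀ {n C C′} → Steps n C C′ → Tidy C → ∀ i → i ℕ.≤ n → Tidy (run R i C)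
    tidy-run ss               t zero    le         = t
    tidy-run ((h , reg) ∷ ss) t (suc i) (ℕ.s≤s le) = tidy-run ss (tidy-step _ reg t) i le

  module _ {B : Set} (p : Prog ⊤ B) (Anchor : Pixel → Set) (Q : Picture → Set) where
    open Compile p
    open Simulation p Anchor
    open Semantics Anchor

    Simulated : List Pixel → Pixel → ℕ → Set
    Simulated P s n = ∃[ T ] (T ℕ.≤ 9 ℕ.* n × HaltsAt robot P s T
      × (∃[ f ] (pic (tiles (run robot T (initial robot P s))) ≗ f × Q f))
      × (∀ i → i ℕ.≤ T → Region (pos (run robot i (initial robot P s))))
      × (∀ i → i ℕ.≤ T → Trajectory.Tidy robot Region P (run robot i (initial robot P s))))

    robot-run : ∀ {P s n} → Unique P → Run p tt n s (pic P) (λ _ q f → Anchor q × Q f) → Simulated P s n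
    robot-run {P} {s} {n} u prog = conclude (simulate {Q = λ q f → Anchor q × Q f} id prog P (λ _ → refl))
      where
        open Trace robot Region
        open Trajectory robot Region P
        conclude : Outcome (λ q f → Anchor q × Q f) (resume (inj₁ (Prog.enter p tt))) s (9 ℕ.* n) P → Simulated P s n
        conclude (t , q′ , ts′ , f , le , ss , e , (aq , sc)) = t , le ,
          (cong state end , λ i lt → proj₁ (steps-before ss i lt)) ,
          (f , subst (λ C → pic (tiles C) ≗ f) (sym end) e , sc) ,
          (λ i le → [ (λ lt → proj₂ (steps-before ss i lt)) , (λ { refl → subst Region (cong pos (sym end)) (q′ , aq , inj₁ refl) }) ]′
              (ℕ.m≤n⇒m<n∨m≡n le)) ,
          (λ i le → tidy-run ss (u , inj₁) i le)
          where
            end : run robot t (initial robot P s) ≡ config (Robot.halt robot) q′ ts′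
            end = run-steps ss

  space-bound : ∀ R P s T ext → (∀ i → i ℕ.≤ T → let q = pos (run R i (initial R P s)) in inBox P q ⊎ q ∈ ext) → additionalSpace R P s T ℕ.≤ length ext
  space-bound R P s T ext cover = length-⊆ (UniqueDec.deduplicate-! _≟P_ outside) sub
    where
      visited outside : List Pixel
      visited = map (λ i → pos (run R i (initial R P s))) (upTo (suc T))
      outside = filter (λ q → ¬? (inBox? P q)) visited
      sub : ∀ {q} → q ∈ deduplicate _≟P_ outside → q ∈ ext
      sub i with ∈-filter⁻ (λ q → ¬? (inBox? P q)) {xs = visited} (∈-deduplicate⁻ _≟P_ outside i)
      ... | j , ¬in with ∈-map⁻ (λ i → pos (run R i (initial R P s))) j
      ...   | k , k∈ , refl with cover k (ℕ.≤-pred (∈-upTo⁻ k∈))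
      ...     | inj₁ in′ = ⊥-elim (¬in in′)
      ...     | inj₂ e   = e

  Achieved : ℕ → ℕ → List Pixel → Pixel → Robot → Set
  Achieved K c P s R =
    let N = length P
        w = width P
        h = height P
    in Σ ℕ λ T →
      HaltsAt R P s T
      × (∃[ a ] ∃[ b ] (∀ q → (q ∈ tiles (run R T (initial R P s))) ⇔ InScaled c P a b q))
      × T ℕ.≤ K ℕ.* ((w ℕ.* w ℕ.+ h ℕ.* h) ℕ.* (c ℕ.* c) ℕ.* N)
      × (∀ i → i ℕ.≤ T → length (tiles (run R i (initial R P s))) ℕ.≤ N ℕ.+ K ℕ.* (c ℕ.* c ℕ.* w ℕ.* h))
      × additionalSpace R P s T ℕ.≤ K ℕ.* (c ℕ.* c ℕ.* N)

  -- For a numeral K, the products would be unfolded in comparing the types.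
  achieve : ∀ {K c P s R T e e′} → HaltsAt R P s T →
    (∃[ a ] ∃[ b ] (∀ q → (q ∈ tiles (run R T (initial R P s))) ⇔ InScaled c P a b q)) →
    T ≲ K · (width P ℕ.* width P ℕ.+ height P ℕ.* height P) ℕ.* (c ℕ.* c) ℕ.* length P →
    (∀ i → i ℕ.≤ T → length (tiles (run R i (initial R P s))) ℕ.≤ length P ℕ.+ e) → e ≲ K · c ℕ.* c ℕ.* width P ℕ.* height P →
    additionalSpace R P s T ℕ.≤ e′ → e′ ≲ K · c ℕ.* c ℕ.* length P →
    Achieved K c P s R
  achieve {P = P} {T = T} stops scaled time few ⌈ e≤ ⌉ space ⌈ e′≤ ⌉ =
    T , stops , scaled , bound time , (λ i le → ℕ.≤-trans (few i le) (ℕ.+-monoʳ-≤ (length P) e≤)) , ℕ.≤-trans space e′≤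

  -- The offsets include `c`: filling a cell leads one pixel past its last column and its last row.
  data CellAnchor (T : Picture) (c : ℕ) (a b : ℤ) : Pixel → Set where
    cellAt : ∀ {x y} → T (x , y) ≡ true → ∀ i j → i ℕ.≤ c → j ℕ.≤ c → CellAnchor T c a b (a + + c * x + + i , b + + c * y + + j)

  -- Scaling factors of at least two.

  module Assembly (c₂ : ℕ) {P : List Pixel} (poly : IsPolyomino P) {s : Pixel} (s∈P : s ∈ P) where
    open Facts poly

    c : ℕ
    c = suc (suc c₂)

    D : ℕ
    D = (w ℕ.+ h) ℕ.+ 16

    wide : X⁺ - X⁻ + + 16 ≤ + D
    wide = lin 4 (λ a b w h → (κ 0 ≼ w) ∷ (κ 0 ≼ h) ∷ (a ⊕ w ≐ b ⊕ κ 1) ∷ [] ⊢ b ⊖ a ⊕ κ 16 ≼ (w ⊕ h) ⊕ κ 16) X⁻ X⁺ (+ w) (+ h) (0≤+ w) (0≤+ h) w≡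
    tall : Y⁺ - Y⁻ + + 16 ≤ + D
    tall = lin 4 (λ a b w h → (κ 0 ≼ w) ∷ (κ 0 ≼ h) ∷ (a ⊕ h ≐ b ⊕ κ 1) ∷ [] ⊢ b ⊖ a ⊕ κ 16 ≼ (w ⊕ h) ⊕ κ 16) Y⁻ Y⁺ (+ w) (+ h) (0≤+ w) (0≤+ h) h≡

    open Whole X⁻ X⁺ Y⁻ Y⁺ D wide tall T (window-legal poly) bounded leftmost (proj₁ s) (proj₂ s) (∈⇒pic s∈P) (enclosed (∈⇒pic s∈P)) (suc c₂)
        (ℕ.s≤s ℕ.z≤n) N few connected′

    module F = First (Margin X⁻ X⁺ Y⁻ Y⁺) inMargin

    opaque
      -- A run refers to a fixed set of anchors, but the place of the copy is known only from the
      -- outcome of the preparation. So the preparation is first treated within the margin alone and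
      -- its exact outcome extracted; that outcome defines `Anchor`, and the run is then transferred
      -- to it.
      prepared : ∃[ v ] ∃[ q ] ∃[ f ] (Prepared v q f ×
        Semantics.WP (Margin X⁻ X⁺ Y⁻ Y⁺) prepare (λ v₁ q₁ f₁ → (v₁ ≡ v × q₁ ≡ q) × f₁ ≡ f) F.prepare-time (Prog.enter prepare tt) s T)
      prepared = Semantics.wp-exact (Margin X⁻ X⁺ Y⁻ Y⁺) F.prepare-run

    v₀ : Win
    v₀ = proj₁ prepared
    q₀ : Pixel
    q₀ = proj₁ (proj₂ prepared)
    f₀ : Picture
    f₀ = proj₁ (proj₂ (proj₂ prepared))
    pr : Prepared v₀ q₀ f₀
    pr = proj₁ (proj₂ (proj₂ (proj₂ prepared)))

    a b : ℤ
    a = Prepared.xr pr + + 3 - + c * X⁻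
    b = Prepared.yb pr - + c * Prepared.y₀ pr

    Anchor : Pixel → Set
    Anchor q = Margin X⁻ X⁺ Y⁻ Y⁺ q ⊎ CellAnchor T c a b q

    module S = Second Anchor (λ p q r s → inj₁ (inMargin p q r s)) pr (λ t i j li lj → inj₂ (cellAt t i j li lj))
    open Semantics Anchor

    total : ℕ
    total = F.prepare-time ℕ.+ S.reproduce-time

    scaler-run : Run (scaler (suc c₂)) tt total s T (λ _ q f → Anchor q × S.Scaled f)
    scaler-run = wp-⟫ $ wp-post (λ { ((refl , refl) , refl) → S.reproduce-run }) $ wp-anchors inj₁ (proj₂ (proj₂ (proj₂ (proj₂ prepared))))

    open Simulation (scaler (suc c₂)) Anchor using (Region)

    -- Anchors are at most 8 pixels off the box, and windows add a pixel on the right and above: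
    -- strips of width 8 and 9, and lengths enlarged by 17. For the same reason a cell, with anchors
    -- at offsets up to `c`, contributes a block of side `c + 2`.
    ring cells ext : List Pixel
    ring = grid (X⁻ - + 8) (Y⁻ - + 8) 8 (h ℕ.+ 17) ++ grid (X⁺ + + 1) (Y⁻ - + 8) 9 (h ℕ.+ 17)
        ++ grid (X⁻ - + 8) (Y⁻ - + 8) (w ℕ.+ 17) 8 ++ grid (X⁻ - + 8) (Y⁺ + + 1) (w ℕ.+ 17) 9
    cells = concatMap (λ p → grid (a + + c * proj₁ p) (b + + c * proj₂ p) (2 ℕ.+ c) (2 ℕ.+ c)) P
    ext = ring ++ cells

    around : ∀ {u v} → X⁻ - + 8 ≤ u → u ≤ X⁺ + + 9 → Y⁻ - + 8 ≤ v → v ≤ Y⁺ + + 9 → inBox P (u , v) ⊎ (u , v) ∈ ring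
    around {u} {v} h₁ h₂ h₃ h₄ with ≤-or-> X⁻ u | ≤-or-> u X⁺ | ≤-or-> Y⁻ v | ≤-or-> v Y⁺
    ... | inj₂ k | _ | _ | _ = inj₂ (∈-++⁺ˡ (grid∋ h₁ (lin 2 (λ u a → (u ⊕ κ 1 ≼ a) ∷ [] ⊢ u ⊕ κ 1 ≼ a ⊖ κ 8 ⊕ κ 8) u X⁻ k) h₃ rows))
      where rows : v + + 1 ≤ Y⁻ - + 8 + + (h ℕ.+ 17)
            rows = lin 4 (λ v a b h → (κ 0 ≼ h) ∷ (a ⊕ h ≐ b ⊕ κ 1) ∷ (v ≼ b ⊕ κ 9) ∷ [] ⊢ v ⊕ κ 1 ≼ a ⊖ κ 8 ⊕ (h ⊕ κ 17)) v Y⁻ Y⁺ (+ h) (0≤+ h) h≡ h₄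
    ... | inj₁ _ | inj₂ k | _ | _ = inj₂ (∈-++⁺ʳ (grid (X⁻ - + 8) (Y⁻ - + 8) 8 (h ℕ.+ 17))
        (∈-++⁺ˡ (grid∋ k (lin 2 (λ u b → (u ≼ b ⊕ κ 9) ∷ [] ⊢ u ⊕ κ 1 ≼ b ⊕ κ 1 ⊕ κ 9) u X⁺ h₂) h₃ rows)))
      where rows : v + + 1 ≤ Y⁻ - + 8 + + (h ℕ.+ 17)
            rows = lin 4 (λ v a b h → (κ 0 ≼ h) ∷ (a ⊕ h ≐ b ⊕ κ 1) ∷ (v ≼ b ⊕ κ 9) ∷ [] ⊢ v ⊕ κ 1 ≼ a ⊖ κ 8 ⊕ (h ⊕ κ 17)) v Y⁻ Y⁺ (+ h) (0≤+ h) h≡ h₄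
    ... | inj₁ _ | inj₁ _ | inj₂ k | _ = inj₂ (∈-++⁺ʳ (grid (X⁻ - + 8) (Y⁻ - + 8) 8 (h ℕ.+ 17))
        (∈-++⁺ʳ (grid (X⁺ + + 1) (Y⁻ - + 8) 9 (h ℕ.+ 17)) (∈-++⁺ˡ
        (grid∋ h₁ columns h₃ (lin 2 (λ u a → (u ⊕ κ 1 ≼ a) ∷ [] ⊢ u ⊕ κ 1 ≼ a ⊖ κ 8 ⊕ κ 8) v Y⁻ k)))))
      where columns : u + + 1 ≤ X⁻ - + 8 + + (w ℕ.+ 17)
            columns = lin 4 (λ v a b h → (κ 0 ≼ h) ∷ (a ⊕ h ≐ b ⊕ κ 1) ∷ (v ≼ b ⊕ κ 9) ∷ [] ⊢ v ⊕ κ 1 ≼ a ⊖ κ 8 ⊕ (h ⊕ κ 17)) u X⁻ X⁺ (+ w) (0≤+ w)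
                w≡ h₂
    ... | inj₁ _ | inj₁ _ | inj₁ _ | inj₂ k = inj₂ (∈-++⁺ʳ (grid (X⁻ - + 8) (Y⁻ - + 8) 8 (h ℕ.+ 17))
        (∈-++⁺ʳ (grid (X⁺ + + 1) (Y⁻ - + 8) 9 (h ℕ.+ 17)) (∈-++⁺ʳ (grid (X⁻ - + 8) (Y⁻ - + 8) (w ℕ.+ 17) 8)
        (grid∋ h₁ columns k (lin 2 (λ u b → (u ≼ b ⊕ κ 9) ∷ [] ⊢ u ⊕ κ 1 ≼ b ⊕ κ 1 ⊕ κ 9) v Y⁺ h₄)))))
      where columns : u + + 1 ≤ X⁻ - + 8 + + (w ℕ.+ 17)
            columns = lin 4 (λ v a b h → (κ 0 ≼ h) ∷ (a ⊕ h ≐ b ⊕ κ 1) ∷ (v ≼ b ⊕ κ 9) ∷ [] ⊢ v ⊕ κ 1 ≼ a ⊖ κ 8 ⊕ (h ⊕ κ 17)) u X⁻ X⁺ (+ w) (0≤+ w)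
                w≡ h₂
    ... | inj₁ k₁ | inj₁ k₂ | inj₁ k₃ | inj₁ k₄ = inj₁ ((k₁ , k₂) , (k₃ , k₄))

    covered : ∀ {q r} → Anchor q → InWin q r → inBox P r ⊎ r ∈ ext
    covered {_} {u , v} (inj₁ (inMargin {x} {y} k₁ k₂ k₃ k₄)) ((i₁ , i₂) , (i₃ , i₄)) = [ inj₁ , inj₂ ∘ ∈-++⁺ˡ ]′ (around (ℤ.≤-trans k₁ i₁)
      (lin 3 (λ x u b → (x ≼ b ⊕ κ 8) ∷ (u ≼ x ⊕ κ 1) ∷ [] ⊢ u ≼ b ⊕ κ 9) x u X⁺ k₂ i₂) (ℤ.≤-trans k₃ i₃)
          (lin 3 (λ x u b → (x ≼ b ⊕ κ 8) ∷ (u ≼ x ⊕ κ 1) ∷ [] ⊢ u ≼ b ⊕ κ 9) y v Y⁺ k₄ i₄))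
    covered {_} {u , v} (inj₂ (cellAt {x} {y} t i j li lj)) ((i₁ , i₂) , (i₃ , i₄)) = inj₂
        (∈-++⁺ʳ ring (∈-blocks⁺ (λ p → grid (a + + c * proj₁ p) (b + + c * proj₂ p) (2 ℕ.+ c) (2 ℕ.+ c)) (pic⇒∈ t)
      (grid∋ (lin 3 (λ z i u → (κ 0 ≼ i) ∷ (z ⊕ i ≼ u) ∷ [] ⊢ z ≼ u) (a + + c * x) (+ i) u (0≤+ i) i₁)
          (lin 4 (λ z i u c → (κ 0 ≼ i) ∷ (u ≼ z ⊕ i ⊕ κ 1) ∷ (i ≼ c) ∷ [] ⊢ u ⊕ κ 1 ≼ z ⊕ (κ 2 ⊕ c)) (a + + c * x) (+ i) u (+ c) (0≤+ i) i₂
          (ℤ.+≤+ li))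
             (lin 3 (λ z i u → (κ 0 ≼ i) ∷ (z ⊕ i ≼ u) ∷ [] ⊢ z ≼ u) (b + + c * y) (+ j) v (0≤+ j) i₃)
                 (lin 4 (λ z i u c → (κ 0 ≼ i) ∷ (u ≼ z ⊕ i ⊕ κ 1) ∷ (i ≼ c) ∷ [] ⊢ u ⊕ κ 1 ≼ z ⊕ (κ 2 ⊕ c)) (b + + c * y) (+ j) v (+ c) (0≤+ j) i₄
                 (ℤ.+≤+ lj)))))

    region-covered : ∀ {r} → Region r → inBox P r ⊎ r ∈ ext
    region-covered (q , an , inj₁ refl)               = covered an (inWin₀ q)
    region-covered (q , an , inj₂ (inj₁ refl))        = covered an (inWin₁ q)
    region-covered (q , an , inj₂ (inj₂ (inj₁ refl))) = covered an (inWin₂ q)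
    region-covered (q , an , inj₂ (inj₂ (inj₂ refl))) = covered an (inWin₃ q)

    scaled-pixels : List Pixel
    scaled-pixels = concatMap (λ p → grid (a + + c * proj₁ p) (b + + c * proj₂ p) c c) P

    scaled⇔ : ∀ {f ts} → S.Scaled f → pic ts ≗ f → ∀ q → (q ∈ ts) ⇔ InScaled c P a b q
    scaled⇔ {f} {ts} sc e q = mk⇔ (to (any? (q ≟P_) scaled-pixels)) from
      where
        outside : q ∉ scaled-pixels → ∀ {p} → T p ≡ true → ∀ i j → i ℕ.< c → j ℕ.< c → q ≢ (a + + c * proj₁ p + + i , b + + c * proj₂ p + + j)
        outside ¬j {x , y} t i j li lj refl = ¬j (∈-blocks⁺ (λ p → grid (a + + c * proj₁ p) (b + + c * proj₂ p) c c) (pic⇒∈ t)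
            (∈-grid (a + + c * x) (b + + c * y) i j li lj))
        to : Dec (q ∈ scaled-pixels) → q ∈ ts → InScaled c P a b q
        to (yes j) _ = let p , p∈ , k = ∈-blocks⁻ (λ p → grid (a + + c * proj₁ p) (b + + c * proj₂ p) c c) P j
                           i , j , li , lj , e = grid⁻ {a + + c * proj₁ p} {b + + c * proj₂ p} {c} {c} k
                       in p , p∈ , i , j , li , lj , e
        to (no ¬j) i with trans (sym (∈⇒pic i)) (trans (e q) (S.Scaled.clean sc q (outside ¬j)))
        ... | ()
        from : InScaled c P a b q → q ∈ ts
        from (p , p∈ , i , j , li , lj , e′) = subst (_∈ ts) (sym e′) (pic⇒∈ (trans (e _) (S.Scaled.filled sc (∈⇒pic p∈) i j li lj)))

    -- Up to constants, Z bounds all lengths, and Z * N the total time.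
    Z : ℕ
    Z = (w ℕ.* w ℕ.+ h ℕ.* h) ℕ.* (c ℕ.* c)

    private
      1≤w : 1 ℕ.≤ w
      1≤w = ℕ.s≤s ℕ.z≤n
      1≤h : 1 ℕ.≤ h
      1≤h = ℕ.s≤s ℕ.z≤n
      1≤c : 1 ℕ.≤ c
      1≤c = ℕ.s≤s ℕ.z≤n
      1≤cc : 1 ℕ.≤ c ℕ.* c
      1≤cc = ℕ.*-mono-≤ 1≤c 1≤c
      w≤Z : w ℕ.≤ Z
      w≤Z = ℕ.≤-trans (grow-factor w w 1≤w) (ℕ.≤-trans (ℕ.m≤m+n _ (h ℕ.* h)) (grow-factor _ _ 1≤cc))
      h≤Z : h ℕ.≤ Z
      h≤Z = ℕ.≤-trans (grow-factor h h 1≤h) (ℕ.≤-trans (ℕ.m≤n+m _ (w ℕ.* w)) (grow-factor _ _ 1≤cc))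
      1≤Z : 1 ℕ.≤ Z
      1≤Z = ℕ.≤-trans 1≤w w≤Z
      cc≤Z : c ℕ.* c ℕ.≤ Z
      cc≤Z = ℕ.≤-trans (ℕ.≤-reflexive (sym (ℕ.*-identityˡ (c ℕ.* c)))) (ℕ.*-monoˡ-≤ (c ℕ.* c) (ℕ.≤-trans (ℕ.*-mono-≤ 1≤w 1≤w) (ℕ.m≤m+n _ (h ℕ.* h))))
      wh≤ : w ℕ.* h ℕ.≤ w ℕ.* w ℕ.+ h ℕ.* h
      wh≤ = [ (λ le → ℕ.≤-trans (ℕ.*-monoˡ-≤ h le) (ℕ.m≤n+m _ (w ℕ.* w))) , (λ le → ℕ.≤-trans (ℕ.*-monoʳ-≤ w le) (ℕ.m≤m+n _ (h ℕ.* h))) ]′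
          (ℕ.≤-total w h)
      Nc≤Z : N ℕ.* c ℕ.≤ Z
      Nc≤Z = ℕ.*-mono-≤ (ℕ.≤-trans N≤wh wh≤) (grow-factor c c 1≤c)
      D≤Z : D ≲ 18 · Z
      D≤Z = (once w≤Z ⊞ once h≤Z) ⊞ constant 16 1≤Z
      D≤N : D ≲ 18 · N
      D≤N = (once w≤N ⊞ once h≤N) ⊞ constant 16 1≤N

    time-bound : 9 ℕ.* total ≲ 200000 · Z ℕ.* N
    -- Nine robot moves per window step: `9 * (10122 + 4000)` is below 200000.
    time-bound = weaken (times 9 (F.prepare-bound 1≤Z 1≤N D≤Z D≤N ⊞ S.reproduce-bound 1≤N cc≤Z Nc≤Z D≤Z D≤N)) refl tt

    ext-bound : length ext ≲ 616 · c ℕ.* c ℕ.* N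
    ext-bound = subst (_≲ 616 · c ℕ.* c ℕ.* N) (sym len) (relax N≤ rings ⊞ blocks)
      where
        N≤ : N ℕ.≤ c ℕ.* c ℕ.* N
        N≤ = ℕ.≤-trans (grow-factor N (c ℕ.* c) 1≤cc) (ℕ.≤-reflexive (ℕ.*-comm N (c ℕ.* c)))
        strip : ∀ {n} k → n ℕ.≤ N → k ℕ.* (n ℕ.+ 17) ≲ k ℕ.* 18 · N
        strip k le = times k (once le ⊞ constant 17 1≤N)
        row : ∀ k → (w ℕ.+ 17) ℕ.* k ≲ k ℕ.* 18 · N
        row k = subst (_≲ k ℕ.* 18 · N) (ℕ.*-comm k (w ℕ.+ 17)) (strip k w≤N)
        rings : 8 ℕ.* (h ℕ.+ 17) ℕ.+ (9 ℕ.* (h ℕ.+ 17) ℕ.+ ((w ℕ.+ 17) ℕ.* 8 ℕ.+ (w ℕ.+ 17) ℕ.* 9)) ≲ 612 · N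
        rings = strip 8 h≤N ⊞ strip 9 h≤N ⊞ row 8 ⊞ row 9
        2+c≤ : 2 ℕ.+ c ≲ 2 · c
        2+c≤ = ⌈ linℕ 1 (λ z → [] ⊢ κ 2 ⊕ (κ 2 ⊕ z) ≼ (κ 2 ⊕ z) ⊕ ((κ 2 ⊕ z) ⊕ κ 0)) c₂ ⌉
        blocks : N ℕ.* ((2 ℕ.+ c) ℕ.* (2 ℕ.+ c)) ≲ 4 · c ℕ.* c ℕ.* N
        blocks = once (ℕ.≤-refl {N}) ⊠ (2+c≤ ⊠ 2+c≤)
        len : length ext ≡ (8 ℕ.* (h ℕ.+ 17) ℕ.+ (9 ℕ.* (h ℕ.+ 17) ℕ.+ ((w ℕ.+ 17) ℕ.* 8 ℕ.+ (w ℕ.+ 17) ℕ.* 9))) ℕ.+ N ℕ.* ((2 ℕ.+ c) ℕ.* (2 ℕ.+ c))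
        len = trans (length-++ ring) (cong₂ ℕ._+_
          (trans (length-++ (grid (X⁻ - + 8) (Y⁻ - + 8) 8 (h ℕ.+ 17))) (cong₂ ℕ._+_ (length-grid (X⁻ - + 8) (Y⁻ - + 8) 8 (h ℕ.+ 17))
            (trans (length-++ (grid (X⁺ + + 1) (Y⁻ - + 8) 9 (h ℕ.+ 17))) (cong₂ ℕ._+_ (length-grid (X⁺ + + 1) (Y⁻ - + 8) 9 (h ℕ.+ 17))
              (trans (length-++ (grid (X⁻ - + 8) (Y⁻ - + 8) (w ℕ.+ 17) 8))
                  (cong₂ ℕ._+_ (length-grid (X⁻ - + 8) (Y⁻ - + 8) (w ℕ.+ 17) 8) (length-grid (X⁻ - + 8) (Y⁺ + + 1) (w ℕ.+ 17) 9)))))))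
          (length-blocks (λ p → grid (a + + c * proj₁ p) (b + + c * proj₂ p) (2 ℕ.+ c) (2 ℕ.+ c)) ((2 ℕ.+ c) ℕ.* (2 ℕ.+ c))
              (λ p → length-grid (a + + c * proj₁ p) (b + + c * proj₂ p) (2 ℕ.+ c) (2 ℕ.+ c)) P))

    -- All tiles lie in `P`, in the box, or in `ext`. The box is counted because pebbles may occupy
    -- its empty pixels; `N ≤ w * h` converts the bound on `ext`.
    tile-bound : w ℕ.* h ℕ.+ length ext ≲ 617 · c ℕ.* c ℕ.* w ℕ.* h
    tile-bound = once wh≤ccwh ⊞ relax N≤ccwh ext-bound
      where
        assoc : c ℕ.* c ℕ.* (w ℕ.* h) ≡ c ℕ.* c ℕ.* w ℕ.* h
        assoc = sym (ℕ.*-assoc (c ℕ.* c) w h)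
        wh≤ccwh : w ℕ.* h ℕ.≤ c ℕ.* c ℕ.* w ℕ.* h
        wh≤ccwh = ℕ.≤-trans (grow-factor (w ℕ.* h) (c ℕ.* c) 1≤cc) (ℕ.≤-reflexive (trans (ℕ.*-comm (w ℕ.* h) (c ℕ.* c)) assoc))
        N≤ccwh : c ℕ.* c ℕ.* N ℕ.≤ c ℕ.* c ℕ.* w ℕ.* h
        N≤ccwh = ℕ.≤-trans (ℕ.*-monoʳ-≤ (c ℕ.* c) N≤wh) (ℕ.≤-reflexive assoc)

    achieved : Achieved 200000 (suc (suc c₂)) P s (Compile.robot (scaler (suc c₂)))
    achieved = conclude (robot-run (scaler (suc c₂)) Anchor S.Scaled (IsPolyomino.unique poly) scaler-run)
      where
        conclude : Simulated (scaler (suc c₂)) Anchor S.Scaled P s total → Achieved 200000 (suc (suc c₂)) P s (Compile.robot (scaler (suc c₂)))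
        conclude (t , le , stops , (f , e , sc) , visited , tidy) = achieve stops (a , b , scaled⇔ sc e)
          (below le time-bound)
          few-tiles (weaken tile-bound refl tt)
          (space-bound (Compile.robot (scaler (suc c₂))) P s t ext (λ i le → region-covered (visited i le))) (weaken ext-bound refl tt)
          where
            few-tiles : ∀ i → i ℕ.≤ t → length (tiles (run (Compile.robot (scaler (suc c₂))) i (initial (Compile.robot (scaler (suc c₂))) P s))) ℕ.≤
                N ℕ.+ (w ℕ.* h ℕ.+ length ext)
            few-tiles i le = subst (length (tiles (run (Compile.robot (scaler (suc c₂))) i (initial (Compile.robot (scaler (suc c₂))) P s))) ℕ.≤_)
              (trans (length-++ P) (cong (N ℕ.+_) (trans (length-++ boxList) (cong (ℕ._+ length ext) (length-grid X⁻ Y⁻ w h)))))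
              (length-⊆ (proj₁ (tidy i le)) (λ j → [ ∈-++⁺ˡ , (λ r → ∈-++⁺ʳ P ([ ∈-++⁺ˡ ∘ box∋ , ∈-++⁺ʳ boxList ]′ (region-covered r))) ]′
                  (proj₂ (tidy i le) j)))

  -- Scaling factor one.

  module Unscaled where
    -- Its start state is its halting state, so it halts after zero moves.
    idle : Robot
    idle = record { nStates = 1 ; start = Fin.zero ; halt = Fin.zero ; δ = λ s b → s , b , up }

    scaled-once : ∀ {P} q → (q ∈ P) ⇔ InScaled 1 P (+ 0) (+ 0) q
    scaled-once {P} (x , y) = mk⇔ (λ i → (x , y) , i , 0 , 0 , ℕ.s≤s ℕ.z≤n , ℕ.s≤s ℕ.z≤n , cong₂ _,_ (scale₁ x) (scale₁ y)) from
      where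
        scale₁ : ∀ x → x ≡ + 0 + + 1 * x + + 0
        scale₁ x = sym (trans (ℤ.+-identityʳ _) (trans (ℤ.+-identityˡ _) (ℤ.*-identityˡ x)))
        from : InScaled 1 P (+ 0) (+ 0) (x , y) → (x , y) ∈ P
        from ((u , v) , i , zero , zero , _ , _ , e) = subst (_∈ P) (sym (trans e (cong₂ _,_ (sym (scale₁ u)) (sym (scale₁ v))))) i
        from (_ , _ , suc _ , _ , ℕ.s≤s () , _)
        from (_ , _ , zero , suc _ , _ , ℕ.s≤s () , _)

    no-space : ∀ {P} (poly : IsPolyomino P) {s} → s ∈ P → additionalSpace idle P s 0 ℕ.≤ 0
    no-space {P} poly {s} s∈P = space-bound idle P s 0 [] λ { zero _ → inj₁ (Facts.bounded poly (∈⇒pic s∈P)) }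

open Analysis

open import Data.Nat using (_+_; _*_; _≤_)

theorem8 : Σ ℕ λ K → ∀ (c : ℕ) → 1 ≤ c → Σ Robot λ R →
  ∀ (P : List Pixel) → IsPolyomino P → ∀ (s : Pixel) → s ∈ P →
    let N = length P
        w = width P
        h = height P
    in Σ ℕ λ T →
      HaltsAt R P s T
      × (∃[ a ] ∃[ b ] (∀ q → (q ∈ tiles (run R T (initial R P s))) ⇔ InScaled c P a b q))
      × T ≤ K * ((w * w + h * h) * (c * c) * N)
      × (∀ i → i ≤ T → length (tiles (run R i (initial R P s))) ≤ N + K * (c * c * w * h))
      × additionalSpace R P s T ≤ K * (c * c * N)
theorem8 = 200000 , λ
  { (suc zero) _ → Unscaled.idle , λ P poly s s∈P →
      0 , (refl , λ _ ()) , (+ 0 , + 0 , Unscaled.scaled-once) , ℕ.z≤n , (λ { zero _ → ℕ.m≤m+n (length P) _ }) , ℕ.≤-trans (Unscaled.no-space poly s∈P) ℕ.z≤n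
  ; (suc (suc c₂)) _ → Compile.robot (scaler (suc c₂)) , λ P poly s s∈P → Assembly.achieved c₂ poly s∈P }
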